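{- There are a constant $C$ and a function $\beta:(0,1)\to(0,\infty)$ with $\beta(\lambda)\to0$ as $\lambda\to0^+$ such that for every $\lambda\in(0,1)$ there is an explicit (efficient) infinite family of $(N,d,\lambda)$-quantum expanders, with $N\to\infty$ along the family and with degree $d\le C/\lambda^{2+\beta(\lambda)}$.
   Context: A linear map $\Phi:\mathbb{C}^{N\times N}\to\mathbb{C}^{N\times N}$ is an $(N,d,\lambda)$-quantum expander if: (degree) $\Phi(\rho)=\sum_{i=1}^d B_i\rho B_i^\dagger$ for some $B_1,\dots,B_d\in\mathbb{C}^{N\times N}$ with $\sum_{i=1}^d B_i^\dagger B_i=I_N$; and (expansion) the second largest eigenvalue of $\Phi$ as a linear map is at most $\lambda$, in the sense that $\|\Phi(\rho)\|_2\le\lambda\|\rho\|_2$ for every $\rho$ with $\mathrm{Tr}(\rho)=0$, where $\|\rho\|_2=\sqrt{\mathrm{Tr}(\rho^\dagger\rho)}$. The family is explicit/efficient if, for fixed $\lambda$, the map $\Phi$ on dimension $N$ can be implemented by a uniformly constructible quantum circuit of size $\mathrm{polylog}(N)$. -}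

module Defs where

open import Data.Bool.Base using (if_then_else_)
open import Data.Digit using (Bit; toDigits)
open import Data.Fin.Base using (Fin; zero; suc; toℕ; fromℕ<; finToFun; funToFin; _↑ˡ_; _↑ʳ_)
open import Data.Fin.Properties using (_≟_; all?; any?)
open import Data.Integer.Base using (+_)
open import Data.List.Base as List using (List; []; _∷_)
open import Data.Maybe.Base using (Maybe; just; nothing)
open import Data.Nat.Base as ℕ using (ℕ; zero; suc; NonZero)
open import Data.Nat.Logarithm using (⌈log₂_⌉)
import Data.Nat.Properties as ℕₚ
open import Data.Product.Base using (Σ; ∃; _×_; _,_; proj₁; proj₂)
open import Data.Rational.Base as ℚ using (ℚ; 0ℚ; 1ℚ; ½; ∣_∣; 1/_)
import Data.Rational.Properties as ℚₚ
open import Data.Rational.Solver using (module +-*-Solver)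
open import Data.Vec.Functional as Vector using (Vector)
open import Function.Base using (_∘_)
open import Function.Definitions using (Injective)
open import Relation.Binary.PropositionalEquality
open import Relation.Nullary.Decidable using (does; yes; no; _⊎-dec_)

------------------------------------------------------------------------
-- Real numbers: rational Cauchy sequences, compared through the setoid
-- equality _≈ᴿ_

IsCauchy : (ℕ → ℚ) → Set
IsCauchy f = ∀ ε → 0ℚ ℚ.< ε →
  ∃ λ N → ∀ m n → N ℕ.≤ m → N ℕ.≤ n → ∣ f m ℚ.- f n ∣ ℚ.≤ ε

-- Without eta, so that arithmetic on neutral terms stays folded.
record ℝ : Set where
  no-eta-equality
  pattern
  constructor mkℝ
  field
    seq    : ℕ → ℚ
    cauchy : IsCauchy seq

open ℝ

infix  4 _≤ᴿ_ _<ᴿ_ _≈ᴿ_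
infixl 6 _+ᴿ_
infixl 7 _*ᴿ_
infixr 8 _^ᴿ_

_≤ᴿ_ : ℝ → ℝ → Set
x ≤ᴿ y = ∀ ε → 0ℚ ℚ.< ε → ∃ λ N → ∀ n → N ℕ.≤ n → seq x n ℚ.≤ seq y n ℚ.+ ε

_<ᴿ_ : ℝ → ℝ → Set
x <ᴿ y = ∃ λ ε → 0ℚ ℚ.< ε × ∃ λ N → ∀ n → N ℕ.≤ n → seq x n ℚ.+ ε ℚ.≤ seq y n

_≈ᴿ_ : ℝ → ℝ → Set
x ≈ᴿ y = x ≤ᴿ y × y ≤ᴿ x

fromℚ : ℚ → ℝ
fromℚ q = mkℝ (λ _ → q) λ ε 0<ε → 0 , λ _ _ _ _ →
  subst (ℚ._≤ ε) (sym (cong ∣_∣ (ℚₚ.+-inverseʳ q))) (ℚₚ.<⇒≤ 0<ε)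

fromℕ : ℕ → ℝ
fromℕ n = fromℚ (+ n ℚ./ 1)

0ᴿ 1ᴿ : ℝ
0ᴿ = fromℚ 0ℚ
1ᴿ = fromℚ 1ℚ

-‿cauchy : (x : ℝ) → IsCauchy (λ n → ℚ.- seq x n)
-‿cauchy x ε 0<ε =
  let N , close = cauchy x ε 0<ε in
  N , λ m n N≤m N≤n →
    subst (ℚ._≤ ε)
      (trans (sym (ℚₚ.∣-p∣≡∣p∣ (seq x m ℚ.- seq x n)))
             (cong ∣_∣ (ℚₚ.neg-distrib-+ (seq x m) (ℚ.- seq x n))))
      (close m n N≤m N≤n)

+-cauchy : (x y : ℝ) → IsCauchy (λ n → seq x n ℚ.+ seq y n)
+-cauchy x y = proof
  where
  proof : IsCauchy (λ n → seq x n ℚ.+ seq y n)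
  proof ε 0<ε = M ℕ.+ N , λ m n p q → begin
    ∣ (seq x m ℚ.+ seq y m) ℚ.- (seq x n ℚ.+ seq y n) ∣
      ≡⟨ cong ∣_∣ (rearrange (seq x m) (seq y m) (seq x n) (seq y n)) ⟩
    ∣ (seq x m ℚ.- seq x n) ℚ.+ (seq y m ℚ.- seq y n) ∣
      ≤⟨ ℚₚ.∣p+q∣≤∣p∣+∣q∣ (seq x m ℚ.- seq x n) (seq y m ℚ.- seq y n) ⟩
    ∣ seq x m ℚ.- seq x n ∣ ℚ.+ ∣ seq y m ℚ.- seq y n ∣
      ≤⟨ ℚₚ.+-mono-≤
           (closeX m n (ℕₚ.m+n≤o⇒m≤o M p) (ℕₚ.m+n≤o⇒m≤o M q))
           (closeY m n (ℕₚ.m+n≤o⇒n≤o M p) (ℕₚ.m+n≤o⇒n≤o M q)) ⟩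
    ½ ℚ.* ε ℚ.+ ½ ℚ.* ε
      ≡⟨ halves ⟩
    ε ∎
    where
    open ℚₚ.≤-Reasoning
    instance
      ε-pos : ℚ.Positive ε
      ε-pos = ℚ.positive 0<ε
    halves : ½ ℚ.* ε ℚ.+ ½ ℚ.* ε ≡ ε
    halves = trans (sym (ℚₚ.*-distribʳ-+ ε ½ ½)) (ℚₚ.*-identityˡ ε)
    0<δ : 0ℚ ℚ.< ½ ℚ.* ε
    0<δ = ℚₚ.positive⁻¹ (½ ℚ.* ε) {{ℚₚ.pos*pos⇒pos ½ ε}}
    M = proj₁ (cauchy x (½ ℚ.* ε) 0<δ)
    N = proj₁ (cauchy y (½ ℚ.* ε) 0<δ)
    closeX = proj₂ (cauchy x (½ ℚ.* ε) 0<δ)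
    closeY = proj₂ (cauchy y (½ ℚ.* ε) 0<δ)
    rearrange : ∀ a b c d → (a ℚ.+ b) ℚ.- (c ℚ.+ d) ≡ (a ℚ.- c) ℚ.+ (b ℚ.- d)
    rearrange = solve 4 (λ a b c d → (a :+ b) :- (c :+ d) := (a :- c) :+ (b :- d)) refl
      where open +-*-Solver

eventuallyBounded : (x : ℝ) → ∃ λ N → ∃ λ B → ℚ.Positive B × (∀ n → N ℕ.≤ n → ∣ seq x n ∣ ℚ.≤ B)
eventuallyBounded x = N , B , B-pos , λ n N≤n → begin
  ∣ seq x n ∣
    ≡⟨ cong ∣_∣ (split (seq x n) (seq x N)) ⟩
  ∣ (seq x n ℚ.- seq x N) ℚ.+ seq x N ∣
    ≤⟨ ℚₚ.∣p+q∣≤∣p∣+∣q∣ (seq x n ℚ.- seq x N) (seq x N) ⟩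
  ∣ seq x n ℚ.- seq x N ∣ ℚ.+ ∣ seq x N ∣
    ≤⟨ ℚₚ.+-mono-≤ (proj₂ C n N N≤n ℕₚ.≤-refl) ℚₚ.≤-refl ⟩
  B ∎
  where
  open ℚₚ.≤-Reasoning
  C = cauchy x 1ℚ (ℚₚ.positive⁻¹ 1ℚ)
  N = proj₁ C
  B = 1ℚ ℚ.+ ∣ seq x N ∣
  B-pos : ℚ.Positive B
  B-pos = ℚₚ.pos+nonNeg⇒pos 1ℚ ∣ seq x N ∣ {{ℚ.nonNegative (ℚₚ.0≤∣p∣ (seq x N))}}
  split : ∀ a b → a ≡ (a ℚ.- b) ℚ.+ b
  split = solve 2 (λ a b → a := (a :- b) :+ b) refl
    where open +-*-Solver

*-cauchy : (x y : ℝ) → IsCauchy (λ n → seq x n ℚ.* seq y n)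
*-cauchy x y = proof
  where
  boundX = eventuallyBounded x
  boundY = eventuallyBounded y
  K = proj₁ boundX
  L = proj₁ boundY
  A = proj₁ (proj₂ boundX)
  B = proj₁ (proj₂ boundY)
  instance
    A-pos : ℚ.Positive A
    A-pos = proj₁ (proj₂ (proj₂ boundX))
    B-pos : ℚ.Positive B
    B-pos = proj₁ (proj₂ (proj₂ boundY))
    A+B-pos : ℚ.Positive (A ℚ.+ B)
    A+B-pos = ℚₚ.pos+pos⇒pos A B
    A+B≢0 : ℚ.NonZero (A ℚ.+ B)
    A+B≢0 = ℚₚ.pos⇒nonZero (A ℚ.+ B)
    1/-pos : ℚ.Positive (1/ (A ℚ.+ B))
    1/-pos = ℚₚ.1/pos⇒pos (A ℚ.+ B)
  open ℚₚ.≤-Reasoning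
  product-≤ : ∀ {p q a b} .{{_ : ℚ.NonNegative a}} →
              ∣ p ∣ ℚ.≤ a → ∣ q ∣ ℚ.≤ b → ∣ p ℚ.* q ∣ ℚ.≤ a ℚ.* b
  product-≤ {p} {q} {a} {b} p≤a q≤b = begin
    ∣ p ℚ.* q ∣       ≡⟨ ℚₚ.∣p*q∣≡∣p∣*∣q∣ p q ⟩
    ∣ p ∣ ℚ.* ∣ q ∣   ≤⟨ ℚₚ.*-monoʳ-≤-nonNeg ∣ q ∣ {{ℚ.nonNegative (ℚₚ.0≤∣p∣ q)}} p≤a ⟩
    a ℚ.* ∣ q ∣       ≤⟨ ℚₚ.*-monoˡ-≤-nonNeg a q≤b ⟩
    a ℚ.* b           ∎
  proof : IsCauchy (λ n → seq x n ℚ.* seq y n)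
  proof ε 0<ε = (K ℕ.+ L) ℕ.+ (M ℕ.+ N) , λ m n p q →
    let p₁ = ℕₚ.m+n≤o⇒m≤o (K ℕ.+ L) p
        p₂ = ℕₚ.m+n≤o⇒n≤o (K ℕ.+ L) p
        q₁ = ℕₚ.m+n≤o⇒m≤o (K ℕ.+ L) q
        q₂ = ℕₚ.m+n≤o⇒n≤o (K ℕ.+ L) q
    in begin
    ∣ seq x m ℚ.* seq y m ℚ.- seq x n ℚ.* seq y n ∣
      ≡⟨ cong ∣_∣ (rearrange (seq x m) (seq y m) (seq x n) (seq y n)) ⟩
    ∣ seq x m ℚ.* (seq y m ℚ.- seq y n) ℚ.+ seq y n ℚ.* (seq x m ℚ.- seq x n) ∣
      ≤⟨ ℚₚ.∣p+q∣≤∣p∣+∣q∣ (seq x m ℚ.* (seq y m ℚ.- seq y n)) (seq y n ℚ.* (seq x m ℚ.- seq x n)) ⟩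
    ∣ seq x m ℚ.* (seq y m ℚ.- seq y n) ∣ ℚ.+ ∣ seq y n ℚ.* (seq x m ℚ.- seq x n) ∣
      ≤⟨ ℚₚ.+-mono-≤
           (product-≤ {seq x m} {seq y m ℚ.- seq y n} {A} {{ℚₚ.pos⇒nonNeg A}}
             (boundedX m (ℕₚ.m+n≤o⇒m≤o K p₁))
             (closeY m n (ℕₚ.m+n≤o⇒n≤o M p₂) (ℕₚ.m+n≤o⇒n≤o M q₂)))
           (product-≤ {seq y n} {seq x m ℚ.- seq x n} {B} {{ℚₚ.pos⇒nonNeg B}}
             (boundedY n (ℕₚ.m+n≤o⇒n≤o K q₁))
             (closeX m n (ℕₚ.m+n≤o⇒m≤o M p₂) (ℕₚ.m+n≤o⇒m≤o M q₂))) ⟩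
    A ℚ.* δ ℚ.+ B ℚ.* δ
      ≡⟨ ℚₚ.*-distribʳ-+ δ A B ⟨
    (A ℚ.+ B) ℚ.* (1/ (A ℚ.+ B) ℚ.* ε)
      ≡⟨ ℚₚ.*-assoc (A ℚ.+ B) (1/ (A ℚ.+ B)) ε ⟨
    ((A ℚ.+ B) ℚ.* 1/ (A ℚ.+ B)) ℚ.* ε
      ≡⟨ cong (ℚ._* ε) (ℚₚ.*-inverseʳ (A ℚ.+ B)) ⟩
    1ℚ ℚ.* ε
      ≡⟨ ℚₚ.*-identityˡ ε ⟩
    ε ∎
    where
    boundedX = proj₂ (proj₂ (proj₂ boundX))
    boundedY = proj₂ (proj₂ (proj₂ boundY))
    δ = 1/ (A ℚ.+ B) ℚ.* ε
    0<δ : 0ℚ ℚ.< δ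
    0<δ = ℚₚ.positive⁻¹ δ {{ℚₚ.pos*pos⇒pos (1/ (A ℚ.+ B)) ε {{ℚ.positive 0<ε}}}}
    M = proj₁ (cauchy x δ 0<δ)
    N = proj₁ (cauchy y δ 0<δ)
    closeX = proj₂ (cauchy x δ 0<δ)
    closeY = proj₂ (cauchy y δ 0<δ)
    rearrange : ∀ a b c d → a ℚ.* b ℚ.- c ℚ.* d ≡ a ℚ.* (b ℚ.- d) ℚ.+ d ℚ.* (a ℚ.- c)
    rearrange = solve 4 (λ a b c d → a :* b :- c :* d := a :* (b :- d) :+ d :* (a :- c)) refl
      where open +-*-Solver

-ᴿ_ : ℝ → ℝ
-ᴿ x@(mkℝ f _) = mkℝ (λ n → ℚ.- f n) (-‿cauchy x)

_+ᴿ_ _*ᴿ_ : ℝ → ℝ → ℝ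
x@(mkℝ f _) +ᴿ y@(mkℝ g _) = mkℝ (λ n → f n ℚ.+ g n) (+-cauchy x y)
x@(mkℝ f _) *ᴿ y@(mkℝ g _) = mkℝ (λ n → f n ℚ.* g n) (*-cauchy x y)

_^ᴿ_ : ℝ → ℕ → ℝ
x ^ᴿ zero  = 1ᴿ
x ^ᴿ suc n = x *ᴿ x ^ᴿ n

-- For 0 < x < 1 and y ≥ 0, "z = x ^ y".  The map y ↦ x ^ y is
-- decreasing, so x ^ y is the unique z ≥ 0 lying above x ^ (p / q) for
-- every rational p / q ≥ y and below it for every rational p / q ≤ y;
-- the comparison with x ^ (p / q) is made after taking q-th powers.
record IsPower (x y z : ℝ) : Set where
  field
    nonNegative : 0ᴿ ≤ᴿ z
    above       : ∀ p q .{{_ : NonZero q}} → y ≤ᴿ fromℚ (+ p ℚ./ q) → x ^ᴿ p ≤ᴿ z ^ᴿ q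
    below       : ∀ p q .{{_ : NonZero q}} → fromℚ (+ p ℚ./ q) ≤ᴿ y → z ^ᴿ q ≤ᴿ x ^ᴿ p

record OpenUnitInterval : Set where
  field
    value    : ℝ
    positive : 0ᴿ <ᴿ value
    below-1  : value <ᴿ 1ᴿ

open OpenUnitInterval public

Extensional : (OpenUnitInterval → ℝ) → Set
Extensional f = ∀ x y → value x ≈ᴿ value y → f x ≈ᴿ f y

TendsTo0At0⁺ : (OpenUnitInterval → ℝ) → Set
TendsTo0At0⁺ f = ∀ ε → 0ᴿ <ᴿ ε → ∃ λ δ → 0ᴿ <ᴿ δ ×
  (∀ x → value x <ᴿ δ → f x <ᴿ ε × -ᴿ ε <ᴿ f x)

------------------------------------------------------------------------
-- Complex matrices

record ℂ : Set where
  no-eta-equality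
  pattern
  constructor _+i_
  field
    re im : ℝ

open ℂ

infix 4 _≈ᶜ_ _≋_

_≈ᶜ_ : ℂ → ℂ → Set
z ≈ᶜ w = re z ≈ᴿ re w × im z ≈ᴿ im w

fromℝ : ℝ → ℂ
fromℝ x = x +i 0ᴿ

0ᶜ 1ᶜ : ℂ
0ᶜ = fromℝ 0ᴿ
1ᶜ = fromℝ 1ᴿ

_+ᶜ_ _*ᶜ_ : ℂ → ℂ → ℂ
(a +i b) +ᶜ (c +i d) = (a +ᴿ c) +i (b +ᴿ d)
(a +i b) *ᶜ (c +i d) = (a *ᴿ c +ᴿ -ᴿ (b *ᴿ d)) +i (a *ᴿ d +ᴿ b *ᴿ c)

conj : ℂ → ℂ
conj (a +i b) = a +i (-ᴿ b)

∑ : ∀ {n} → Vector ℂ n → ℂ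
∑ = Vector.foldr _+ᶜ_ 0ᶜ

Mat : ℕ → Set
Mat N = Fin N → Fin N → ℂ

_≋_ : ∀ {N} → Mat N → Mat N → Set
A ≋ B = ∀ i j → A i j ≈ᶜ B i j

I : ∀ {N} → Mat N
I i j = if does (i ≟ j) then 1ᶜ else 0ᶜ

infixl 7 _·_
_·_ : ∀ {N} → Mat N → Mat N → Mat N
(A · B) i j = ∑ λ k → A i k *ᶜ B k j

infix 9 _†
_† : ∀ {N} → Mat N → Mat N
(A †) i j = conj (A j i)

∑ᴹ : ∀ {n N} → Vector (Mat N) n → Mat N
∑ᴹ A i j = ∑ λ k → A k i j

Tr : ∀ {N} → Mat N → ℂ
Tr A = ∑ λ i → A i i

-- s = ‖ρ‖₂ = √ Tr(ρ†ρ)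
IsNorm₂ : ∀ {N} → Mat N → ℝ → Set
IsNorm₂ ρ s = 0ᴿ ≤ᴿ s × fromℝ (s *ᴿ s) ≈ᶜ Tr (ρ † · ρ)

------------------------------------------------------------------------
-- Quantum expanders

SuperOperator : ℕ → Set
SuperOperator N = Mat N → Mat N

kraus : ∀ {d N} → Vector (Mat N) d → SuperOperator N
kraus B ρ = ∑ᴹ λ i → B i · ρ · B i †

HasDegree : ∀ {N} → ℕ → SuperOperator N → Set
HasDegree {N} d Φ = ∃ λ (B : Vector (Mat N) d) →
  (∀ ρ → Φ ρ ≋ kraus B ρ) × ∑ᴹ (λ i → B i † · B i) ≋ I

Expands : ∀ {N} → ℝ → SuperOperator N → Set
Expands lam Φ = ∀ ρ → Tr ρ ≈ᶜ 0ᶜ →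
  ∃ λ s → ∃ λ t → IsNorm₂ (Φ ρ) s × IsNorm₂ ρ t × s ≤ᴿ lam *ᴿ t

-- Linearity of Φ (up to _≋_) is a consequence of HasDegree.
IsQuantumExpander : (N d : ℕ) → ℝ → SuperOperator N → Set
IsQuantumExpander N d lam Φ = HasDegree d Φ × Expands lam Φ

------------------------------------------------------------------------
-- Quantum circuits over a finite gate set.  The computational basis of
-- m qubits is indexed by Fin (2 ^ m), with finToFun reading off bits.

record GateSet : Set where
  field
    gates   : ℕ
    arity   : Fin gates → ℕ
    matrix  : (g : Fin gates) → Mat (2 ℕ.^ arity g)
    unitary : ∀ g → matrix g † · matrix g ≋ I

module _ (𝒢 : GateSet) where
  open GateSet 𝒢

  record Op (m : ℕ) : Set where
    field
      gate     : Fin gates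
      wires    : Fin (arity gate) → Fin m
      distinct : Injective _≡_ _≡_ wires

  record Circuit (n : ℕ) : Set where
    field
      ancillas : ℕ
      ops      : List (Op (n ℕ.+ ancillas))

module _ {𝒢 : GateSet} where
  open GateSet 𝒢

  -- The gate on its wires, tensored with the identity on the others.
  opMatrix : ∀ {m} → Op 𝒢 m → Mat (2 ℕ.^ m)
  opMatrix o x y =
    if does (all? λ j → any? (λ i → wires i ≟ j) ⊎-dec (bits x j ≟ bits y j))
    then matrix gate (funToFin (bits x ∘ wires)) (funToFin (bits y ∘ wires))
    else 0ᶜ
    where
    open Op o
    bits = finToFun {2}

  -- The head of the list is the gate applied first.
  opsMatrix : ∀ {m} → List (Op 𝒢 m) → Mat (2 ℕ.^ m)
  opsMatrix []       = I
  opsMatrix (o ∷ os) = opsMatrix os · opMatrix o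

  -- σ ↦ Tr_anc (U (σ ⊗ |0⟩⟨0|) U†), written with the Kraus operators
  -- ⟨w|_anc U |0⟩_anc, w ranging over the ancilla basis.
  channel : ∀ {n} → Circuit 𝒢 n → SuperOperator (2 ℕ.^ n)
  channel {n} Γ = kraus λ (w : Fin (2 ℕ.^ ancillas)) u v →
    opsMatrix ops (join u (finToFun w)) (join v (λ _ → zero))
    where
    open Circuit Γ
    join : Fin (2 ℕ.^ n) → (Fin ancillas → Fin 2) → Fin (2 ℕ.^ (n ℕ.+ ancillas))
    join u w = funToFin (finToFun {2} {n} u Vector.++ w)

  size : ∀ {n} → Circuit 𝒢 n → ℕ
  size Γ = ancillas ℕ.+ List.length ops
    where open Circuit Γ

  -- Unary numbers 1…10 are self-delimiting, so this is injective.
  encode : ∀ {n} → Circuit 𝒢 n → List Bit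
  encode {n} Γ = unary ancillas List.++ List.concatMap encodeOp ops
    where
    open Circuit Γ
    unary : ℕ → List Bit
    unary k = List.replicate k (suc zero) List.++ (zero ∷ [])
    encodeOp : Op 𝒢 (n ℕ.+ ancillas) → List Bit
    encodeOp o = unary (toℕ gate) List.++ List.concat (List.tabulate (unary ∘ toℕ ∘ wires))
      where open Op o

-- A matrix on ℂᴺ as the upper left block of a matrix on ℂᴹ.
embed : ∀ {N M} → Mat N → Mat M
embed {N} ρ u v with toℕ u ℕₚ.<? N | toℕ v ℕₚ.<? N
... | yes u<N | yes v<N = ρ (fromℕ< u<N) (fromℕ< v<N)
... | _       | _       = 0ᶜ

Implements : ∀ {𝒢 N} → Circuit 𝒢 ⌈log₂ N ⌉ → SuperOperator N → Set
Implements Γ Φ = ∀ ρ → channel Γ (embed ρ) ≋ embed (Φ ρ)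

------------------------------------------------------------------------
-- Deterministic single-tape Turing machines; nothing is the blank symbol

Symbol : Set
Symbol = Maybe Bit

data Move : Set where
  left right : Move

record TuringMachine : Set where
  field
    states : ℕ
    start  : Fin states
    δ      : Fin states → Symbol → Maybe (Fin states × Symbol × Move)

record Config (states : ℕ) : Set where
  constructor config
  field
    state  : Fin states
    before : List Symbol   -- to the left of the head, nearest cell first
    here   : Symbol
    after  : List Symbol

module _ (M : TuringMachine) where
  open TuringMachine M

  load : Fin states → List Symbol → List Symbol → Config states
  load s ls []       = config s ls nothing []
  load s ls (r ∷ rs) = config s ls r rs

  move : Fin states → List Symbol → Symbol → List Symbol → Move → Config states
  move s ls       x rs right = load s (x ∷ ls) rs
  move s []       x rs left  = config s [] nothing (x ∷ rs)
  move s (l ∷ ls) x rs left  = config s ls l (x ∷ rs)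

  -- The halting configuration, if it is reached within the given number of steps.
  run : ℕ → Config states → Maybe (Config states)
  run t (config s ls x rs) with δ s x | t
  ... | nothing           | _      = just (config s ls x rs)
  ... | just _            | zero   = nothing
  ... | just (s′ , y , d) | suc t′ = run t′ (move s′ ls y rs d)

  -- The output is the maximal blank-free word starting at the head.
  word : List Symbol → List Bit
  word []             = []
  word (nothing ∷ _)  = []
  word (just b ∷ xs)  = b ∷ word xs

  OutputsWithin : ℕ → List Bit → List Bit → Set
  OutputsWithin t input output = ∃ λ c →
    run t (load start [] (List.map just input)) ≡ just c ×
    word (Config.here c ∷ Config.after c) ≡ output

------------------------------------------------------------------------
-- Explicit families

polylog : ℕ → ℕ → ℕ
polylog c N = c ℕ.* ⌈log₂ N ⌉ ℕ.^ c ℕ.+ c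

binary : ℕ → List Bit
binary N = proj₁ (toDigits 2 N)

-- One gate set, one machine and one polynomial serve the whole family;
-- the machine maps the dimension in binary (least significant digit first) to the circuit.
Explicit : (dim : ℕ → ℕ) → (∀ k → SuperOperator (dim k)) → Set
Explicit dim Φ =
  ∃ λ (𝒢 : GateSet) → ∃ λ (M : TuringMachine) → ∃ λ (c : ℕ) →
  ∀ k → ∃ λ (Γ : Circuit 𝒢 ⌈log₂ dim k ⌉) →
    Implements Γ (Φ k) ×
    size Γ ℕ.≤ polylog c (dim k) ×
    OutputsWithin M (polylog c (dim k)) (binary (dim k)) (encode Γ)

record ExplicitExpanderFamily (d : ℕ) (lam : ℝ) : Set where
  field
    dim      : ℕ → ℕ
    Φ        : ∀ k → SuperOperator (dim k)
    diverges : ∀ M → ∃ λ K → ∀ k → K ℕ.≤ k → M ℕ.≤ dim k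
    expander : ∀ k → IsQuantumExpander (dim k) d lam (Φ k)
    explicit : Explicit dim Φ

-- d ≤ C / x ^ y for 0 < x < 1, y ≥ 0, with the positive denominator cleared.
DegreeBound : ℕ → ℝ → ℝ → ℝ → Set
DegreeBound d C x y = ∃ λ z → IsPower x y z × fromℕ d *ᴿ z ≤ᴿ C

{-# OPTIONS --safe #-}
module Submission where

open import Data.Bool.Base using (Bool; true; false; if_then_else_; not)
open import Data.Fin.Base as Fin using (Fin; zero; suc; toℕ; finToFun; funToFin; inject₁; _↑ˡ_; _↑ʳ_; splitAt; combine; remQuot)
open import Data.Fin.Patterns
import Data.Fin.Properties as Fin
import Data.Integer.Base as ℤ
import Data.Integer.Properties as ℤ
open import Data.List.Base as List using (List; []; _∷_; _++_; map; _∷ʳ_; length; concat; replicate; filterᵇ; allFin; concatMap; reverse; tabulate)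
import Data.List.Properties as List
open import Data.List.Relation.Unary.All as All using (All; []; _∷_)
import Data.List.Relation.Unary.All.Properties as All
open import Data.List.Relation.Unary.AllPairs using (AllPairs; []; _∷_)
open import Data.List.Relation.Unary.Unique.Propositional.Properties using (allFin⁺)
open import Data.List.Reverse using (Reverse; []; _∶_∶ʳ_; reverseView)
open import Data.Maybe.Base as Maybe using (Maybe; just; nothing)
open import Data.Nat.Base as ℕ using (ℕ; zero; suc; z≤n; s≤s)
open import Data.Nat.Logarithm using (⌈log₂2^n⌉≡n)
import Data.Nat.Properties as ℕ
open import Data.Product.Base using (Σ; ∃; _×_; _,_; proj₁; proj₂)
open import Data.Sum.Base using (_⊎_; inj₁; inj₂; [_,_])
import Data.Sum.Properties as Sum
open import Data.Unit.Base using (⊤; tt)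
open import Data.Vec.Functional as Vector using (Vector)
open import Function.Base using (_∘_)
open import Function.Definitions using (Injective)
open import Level using (0ℓ)
open import Relation.Binary.Definitions using (DecidableEquality)
open import Relation.Binary.PropositionalEquality hiding (J; [_])
open import Relation.Nullary using (¬_; Dec; yes; no; does; contradiction)
open import Relation.Nullary.Decidable using (dec-true; dec-false; map′; _×-dec_; _⊎-dec_)

-- Every channel here is a uniform mixture of conjugations by signed permutation matrices, indexed
-- by bit strings of even length `h`; its degree is `2 ^ h` and its Kraus amplitudes `½ ^ (h / 2)`
-- are rational. For fixed `lam` the mixture is given by one finite table of words in an alphabet of
-- letters, and a letter makes sense on every number `n` of sites.
--
-- Base system. A site is a pair of bits `(p , q)`. A letter multiplies by a character of the top
-- site, adds the q of every site to the p of the site above it, turns all sites by a common power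
-- of an element of order three of GL₂(𝔽₂), and adds a vector at the bottom site. Letters are
-- Clifford operators, so conjugation by a letter permutes the Pauli coefficients `(a , b)` of a
-- matrix up to sign. Averaging over the phase at the top and the shift at the bottom removes the
-- coefficients for which a certain site at the end of `a` or of `b` is nonzero. The random turn
-- lets the last nonzero site of `a` climb, or, if `a` vanishes, the first nonzero site of `b`
-- descend, with probability at least 5/8, so every nonzero coefficient drifts towards removal. A
-- Schur test with weights geometric in the position of that site shows that the average over two
-- letters contracts the nonzero coefficients by `κ` = 31/32, whatever `n` is.
--
-- Amplification. Independent words would waste degree, so the words are read off along a walk on a
-- Cayley graph of `K ^ s`, where `K` is the group of words of fixed length and the `4 ^ k`
-- generators have bias ε, about `k / 2 ^ k` up to a constant. Such generators exist by the method
-- of conditional expectations. The `s` steps of a round read the `s` different blocks of the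
-- position. On functions independent of the position a fresh block acts like an independent average
-- over `K`, which contracts by ε; on the complement the walk contracts by ε. Sorting the products
-- by the step at which the uniform part is taken gives `r s ≤ (s + 1)² ε ^ (s - 1)` for a round:
-- only one factor ε is lost. A round costs `2 k s` bits, so the degree is about the contraction to
-- the power `-2 s / (s - 1)`. With `s = 2 q + 2` and `k` large, this beats the exponent
-- `2 + 1 / q`, with a factor ½ to spare in each round (`gadget`).
--
-- The exponent. Take `q = 2 ^ j`. The initial position of the walk costs a constant number of bits,
-- which the spare factors pay for as soon as `lam` is below a threshold depending on `j`. The
-- numbers `Δ j` decrease to 0 and lie below the thresholds, and gadget `j` is used when a rational
-- approximation from below to `lam` lies between `Δ (suc j)` and `Δ j`. The function `β` is a
-- weighted sum of truncated linear functions, built to be continuous, to tend to 0 and to be at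
-- least `½ ^ j` there. Only gadget 0 is used without a threshold, and it determines the constant
-- `C₀`.
--
-- Explicitness. A circuit prepares the uniform superposition of control strings in the ancillas and
-- applies the letters of the selected word by controlled gates on neighbouring sites. The gate set
-- depends on `lam` only. The dimension is a power of four, whose binary expansion is a run of zeros
-- and a 1; a Turing machine uses the zeros as a counter and prints the circuit with a few nested
-- loops. All estimates are proved for the rational approximations term by term; limits enter only
-- in norms, real powers and `β`.

module Binary where
  open import Data.Digit using (toDigits; fromDigits)
  open import Data.Nat.Base using (_+_; _*_; _^_)
  open import Defs using (binary)

  private
    odd≢even : ∀ a b → suc (b * 2) ≢ a * 2
    odd≢even (suc a) (suc b) e = odd≢even a b (ℕ.suc-injective (ℕ.suc-injective e))

    2^suc : ∀ n → 2 ^ suc n ≡ 2 ^ n * 2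
    2^suc n = ℕ.*-comm 2 (2 ^ n)

    digits : ∀ n (ds : List (Fin 2)) → fromDigits ds ≡ 2 ^ n → ∃ λ zs → ds ≡ replicate n zero ++ suc zero ∷ zs
    digits zero [] ()
    digits zero (zero ∷ ds) e = contradiction (sym e) (odd≢even (fromDigits ds) 0)
    digits zero (suc zero ∷ ds) e = ds , refl
    digits (suc n) [] e = contradiction e (ℕ.<⇒≢ (ℕ.m^n>0 2 (suc n)))
    digits (suc n) (zero ∷ ds) e with digits n ds (ℕ.*-cancelʳ-≡ (fromDigits ds) (2 ^ n) 2 (trans e (2^suc n)))
    ... | zs , refl = zs , refl
    digits (suc n) (suc zero ∷ ds) e = contradiction (trans e (2^suc n)) (odd≢even (2 ^ n) (fromDigits ds))

  -- `toDigits` only promises a list with value `2 ^ n`, so the digits are found by peeling off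
  -- parities, and the tail `zs` beyond the 1 stays unspecified.
  binary-2^ : ∀ n → ∃ λ zs → binary (2 ^ n) ≡ replicate n zero ++ suc zero ∷ zs
  binary-2^ n = digits n _ (proj₂ (toDigits 2 (2 ^ n)))

-- A small programming language compiled to single-tape Turing machines

module Turing where
  open import Data.List.Base using (drop; _ʳ++_)
  open import Data.Nat.DivMod using (_mod_; m<n⇒m%n≡m; m%n<n)
  open import Data.Nat.Base using (_+_; _*_; _∸_; _≤_; _<_)
  open import Defs using (Symbol; Move; left; right; TuringMachine; Config; config; run; load; move; word; OutputsWithin)
  open import Data.Nat.Tactic.RingSolver using (solve-∀)

  data Print : Set where
    bit : Fin 2 → Print
    ones all : Print

  -- The only data is a unary counter, a row of cells of which an initial part is marked. `advance`
  -- marks one more cell, `reset` unmarks all, and `again b` jumps back by `b` instructions unless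
  -- all cells are marked. `ones` and `all` print one 1 for every marked cell, respectively for
  -- every cell.
  data Instr : Set where
    print : Print → Instr
    advance reset halt : Instr
    again : ℕ → Instr

  -- A product of finite sets, so that `combine` numbers the states. The second component is a bit
  -- carried along, or separates two phases that share a number.
  Phase : Set
  Phase = Fin 9 × Fin 2

  pattern carry b = 0F , b
  pattern out b = 1F , b
  pattern ret b = 2F , b
  pattern find b = 3F , b
  pattern start = 4F , 0F
  pattern back = 4F , 1F
  pattern jump = 5F , 0F
  pattern done = 5F , 1F
  pattern setup₀ = 6F , 0F
  pattern setup₁ = 6F , 1F
  pattern setup₂ = 7F , 0F
  pattern setup₃ = 7F , 1F
  pattern clear b = 8F , b

  Action : Set
  Action = ℕ × Phase × Symbol × Move

  symbol : Print → Fin 2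
  symbol (bit b) = b
  symbol ones = 1F
  symbol all = 1F

  -- A tape holds, from left to right, the counter, a blank, the output and a blank. Between
  -- two instructions the head is on the cell to the left of the first blank.
  enter : Instr → ℕ → Symbol → Action
  enter (print (bit _)) pc x = pc , carry 0F , x , right
  enter (print all) pc (just b) = pc , carry b , nothing , right
  enter (print all) pc nothing = pc , back , nothing , right
  enter (print ones) pc (just 1F) = pc , carry 1F , nothing , right
  enter (print ones) pc x = pc , back , x , right
  enter advance pc (just 1F) = pc , start , just 1F , left
  enter advance pc (just 0F) = pc , back , just 1F , right
  enter advance pc nothing = pc , back , nothing , right
  enter reset pc (just 1F) = pc , start , just 0F , left
  enter reset pc x = pc , back , x , right
  enter (again _) pc (just 1F) = pc , start , just 1F , left
  enter (again _) pc (just 0F) = pc , jump , just 0F , right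
  enter (again _) pc nothing = pc , back , nothing , right
  enter halt pc x = pc , jump , x , right

  jumped : Instr → ℕ → Action
  jumped halt pc = pc , done , nothing , right
  jumped (again b) pc = pc ∸ b , start , nothing , left
  jumped _ pc = suc pc , start , nothing , left

  written : Instr → Fin 2
  written (print p) = symbol p
  written _ = 0F

  -- Applies when the head is back on the blank between counter and output. A single bit is then
  -- finished, whereas a counted print still has to restore the cell that it blanked.
  resume : Instr → ℕ → Fin 2 → Action
  resume (print (bit _)) pc a = suc pc , start , nothing , left
  resume _ pc a = pc , find a , nothing , left

  rule : Instr → ℕ → Phase → Symbol → Maybe Action
  rule c pc (carry a) (just b) = just (pc , carry a , just b , right)
  rule c pc (carry a) nothing = just (pc , out a , nothing , right)
  rule c pc (out a) (just b) = just (pc , out a , just b , right)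
  rule c pc (out a) nothing = just (pc , clear a , just (written c) , right)
  -- The cell after the new bit may still hold a digit of the input; blanking it keeps the output
  -- delimited.
  rule c pc (clear a) x = just (pc , ret a , nothing , left)
  rule c pc (ret a) (just b) = just (pc , ret a , just b , left)
  rule c pc (ret a) nothing = just (resume c pc a)
  rule c pc (find a) (just b) = just (pc , find a , just b , left)
  rule c pc (find a) nothing = just (pc , start , just a , left)
  rule c pc start x = just (enter c pc x)
  rule c pc back (just b) = just (pc , back , just b , right)
  rule c pc back nothing = just (suc pc , start , nothing , left)
  rule c pc jump (just b) = just (pc , jump , just b , right)
  rule c pc jump nothing = just (jumped c pc)
  rule c pc done x = nothing
  -- The set-up erases two zeros, keeps the other zeros as counter cells, and turns the first 1 into
  -- the separator and the cell after it into the end of an empty output.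
  rule c pc setup₀ x = just (pc , setup₁ , nothing , right)
  rule c pc setup₁ x = just (pc , setup₂ , nothing , right)
  rule c pc setup₂ (just 0F) = just (pc , setup₂ , just 0F , right)
  rule c pc setup₂ (just 1F) = just (pc , setup₃ , nothing , right)
  rule c pc setup₂ nothing = just (pc , start , nothing , left)
  rule c pc setup₃ x = just (pc , setup₂ , nothing , left)

  first : List Instr → Instr
  first [] = halt
  first (c ∷ _) = c

  text : ℕ → ℕ → Print → List (Fin 2)
  text i j (bit b) = b ∷ []
  text i j ones = replicate i 1F
  text i j all = replicate (i + j) 1F

  -- Bounds the time of one instruction when counter and output have length at most `X`: each of at
  -- most `X` cells may require a trip to the end of the output and back, and the turn at the end
  -- adds linearly many steps.
  cost : ℕ → ℕ
  cost X = X * (4 * X + 7) + (X + (X + 6))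

  module Machine (prog : List Instr) where

    P : ℕ
    P = length prog

    -- The reduction modulo `suc P` makes the encoding total; it is invertible on the program
    -- counters up to `P`, which are the ones that occur.
    encodeState : ℕ → Phase → Fin (suc P * 18)
    encodeState pc (a , b) = combine (pc mod suc P) (combine {9} {2} a b)

    decodeState : Fin (suc P * 18) → ℕ × Phase
    decodeState s = toℕ (proj₁ (remQuot {suc P} 18 s)) , remQuot {9} 2 (proj₂ (remQuot {suc P} 18 s))

    perform : Action → Fin (suc P * 18) × Symbol × Move
    perform (pc , l , y , d) = encodeState pc l , y , d

    transition : ℕ × Phase → Symbol → Maybe (Fin (suc P * 18) × Symbol × Move)
    transition (pc , l) x = Maybe.map perform (rule (first (drop pc prog)) pc l x)

    M : TuringMachine
    M = record { states = suc P * 18 ; start = encodeState 0 setup₀ ; δ = λ s x → transition (decodeState s) x }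

    open TuringMachine M using (δ)

    decode-encode : ∀ {pc} l → pc ≤ P → decodeState (encodeState pc l) ≡ (pc , l)
    decode-encode {pc} (a , b) pc≤P = cong₂ _,_
      (trans (cong (λ z → toℕ (proj₁ z)) quot) (trans (Fin.toℕ-fromℕ< (m%n<n pc (suc P))) (m<n⇒m%n≡m (s≤s pc≤P))))
      (trans (cong (λ z → remQuot {9} 2 (proj₂ z)) quot) (Fin.remQuot-combine {9} {2} a b))
      where quot = Fin.remQuot-combine {suc P} {18} (pc mod suc P) (combine {9} {2} a b)

    Cfg : Set
    Cfg = Config (suc P * 18)

    view : Fin (suc P * 18) → List Symbol → List Symbol → Cfg
    view s [] rs = config s [] nothing rs
    view s (x ∷ ls) rs = config s ls x rs

    infix 4 _⟶[_]_
    -- Quantifying over the remaining fuel `u` makes runs composable without reference to halting.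
    record _⟶[_]_ (c : Cfg) (T : ℕ) (c′ : Cfg) : Set where
      constructor mk
      field
        time : ℕ
        within : time ≤ T
        reaches : ∀ u → run M (time + u) c ≡ run M u c′

    infixr 3 _≫_
    _≫_ : ∀ {c c′ c″ S T} → c ⟶[ S ] c′ → c′ ⟶[ T ] c″ → c ⟶[ S + T ] c″
    _≫_ {c} (mk s s≤S p) (mk t t≤T q) = mk (s + t) (ℕ.+-mono-≤ s≤S t≤T) λ u → trans (cong (λ v → run M v c) (ℕ.+-assoc s t u)) (trans (p (t + u)) (q u))

    stay : ∀ {c} → c ⟶[ 0 ] c
    stay = mk 0 z≤n λ u → refl

    relax : ∀ {c c′ S T} → S ≤ T → c ⟶[ S ] c′ → c ⟶[ T ] c′
    relax S≤T (mk t t≤S p) = mk t (ℕ.≤-trans t≤S S≤T) p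

    private
      run-step : ∀ s ls x rs {s′ y d} → δ s x ≡ just (s′ , y , d) → ∀ t → run M (suc t) (config s ls x rs) ≡ run M t (move M s′ ls y rs d)
      run-step s ls x rs e t rewrite e = refl

      move-left : ∀ s ls x rs → move M s ls x rs left ≡ view s ls (x ∷ rs)
      move-left s [] x rs = refl
      move-left s (l ∷ ls) x rs = refl

    -- The input is known up to its first 1 only; the output gradually overwrites the rest.
    module Run (trailing : List (Fin 2)) where

      -- The set-up blanks the digit that follows the 1, hence the `drop 1`. Each printed bit then
      -- uses up one more cell of what remains of the input.
      beyond : List Symbol
      beyond = drop 1 (map just trailing)

      ended output : List (Fin 2) → List Symbol
      ended os = map just os ++ nothing ∷ drop (length os) beyond
      output os = nothing ∷ ended os

      module At (pc : ℕ) (pc≤P : pc ≤ P) (c : Instr) (fetched : first (drop pc prog) ≡ c) where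

        at : Phase → Fin (suc P * 18)
        at = encodeState pc

        private
          δ-at : ∀ l {x a} → rule c pc l x ≡ just a → δ (at l) x ≡ just (perform a)
          δ-at l {x} e = trans (cong (λ z → transition z x) (decode-encode l pc≤P)) (cong (Maybe.map perform) (trans (cong (λ i → rule i pc l x) fetched) e))

        goRight : ∀ l x ls rs {pc′ l′ y} → rule c pc l x ≡ just (pc′ , l′ , y , right) → config (at l) ls x rs ⟶[ 1 ] load M (encodeState pc′ l′) (y ∷ ls) rs
        goRight l x ls rs e = mk 1 ℕ.≤-refl (run-step (at l) ls x rs (δ-at l e))

        goLeft : ∀ l x ls rs {pc′ l′ y} → rule c pc l x ≡ just (pc′ , l′ , y , left) → config (at l) ls x rs ⟶[ 1 ] view (encodeState pc′ l′) ls (y ∷ rs)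
        goLeft l x ls rs {pc′} {l′} {y} e = mk 1 ℕ.≤-refl λ u → trans (run-step (at l) ls x rs (δ-at l e) u) (cong (run M u) (move-left (encodeState pc′ l′) ls y rs))

        blocked : ∀ {l x ls rs} → rule c pc l x ≡ nothing → ∀ t → run M t (config (at l) ls x rs) ≡ just (config (at l) ls x rs)
        blocked {l} {x} e t rewrite trans (cong (λ z → transition z x) (decode-encode l pc≤P)) (cong (Maybe.map perform) (trans (cong (λ i → rule i pc l x) fetched) e)) = refl

        Rightward Leftward : Phase → Set
        Rightward l = ∀ b → rule c pc l (just b) ≡ just (pc , l , just b , right)
        Leftward l = ∀ b → rule c pc l (just b) ≡ just (pc , l , just b , left)

        skipRight : ∀ l → Rightward l → ∀ xs ls rs → load M (at l) ls (map just xs ++ rs) ⟶[ length xs ] load M (at l) (map just xs ʳ++ ls) rs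
        skipRight l r [] ls rs = stay
        skipRight l r (x ∷ xs) ls rs = goRight l (just x) ls (map just xs ++ rs) (r x) ≫ skipRight l r xs (just x ∷ ls) rs

        skipLeft : ∀ l → Leftward l → ∀ xs ls rs → view (at l) (map just xs ʳ++ ls) rs ⟶[ length xs ] view (at l) ls (map just xs ++ rs)
        skipLeft l r [] ls rs = stay
        skipLeft l r (x ∷ xs) ls rs = relax (ℕ.≤-reflexive (ℕ.+-comm (length xs) 1)) (skipLeft l r xs (just x ∷ ls) rs ≫ goLeft l (just x) ls (map just xs ++ rs) (r x))

        -- One round trip with a bit `a` remembered in the state: over the counter cells `d` and the
        -- output, where a bit is appended and the next cell blanked, and back to the separator. The
        -- output is crossed twice, hence the two summands `length os`.
        deliver : ∀ a ls d os → load M (at (carry a)) ls (map just d ++ output os) ⟶[ length d + 1 + length os + length os + 3 ]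
          config (at (ret a)) (map just d ʳ++ ls) nothing (ended (os ++ written c ∷ []))
        deliver a ls d os = subst (λ r → load M (at (carry a)) ls (map just d ++ output os) ⟶[ length d + 1 + length os + length os + 3 ] config (at (ret a)) (map just d ʳ++ ls) nothing r) end≡
          (relax (ℕ.≤-reflexive (trans (cong (λ n → length d + (1 + (length os + (1 + (1 + n))))) (List.length-++ os)) (reassoc (length d) (length os))))
          (skipRight (carry a) (λ b → refl) d ls (output os) ≫ goRight (carry a) nothing (map just d ʳ++ ls) (ended os) refl
            ≫ skipRight (out a) (λ b → refl) os ls′ (nothing ∷ drop (length os) beyond)
            ≫ goRight (out a) nothing (map just os ʳ++ ls′) (drop (length os) beyond) refl
            ≫ clear-next (drop (length os) beyond)
            ≫ skipLeft (ret a) (λ b → refl) (os ++ written c ∷ []) ls′ (nothing ∷ drop 1 (drop (length os) beyond))))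
          where
          ls′ = nothing ∷ (map just d ʳ++ ls)
          snoc-ʳ++ : ∀ (os : List (Fin 2)) {b} ls → just b ∷ (map just os ʳ++ ls) ≡ map just (os ++ b ∷ []) ʳ++ ls
          snoc-ʳ++ [] ls = refl
          snoc-ʳ++ (o ∷ os) ls = snoc-ʳ++ os (just o ∷ ls)
          clear-next : ∀ rs → load M (at (clear a)) (just (written c) ∷ (map just os ʳ++ ls′)) rs ⟶[ 1 ] view (at (ret a)) (map just (os ++ written c ∷ []) ʳ++ ls′) (nothing ∷ drop 1 rs)
          clear-next rs = subst (λ ks → load M (at (clear a)) (just (written c) ∷ (map just os ʳ++ ls′)) rs ⟶[ 1 ] view (at (ret a)) ks (nothing ∷ drop 1 rs)) (snoc-ʳ++ os ls′) (cleared rs)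
            where
            cleared : ∀ rs → load M (at (clear a)) (just (written c) ∷ (map just os ʳ++ ls′)) rs ⟶[ 1 ] view (at (ret a)) (just (written c) ∷ (map just os ʳ++ ls′)) (nothing ∷ drop 1 rs)
            cleared [] = goLeft (clear a) nothing _ [] refl
            cleared (r ∷ rs) = goLeft (clear a) r _ rs refl
          end≡ : map just (os ++ written c ∷ []) ++ nothing ∷ drop 1 (drop (length os) beyond) ≡ ended (os ++ written c ∷ [])
          end≡ = cong (λ zs → map just (os ++ written c ∷ []) ++ nothing ∷ zs)
            (trans (List.drop-drop (length os) 1 beyond) (cong (λ n → drop n beyond) (sym (List.length-++ os))))
          reassoc : ∀ x y → x + (1 + (y + (1 + (1 + (y + 1))))) ≡ x + 1 + y + y + 3
          reassoc = solve-∀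

        -- The phase `start` scans the counter from its right end, changing a cell x to f x
        -- and emitting e, until it turns around; the cells passed already are d.
        module Scan (f : Fin 2 → Fin 2) (e : List (Fin 2)) (X : ℕ) where

          emitted : List (Fin 2) → List (Fin 2) → List (Fin 2)
          emitted [] os = os
          emitted (_ ∷ xs) os = emitted xs (os ++ e)

          Cell : Fin 2 → Set
          Cell x = ∀ ls d os → length d ≤ X → length os ≤ X → config (at start) ls (just x) (map just d ++ output os) ⟶[ 4 * X + 7 ]
            view (at start) ls (just (f x) ∷ map just d ++ output (os ++ e))

          scan : ∀ {y y′ l pc′} → rule c pc start y ≡ just (pc , l , y′ , right) → Rightward l → rule c pc l nothing ≡ just (pc′ , start , nothing , left) →
            ∀ xs → All Cell xs → ∀ ls d os → length xs + length d ≤ X → length xs * length e + length os ≤ X →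
            view (at start) (map just xs ++ y ∷ ls) (map just d ++ output os) ⟶[ length xs * (4 * X + 7) + (X + 2) ]
            view (encodeState pc′ start) (map just d ʳ++ (map just (map f xs) ++ y′ ∷ ls)) (output (emitted xs os))
          scan {y} {y′} {l} turn r stop [] [] ls d os d≤X os≤X = relax (ℕ.≤-trans (ℕ.≤-reflexive (reorder (length d))) (ℕ.+-monoˡ-≤ 2 d≤X))
            (goRight start y ls (map just d ++ output os) turn ≫ skipRight l r d (y′ ∷ ls) (output os) ≫ goLeft l nothing (map just d ʳ++ (y′ ∷ ls)) (ended os) stop)
            where
            reorder : ∀ a → 1 + (a + 1) ≡ a + 2
            reorder = solve-∀
          scan {y} turn r stop (x ∷ xs) (cell ∷ cells) ls d os d≤X os≤X = relax (ℕ.≤-reflexive (sym (ℕ.+-assoc (4 * X + 7) (length xs * (4 * X + 7)) (X + 2))))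
            (cell (map just xs ++ y ∷ ls) d os (ℕ.≤-trans (ℕ.m≤n+m (length d) (suc (length xs))) d≤X) (ℕ.≤-trans (ℕ.m≤n+m (length os) (suc (length xs) * length e)) os≤X)
            ≫ scan turn r stop xs cells ls (f x ∷ d) (os ++ e) (subst (_≤ X) (sym (ℕ.+-suc (length xs) (length d))) d≤X)
                (subst (_≤ X) (trans (reorder (length e) (length xs * length e) (length os)) (cong (length xs * length e +_) (sym (List.length-++ os)))) os≤X))
            where
            reorder : ∀ a b c → (a + b) + c ≡ b + (c + a)
            reorder = solve-∀

          keep-cell : ∀ {x} → e ≡ [] → rule c pc start (just x) ≡ just (pc , start , just (f x) , left) → Cell x
          keep-cell {x} e≡[] r ls d os _ _ = relax (ℕ.m≤n⇒m≤o+n (4 * X) (s≤s z≤n))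
            (subst (λ os′ → config (at start) ls (just x) (map just d ++ output os) ⟶[ 1 ] view (at start) ls (just (f x) ∷ map just d ++ output os′))
              (sym (trans (cong (os ++_) e≡[]) (List.++-identityʳ os))) (goLeft start (just x) ls (map just d ++ output os) r))

          -- The cell is blanked while its value travels in the state; the blank is the mark by
          -- which `find` recognises the cell on the way back and restores it.
          count-cell : ∀ {x} → f x ≡ x → e ≡ written c ∷ [] → (∀ a → resume c pc a ≡ (pc , find a , nothing , left)) →
            rule c pc start (just x) ≡ just (pc , carry x , nothing , right) → Cell x
          count-cell {x} fx e≡ res r ls d os d≤X os≤X rewrite fx | e≡ = relax
            (ℕ.≤-trans (ℕ.≤-reflexive (total (length d) (length os))) (ℕ.≤-trans (ℕ.+-monoˡ-≤ 7 (ℕ.+-mono-≤ (ℕ.*-monoʳ-≤ 2 d≤X) (ℕ.*-monoʳ-≤ 2 os≤X))) (ℕ.≤-reflexive (double X))))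
            (goRight start (just x) ls (map just d ++ output os) r ≫ deliver x (nothing ∷ ls) d os ≫ goLeft (ret x) nothing (map just d ʳ++ (nothing ∷ ls)) (ended (os ++ written c ∷ [])) (cong just (res x))
            ≫ skipLeft (find x) (λ b → refl) d (nothing ∷ ls) (output (os ++ written c ∷ [])) ≫ goLeft (find x) nothing ls (map just d ++ output (os ++ written c ∷ [])) refl)
            where
            total : ∀ a b → 1 + (a + 1 + b + b + 3 + (1 + (a + 1))) ≡ 2 * a + 2 * b + 7
            total = solve-∀
            double : ∀ a → 2 * a + 2 * a + 7 ≡ 4 * a + 7
            double = solve-∀

        print-bit : ∀ {b} → c ≡ print (bit b) → ∀ x ls os → config (at start) ls x (output os) ⟶[ 2 * length os + 6 ]
          config (encodeState (suc pc) start) ls x (output (os ++ b ∷ []))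
        print-bit refl x ls os = relax (ℕ.≤-reflexive (total (length os))) (goRight start x ls (output os) refl ≫ deliver 0F (x ∷ ls) [] os ≫ goLeft (ret 0F) nothing (x ∷ ls) (ended (os ++ written c ∷ [])) refl)
          where
          total : ∀ b → 1 + (0 + 1 + b + b + 3 + 1) ≡ 2 * b + 6
          total = solve-∀

      -- The two blanks at the left end are the erased leading digits of the input.
      zeros : ℕ → List Symbol
      zeros j = map just (replicate j 0F) ++ nothing ∷ nothing ∷ []

      tape : ℕ → ℕ → List Symbol
      tape i j = map just (replicate i 1F) ++ zeros j

      record State : Set where
        constructor state
        field
          counter : ℕ
          marked empty : ℕ
          printed : List (Fin 2)

        cells : ℕ
        cells = marked + empty

        home : Cfg
        home = view (encodeState counter start) (tape marked empty) (output printed)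

      open State

      infix 4 _⇒[_]_
      -- `J` bounds the number of executed instructions. An instruction appends at most as many bits
      -- as the counter has cells, so the output length is controlled along the run, and one bound
      -- `X` on counter and output together serves for the time of every instruction.
      record _⇒[_]_ (s : State) (J : ℕ) (s′ : State) : Set where
        field
          preserved : cells s′ ≡ cells s
          growth : length (printed s′) ≤ length (printed s) + J * suc (cells s)
          executes : ∀ X → cells s + (length (printed s) + J * suc (cells s)) ≤ X → home s ⟶[ J * cost X ] home s′

      open _⇒[_]_

      rest-⇒ : ∀ {s} → s ⇒[ 0 ] s
      rest-⇒ = record { preserved = refl ; growth = ℕ.m≤m+n _ 0 ; executes = λ _ _ → stay }

      relax-⇒ : ∀ {s s′ J K} → J ≤ K → s ⇒[ J ] s′ → s ⇒[ K ] s′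
      relax-⇒ {s} J≤K p = record { preserved = preserved p
        ; growth = ℕ.≤-trans (growth p) (ℕ.+-monoʳ-≤ (length (printed s)) (ℕ.*-monoˡ-≤ (suc (cells s)) J≤K))
        ; executes = λ X b → relax (ℕ.*-monoˡ-≤ (cost X) J≤K)
            (executes p X (ℕ.≤-trans (ℕ.+-monoʳ-≤ (cells s) (ℕ.+-monoʳ-≤ (length (printed s)) (ℕ.*-monoˡ-≤ (suc (cells s)) J≤K))) b)) }

      infixr 3 _»_
      _»_ : ∀ {s s′ s″ J K} → s ⇒[ J ] s′ → s′ ⇒[ K ] s″ → s ⇒[ J + K ] s″
      _»_ {s} {s′} {s″} {J} {K} p q = record { preserved = trans (preserved q) (preserved p)
        ; growth = ℕ.≤-trans (growth q) (subst (λ m → length (printed s′) + K * suc m ≤ length (printed s) + (J + K) * suc (cells s)) (sym (preserved p)) bound)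
        ; executes = λ X b → relax (ℕ.≤-reflexive (sym (ℕ.*-distribʳ-+ (cost X) J K)))
            (executes p X (ℕ.≤-trans (ℕ.+-monoʳ-≤ (cells s) (ℕ.+-monoʳ-≤ (length (printed s)) (ℕ.*-monoˡ-≤ (suc (cells s)) (ℕ.m≤m+n J K)))) b)
            ≫ executes q X (ℕ.≤-trans (subst (λ m → m + (length (printed s′) + K * suc m) ≤ cells s + (length (printed s) + (J + K) * suc (cells s))) (sym (preserved p)) (ℕ.+-monoʳ-≤ (cells s) bound)) b)) }
        where
        distribute : ∀ a j k c → a + j * c + k * c ≡ a + (j + k) * c
        distribute = solve-∀
        bound : length (printed s′) + K * suc (cells s) ≤ length (printed s) + (J + K) * suc (cells s)
        bound = ℕ.≤-trans (ℕ.+-monoˡ-≤ (K * suc (cells s)) (growth p)) (ℕ.≤-reflexive (distribute (length (printed s)) J K (suc (cells s))))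

      retarget : ∀ {c T c′ c″} → c′ ≡ c″ → c ⟶[ T ] c′ → c ⟶[ T ] c″
      retarget refl r = r

      drop-≤ : ∀ {c rest} (cs : List Instr) pc → drop pc cs ≡ c ∷ rest → pc ≤ length cs
      drop-≤ cs zero e = z≤n
      drop-≤ (_ ∷ cs) (suc pc) e = s≤s (drop-≤ cs pc e)

      module Execute {pc : ℕ} {c : Instr} {rest : List Instr} (fetched : drop pc prog ≡ c ∷ rest) where
        open At pc (drop-≤ prog pc fetched) c (cong first fetched)

        private
          single : ∀ s s′ → cells s′ ≡ cells s → length (printed s′) ≤ length (printed s) + cells s →
            (∀ X → cells s + length (printed s) ≤ X → cells s ≤ X → home s ⟶[ cost X ] home s′) → s ⇒[ 1 ] s′
          single s s′ same grown exec = record { preserved = same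
            ; growth = ℕ.≤-trans grown (ℕ.+-monoʳ-≤ (length (printed s)) (ℕ.≤-trans (ℕ.n≤1+n (cells s)) (ℕ.≤-reflexive (sym (ℕ.*-identityˡ (suc (cells s)))))))
            ; executes = λ X b → relax (ℕ.≤-reflexive (sym (ℕ.*-identityˡ (cost X))))
                (exec X (ℕ.≤-trans (ℕ.+-monoʳ-≤ (cells s) (ℕ.m≤m+n (length (printed s)) _)) b) (ℕ.≤-trans (ℕ.m≤m+n (cells s) _) b)) }

          scan-cost : ∀ {n X} → n ≤ X → n * (4 * X + 7) + (X + 2) ≤ cost X
          scan-cost {n} {X} n≤X = ℕ.+-mono-≤ (ℕ.*-monoˡ-≤ (4 * X + 7) n≤X) (ℕ.+-monoʳ-≤ X (ℕ.m≤n⇒m≤o+n X (s≤s (s≤s z≤n))))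

          emitted-[] : ∀ f X xs os → Scan.emitted f [] X xs os ≡ os
          emitted-[] f X [] os = refl
          emitted-[] f X (x ∷ xs) os = trans (emitted-[] f X xs (os ++ [])) (List.++-identityʳ os)

          emitted-1 : ∀ f X xs os → Scan.emitted f (1F ∷ []) X xs os ≡ os ++ replicate (length xs) 1F
          emitted-1 f X [] os = sym (List.++-identityʳ os)
          emitted-1 f X (x ∷ xs) os = trans (emitted-1 f X xs (os ++ 1F ∷ [])) (List.++-assoc os (1F ∷ []) (replicate (length xs) 1F))

          scan-ones : ∀ (f : Fin 2 → Fin 2) e i {y y′ l pc′} ls os X → (∀ X → Scan.Cell f e X 1F) →
            rule c pc start y ≡ just (pc , l , y′ , right) → Rightward l → rule c pc l nothing ≡ just (pc′ , start , nothing , left) →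
            length e ≤ 1 → i ≤ X → i + length os ≤ X →
            view (at start) (map just (replicate i 1F) ++ y ∷ ls) (output os) ⟶[ cost X ]
            view (encodeState pc′ start) (map just (replicate i (f 1F)) ++ y′ ∷ ls) (output (Scan.emitted f e X (replicate i 1F) os))
          scan-ones f e i {y} {y′} {l} {pc′} ls os X cell turn r stop e≤1 i≤X io≤X = relax (scan-cost {length (replicate i 1F)} len≤X)
            (retarget (cong (λ xs → view (encodeState pc′ start) (map just xs ++ y′ ∷ ls) (output (Scan.emitted f e X (replicate i 1F) os))) (List.map-replicate f i 1F))
              (Scan.scan f e X {y} {y′} {l} {pc′} turn r stop (replicate i 1F) (All.replicate⁺ i (cell X)) ls [] os
                (ℕ.≤-trans (ℕ.≤-reflexive (ℕ.+-identityʳ _)) len≤X)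
                (ℕ.≤-trans (ℕ.+-monoˡ-≤ (length os) (ℕ.≤-trans (ℕ.*-monoʳ-≤ (length (replicate i 1F)) e≤1) (ℕ.≤-reflexive (trans (ℕ.*-identityʳ _) (List.length-replicate i))))) io≤X)))
            where
            len≤X : length (replicate i 1F) ≤ X
            len≤X = subst (_≤ X) (sym (List.length-replicate i)) i≤X

        -- The counter is required to be nonempty because `single` charges the growth of the output
        -- to the cells.
        print-bit-⇒ : ∀ {b} → c ≡ print (bit b) → ∀ i j os → 0 < i + j → state pc i j os ⇒[ 1 ] state (suc pc) i j (os ++ b ∷ [])
        print-bit-⇒ {b} e i j os 0<m = single _ _ refl (ℕ.≤-trans (ℕ.≤-reflexive (List.length-++ os)) (ℕ.+-monoʳ-≤ (length os) 0<m))
          λ X mo≤X _ → relax (ℕ.m≤n⇒m≤o+n (X * (4 * X + 7)) (ℕ.≤-trans (ℕ.≤-reflexive (double (length os))) (ℕ.+-mono-≤ (o≤ mo≤X) (ℕ.+-monoˡ-≤ 6 (o≤ mo≤X))))) (by-cells i j)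
          where
          o≤ : ∀ {X} → i + j + length os ≤ X → length os ≤ X
          o≤ = ℕ.≤-trans (ℕ.m≤n+m (length os) (i + j))
          double : ∀ o → 2 * o + 6 ≡ o + (o + 6)
          double = solve-∀
          by-cells : ∀ i j → home (state pc i j os) ⟶[ 2 * length os + 6 ] home (state (suc pc) i j (os ++ b ∷ []))
          by-cells zero zero = print-bit e nothing (nothing ∷ []) os
          by-cells zero (suc j) = print-bit e (just 0F) (zeros j) os
          by-cells (suc i) j = print-bit e (just 1F) (tape i j) os

        print-ones-⇒ : c ≡ print ones → ∀ i j os → state pc i j os ⇒[ 1 ] state (suc pc) i j (os ++ replicate i 1F)
        print-ones-⇒ refl i j os = single _ _ refl
          (ℕ.≤-trans (ℕ.≤-reflexive (trans (List.length-++ os) (cong (length os +_) (List.length-replicate i)))) (ℕ.+-monoʳ-≤ (length os) (ℕ.m≤m+n i j)))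
          λ X mo≤X m≤X → retarget (cong (λ os → home (state (suc pc) i j os)) (trans (emitted-1 (λ x → x) X (replicate i 1F) os) (cong (λ n → os ++ replicate n 1F) (List.length-replicate i))))
            (by-cells j X (ℕ.≤-trans (ℕ.m≤m+n i j) m≤X) (ℕ.≤-trans (ℕ.+-monoˡ-≤ (length os) (ℕ.m≤m+n i j)) mo≤X))
          where
          cell : ∀ X → Scan.Cell (λ x → x) (1F ∷ []) X 1F
          cell X = Scan.count-cell (λ x → x) (1F ∷ []) X refl refl (λ a → refl) refl
          by-cells : ∀ j X → i ≤ X → i + length os ≤ X → home (state pc i j os) ⟶[ cost X ] home (state (suc pc) i j (Scan.emitted (λ x → x) (1F ∷ []) X (replicate i 1F) os))
          by-cells zero X = scan-ones (λ x → x) (1F ∷ []) i {l = back} (nothing ∷ []) os X cell refl (λ b → refl) refl (s≤s z≤n)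
          by-cells (suc j) X = scan-ones (λ x → x) (1F ∷ []) i {l = back} (zeros j) os X cell refl (λ b → refl) refl (s≤s z≤n)

        print-all-⇒ : c ≡ print all → ∀ i j os → state pc i j os ⇒[ 1 ] state (suc pc) i j (os ++ replicate (i + j) 1F)
        print-all-⇒ refl i j os = single _ _ refl (ℕ.≤-reflexive (trans (List.length-++ os) (cong (length os +_) (List.length-replicate (i + j)))))
          λ X mo≤X m≤X → subst₂ (λ ls os′ → view (at start) ls (output os) ⟶[ cost X ] view (encodeState (suc pc) start) ls (output os′)) tape≡
            (trans (emitted-1 (λ x → x) X xs os) (cong (λ n → os ++ replicate n 1F) xs-length))
            (relax (scan-cost {length xs} (subst (_≤ X) (sym xs-length) m≤X))
            (retarget (cong (λ ys → view (encodeState (suc pc) start) (map just ys ++ nothing ∷ nothing ∷ []) (output (Scan.emitted (λ x → x) (1F ∷ []) X xs os))) (List.map-id xs))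
            (Scan.scan (λ x → x) (1F ∷ []) X {l = back} refl (λ b → refl) refl xs (All.universal (λ x → Scan.count-cell (λ x → x) (1F ∷ []) X refl refl (λ a → refl) refl) xs) (nothing ∷ []) [] os
              (subst (_≤ X) (sym (trans (ℕ.+-identityʳ (length xs)) xs-length)) m≤X)
              (subst (λ n → n + length os ≤ X) (sym (trans (ℕ.*-identityʳ (length xs)) xs-length)) mo≤X))))
          where
          xs : List (Fin 2)
          xs = replicate i 1F ++ replicate j 0F
          xs-length : length xs ≡ i + j
          xs-length = trans (List.length-++ (replicate i 1F)) (cong₂ _+_ (List.length-replicate i) (List.length-replicate j))
          tape≡ : map just xs ++ nothing ∷ nothing ∷ [] ≡ tape i j
          tape≡ = trans (cong (_++ nothing ∷ nothing ∷ []) (List.map-++ just (replicate i 1F) (replicate j 0F))) (List.++-assoc (map just (replicate i 1F)) (map just (replicate j 0F)) _)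

        private
          silent : ∀ (f : Fin 2 → Fin 2) s i′ j′ {y y′ l pc′} ls → tape (marked s) (empty s) ≡ map just (replicate (marked s) 1F) ++ y ∷ ls →
            map just (replicate (marked s) (f 1F)) ++ y′ ∷ ls ≡ tape i′ j′ → i′ + j′ ≡ cells s → counter s ≡ pc →
            rule c pc start (just 1F) ≡ just (pc , start , just (f 1F) , left) →
            rule c pc start y ≡ just (pc , l , y′ , right) → Rightward l → rule c pc l nothing ≡ just (pc′ , start , nothing , left) →
            s ⇒[ 1 ] state pc′ i′ j′ (printed s)
          silent f s@(state _ i j os) i′ j′ {y} {y′} {l} {pc′} ls before after same refl go turn r stop = single s _ same (ℕ.m≤m+n (length os) (i + j))
            λ X mo≤X m≤X → subst₂ (λ ks ks′ → view (at start) ks (output os) ⟶[ cost X ] view (encodeState pc′ start) ks′ (output os)) (sym before) after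
              (retarget (cong (λ os → view (encodeState pc′ start) (map just (replicate i (f 1F)) ++ y′ ∷ ls) (output os)) (emitted-[] f X (replicate i 1F) os))
                (scan-ones f [] i {l = l} ls os X (λ X → Scan.keep-cell f [] X refl go) turn r stop z≤n (ℕ.≤-trans (ℕ.m≤m+n i j) m≤X) (ℕ.≤-trans (ℕ.+-monoˡ-≤ (length os) (ℕ.m≤m+n i j)) mo≤X)))

        advance-⇒ : c ≡ advance → ∀ i j os → state pc i (suc j) os ⇒[ 1 ] state (suc pc) (suc i) j os
        advance-⇒ refl i j os = silent (λ x → x) (state pc i (suc j) os) (suc i) j {l = back} (zeros j) refl (snoc i) (sym (ℕ.+-suc i j)) refl refl refl (λ b → refl) refl
          where
          snoc : ∀ i → map just (replicate i 1F) ++ just 1F ∷ zeros j ≡ just 1F ∷ tape i j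
          snoc zero = refl
          snoc (suc i) = cong (just 1F ∷_) (snoc i)

        reset-⇒ : c ≡ reset → ∀ i os → state pc i 0 os ⇒[ 1 ] state (suc pc) 0 i os
        reset-⇒ refl i os = silent (λ _ → 0F) (state pc i 0 os) 0 i {l = back} (nothing ∷ []) refl refl (sym (ℕ.+-identityʳ i)) refl refl refl (λ b → refl) refl

        again-⇒ : ∀ {b} → c ≡ again b → ∀ i j os → state pc i (suc j) os ⇒[ 1 ] state (pc ∸ b) i (suc j) os
        again-⇒ refl i j os = silent (λ x → x) (state pc i (suc j) os) i (suc j) {l = jump} (zeros j) refl refl refl refl refl refl (λ b → refl) refl

        leave-⇒ : ∀ {b} → c ≡ again b → ∀ i os → state pc i 0 os ⇒[ 1 ] state (suc pc) i 0 os
        leave-⇒ refl i os = silent (λ x → x) (state pc i 0 os) i 0 {l = back} (nothing ∷ []) refl refl refl refl refl refl (λ b → refl) refl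

        halts : c ≡ halt → ∀ ls os → ∃ λ d → ∃ λ T → T ≤ 2 × word M (Config.here d ∷ Config.after d) ≡ os ×
          ∀ t → run M (T + t) (view (at start) ls (output os)) ≡ just d
        halts refl ls os = final os , time , within , read os , λ t → trans (reaches t) (stopped os t)
          where
          cells₀ : List Symbol → List Symbol
          cells₀ [] = nothing ∷ nothing ∷ []
          cells₀ (x ∷ ls) = nothing ∷ x ∷ ls
          turned : ∀ ls → view (at start) ls (output os) ⟶[ 2 ] load M (at done) (cells₀ ls) (ended os)
          turned [] = goRight start nothing [] (output os) refl ≫ goRight jump nothing (nothing ∷ []) (ended os) refl
          turned (x ∷ ls) = goRight start x ls (output os) refl ≫ goRight jump nothing (x ∷ ls) (ended os) refl
          open _⟶[_]_ (turned ls)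
          final : List (Fin 2) → Cfg
          final os = load M (at done) (cells₀ ls) (ended os)
          stopped : ∀ os t → run M t (final os) ≡ just (final os)
          stopped [] = blocked {done} {nothing} {cells₀ ls} {beyond} refl
          stopped (o ∷ os) = blocked {done} {just o} {cells₀ ls} {map just os ++ nothing ∷ drop (suc (length os)) beyond} refl
          read-all : ∀ os zs → word M (map just os ++ nothing ∷ zs) ≡ os
          read-all [] zs = refl
          read-all (o ∷ os) zs = cong (o ∷_) (read-all os zs)
          read : ∀ os → word M (Config.here (final os) ∷ Config.after (final os)) ≡ os
          read [] = refl
          read (o ∷ os) = cong (o ∷_) (read-all os (drop (suc (length os)) beyond))

      boot : ∀ m → load M (encodeState 0 setup₀) [] (map just (replicate (suc (suc m)) 0F) ++ just 1F ∷ map just trailing) ⟶[ 2 + (m + 3) ] home (state 0 0 m [])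
      boot m = goRight setup₀ (just 0F) [] (map just (replicate (suc m) 0F) ++ just 1F ∷ map just trailing) refl
        ≫ goRight setup₁ (just 0F) (nothing ∷ []) (map just (replicate m 0F) ++ just 1F ∷ map just trailing) refl
        ≫ subst (λ n → load M (at setup₂) (zeros 0) (map just (replicate m 0F) ++ just 1F ∷ map just trailing) ⟶[ m + 3 ] view (at start) (zeros n) (output [])) (ℕ.+-identityʳ m) (sweep m 0)
        where
        open At 0 z≤n (first prog) refl
        cleared : ∀ ls rs → load M (at setup₃) (nothing ∷ ls) rs ⟶[ 1 ] config (at setup₂) ls nothing (nothing ∷ drop 1 rs)
        cleared ls [] = goLeft setup₃ nothing (nothing ∷ ls) [] refl
        cleared ls (r ∷ rs) = goLeft setup₃ r (nothing ∷ ls) rs refl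
        sweep : ∀ b a → load M (at setup₂) (zeros a) (map just (replicate b 0F) ++ just 1F ∷ map just trailing) ⟶[ b + 3 ] view (at start) (zeros (b + a)) (output [])
        sweep zero a = goRight setup₂ (just 1F) (zeros a) (map just trailing) refl ≫ cleared (zeros a) (map just trailing) ≫ goLeft setup₂ nothing (zeros a) (nothing ∷ beyond) refl
        sweep (suc b) a = goRight setup₂ (just 0F) (zeros a) (map just (replicate b 0F) ++ just 1F ∷ map just trailing) refl
          ≫ retarget (cong (λ n → view (at start) (zeros n) (output [])) (ℕ.+-suc b a)) (sweep b (suc a))

      -- `run` accepts surplus fuel after halting, so a total time below `T` is padded to exactly
      -- `T`.
      outputs : ∀ {m J pc i j os} → state 0 0 m [] ⇒[ J ] state pc i j os → drop pc prog ≡ halt ∷ [] →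
        ∀ T → 2 + (m + 3) + (J * cost (m + J * suc m) + 2) ≤ T → OutputsWithin M T (replicate (suc (suc m)) 0F ++ 1F ∷ trailing) os
      outputs {m} {J} {pc} {i} {j} {os} p end T bound = proj₁ h , trans (cong (λ t → run M t c₀) (sym split)) (trans (reaches (tₕ + u)) (proj₂ (proj₂ (proj₂ (proj₂ h))) u)) , proj₁ (proj₂ (proj₂ (proj₂ h)))
        where
        c₀ = load M (encodeState 0 setup₀) [] (map just (replicate (suc (suc m)) 0F ++ 1F ∷ trailing))
        open _⟶[_]_ (subst (λ xs → load M (encodeState 0 setup₀) [] xs ⟶[ 2 + (m + 3) ] home (state 0 0 m [])) (sym (List.map-++ just (replicate (suc (suc m)) 0F) (1F ∷ trailing))) (boot m)
          ≫ executes p (m + J * suc m) ℕ.≤-refl)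
        h = Execute.halts {pc} end refl (tape i j) os
        tₕ = proj₁ (proj₂ h)
        total≤T : time + tₕ ≤ T
        total≤T = ℕ.≤-trans (ℕ.+-mono-≤ within (proj₁ (proj₂ (proj₂ h)))) (ℕ.≤-trans (ℕ.≤-reflexive (ℕ.+-assoc (2 + (m + 3)) (J * cost (m + J * suc m)) 2)) bound)
        u = T ∸ (time + tₕ)
        split : time + (tₕ + u) ≡ T
        split = trans (sym (ℕ.+-assoc time tₕ u)) (ℕ.m+[n∸m]≡n total≤T)

      drop-++ : ∀ (xs : List Instr) {ys} pc → drop pc prog ≡ xs ++ ys → drop (length xs + pc) prog ≡ ys
      drop-++ xs {ys} pc e = trans (cong (λ n → drop n prog) (ℕ.+-comm (length xs) pc)) (trans (sym (List.drop-drop pc (length xs) prog)) (trans (cong (drop (length xs)) e) (drop-length xs)))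
        where
        drop-length : ∀ (xs : List Instr) → drop (length xs) (xs ++ ys) ≡ ys
        drop-length [] = refl
        drop-length (x ∷ xs) = drop-length xs

      print-⇒ : ∀ p {pc rest} → drop pc prog ≡ print p ∷ rest → ∀ i j os → 0 < i + j → state pc i j os ⇒[ 1 ] state (suc pc) i j (os ++ text i j p)
      print-⇒ (bit b) at i j os 0<m = Execute.print-bit-⇒ at refl i j os 0<m
      print-⇒ ones at i j os 0<m = Execute.print-ones-⇒ at refl i j os
      print-⇒ all at i j os 0<m = Execute.print-all-⇒ at refl i j os

      prints-⇒ : ∀ ps pc {rest} → drop pc prog ≡ map print ps ++ rest → ∀ i j os → 0 < i + j →
        state pc i j os ⇒[ length ps ] state (length (map print ps) + pc) i j (os ++ concatMap (text i j) ps)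
      prints-⇒ [] pc at i j os 0<m = subst (λ os′ → state pc i j os ⇒[ 0 ] state pc i j os′) (sym (List.++-identityʳ os)) rest-⇒
      prints-⇒ (p ∷ ps) pc {rest} at i j os 0<m = subst₂ (λ n os′ → state pc i j os ⇒[ suc (length ps) ] state n i j os′) (ℕ.+-suc (length (map print ps)) pc) (List.++-assoc os (text i j p) (concatMap (text i j) ps))
        (print-⇒ p at i j os 0<m » prints-⇒ ps (suc pc) (drop-++ (print p ∷ []) pc at) i j (os ++ text i j p) 0<m)

-- The program that prints the circuits, and its running time

module Program where
  open import Data.List.Base using (drop)
  open import Data.Nat.ListAction using (sum)
  open import Data.Nat.Base using (_+_; _*_; _∸_; _^_; _≤_; _<_)
  open import Data.Nat.Tactic.RingSolver using (solve-∀)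
  open import Defs using (OutputsWithin; TuringMachine)
  open Turing

  -- The self-delimiting numerals used by `encode`.
  unary : ℕ → List (Fin 2)
  unary k = replicate k 1F ++ 0F ∷ []

  ones-unary : ∀ i k → replicate i 1F ++ unary k ≡ unary (i + k)
  ones-unary i k = trans (sym (List.++-assoc (replicate i 1F) (replicate k 1F) (0F ∷ []))) (cong (_++ 0F ∷ []) (sym (replicate-+ i)))
    where
    replicate-+ : ∀ i → replicate (i + k) 1F ≡ replicate i 1F ++ replicate k 1F
    replicate-+ zero = refl
    replicate-+ (suc i) = cong (1F ∷_) (replicate-+ i)

  -- The wires of the h control qubits come after the m + 2 data wires.
  module Layout (h : ℕ) where

    controlText : ℕ → List (Fin 2)
    controlText m = concat (tabulate {n = h} λ i → unary (m + (2 + toℕ i)))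

    -- The encoding of one operation: gate number, control wires, data wires. Data wires are given
    -- relative to `i`, the number of marked cells at that moment.
    opText : ℕ → ℕ → ℕ → List ℕ → List (Fin 2)
    opText m i g ks = unary g ++ controlText m ++ concatMap (λ k → unary (i + k)) ks

    control : List Print
    control = concat (tabulate {n = h} λ i → all ∷ map bit (unary (2 + toℕ i)))

    printOp : ℕ → List ℕ → List Print
    printOp g ks = map bit (unary g) ++ control ++ concatMap (λ k → ones ∷ map bit (unary k)) ks

    -- The numbers of the `lower`, `link` and `upper` gates that belong to one position in a word.
    Gates : Set
    Gates = ℕ × ℕ × ℕ

    body : ℕ → List Instr
    -- A link touches the q of one site and both bits of the next, at offsets 1, 2 and 3; a site has
    -- two wires, hence two `advance`.
    body l = map print (printOp l (1 ∷ 2 ∷ 3 ∷ [])) ++ advance ∷ advance ∷ []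

    block : Gates → List Instr
    -- When the loop ends all `m` cells are marked, and `m` is the first wire of the top site.
    block (b , l , t) = map print (printOp b (0 ∷ 1 ∷ [])) ++ body l ++ again (length (body l)) ∷ map print (printOp t (0 ∷ 1 ∷ [])) ++ reset ∷ []

    header : List Print
    header = map bit (unary h) ++ map bit (unary 0) ++ control

    program : List Gates → List Instr
    program gs = map print header ++ concatMap block gs ++ halt ∷ []

    linksText : ℕ → ℕ → ℕ → ℕ → List (Fin 2)
    linksText m l zero a = []
    linksText m l (suc t) a = opText m (a * 2) l (1 ∷ 2 ∷ 3 ∷ []) ++ linksText m l t (suc a)

    blockText : ℕ → Gates → List (Fin 2)
    blockText k (b , l , t) = opText (suc k * 2) 0 b (0 ∷ 1 ∷ []) ++ linksText (suc k * 2) l (suc k) 0 ++ opText (suc k * 2) (suc k * 2) t (0 ∷ 1 ∷ [])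

    programText : ℕ → List Gates → List (Fin 2)
    programText k gs = (unary h ++ unary 0 ++ controlText (suc k * 2)) ++ concatMap (blockText k) gs

    module _ (i j : ℕ) where
      private
        says : List Print → List (Fin 2)
        says = concatMap (text i j)

        says-++ : ∀ ps qs {v w} → says ps ≡ v → says qs ≡ w → says (ps ++ qs) ≡ v ++ w
        says-++ ps qs p q = trans (List.concatMap-++ (text i j) ps qs) (cong₂ _++_ p q)

        says-bits : ∀ w → says (map bit w) ≡ w
        says-bits [] = refl
        says-bits (b ∷ w) = cong (b ∷_) (says-bits w)

        says-tabulate : ∀ {n} (f : Fin n → List Print) (w : Fin n → List (Fin 2)) → (∀ i → says (f i) ≡ w i) → says (concat (tabulate f)) ≡ concat (tabulate w)
        says-tabulate {zero} f w e = refl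
        says-tabulate {suc n} f w e = says-++ (f zero) (concat (tabulate (f ∘ suc))) (e zero) (says-tabulate (f ∘ suc) (w ∘ suc) (e ∘ suc))

        says-control : says control ≡ controlText (i + j)
        says-control = says-tabulate {h} _ _ λ t → trans (cong (replicate (i + j) 1F ++_) (says-bits (unary (2 + toℕ t)))) (ones-unary (i + j) (2 + toℕ t))

        says-wires : ∀ ks → says (concatMap (λ k → ones ∷ map bit (unary k)) ks) ≡ concatMap (λ k → unary (i + k)) ks
        says-wires [] = refl
        says-wires (k ∷ ks) = says-++ (ones ∷ map bit (unary k)) _ (trans (cong (replicate i 1F ++_) (says-bits (unary k))) (ones-unary i k)) (says-wires ks)

      printOp-text : ∀ g ks → says (printOp g ks) ≡ opText (i + j) i g ks
      printOp-text g ks = says-++ (map bit (unary g)) _ (says-bits (unary g)) (says-++ control _ says-control (says-wires ks))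

      header-text : says header ≡ unary h ++ unary 0 ++ controlText (i + j)
      header-text = says-++ (map bit (unary h)) _ (says-bits (unary h)) (says-++ (map bit (unary 0)) control (says-bits (unary 0)) says-control)

    iteration : ℕ → ℕ
    iteration l = length (printOp l (1 ∷ 2 ∷ 3 ∷ [])) + 3

    blockSteps : Gates → ℕ
    blockSteps (b , l , t) = length (printOp b (0 ∷ 1 ∷ [])) + (iteration l + (length (printOp t (0 ∷ 1 ∷ [])) + 1))

    -- Does not depend on `k`: the part outside the loops is counted once per pass as well, so
    -- `suc k * steps gs` bounds the executed instructions.
    steps : List Gates → ℕ
    steps gs = length header + sum (map blockSteps gs)

    module _ (prog : List Instr) (trailing : List (Fin 2)) where
      open Machine prog
      open Run trailing

      op-⇒ : ∀ g ks pc {rest} → drop pc prog ≡ map print (printOp g ks) ++ rest → ∀ i j os {m} → i + j ≡ m → 0 < m →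
        state pc i j os ⇒[ length (printOp g ks) ] state (length (map print (printOp g ks)) + pc) i j (os ++ opText m i g ks)
      op-⇒ g ks pc at i j os refl 0<m = subst (λ w → state pc i j os ⇒[ length (printOp g ks) ] state (length (map print (printOp g ks)) + pc) i j (os ++ w))
        (printOp-text i j g ks) (prints-⇒ (printOp g ks) pc at i j os 0<m)

      body-⇒ : ∀ l pc {rest} → drop pc prog ≡ body l ++ rest → ∀ i j os {m} → i + suc (suc j) ≡ m → 0 < m →
        state pc i (suc (suc j)) os ⇒[ length (printOp l (1 ∷ 2 ∷ 3 ∷ [])) + 2 ] state (length (body l) + pc) (suc (suc i)) j (os ++ opText m i l (1 ∷ 2 ∷ 3 ∷ []))
      body-⇒ l pc {rest} at i j os {m} e 0<m = subst (λ n → state pc i (suc (suc j)) os ⇒[ length ps + 2 ] state n (suc (suc i)) j (os ++ opText m i l (1 ∷ 2 ∷ 3 ∷ []))) pc≡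
        (op-⇒ l (1 ∷ 2 ∷ 3 ∷ []) pc at₀ i (suc (suc j)) os e 0<m » Execute.advance-⇒ at₁ refl i (suc j) _ » Execute.advance-⇒ (drop-++ (advance ∷ []) p at₁) refl (suc i) j _)
        where
        ps = printOp l (1 ∷ 2 ∷ 3 ∷ [])
        p = length (map print ps) + pc
        at₀ : drop pc prog ≡ map print ps ++ advance ∷ advance ∷ rest
        at₀ = trans at (List.++-assoc (map print ps) (advance ∷ advance ∷ []) rest)
        at₁ : drop p prog ≡ advance ∷ advance ∷ rest
        at₁ = drop-++ (map print ps) pc at₀
        pc≡ : suc (suc p) ≡ length (body l) + pc
        pc≡ = trans (cong (_+ pc) (ℕ.+-comm 2 (length (map print ps)))) (cong (_+ pc) (sym (List.length-++ (map print ps))))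

      loop-⇒ : ∀ l pc {rest} → drop pc prog ≡ body l ++ again (length (body l)) ∷ rest → ∀ t a os {m} → a * 2 + suc t * 2 ≡ m → 0 < m →
        state pc (a * 2) (suc t * 2) os ⇒[ suc t * iteration l ] state (suc (length (body l) + pc)) (suc (t + a) * 2) 0 (os ++ linksText m l (suc t) a)
      loop-⇒ l pc at zero a os {m} e 0<m = subst (λ w → state pc (a * 2) 2 os ⇒[ 1 * iteration l ] state (suc (length (body l) + pc)) (suc a * 2) 0 (os ++ w)) (sym (List.++-identityʳ _))
        (relax-⇒ (ℕ.≤-reflexive (count (length (printOp l (1 ∷ 2 ∷ 3 ∷ []))))) (body-⇒ l pc at (a * 2) 0 os e 0<m » Execute.leave-⇒ (drop-++ (body l) pc at) refl (suc a * 2) _))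
        where
        count : ∀ n → n + 2 + 1 ≡ 1 * (n + 3)
        count = solve-∀
      loop-⇒ l pc at (suc t) a os {m} e 0<m = relax-⇒ (ℕ.≤-reflexive (count (length (printOp l (1 ∷ 2 ∷ 3 ∷ []))) (suc t * iteration l)))
        (body-⇒ l pc at (a * 2) (suc t * 2) os e 0<m
        » subst (λ n → state (length (body l) + pc) (suc a * 2) (suc t * 2) os₁ ⇒[ 1 ] state n (suc a * 2) (suc t * 2) os₁) (ℕ.m+n∸m≡n (length (body l)) pc)
            (Execute.again-⇒ (drop-++ (body l) pc at) refl (suc a * 2) (suc (t * 2)) os₁)
        » subst₂ (λ n w → state pc (suc a * 2) (suc t * 2) os₁ ⇒[ suc t * iteration l ] state (suc (length (body l) + pc)) (suc n * 2) 0 w) (ℕ.+-suc t a) (List.++-assoc os _ _)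
            (loop-⇒ l pc at t (suc a) os₁ (trans (shift (a * 2) (suc t * 2)) e) 0<m))
        where
        os₁ = os ++ opText m (a * 2) l (1 ∷ 2 ∷ 3 ∷ [])
        count : ∀ n r → n + 2 + (1 + r) ≡ (n + 3) + r
        count = solve-∀
        shift : ∀ x y → suc (suc x) + y ≡ x + suc (suc y)
        shift x y = sym (trans (ℕ.+-suc x (suc y)) (cong suc (ℕ.+-suc x y)))

      Blocks : ℕ → ℕ → List Instr → ℕ → List (Fin 2) → List (Fin 2) → Set
      Blocks k pc rest J os os′ = ∃ λ pc′ → drop pc′ prog ≡ rest × state pc 0 (suc k * 2) os ⇒[ J ] state pc′ 0 (suc k * 2) os′

      block-⇒ : ∀ k g pc {rest} → drop pc prog ≡ block g ++ rest → ∀ os → Blocks k pc rest (suc k * blockSteps g) os (os ++ blockText k g)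
      block-⇒ k (b , l , t) pc {rest} at os = suc p₃ , drop-++ (reset ∷ []) p₃ at₃ , subst (λ w → state pc 0 m os ⇒[ suc k * blockSteps (b , l , t) ] state (suc p₃) 0 m w) os≡
        (relax-⇒ bound (op-⇒ b (0 ∷ 1 ∷ []) pc at₀ 0 m os refl (s≤s z≤n)
          » loop-⇒ l p₁ at₁ k 0 os₁ refl (s≤s z≤n)
          » subst (λ n → state p₂ (suc n * 2) 0 os₂ ⇒[ length (printOp t (0 ∷ 1 ∷ [])) ] state p₃ m 0 os₃) (sym (ℕ.+-identityʳ k))
              (op-⇒ t (0 ∷ 1 ∷ []) p₂ at₂ m 0 os₂ (ℕ.+-identityʳ m) (s≤s z≤n))
          » Execute.reset-⇒ at₃ refl m os₃))
        where
        m = suc k * 2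
        opening = map print (printOp b (0 ∷ 1 ∷ []))
        closing = map print (printOp t (0 ∷ 1 ∷ []))
        tail = again (length (body l)) ∷ closing ++ reset ∷ rest
        p₁ = length opening + pc
        p₂ = suc (length (body l) + p₁)
        p₃ = length closing + p₂
        os₁ = os ++ opText m 0 b (0 ∷ 1 ∷ [])
        os₂ = os₁ ++ linksText m l (suc k) 0
        os₃ = os₂ ++ opText m m t (0 ∷ 1 ∷ [])
        at₀ : drop pc prog ≡ opening ++ body l ++ tail
        at₀ = trans at (trans (List.++-assoc opening _ rest) (cong (opening ++_) (trans (List.++-assoc (body l) _ rest) (cong (λ xs → body l ++ again (length (body l)) ∷ xs) (List.++-assoc closing (reset ∷ []) rest)))))
        at₁ : drop p₁ prog ≡ body l ++ tail
        at₁ = drop-++ opening pc at₀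
        at₂ : drop p₂ prog ≡ closing ++ reset ∷ rest
        at₂ = drop-++ (again (length (body l)) ∷ []) _ (drop-++ (body l) p₁ at₁)
        at₃ : drop p₃ prog ≡ reset ∷ rest
        at₃ = drop-++ closing p₂ at₂
        os≡ : os₃ ≡ os ++ blockText k (b , l , t)
        os≡ = trans (List.++-assoc os₁ _ _) (List.++-assoc os _ _)
        spread : ∀ k x i y → suc k * (x + (i + (y + 1))) ≡ (x + (suc k * i + (y + 1))) + k * (x + (y + 1))
        spread = solve-∀
        bound : length (printOp b (0 ∷ 1 ∷ [])) + (suc k * iteration l + (length (printOp t (0 ∷ 1 ∷ [])) + 1)) ≤ suc k * blockSteps (b , l , t)
        bound = ℕ.≤-trans (ℕ.m≤m+n _ _) (ℕ.≤-reflexive (sym (spread k (length (printOp b (0 ∷ 1 ∷ []))) (iteration l) (length (printOp t (0 ∷ 1 ∷ []))))))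

      blocks-⇒ : ∀ k gs pc {rest} → drop pc prog ≡ concatMap block gs ++ rest → ∀ os → Blocks k pc rest (suc k * sum (map blockSteps gs)) os (os ++ concatMap (blockText k) gs)
      blocks-⇒ k [] pc at os = pc , at , subst (λ w → state pc 0 (suc k * 2) os ⇒[ suc k * 0 ] state pc 0 (suc k * 2) w) (sym (List.++-identityʳ os)) (relax-⇒ z≤n rest-⇒)
      blocks-⇒ k (g ∷ gs) pc {rest} at os =
        let p₁ , at₁ , run₁ = block-⇒ k g pc (trans at (List.++-assoc (block g) (concatMap block gs) rest)) os
            p₂ , at₂ , run₂ = blocks-⇒ k gs p₁ at₁ (os ++ blockText k g)
        in p₂ , at₂ , subst₂ (λ J w → state pc 0 (suc k * 2) os ⇒[ J ] state p₂ 0 (suc k * 2) w) (sym (ℕ.*-distribˡ-+ (suc k) (blockSteps g) _)) (List.++-assoc os _ _) (run₁ » run₂)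

    module _ (gs : List Gates) (trailing : List (Fin 2)) where
      open Machine (program gs)
      open Run trailing

      program-⇒ : ∀ k → Blocks (program gs) trailing k 0 (halt ∷ []) (suc k * steps gs) [] (programText k gs)
      program-⇒ k =
        let pc , at , run = blocks-⇒ (program gs) trailing k gs _ (drop-++ (map print header) 0 refl) (concatMap (text 0 (suc k * 2)) header)
        in pc , at , subst (λ w → state 0 0 (suc k * 2) [] ⇒[ suc k * steps gs ] state pc 0 (suc k * 2) (w ++ concatMap (blockText k) gs)) (header-text 0 (suc k * 2))
          (relax-⇒ (ℕ.≤-trans (ℕ.+-monoˡ-≤ _ (ℕ.m≤n*m (length header) (suc k))) (ℕ.≤-reflexive (sym (ℕ.*-distribˡ-+ (suc k) (length header) _))))
            (prints-⇒ header 0 refl 0 (suc k * 2) [] (s≤s z≤n) » run))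

      program-outputs : ∀ k T → 2 + (suc k * 2 + 3) + (suc k * steps gs * cost (suc k * 2 + suc k * steps gs * suc (suc k * 2)) + 2) ≤ T →
        OutputsWithin M T (replicate (suc (suc (suc k * 2))) 0F ++ 1F ∷ trailing) (programText k gs)
      program-outputs k = let pc , at , run = program-⇒ k in outputs run at

  cost-mono : ∀ {X Y} → X ≤ Y → cost X ≤ cost Y
  cost-mono X≤Y = ℕ.+-mono-≤ (ℕ.*-mono-≤ X≤Y (ℕ.+-monoˡ-≤ 7 (ℕ.*-monoʳ-≤ 4 X≤Y))) (ℕ.+-mono-≤ X≤Y (ℕ.+-monoˡ-≤ 6 X≤Y))

  degree : ℕ → ℕ
  degree A = 19 * (A * (suc A * suc A)) + 8

  -- With `n` the number of data qubits there are at most `A n` instructions and the tape in use has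
  -- length at most `(A + 1) n²`. The cost per instruction is quadratic in that length, so the total
  -- has order `n ^ 5`, which a constant `c` at least `degree A` absorbs both as factor and as
  -- exponent.
  time-bound : ∀ A k c → degree A ≤ c → 2 + (suc k * 2 + 3) + (suc k * A * cost (suc k * 2 + suc k * A * suc (suc k * 2)) + 2) ≤ c * (suc (suc k) * 2) ^ c + c
  time-bound A k c D≤c = begin
    2 + (m + 3) + (suc k * A * cost (m + suc k * A * suc m) + 2)
      ≤⟨ ℕ.+-monoʳ-≤ (2 + (m + 3)) (ℕ.+-monoˡ-≤ 2 (ℕ.*-mono-≤ (ℕ.*-monoˡ-≤ A k≤n) (ℕ.≤-trans (cost-mono X≤Y) (cost-square Y 1≤Y)))) ⟩
    2 + (m + 3) + (n * A * (19 * (Y * Y)) + 2)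
      ≡⟨ expand n (suc k * 2) A ⟩
    (m + 7) + 19 * (A * (suc A * suc A)) * n ^ 5
      ≤⟨ ℕ.+-monoˡ-≤ _ (ℕ.≤-trans (ℕ.+-monoˡ-≤ 7 (ℕ.≤-trans m≤n (n≤n^suc 4))) (ℕ.≤-reflexive (ℕ.+-comm (n ^ 5) 7))) ⟩
    7 + n ^ 5 + 19 * (A * (suc A * suc A)) * n ^ 5
      ≡⟨ collect (n ^ 5) (19 * (A * (suc A * suc A))) ⟩
    suc (19 * (A * (suc A * suc A))) * n ^ 5 + 7
      ≤⟨ ℕ.+-mono-≤ (ℕ.*-mono-≤ (ℕ.≤-trans (ℕ.≤-trans (ℕ.m≤m+n (suc D) 7) (ℕ.≤-reflexive (sym (ℕ.+-suc D 7)))) D≤c) (ℕ.^-monoʳ-≤ n 5≤c)) 7≤c ⟩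
    c * n ^ c + c ∎
    where
    open ℕ.≤-Reasoning
    m = suc k * 2
    n = suc (suc k) * 2
    D = 19 * (A * (suc A * suc A))
    Y = suc A * (n * n)
    7≤c : 7 ≤ c
    7≤c = ℕ.≤-trans (ℕ.≤-trans (ℕ.n≤1+n 7) (ℕ.m≤n+m 8 D)) D≤c
    5≤c : 5 ≤ c
    5≤c = ℕ.≤-trans (ℕ.m≤m+n 5 2) 7≤c
    m≤n : m ≤ n
    m≤n = ℕ.m≤n+m m 2
    k≤n : suc k ≤ n
    k≤n = ℕ.≤-trans (ℕ.m≤m*n (suc k) 2) m≤n
    n≤n^suc : ∀ e → n ≤ n ^ suc e
    n≤n^suc e = ℕ.≤-trans (ℕ.≤-reflexive (sym (ℕ.*-identityʳ n))) (ℕ.*-monoʳ-≤ n (ℕ.m^n>0 n e))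
    1≤Y : 1 ≤ Y
    1≤Y = s≤s z≤n
    X≤Y : m + suc k * A * suc m ≤ Y
    X≤Y = ℕ.≤-trans (ℕ.+-mono-≤ (ℕ.≤-trans m≤n (ℕ.m≤m*n n n)) (ℕ.*-mono-≤ (ℕ.*-monoˡ-≤ A k≤n) (ℕ.n≤1+n (suc m)))) (ℕ.≤-reflexive (collect′ n A))
      where
      collect′ : ∀ n A → n * n + n * A * n ≡ suc A * (n * n)
      collect′ = solve-∀
    cost-square : ∀ Z → 1 ≤ Z → cost Z ≤ 19 * (Z * Z)
    cost-square (suc z) _ = ℕ.≤-trans (ℕ.m≤m+n _ (15 * (z * z) + 21 * z)) (ℕ.≤-reflexive (slack z))
      where
      slack : ∀ z → suc z * (4 * suc z + 7) + (suc z + (suc z + 6)) + (15 * (z * z) + 21 * z) ≡ 19 * (suc z * suc z)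
      slack = solve-∀
    expand : ∀ n m A → 2 + (m + 3) + (n * A * (19 * (suc A * (n * n) * (suc A * (n * n)))) + 2) ≡ (m + 7) + 19 * (A * (suc A * suc A)) * (n * (n * (n * (n * (n * 1)))))
    expand = solve-∀
    collect : ∀ a d → 7 + a + d * a ≡ suc d * a + 7
    collect = solve-∀

open import Data.Nat.Tactic.RingSolver using () renaming (solve-∀ to solveℕ)
open import Data.Rational.Base as ℚ using (ℚ; 0ℚ; 1ℚ; ½; _+_; _*_; _-_; -_; _≤_; _<_; _/_; ∣_∣; mkℚ; toℚᵘ; _⊓_)
open import Data.Rational.Properties as ℚ using (*-assoc; *-cancelˡ-≤-pos; *-comm; *-distribʳ-+; *-distribˡ-+; *-identityʳ; *-identityˡ; *-inverseˡ; *-monoʳ-<-pos; *-monoʳ-≤-nonNeg; *-monoˡ-<-pos; *-monoˡ-≤-nonNeg; *-zeroʳ; *-zeroˡ; +-*-commutativeRing; +-assoc; +-comm; +-identityʳ; +-identityˡ; +-inverseʳ; +-inverseˡ; +-mono-<; +-mono-≤; +-monoʳ-<; +-monoʳ-≤; +-monoˡ-<; +-monoˡ-≤; 0≤p⇒∣p∣≡p; 0≤∣p∣; 1/pos⇒pos; <-irrefl; <-trans; <-≤-trans; <⇒≢; <⇒≤; neg-antimono-≤; negative⁻¹; pos*pos⇒pos; positive⁻¹; pos⇒nonZero; p≤q⇒p⊓q≡p; p≥q⇒p⊓q≡q; p⊓q≤p; p⊓q≤q; toℚᵘ-fromℚᵘ; toℚᵘ-homo-*; toℚᵘ-homo-+;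 toℚᵘ-injective; ↥p/↧p≡p; ∣p∣≡p∨∣p∣≡-p; ≤-<-trans; ≤-antisym; ≤-refl; ≤-reflexive; ≤-total; ≤-trans; ≤ᵇ⇒≤; ≮⇒≥; ≰⇒>; ⊓-glb; ⊓-sel)
import Data.Rational.Unnormalised.Base as ℚᵘ
import Data.Rational.Unnormalised.Properties as ℚᵘ
open import Tactic.RingSolver using (solve-∀)
open import Tactic.RingSolver.Core.AlmostCommutativeRing using (AlmostCommutativeRing; fromCommutativeRing)
open Turing using (module Machine)
open Binary
open Program

-- Rational arithmetic and finite sums

ring : AlmostCommutativeRing 0ℓ 0ℓ
ring = fromCommutativeRing +-*-commutativeRing isZero
  where
  isZero : ∀ x → Maybe (0ℚ ≡ x)
  isZero x with 0ℚ ℚ.≟ x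
  ... | yes p = just p
  ... | no _ = nothing

*-exchange : ∀ a b c → a * (b * c) ≡ b * (a * c)
*-exchange = solve-∀ ring

*-squares : ∀ a b → a * b * (a * b) ≡ a * a * (b * b)
*-squares = solve-∀ ring

*-squares-assoc : ∀ a b c → a * a * (b * b * c) ≡ a * b * (a * b) * c
*-squares-assoc = solve-∀ ring

*-interchange : ∀ a b c d → a * b * (c * d) ≡ a * c * (b * d)
*-interchange = solve-∀ ring

*-swapʳ : ∀ a b c → a * b * c ≡ a * c * b
*-swapʳ = solve-∀ ring

+-cancel : ∀ a b → a + b - a ≡ b
+-cancel = solve-∀ ring

infixr 8 _^_
_^_ : ℚ → ℕ → ℚ
x ^ zero = 1ℚ
x ^ suc n = x * x ^ n

sq : ℚ → ℚ
sq x = x * x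

0≤1 : 0ℚ ≤ 1ℚ
0≤1 = <⇒≤ (positive⁻¹ 1ℚ)

0<1 : 0ℚ < 1ℚ
0<1 = positive⁻¹ 1ℚ

*-monoˡ : ∀ {a b c} → 0ℚ ≤ a → b ≤ c → a * b ≤ a * c
*-monoˡ {a} 0≤a = *-monoˡ-≤-nonNeg a {{ℚ.nonNegative 0≤a}}

*-monoʳ : ∀ {a b c} → 0ℚ ≤ a → b ≤ c → b * a ≤ c * a
*-monoʳ {a} 0≤a = *-monoʳ-≤-nonNeg a {{ℚ.nonNegative 0≤a}}

*-mono : ∀ {a b c d} → 0ℚ ≤ a → 0ℚ ≤ d → a ≤ b → c ≤ d → a * c ≤ b * d
*-mono 0≤a 0≤d a≤b c≤d = ≤-trans (*-monoˡ 0≤a c≤d) (*-monoʳ 0≤d a≤b)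

*-nonNeg : ∀ {a b} → 0ℚ ≤ a → 0ℚ ≤ b → 0ℚ ≤ a * b
*-nonNeg {a} {b} 0≤a 0≤b = subst (_≤ a * b) (*-zeroʳ a) (*-monoˡ 0≤a 0≤b)

*-pos : ∀ {a b} → 0ℚ < a → 0ℚ < b → 0ℚ < a * b
*-pos {a} {b} 0<a 0<b = positive⁻¹ (a * b) {{pos*pos⇒pos a {{ℚ.positive 0<a}} b {{ℚ.positive 0<b}}}}

*-monoˡ-< : ∀ {a b c} → 0ℚ < a → b < c → a * b < a * c
*-monoˡ-< {a} 0<a = *-monoʳ-<-pos a {{ℚ.positive 0<a}}

cancelˡ : ∀ {a b c} → 0ℚ < a → a * b ≤ a * c → b ≤ c
cancelˡ {a} 0<a = *-cancelˡ-≤-pos a {{ℚ.positive 0<a}}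

+-nonNeg : ∀ {a b} → 0ℚ ≤ a → 0ℚ ≤ b → 0ℚ ≤ a + b
+-nonNeg p q = +-mono-≤ p q

+-pos : ∀ {a b} → 0ℚ < a → 0ℚ < b → 0ℚ < a + b
+-pos p q = +-mono-< p q

diff⇒≤ : ∀ {a b} → 0ℚ ≤ b - a → a ≤ b
diff⇒≤ {a} {b} p = subst₂ _≤_ (+-identityˡ a) (cancel a b) (+-monoˡ-≤ a p)
  where
  cancel : ∀ a b → b - a + a ≡ b
  cancel = solve-∀ ring

≤⇒diff : ∀ {a b} → a ≤ b → 0ℚ ≤ b - a
≤⇒diff {a} {b} p = subst (_≤ b - a) (+-inverseʳ a) (+-monoˡ-≤ (- a) p)

sq-nonNeg : ∀ x → 0ℚ ≤ sq x
sq-nonNeg x with ≤-total 0ℚ x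
... | inj₁ p = *-nonNeg p p
... | inj₂ p = subst (0ℚ ≤_) (neg² x) (*-nonNeg q q)
  where
  q = subst (_≤ - x) refl (neg-antimono-≤ p)
  neg² : ∀ x → (- x) * (- x) ≡ x * x
  neg² = solve-∀ ring

^-nonNeg : ∀ {x} n → 0ℚ ≤ x → 0ℚ ≤ x ^ n
^-nonNeg zero p = 0≤1
^-nonNeg (suc n) p = *-nonNeg p (^-nonNeg n p)

^-pos : ∀ {x} n → 0ℚ < x → 0ℚ < x ^ n
^-pos zero p = 0<1
^-pos (suc n) p = *-pos p (^-pos n p)

^-mono : ∀ {x y} n → 0ℚ ≤ x → x ≤ y → x ^ n ≤ y ^ n
^-mono zero 0≤x x≤y = ≤-refl
^-mono (suc n) 0≤x x≤y =
  *-mono 0≤x (^-nonNeg n (≤-trans 0≤x x≤y)) x≤y (^-mono n 0≤x x≤y)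

^-+ : ∀ x m n → x ^ (m ℕ.+ n) ≡ x ^ m * x ^ n
^-+ x zero n = sym (*-identityˡ (x ^ n))
^-+ x (suc m) n = trans (cong (x *_) (^-+ x m n)) (sym (*-assoc x (x ^ m) (x ^ n)))

^-* : ∀ x m n → x ^ (m ℕ.* n) ≡ (x ^ n) ^ m
^-* x zero n = refl
^-* x (suc m) n = trans (^-+ x n (m ℕ.* n)) (cong (x ^ n *_) (^-* x m n))

^-distrib-* : ∀ x y n → (x * y) ^ n ≡ x ^ n * y ^ n
^-distrib-* x y zero = refl
^-distrib-* x y (suc n) = trans (cong (x * y *_) (^-distrib-* x y n)) (*-interchange x y (x ^ n) (y ^ n))
  where

1^ : ∀ n → 1ℚ ^ n ≡ 1ℚ
1^ zero = refl
1^ (suc n) = trans (*-identityˡ (1ℚ ^ n)) (1^ n)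

private variable
  𝔸 𝔹 : Set

∑ : List 𝔸 → (𝔸 → ℚ) → ℚ
∑ [] f = 0ℚ
∑ (x ∷ xs) f = f x + ∑ xs f

∑-cong : ∀ (xs : List 𝔸) {f g} → (∀ x → f x ≡ g x) → ∑ xs f ≡ ∑ xs g
∑-cong [] e = refl
∑-cong (x ∷ xs) e = cong₂ _+_ (e x) (∑-cong xs e)

∑-0 : ∀ (xs : List 𝔸) → ∑ xs (λ _ → 0ℚ) ≡ 0ℚ
∑-0 [] = refl
∑-0 (x ∷ xs) = trans (+-identityˡ _) (∑-0 xs)

∑-+ : ∀ (xs : List 𝔸) f g → ∑ xs (λ x → f x + g x) ≡ ∑ xs f + ∑ xs g
∑-+ [] f g = refl
∑-+ (x ∷ xs) f g = trans (cong (f x + g x +_) (∑-+ xs f g)) (shuffle (f x) (g x) (∑ xs f) (∑ xs g))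
  where
  shuffle : ∀ a b c d → a + b + (c + d) ≡ a + c + (b + d)
  shuffle = solve-∀ ring

∑-*ˡ : ∀ (xs : List 𝔸) c f → ∑ xs (λ x → c * f x) ≡ c * ∑ xs f
∑-*ˡ [] c f = sym (*-zeroʳ c)
∑-*ˡ (x ∷ xs) c f = trans (cong (c * f x +_) (∑-*ˡ xs c f)) (sym (*-distribˡ-+ c (f x) (∑ xs f)))

∑-*ʳ : ∀ (xs : List 𝔸) c f → ∑ xs (λ x → f x * c) ≡ ∑ xs f * c
∑-*ʳ xs c f = trans (∑-cong xs λ x → *-comm (f x) c) (trans (∑-*ˡ xs c f) (*-comm c (∑ xs f)))

∑-swap : ∀ (xs : List 𝔸) (ys : List 𝔹) (f : 𝔸 → 𝔹 → ℚ) →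
         ∑ xs (λ x → ∑ ys (f x)) ≡ ∑ ys (λ y → ∑ xs (λ x → f x y))
∑-swap [] ys f = sym (∑-0 ys)
∑-swap (x ∷ xs) ys f = trans (cong (∑ ys (f x) +_) (∑-swap xs ys f)) (sym (∑-+ ys (f x) _))

∑-mono : ∀ (xs : List 𝔸) {f g} → (∀ x → f x ≤ g x) → ∑ xs f ≤ ∑ xs g
∑-mono [] e = ≤-refl
∑-mono (x ∷ xs) e = +-mono-≤ (e x) (∑-mono xs e)

∑-nonNeg : ∀ (xs : List 𝔸) {f} → (∀ x → 0ℚ ≤ f x) → 0ℚ ≤ ∑ xs f
∑-nonNeg [] e = ≤-refl
∑-nonNeg (x ∷ xs) e = +-nonNeg (e x) (∑-nonNeg xs e)

∑-++ : ∀ (xs ys : List 𝔸) f → ∑ (xs ++ ys) f ≡ ∑ xs f + ∑ ys f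
∑-++ [] ys f = sym (+-identityˡ _)
∑-++ (x ∷ xs) ys f = trans (cong (f x +_) (∑-++ xs ys f)) (sym (+-assoc (f x) (∑ xs f) (∑ ys f)))

∑-map : ∀ (h : 𝔸 → 𝔹) xs f → ∑ (map h xs) f ≡ ∑ xs (λ x → f (h x))
∑-map h [] f = refl
∑-map h (x ∷ xs) f = cong (f (h x) +_) (∑-map h xs f)

∑-prod : ∀ (xs : List 𝔸) (ys : List 𝔹) f g → ∑ xs (λ x → ∑ ys (λ y → f x * g y)) ≡ ∑ xs f * ∑ ys g
∑-prod xs ys f g = trans (∑-cong xs λ x → ∑-*ˡ ys (f x) g) (∑-*ʳ xs (∑ ys g) f)

pairs : List 𝔸 → List 𝔹 → List (𝔸 × 𝔹)
pairs [] ys = []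
pairs (x ∷ xs) ys = map (x ,_) ys ++ pairs xs ys

∑-pairs : ∀ (xs : List 𝔸) (ys : List 𝔹) f → ∑ (pairs xs ys) f ≡ ∑ xs (λ x → ∑ ys (λ y → f (x , y)))
∑-pairs [] ys f = refl
∑-pairs (x ∷ xs) ys f = trans (∑-++ (map (x ,_) ys) (pairs xs ys) f)
  (cong₂ _+_ (∑-map (x ,_) ys f) (∑-pairs xs ys f))

-- Minkowski's inequality, in a form that avoids square roots.
minkowski : ∀ (xs : List 𝔸) (f g : 𝔸 → ℚ) {a b n} → 0ℚ < a → 0ℚ < b →
  ∑ xs (λ x → sq (f x)) ≤ sq a * n → ∑ xs (λ x → sq (g x)) ≤ sq b * n →
  ∑ xs (λ x → sq (f x + g x)) ≤ sq (a + b) * n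
minkowski xs f g {a} {b} {n} 0<a 0<b F G = cancelˡ (*-pos 0<a 0<b) (begin
  a * b * ∑ xs (λ x → sq (f x + g x))
    ≡⟨ ∑-*ˡ xs (a * b) (λ x → sq (f x + g x)) ⟨
  ∑ xs (λ x → a * b * sq (f x + g x))
    -- Pointwise weighted Cauchy-Schwarz: the difference of the two sides is the square of
    -- `b * f x - a * g x`.
    ≤⟨ ∑-mono xs (λ x → diff⇒≤ (subst (0ℚ ≤_) {y = b * (a + b) * sq (f x) + a * (a + b) * sq (g x) - a * b * sq (f x + g x)}
         (expand a b (f x) (g x)) (sq-nonNeg (b * f x - a * g x)))) ⟩
  ∑ xs (λ x → b * (a + b) * sq (f x) + a * (a + b) * sq (g x))
    ≡⟨ trans (∑-+ xs (λ x → b * (a + b) * sq (f x)) (λ x → a * (a + b) * sq (g x)))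
         (cong₂ _+_ (∑-*ˡ xs (b * (a + b)) (λ x → sq (f x))) (∑-*ˡ xs (a * (a + b)) (λ x → sq (g x)))) ⟩
  b * (a + b) * ∑ xs (λ x → sq (f x)) + a * (a + b) * ∑ xs (λ x → sq (g x))
    ≤⟨ +-mono-≤ (*-monoˡ (<⇒≤ (*-pos 0<b (+-pos 0<a 0<b))) F)
                   (*-monoˡ (<⇒≤ (*-pos 0<a (+-pos 0<a 0<b))) G) ⟩
  b * (a + b) * (sq a * n) + a * (a + b) * (sq b * n)
    ≡⟨ collect a b n ⟩
  a * b * (sq (a + b) * n) ∎)
  where
  open ℚ.≤-Reasoning
  expand : ∀ a b x y → (b * x - a * y) * (b * x - a * y) ≡
    (b * (a + b) * (x * x) + a * (a + b) * (y * y)) - a * b * ((x + y) * (x + y))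
  expand = solve-∀ ring
  collect : ∀ a b n → b * (a + b) * (a * a * n) + a * (a + b) * (b * b * n) ≡ a * b * ((a + b) * (a + b) * n)
  collect = solve-∀ ring

-- Fourier analysis on finite elementary abelian 2-groups

record Finite (𝔸 : Set) : Set where
  infix 4 _≟_
  field
    elems : List 𝔸
    _≟_ : DecidableEquality 𝔸
    -- States in one equation that `elems` is exhaustive and free of repetitions.
    pick : ∀ a (f : 𝔸 → ℚ) → ∑ elems (λ x → if does (x ≟ a) then f x else 0ℚ) ≡ f a

-- Double counting: `f (φ x)` is expanded as an indicator sum over the target, the two sums are
-- exchanged, and the inner one is picked at `ψ y`.
reindex : (F : Finite 𝔸) (G : Finite 𝔹) (φ : 𝔸 → 𝔹) (ψ : 𝔹 → 𝔸) →
  (∀ x → ψ (φ x) ≡ x) → (∀ y → φ (ψ y) ≡ y) →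
  ∀ f → ∑ (Finite.elems F) (λ x → f (φ x)) ≡ ∑ (Finite.elems G) f
reindex F G φ ψ ψφ φψ f = begin
  ∑ F.elems (λ x → f (φ x))
    ≡⟨ ∑-cong F.elems (λ x → sym (G.pick (φ x) f)) ⟩
  ∑ F.elems (λ x → ∑ G.elems (λ y → if does (y G.≟ φ x) then f y else 0ℚ))
    ≡⟨ ∑-swap F.elems G.elems (λ x y → if does (y G.≟ φ x) then f y else 0ℚ) ⟩
  ∑ G.elems (λ y → ∑ F.elems (λ x → if does (y G.≟ φ x) then f y else 0ℚ))
    ≡⟨ ∑-cong G.elems (λ y → trans
         (∑-cong F.elems λ x → cong (if_then f y else 0ℚ) (same x y))
         (F.pick (ψ y) (λ _ → f y))) ⟩
  ∑ G.elems f ∎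
  where
  open ≡-Reasoning
  module F = Finite F
  module G = Finite G
  same : ∀ x y → does (y G.≟ φ x) ≡ does (x F.≟ ψ y)
  same x y with x F.≟ ψ y
  ... | yes refl = dec-true (y G.≟ φ (ψ y)) (sym (φψ y))
  ... | no x≢ = dec-false (y G.≟ φ x) λ { refl → x≢ (sym (ψφ x)) }

ι : ℕ → ℚ
ι zero = 0ℚ
ι (suc n) = 1ℚ + ι n

ι-nonNeg : ∀ n → 0ℚ ≤ ι n
ι-nonNeg zero = ≤-refl
ι-nonNeg (suc n) = +-nonNeg 0≤1 (ι-nonNeg n)

ι-+ : ∀ m n → ι (m ℕ.+ n) ≡ ι m + ι n
ι-+ zero n = sym (+-identityˡ (ι n))
ι-+ (suc m) n = trans (cong (1ℚ +_) (ι-+ m n)) (sym (+-assoc 1ℚ (ι m) (ι n)))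

ι-* : ∀ m n → ι (m ℕ.* n) ≡ ι m * ι n
ι-* zero n = sym (*-zeroˡ (ι n))
ι-* (suc m) n = trans (ι-+ n (m ℕ.* n)) (trans (cong (ι n +_) (ι-* m n)) (factor (ι m) (ι n)))
  where
  factor : ∀ a b → b + a * b ≡ (1ℚ + a) * b
  factor = solve-∀ ring

ι-^ : ∀ m n → ι (m ℕ.^ n) ≡ ι m ^ n
ι-^ m zero = refl
ι-^ m (suc n) = trans (ι-* m (m ℕ.^ n)) (cong (ι m *_) (ι-^ m n))

ι-mono : ∀ {m n} → m ℕ.≤ n → ι m ≤ ι n
ι-mono {n = n} z≤n = ι-nonNeg n
ι-mono (s≤s m≤n) = +-monoʳ-≤ 1ℚ (ι-mono m≤n)

1≤^ : ∀ {x} n → 1ℚ ≤ x → 1ℚ ≤ x ^ n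
1≤^ {x} n 1≤x = subst (_≤ x ^ n) (1^ n) (^-mono n 0≤1 1≤x)

^≤1 : ∀ {x} n → 0ℚ ≤ x → x ≤ 1ℚ → x ^ n ≤ 1ℚ
^≤1 {x} n 0≤x x≤1 = subst (x ^ n ≤_) (1^ n) (^-mono n 0≤x x≤1)

bernoulli : ∀ {x} n → 0ℚ ≤ x → 1ℚ + ι n * x ≤ (1ℚ + x) ^ n
bernoulli {x} zero 0≤x = ≤-reflexive (trans (cong (1ℚ +_) (*-zeroˡ x)) (+-identityʳ 1ℚ))
bernoulli {x} (suc n) 0≤x = ≤-trans
  (diff⇒≤ (subst (0ℚ ≤_) (expand (ι n) x) (*-nonNeg (ι-nonNeg n) (sq-nonNeg x))))
  (*-monoˡ (+-nonNeg 0≤1 0≤x) (bernoulli n 0≤x))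
  where
  expand : ∀ m x → m * (x * x) ≡ (1ℚ + x) * (1ℚ + m * x) - (1ℚ + (1ℚ + m) * x)
  expand = solve-∀ ring

bernoulli⁻ : ∀ {x} n → 0ℚ ≤ x → x ≤ 1ℚ → 1ℚ - ι n * x ≤ (1ℚ - x) ^ n
bernoulli⁻ {x} zero 0≤x x≤1 = ≤-reflexive (trans (cong (λ t → 1ℚ - t) (*-zeroˡ x)) (+-identityʳ 1ℚ))
bernoulli⁻ {x} (suc n) 0≤x x≤1 = ≤-trans
  (diff⇒≤ (subst (0ℚ ≤_) (expand (ι n) x) (*-nonNeg (ι-nonNeg n) (sq-nonNeg x))))
  (*-monoˡ (≤⇒diff x≤1) (bernoulli⁻ n 0≤x x≤1))
  where
  expand : ∀ m x → m * (x * x) ≡ (1ℚ - x) * (1ℚ - m * x) - (1ℚ - (1ℚ + m) * x)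
  expand = solve-∀ ring

term≤∑ : (F : Finite 𝔸) {f : 𝔸 → ℚ} → (∀ x → 0ℚ ≤ f x) → ∀ a → f a ≤ ∑ (Finite.elems F) f
term≤∑ F {f} 0≤f a = subst (_≤ ∑ (Finite.elems F) f) (Finite.pick F a f) (∑-mono (Finite.elems F) below)
  where
  below : ∀ x → (if does (Finite._≟_ F x a) then f x else 0ℚ) ≤ f x
  below x with does (Finite._≟_ F x a)
  ... | true = ≤-refl
  ... | false = 0≤f x

<⇒≱ : ∀ {p q} → p < q → ¬ (q ≤ p)
<⇒≱ p<q q≤p = <-irrefl refl (<-≤-trans p<q q≤p)

-- Finite elementary abelian 2-groups, identified with their dual groups by
-- means of a symmetric bicharacter χ.
record Group (A : Set) : Set where
  infixl 6 _⊕_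
  field
    finite : Finite A
    _⊕_ : A → A → A
    𝟘 : A
    ⊕-assoc : ∀ x y z → (x ⊕ y) ⊕ z ≡ x ⊕ (y ⊕ z)
    ⊕-comm : ∀ x y → x ⊕ y ≡ y ⊕ x
    ⊕-idˡ : ∀ x → 𝟘 ⊕ x ≡ x
    ⊕-self : ∀ x → x ⊕ x ≡ 𝟘
    χ : A → A → ℚ
    χ-⊕ : ∀ c x y → χ c (x ⊕ y) ≡ χ c x * χ c y
    χ-sym : ∀ x y → χ x y ≡ χ y x
    χ-sq : ∀ x y → χ x y * χ x y ≡ 1ℚ
    orth : ∀ z → z ≢ 𝟘 → ∑ (Finite.elems finite) (λ c → χ c z) ≡ 0ℚ
    dim : ℕ
    card : ∑ (Finite.elems finite) (λ _ → 1ℚ) ≡ (1ℚ + 1ℚ) ^ dim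

  open Finite finite public

  size : ℚ
  size = (1ℚ + 1ℚ) ^ dim

  isize : ℚ
  isize = ½ ^ dim

  size-inv : isize * size ≡ 1ℚ
  size-inv = trans (sym (^-distrib-* ½ (1ℚ + 1ℚ) dim)) (1^ dim)

  size-pos : 0ℚ < size
  size-pos = ^-pos dim (positive⁻¹ (1ℚ + 1ℚ))

  isize-pos : 0ℚ < isize
  isize-pos = ^-pos dim (positive⁻¹ ½)

  ∑-const : ∀ c → ∑ elems (λ _ → c) ≡ size * c
  ∑-const c = trans (∑-cong elems λ _ → sym (*-identityˡ c)) (trans (∑-*ʳ elems c (λ _ → 1ℚ)) (cong (_* c) card))

  ⊕-idʳ : ∀ x → x ⊕ 𝟘 ≡ x
  ⊕-idʳ x = trans (⊕-comm x 𝟘) (⊕-idˡ x)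

  ⊕-cancel : ∀ x y → (x ⊕ y) ⊕ y ≡ x
  ⊕-cancel x y = trans (⊕-assoc x y y) (trans (cong (x ⊕_) (⊕-self y)) (⊕-idʳ x))

  ⊕≡𝟘 : ∀ {x y} → x ⊕ y ≡ 𝟘 → x ≡ y
  ⊕≡𝟘 {x} {y} e = trans (sym (⊕-cancel x y)) (trans (cong (_⊕ y) e) (⊕-idˡ y))

  ⊕-interchange : ∀ a b c d → (a ⊕ b) ⊕ (c ⊕ d) ≡ (a ⊕ c) ⊕ (b ⊕ d)
  ⊕-interchange a b c d = trans (⊕-assoc a b (c ⊕ d)) (trans (cong (a ⊕_)
    (trans (sym (⊕-assoc b c d)) (trans (cong (_⊕ d) (⊕-comm b c)) (⊕-assoc c b d))))
    (sym (⊕-assoc a c (b ⊕ d))))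

  ∑-shift : ∀ z (f : A → ℚ) → ∑ elems (λ x → f (x ⊕ z)) ≡ ∑ elems f
  ∑-shift z f = reindex finite finite (_⊕ z) (_⊕ z) (λ x → ⊕-cancel x z) (λ x → ⊕-cancel x z) f

  χ-𝟘 : ∀ c → χ c 𝟘 ≡ 1ℚ
  χ-𝟘 c = trans (cong (χ c) (sym (⊕-self 𝟘))) (trans (χ-⊕ c 𝟘 𝟘) (χ-sq c 𝟘))

  χ-𝟘ˡ : ∀ c → χ 𝟘 c ≡ 1ℚ
  χ-𝟘ˡ c = trans (χ-sym 𝟘 c) (χ-𝟘 c)

  χ-⊕ˡ : ∀ x y c → χ (x ⊕ y) c ≡ χ x c * χ y c
  χ-⊕ˡ x y c = trans (χ-sym (x ⊕ y) c) (trans (χ-⊕ c x y) (cong₂ _*_ (χ-sym c x) (χ-sym c y)))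

  orthogonality : ∀ x y → ∑ elems (λ c → χ c x * χ c y) ≡ (if does (x ≟ y) then size else 0ℚ)
  orthogonality x y with x ≟ y
  ... | yes refl = trans (∑-cong elems λ c → χ-sq c x) card
  ... | no x≢y = trans (∑-cong elems λ c → sym (χ-⊕ c x y)) (orth (x ⊕ y) (λ e → x≢y (⊕≡𝟘 e)))

  hat : (A → ℚ) → A → ℚ
  hat f c = ∑ elems (λ x → χ c x * f x)

  parseval : ∀ f → ∑ elems (λ c → sq (hat f c)) ≡ size * ∑ elems (λ x → sq (f x))
  parseval f = begin
    ∑ elems (λ c → hat f c * hat f c)
      ≡⟨ ∑-cong elems (λ c → sym (∑-prod elems elems (λ x → χ c x * f x) (λ y → χ c y * f y))) ⟩
    ∑ elems (λ c → ∑ elems (λ x → ∑ elems (λ y → χ c x * f x * (χ c y * f y))))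
      ≡⟨ ∑-swap elems elems (λ c x → ∑ elems (λ y → χ c x * f x * (χ c y * f y))) ⟩
    ∑ elems (λ x → ∑ elems (λ c → ∑ elems (λ y → χ c x * f x * (χ c y * f y))))
      ≡⟨ ∑-cong elems (λ x → ∑-swap elems elems (λ c y → χ c x * f x * (χ c y * f y))) ⟩
    ∑ elems (λ x → ∑ elems (λ y → ∑ elems (λ c → χ c x * f x * (χ c y * f y))))
      ≡⟨ ∑-cong elems (λ x → trans (∑-cong elems (λ y → inner x y)) (pick x (λ y → size * (f x * f y)))) ⟩
    ∑ elems (λ x → size * (f x * f x))
      ≡⟨ ∑-*ˡ elems size (λ x → f x * f x) ⟩
    size * ∑ elems (λ x → f x * f x) ∎
    where
    open ≡-Reasoning
    shuffle : ∀ a b c d → a * b * (c * d) ≡ (b * d) * (a * c)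
    shuffle = solve-∀ ring
    inner : ∀ x y → ∑ elems (λ c → χ c x * f x * (χ c y * f y)) ≡
                    (if does (y ≟ x) then size * (f x * f y) else 0ℚ)
    inner x y = trans (∑-cong elems λ c → trans (shuffle (χ c x) (f x) (χ c y) (f y)) (cong (f x * f y *_) (*-comm (χ c x) (χ c y))))
      (trans (∑-*ˡ elems (f x * f y) (λ c → χ c y * χ c x))
      (trans (cong (f x * f y *_) (orthogonality y x)) select))
      where
      select : f x * f y * (if does (y ≟ x) then size else 0ℚ) ≡ (if does (y ≟ x) then size * (f x * f y) else 0ℚ)
      select with does (y ≟ x)
      ... | true = *-comm (f x * f y) size
      ... | false = *-zeroʳ (f x * f y)

Bit : Set
Bit = Fin 2

pattern 0b = zero
pattern 1b = suc zero

xor : Bit → Bit → Bit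
xor 0b y = y
xor 1b 0b = 1b
xor 1b 1b = 0b

sign : Bit → ℚ
sign 0b = 1ℚ
sign 1b = - 1ℚ

and : Bit → Bit → Bit
and 0b y = 0b
and 1b y = y

bitGroup : Group Bit
bitGroup = record
  { finite = record { elems = 0b ∷ 1b ∷ [] ; _≟_ = Fin._≟_ ; pick = pickBit }
  ; _⊕_ = xor ; 𝟘 = 0b
  ; ⊕-assoc = λ { 0b y z → refl ; 1b 0b z → refl ; 1b 1b 0b → refl ; 1b 1b 1b → refl }
  ; ⊕-comm = λ { 0b 0b → refl ; 0b 1b → refl ; 1b 0b → refl ; 1b 1b → refl }
  ; ⊕-idˡ = λ _ → refl
  ; ⊕-self = λ { 0b → refl ; 1b → refl }
  ; χ = λ x y → sign (and x y)
  ; χ-⊕ = λ { 0b x y → refl ; 1b 0b 0b → refl ; 1b 0b 1b → refl ; 1b 1b 0b → refl ; 1b 1b 1b → refl }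
  ; χ-sym = λ { 0b 0b → refl ; 0b 1b → refl ; 1b 0b → refl ; 1b 1b → refl }
  ; χ-sq = λ { 0b y → refl ; 1b 0b → refl ; 1b 1b → refl }
  ; orth = λ { 0b z≢0 → contradiction refl z≢0 ; 1b _ → refl }
  ; dim = 1 ; card = refl }
  where
  pickBit : ∀ a (f : Bit → ℚ) → ∑ (0b ∷ 1b ∷ []) (λ x → if does (x Fin.≟ a) then f x else 0ℚ) ≡ f a
  pickBit 0b f = +-identityʳ (f 0b)
  pickBit 1b f = trans (+-identityˡ _) (+-identityʳ (f 1b))

unitGroup : Group ⊤
unitGroup = record
  { finite = record { elems = tt ∷ [] ; _≟_ = λ _ _ → yes refl ; pick = λ a f → +-identityʳ (f tt) }
  ; _⊕_ = λ _ _ → tt ; 𝟘 = tt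
  ; ⊕-assoc = λ _ _ _ → refl ; ⊕-comm = λ _ _ → refl ; ⊕-idˡ = λ _ → refl ; ⊕-self = λ _ → refl
  ; χ = λ _ _ → 1ℚ ; χ-⊕ = λ _ _ _ → refl ; χ-sym = λ _ _ → refl ; χ-sq = λ _ _ → refl
  ; orth = λ z z≢0 → contradiction refl z≢0
  ; dim = 0 ; card = refl }

finitePair : ∀ {A B} → Finite A → Finite B → Finite (A × B)
finitePair {A} {B} F G = record
  { elems = pairs F.elems G.elems
  ; _≟_ = _≟_
  ; pick = pickPair }
  where
  module F = Finite F
  module G = Finite G
  _≟_ : ∀ (x y : A × B) → Dec (x ≡ y)
  (x , y) ≟ (a , b) = map′ (λ (p , q) → cong₂ _,_ p q) (λ e → cong proj₁ e , cong proj₂ e) ((x F.≟ a) ×-dec (y G.≟ b))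
  split : ∀ x y a b (q : ℚ) → (if does ((x , y) ≟ (a , b)) then q else 0ℚ) ≡
          (if does (y G.≟ b) then (if does (x F.≟ a) then q else 0ℚ) else 0ℚ)
  split x y a b q with does (x F.≟ a) | does (y G.≟ b)
  ... | true | true = refl
  ... | true | false = refl
  ... | false | true = refl
  ... | false | false = refl
  pickPair : ∀ a (f : A × B → ℚ) → ∑ (pairs F.elems G.elems)
    (λ x → if does (x ≟ a) then f x else 0ℚ) ≡ f a
  pickPair (a , b) f = trans (∑-pairs F.elems G.elems _) (trans
    (∑-cong F.elems λ x → trans (∑-cong G.elems λ y → split x y a b (f (x , y)))
      (G.pick b (λ y → if does (x F.≟ a) then f (x , y) else 0ℚ)))
    (F.pick a (λ x → f (x , b))))

pairGroup : ∀ {A B} → Group A → Group B → Group (A × B)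
pairGroup {A} {B} G H = record
  { finite = finitePair G.finite H.finite
  ; _⊕_ = λ (a , b) (c , d) → (a G.⊕ c) , (b H.⊕ d) ; 𝟘 = G.𝟘 , H.𝟘
  ; ⊕-assoc = λ (a , b) (c , d) (e , f) → cong₂ _,_ (G.⊕-assoc a c e) (H.⊕-assoc b d f)
  ; ⊕-comm = λ (a , b) (c , d) → cong₂ _,_ (G.⊕-comm a c) (H.⊕-comm b d)
  ; ⊕-idˡ = λ (a , b) → cong₂ _,_ (G.⊕-idˡ a) (H.⊕-idˡ b)
  ; ⊕-self = λ (a , b) → cong₂ _,_ (G.⊕-self a) (H.⊕-self b)
  ; χ = λ (a , b) (c , d) → G.χ a c * H.χ b d
  ; χ-⊕ = λ (a , b) (c , d) (e , f) → trans (cong₂ _*_ (G.χ-⊕ a c e) (H.χ-⊕ b d f))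
            (*-interchange (G.χ a c) (G.χ a e) (H.χ b d) (H.χ b f))
  ; χ-sym = λ (a , b) (c , d) → cong₂ _*_ (G.χ-sym a c) (H.χ-sym b d)
  ; χ-sq = λ (a , b) (c , d) → trans (*-interchange (G.χ a c) (H.χ b d) (G.χ a c) (H.χ b d)) (cong₂ _*_ (G.χ-sq a c) (H.χ-sq b d))
  ; orth = orthPair
  ; dim = G.dim ℕ.+ H.dim
  ; card = trans (∑-pairs G.elems H.elems (λ _ → 1ℚ)) (trans (∑-prod G.elems H.elems (λ _ → 1ℚ) (λ _ → 1ℚ))
             (trans (cong₂ _*_ G.card H.card) (sym (^-+ (1ℚ + 1ℚ) G.dim H.dim)))) }
  where
  module G = Group G
  module H = Group H
  orthPair : ∀ z → z ≢ (G.𝟘 , H.𝟘) → ∑ (pairs G.elems H.elems) (λ c → G.χ (proj₁ c) (proj₁ z) * H.χ (proj₂ c) (proj₂ z)) ≡ 0ℚ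
  orthPair (x , y) z≢0 = trans (∑-pairs G.elems H.elems _) (trans
    (∑-prod G.elems H.elems (λ c → G.χ c x) (λ d → H.χ d y)) zeroProd)
    where
    zeroProd : ∑ G.elems (λ c → G.χ c x) * ∑ H.elems (λ d → H.χ d y) ≡ 0ℚ
    zeroProd with x G.≟ G.𝟘
    ... | no x≢0 = trans (cong (_* ∑ H.elems (λ d → H.χ d y)) (G.orth x x≢0)) (*-zeroˡ (∑ H.elems (λ d → H.χ d y)))
    ... | yes refl = trans (cong (∑ G.elems (λ c → G.χ c x) *_) (H.orth y λ { refl → z≢0 refl })) (*-zeroʳ (∑ G.elems (λ c → G.χ c x)))

Pow : Set → ℕ → Set
Pow A zero = ⊤
Pow A (suc n) = A × Pow A n

powGroup : ∀ {A} → Group A → ∀ n → Group (Pow A n)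
powGroup G zero = unitGroup
powGroup G (suc n) = pairGroup G (powGroup G n)

powDim : ∀ {A} (G : Group A) n → Group.dim (powGroup G n) ≡ n ℕ.* Group.dim G
powDim G zero = refl
powDim G (suc n) = cong (Group.dim G ℕ.+_) (powDim G n)

bits : ∀ n → Group (Pow Bit n)
bits = powGroup bitGroup

letterAverage : ∀ {A V : Set} → Group A → (A → V → ℚ) → (A → V → V) → (V → ℚ) → V → ℚ
letterAverage G sg mv g v = Group.isize G * ∑ (Group.elems G) (λ l → sg l v * g (mv l v))

-- The wide replacement walk

module Rates (ε : ℚ) (0<ε : 0ℚ < ε) where
  -- `r n` will bound the norm of `n` walk steps that read different blocks, and `x n` the norm of
  -- such steps followed by averaging over the position.
  x r : ℕ → ℚ
  x zero = 1ℚ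
  x (suc n) = ε ^ suc n + x n * ε
  r zero = 1ℚ
  r (suc n) = x n + r n * ε

  x-pos : ∀ n → 0ℚ < x n
  x-pos zero = 0<1
  x-pos (suc n) = +-pos (^-pos (suc n) 0<ε) (*-pos (x-pos n) 0<ε)

  r-pos : ∀ n → 0ℚ < r n
  r-pos zero = 0<1
  r-pos (suc n) = +-pos (x-pos n) (*-pos (r-pos n) 0<ε)

module _ {K G X C Ix : Set} (GK : Group K) (GG : Group G) where
  private
    module K = Group GK
  open Group GG

  -- The position in `G` consists of blocks in `K`: `blk a` reads block `a` and `ins a` changes this
  -- block only. `K` acts on functions on `X` by the signed isometries `(sg , σ)`, whose average
  -- contracts by ε, and the generators `shift` of the Cayley graph have bias at most ε.
  module Walk
    (blk : C → G → K) (ins : C → K → G)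
    (blk-ins : ∀ a y k → blk a (y ⊕ ins a k) ≡ blk a y K.⊕ k)
    (blk-other : ∀ {a b} y k → a ≢ b → blk b (y ⊕ ins a k) ≡ blk b y)
    (is : List Ix) (shift : Ix → G) (invd : ℚ) (invd-inv : invd * ∑ is (λ _ → 1ℚ) ≡ 1ℚ)
    (ε : ℚ) (0<ε : 0ℚ < ε)
    (bias : ∀ c → c ≢ 𝟘 → sq (invd * ∑ is (λ i → χ c (shift i))) ≤ sq ε)
    (xs : List X) (sg : K → X → ℚ) (σ : K → X → X)
    (isometry : ∀ k (v : X → ℚ) → ∑ xs (λ x → sq (sg k x * v (σ k x))) ≡ ∑ xs (λ x → sq (v x)))
    (contraction : ∀ (v : X → ℚ) → ∑ xs (λ x → sq (K.isize * ∑ K.elems (λ k → sg k x * v (σ k x)))) ≤ sq ε * ∑ xs (λ x → sq (v x)))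
    where

    open Rates ε 0<ε

    F : Set
    F = G → X → ℚ

    N : F → ℚ
    N f = ∑ (pairs elems xs) (λ (y , x) → sq (f y x))

    infix 4 _≗₂_
    _≗₂_ : F → F → Set
    f ≗₂ g = ∀ y x → f y x ≡ g y x

    _⊞_ : F → F → F
    (f ⊞ g) y x = f y x + g y x

    -- `M a` applies the action prescribed by block `a` of the position, `Y` is one step of the
    -- walk, `J` the projection to functions independent of the position, and `E` the nonuniform
    -- rest of `Y`.
    M : C → F → F
    M a f y x = sg (blk a y) x * f y (σ (blk a y) x)

    Y J E : F → F
    Y f y x = invd * ∑ is (λ i → f (y ⊕ shift i) x)
    J f _ x = isize * ∑ elems (λ y → f y x)
    E f y x = Y f y x - J f y x

    R : List C → F → F
    R [] f = f
    R (a ∷ as) f = M a (Y (R as f))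

    N-cong : ∀ {f g} → f ≗₂ g → N f ≡ N g
    N-cong e = ∑-cong (pairs elems xs) (λ (y , x) → cong sq (e y x))

    N-rows : ∀ f → N f ≡ ∑ elems (λ y → ∑ xs (λ x → sq (f y x)))
    N-rows f = ∑-pairs elems xs (λ (y , x) → sq (f y x))

    N-columns : ∀ f → N f ≡ ∑ xs (λ x → ∑ elems (λ y → sq (f y x)))
    N-columns f = trans (N-rows f) (∑-swap elems xs (λ y x → sq (f y x)))

    N-const : ∀ (v : X → ℚ) → N (λ _ → v) ≡ size * ∑ xs (λ x → sq (v x))
    N-const v = trans (N-rows (λ _ → v)) (∑-const (∑ xs (λ x → sq (v x))))

    M-cong : ∀ a {f g} → f ≗₂ g → M a f ≗₂ M a g
    M-cong a e y x = cong (sg (blk a y) x *_) (e y (σ (blk a y) x))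

    Y-cong : ∀ {f g} → f ≗₂ g → Y f ≗₂ Y g
    Y-cong e y x = cong (invd *_) (∑-cong is (λ i → e (y ⊕ shift i) x))

    J-cong : ∀ {f g} → f ≗₂ g → J f ≗₂ J g
    J-cong e y x = cong (isize *_) (∑-cong elems (λ y → e y x))

    R-cong : ∀ as {f g} → f ≗₂ g → R as f ≗₂ R as g
    R-cong [] e = e
    R-cong (a ∷ as) e = M-cong a (Y-cong (R-cong as e))

    M-⊞ : ∀ a f g → M a (f ⊞ g) ≗₂ (M a f ⊞ M a g)
    M-⊞ a f g y x = *-distribˡ-+ (sg (blk a y) x) (f y (σ (blk a y) x)) (g y (σ (blk a y) x))

    scaled-∑-+ : ∀ {A : Set} (zs : List A) c f g → c * ∑ zs (λ z → f z + g z) ≡ c * ∑ zs f + c * ∑ zs g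
    scaled-∑-+ zs c f g = trans (cong (c *_) (∑-+ zs f g)) (*-distribˡ-+ c (∑ zs f) (∑ zs g))

    Y-⊞ : ∀ f g → Y (f ⊞ g) ≗₂ (Y f ⊞ Y g)
    Y-⊞ f g y x = scaled-∑-+ is invd (λ i → f (y ⊕ shift i) x) (λ i → g (y ⊕ shift i) x)

    J-⊞ : ∀ f g → J (f ⊞ g) ≗₂ (J f ⊞ J g)
    J-⊞ f g y x = scaled-∑-+ elems isize (λ y → f y x) (λ y → g y x)

    R-⊞ : ∀ as f g → R as (f ⊞ g) ≗₂ (R as f ⊞ R as g)
    R-⊞ [] f g y x = refl
    R-⊞ (a ∷ as) f g y x = trans
      (M-cong a (λ y x → trans (Y-cong (R-⊞ as f g) y x) (Y-⊞ (R as f) (R as g) y x)) y x)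
      (M-⊞ a (Y (R as f)) (Y (R as g)) y x)

    R-++ : ∀ as bs f → R (as ++ bs) f ≡ R as (R bs f)
    R-++ [] bs f = refl
    R-++ (a ∷ as) bs f = cong (λ h → M a (Y h)) (R-++ as bs f)

    N-M : ∀ a f → N (M a f) ≡ N f
    N-M a f = trans (N-rows (M a f)) (trans (∑-cong elems λ y → isometry (blk a y) (f y)) (sym (N-rows f)))

    split-Y : ∀ f → Y f ≗₂ (J f ⊞ E f)
    split-Y f y x = recombine (Y f y x) (J f y x)
      where
      recombine : ∀ a b → a ≡ b + (a - b)
      recombine = solve-∀ ring

    Y-const : ∀ v → Y (λ _ → v) ≗₂ (λ _ → v)
    Y-const v y x = trans (cong (invd *_) (trans (∑-cong is λ _ → sym (*-identityˡ (v x))) (∑-*ʳ is (v x) (λ _ → 1ℚ))))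
      (trans (sym (*-assoc invd (∑ is (λ _ → 1ℚ)) (v x))) (trans (cong (_* v x) invd-inv) (*-identityˡ (v x))))

    J-const : ∀ v → J (λ _ → v) ≗₂ (λ _ → v)
    J-const v y x = trans (cong (isize *_) (∑-const (v x))) (trans (sym (*-assoc isize size (v x)))
      (trans (cong (_* v x) size-inv) (*-identityˡ (v x))))

    module _ (g : G → ℚ) where
      private
        Yg Jg Eg : G → ℚ
        Yg y = invd * ∑ is (λ i → g (y ⊕ shift i))
        Jg y = isize * ∑ elems g
        Eg y = Yg y - Jg y

        weight : G → ℚ
        weight c = invd * ∑ is (λ i → χ c (shift i))

        pull : ∀ c z → ∑ elems (λ y → χ c y * g (y ⊕ z)) ≡ χ c z * hat g c
        pull c z = trans (sym (∑-shift z (λ y → χ c y * g (y ⊕ z))))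
          (trans (∑-cong elems λ y → trans (cong₂ _*_ (χ-⊕ c y z) (cong g (⊕-cancel y z))) (shuffle (χ c y) (χ c z) (g y)))
          (∑-*ˡ elems (χ c z) (λ y → χ c y * g y)))
          where
          shuffle : ∀ a b c → a * b * c ≡ b * (a * c)
          shuffle = solve-∀ ring

        hat-Y : ∀ c → hat Yg c ≡ weight c * hat g c
        hat-Y c = begin
          ∑ elems (λ y → χ c y * (invd * ∑ is (λ i → g (y ⊕ shift i))))
            ≡⟨ ∑-cong elems (λ y → trans (*-exchange (χ c y) invd (∑ is (λ i → g (y ⊕ shift i)))) (cong (invd *_) (sym (∑-*ˡ is (χ c y) (λ i → g (y ⊕ shift i)))))) ⟩
          ∑ elems (λ y → invd * ∑ is (λ i → χ c y * g (y ⊕ shift i)))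
            ≡⟨ ∑-*ˡ elems invd (λ y → ∑ is (λ i → χ c y * g (y ⊕ shift i))) ⟩
          invd * ∑ elems (λ y → ∑ is (λ i → χ c y * g (y ⊕ shift i)))
            ≡⟨ cong (invd *_) (∑-swap elems is (λ y i → χ c y * g (y ⊕ shift i))) ⟩
          invd * ∑ is (λ i → ∑ elems (λ y → χ c y * g (y ⊕ shift i)))
            ≡⟨ cong (invd *_) (trans (∑-cong is (λ i → pull c (shift i))) (∑-*ʳ is (hat g c) (λ i → χ c (shift i)))) ⟩
          invd * (∑ is (λ i → χ c (shift i)) * hat g c)
            ≡⟨ *-assoc invd (∑ is (λ i → χ c (shift i))) (hat g c) ⟨
          weight c * hat g c ∎
          where
          open ≡-Reasoning

        hat-J : ∀ c → hat Jg c ≡ isize * ∑ elems g * ∑ elems (λ y → χ y c)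
        hat-J c = trans (∑-*ʳ elems (isize * ∑ elems g) (χ c)) (trans (*-comm (∑ elems (χ c)) (isize * ∑ elems g))
          (cong (isize * ∑ elems g *_) (∑-cong elems (χ-sym c))))

        hat-E : ∀ c → hat Eg c ≡ hat Yg c - hat Jg c
        hat-E c = trans (∑-cong elems λ y → distrib (χ c y) (Yg y) (Jg y))
          (trans (∑-+ elems (λ y → χ c y * Yg y) (λ y → - 1ℚ * (χ c y * Jg y)))
          (trans (cong (hat Yg c +_) (∑-*ˡ elems (- 1ℚ) (λ y → χ c y * Jg y))) (negate (hat Yg c) (hat Jg c))))
          where
          distrib : ∀ a b c → a * (b - c) ≡ a * b + - 1ℚ * (a * c)
          distrib = solve-∀ ring
          negate : ∀ a b → a + - 1ℚ * b ≡ a - b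
          negate = solve-∀ ring

        at-𝟘 : hat Eg 𝟘 ≡ 0ℚ
        at-𝟘 = trans (hat-E 𝟘) (trans (cong₂ _-_
          (trans (hat-Y 𝟘) (cong (_* hat g 𝟘) (trans (cong (invd *_) (∑-cong is (λ i → χ-𝟘ˡ (shift i)))) invd-inv)))
          (trans (hat-J 𝟘) (trans (cong (isize * ∑ elems g *_) (trans (∑-cong elems χ-𝟘) card))
            (trans (*-swapʳ isize (∑ elems g) size) (cong₂ _*_ size-inv
              (∑-cong elems λ y → sym (trans (cong (_* g y) (χ-𝟘ˡ y)) (*-identityˡ (g y)))))))))
          (+-inverseʳ (1ℚ * hat g 𝟘)))
          where

        at-≢𝟘 : ∀ c → c ≢ 𝟘 → hat Eg c ≡ weight c * hat g c
        at-≢𝟘 c c≢𝟘 = trans (hat-E c) (trans (cong₂ _-_ (hat-Y c)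
          (trans (hat-J c) (trans (cong (isize * ∑ elems g *_) (orth c c≢𝟘)) (*-zeroʳ (isize * ∑ elems g)))))
          (+-identityʳ (weight c * hat g c)))

        pointwise : ∀ c → sq (hat Eg c) ≤ sq ε * sq (hat g c)
        pointwise c with c ≟ 𝟘
        ... | yes refl = subst (_≤ sq ε * sq (hat g 𝟘)) (sym (cong sq at-𝟘)) (*-nonNeg (sq-nonNeg ε) (sq-nonNeg (hat g 𝟘)))
        ... | no c≢𝟘 = subst (_≤ sq ε * sq (hat g c))
                (sym (trans (cong sq (at-≢𝟘 c c≢𝟘)) (*-squares (weight c) (hat g c))))
                (*-monoʳ (sq-nonNeg (hat g c)) (bias c c≢𝟘))
          where

      -- In Fourier space `Y` multiplies by the bias `weight c`, and subtracting `J` removes exactly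
      -- the trivial character, so Parseval turns the bias into an operator norm.
      column-bound : ∑ elems (λ y → sq (Eg y)) ≤ sq ε * ∑ elems (λ y → sq (g y))
      column-bound = cancelˡ size-pos (begin
        size * ∑ elems (λ y → sq (Eg y)) ≡⟨ parseval Eg ⟨
        ∑ elems (λ c → sq (hat Eg c)) ≤⟨ ∑-mono elems pointwise ⟩
        ∑ elems (λ c → sq ε * sq (hat g c)) ≡⟨ ∑-*ˡ elems (sq ε) (λ c → sq (hat g c)) ⟩
        sq ε * ∑ elems (λ c → sq (hat g c)) ≡⟨ cong (sq ε *_) (parseval g) ⟩
        sq ε * (size * ∑ elems (λ y → sq (g y))) ≡⟨ *-exchange (sq ε) size (∑ elems (λ y → sq (g y))) ⟩
        size * (sq ε * ∑ elems (λ y → sq (g y))) ∎)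
        where
        open ℚ.≤-Reasoning

      -- The difference of the two sides is the sum of squared deviations from the mean.
      mean-bound : ∑ elems (λ y → sq (Jg y)) ≤ ∑ elems (λ y → sq (g y))
      mean-bound = diff⇒≤ (subst (0ℚ ≤_) variance (∑-nonNeg elems (λ y → sq-nonNeg (g y - m))))
        where
        m = isize * ∑ elems g
        expand : ∀ a b → (a - b) * (a - b) ≡ a * a + (- (b + b)) * a + b * b
        expand = solve-∀ ring
        S = ∑ elems (λ y → sq (g y))
        collapse : ∀ S m z T → z * m ≡ T → S + (- (m + m)) * T + z * (m * m) ≡ S - z * (m * m)
        collapse S m z .(z * m) refl = lemma S m z
          where
          lemma : ∀ S m z → S + (- (m + m)) * (z * m) + z * (m * m) ≡ S - z * (m * m)
          lemma = solve-∀ ring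
        total : size * m ≡ ∑ elems g
        total = trans (sym (*-assoc size isize (∑ elems g))) (trans (cong (_* ∑ elems g) (trans (*-comm size isize) size-inv)) (*-identityˡ (∑ elems g)))
        variance : ∑ elems (λ y → sq (g y - m)) ≡ S - ∑ elems (λ y → sq (Jg y))
        variance = trans (∑-cong elems λ y → expand (g y) m)
          (trans (∑-+ elems (λ y → g y * g y + (- (m + m)) * g y) (λ _ → m * m))
          (trans (cong₂ _+_ (trans (∑-+ elems (λ y → g y * g y) (λ y → (- (m + m)) * g y)) (cong (S +_) (∑-*ˡ elems (- (m + m)) g))) (∑-const (m * m)))
          (trans (collapse S m size (∑ elems g) total) (cong (λ t → S - t) (sym (∑-const (m * m)))))))

    N-E : ∀ f → N (E f) ≤ sq ε * N f
    N-E f = subst₂ _≤_ (sym (N-columns (E f))) (trans (∑-*ˡ xs (sq ε) _) (cong (sq ε *_) (sym (N-columns f))))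
      (∑-mono xs λ x → column-bound (λ y → f y x))

    N-J : ∀ f → N (J f) ≤ N f
    N-J f = subst₂ _≤_ (sym (N-columns (J f))) (sym (N-columns f)) (∑-mono xs λ x → mean-bound (λ y → f y x))

    J-Y : ∀ f → J (Y f) ≗₂ J f
    J-Y f _ x = cong (isize *_) (begin
      ∑ elems (λ y → invd * ∑ is (λ i → f (y ⊕ shift i) x))
        ≡⟨ ∑-*ˡ elems invd (λ y → ∑ is (λ i → f (y ⊕ shift i) x)) ⟩
      invd * ∑ elems (λ y → ∑ is (λ i → f (y ⊕ shift i) x))
        ≡⟨ cong (invd *_) (∑-swap elems is (λ y i → f (y ⊕ shift i) x)) ⟩
      invd * ∑ is (λ i → ∑ elems (λ y → f (y ⊕ shift i) x))
        ≡⟨ cong (invd *_) (∑-cong is (λ i → ∑-shift (shift i) (λ y → f y x))) ⟩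
      invd * ∑ is (λ i → ∑ elems (λ y → f y x))
        ≡⟨ Y-const (λ x → ∑ elems (λ y → f y x)) 𝟘 x ⟩
      ∑ elems (λ y → f y x) ∎)
      where open ≡-Reasoning

    Ignores : C → F → Set
    Ignores a f = ∀ k y x → f (y ⊕ ins a k) x ≡ f y x

    -- The words of `as` read only their own blocks, and the shifts of the walk commute with a
    -- change in block `a`.
    ignores-R : ∀ a as f → All (a ≢_) as → Ignores a f → Ignores a (R as f)
    ignores-R a [] f [] i = i
    ignores-R a (b ∷ bs) f (a≢b ∷ a∉) i k y x = cong₂ _*_ (cong (λ k → sg k x) same)
      (trans (cong (λ l → Y (R bs f) (y ⊕ ins a k) (σ l x)) same)
        (cong (invd *_) (∑-cong is λ i′ →
          trans (cong (λ z → R bs f z (σ (blk b y) x)) (rotate y (ins a k) (shift i′)))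
                (ignores-R a bs f a∉ i k (y ⊕ shift i′) (σ (blk b y) x)))))
      where
      same = blk-other y k a≢b
      rotate : ∀ a b c → a ⊕ b ⊕ c ≡ a ⊕ c ⊕ b
      rotate a b c = trans (⊕-assoc a b c) (trans (cong (a ⊕_) (⊕-comm b c)) (sym (⊕-assoc a c b)))

    A : (X → ℚ) → X → ℚ
    A v x = K.isize * ∑ K.elems (λ k → sg k x * v (σ k x))

    -- A block that f ignores is uniform and independent of f, so averaging over it turns M a into A.
    J-M : ∀ a f → Ignores a f → ∀ y x → J (M a f) y x ≡ A (J f 𝟘) x
    J-M a f i _ x = begin
      isize * ∑ elems (λ y → Φ (blk a y) y)
        ≡⟨ cong (isize *_) average ⟩
      isize * (K.isize * ∑ K.elems (λ k → ∑ elems (Φ k)))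
        ≡⟨ *-exchange isize K.isize _ ⟩
      K.isize * (isize * ∑ K.elems (λ k → ∑ elems (Φ k)))
        ≡⟨ cong (K.isize *_) (trans (sym (∑-*ˡ K.elems isize (λ k → ∑ elems (Φ k))))
             (∑-cong K.elems λ k → trans (cong (isize *_) (∑-*ˡ elems (sg k x) (λ y → f y (σ k x)))) (*-exchange isize (sg k x) _))) ⟩
      A (J f 𝟘) x ∎
      where
      open ≡-Reasoning
      Φ : K → G → ℚ
      Φ k y = sg k x * f y (σ k x)
      T = ∑ elems (λ y → Φ (blk a y) y)
      moved : ∀ k → T ≡ ∑ elems (λ y → Φ (blk a y K.⊕ k) y)
      moved k = trans (sym (∑-shift (ins a k) (λ y → Φ (blk a y) y))) (∑-cong elems λ y →
        cong₂ _*_ (cong (λ l → sg l x) (blk-ins a y k))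
          (trans (cong (λ l → f (y ⊕ ins a k) (σ l x)) (blk-ins a y k)) (i k y (σ (blk a y K.⊕ k) x))))
      average : T ≡ K.isize * ∑ K.elems (λ k → ∑ elems (Φ k))
      average = begin
        T
          ≡⟨ trans (sym (*-identityˡ T)) (trans (cong (_* T) (sym K.size-inv)) (*-assoc K.isize K.size T)) ⟩
        K.isize * (K.size * T)
          ≡⟨ cong (K.isize *_) (sym (K.∑-const T)) ⟩
        K.isize * ∑ K.elems (λ _ → T)
          ≡⟨ cong (K.isize *_) (trans (∑-cong K.elems moved) (∑-swap K.elems elems (λ k y → Φ (blk a y K.⊕ k) y))) ⟩
        K.isize * ∑ elems (λ y → ∑ K.elems (λ k → Φ (blk a y K.⊕ k) y))
          ≡⟨ cong (K.isize *_) (∑-cong elems λ y → trans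
               (∑-cong K.elems λ k → cong (λ l → Φ l y) (K.⊕-comm (blk a y) k)) (K.∑-shift (blk a y) (λ k → Φ k y))) ⟩
        K.isize * ∑ elems (λ y → ∑ K.elems (λ k → Φ k y))
          ≡⟨ cong (K.isize *_) (sym (∑-swap K.elems elems Φ)) ⟩
        K.isize * ∑ K.elems (λ k → ∑ elems (Φ k)) ∎

    -- As the blocks are distinct and ignored by `f`, the first one is fresh for everything that
    -- follows, so under `J` it acts as the full average `A` over `K`. Each step therefore gains a
    -- factor ε from the contraction rather than from the walk.
    N-J-R : ∀ as f → AllPairs _≢_ as → All (λ a → Ignores a f) as → N (J (R as f)) ≤ sq (ε ^ length as) * N (J f)
    N-J-R [] f _ _ = ≤-reflexive (sym (*-identityˡ (N (J f))))
    N-J-R (a ∷ as) f (a∉ ∷ u) (i ∷ is′) = begin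
      N (J (M a (Y h)))
        ≡⟨ N-cong (λ y x → trans (J-M a (Y h) ignores-Y y x) (cong (K.isize *_) (∑-cong K.elems λ k → cong (sg k x *_) (J-Y h 𝟘 (σ k x))))) ⟩
      N (λ _ → A v) ≡⟨ N-const (A v) ⟩
      size * ∑ xs (λ x → sq (A v x)) ≤⟨ *-monoˡ (<⇒≤ size-pos) (contraction v) ⟩
      size * (sq ε * ∑ xs (λ x → sq (v x))) ≡⟨ *-exchange size (sq ε) _ ⟩
      sq ε * (size * ∑ xs (λ x → sq (v x))) ≡⟨ cong (sq ε *_) (sym (N-const v)) ⟩
      sq ε * N (J h) ≤⟨ *-monoˡ (sq-nonNeg ε) (N-J-R as f u is′) ⟩
      sq ε * (sq (ε ^ length as) * N (J f)) ≡⟨ *-squares-assoc ε (ε ^ length as) (N (J f)) ⟩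
      sq (ε * ε ^ length as) * N (J f) ∎
      where
      open ℚ.≤-Reasoning
      h = R as f
      v = J h 𝟘
      ignores-Y : Ignores a (Y h)
      ignores-Y k y x = cong (invd *_) (∑-cong is λ j →
        trans (cong (λ z → h z x) (trans (⊕-assoc y (ins a k) (shift j)) (trans (cong (y ⊕_) (⊕-comm (ins a k) (shift j))) (sym (⊕-assoc y (shift j) (ins a k))))))
              (ignores-R a as f a∉ i k (y ⊕ shift j) x))

    private
      N-⊞ : ∀ f g {a b n} → 0ℚ < a → 0ℚ < b → N f ≤ sq a * n → N g ≤ sq b * n → N (f ⊞ g) ≤ sq (a + b) * n
      N-⊞ f g = minkowski (pairs elems xs) (λ (y , x) → f y x) (λ (y , x) → g y x)

      compose : ∀ {n f} a b → n ≤ sq a * N (E f) → sq b ≡ sq ε → n ≤ sq (a * b) * N f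
      compose {n} {f} a b p e = begin
        n ≤⟨ p ⟩
        sq a * N (E f) ≤⟨ *-monoˡ (sq-nonNeg a) (N-E f) ⟩
        sq a * (sq ε * N f) ≡⟨ cong (λ t → sq a * (t * N f)) (sym e) ⟩
        sq a * (sq b * N f) ≡⟨ *-squares-assoc a b (N f) ⟩
        sq (a * b) * N f ∎
        where
        open ℚ.≤-Reasoning

      init-unique : ∀ as {b : C} → AllPairs _≢_ (as ∷ʳ b) → AllPairs _≢_ as
      init-unique [] _ = []
      init-unique (a ∷ as) (p ∷ ps) = All.++⁻ˡ as p ∷ init-unique as ps

      R-last : ∀ as b f → R (as ∷ʳ b) f ≗₂ (R as (M b (J f)) ⊞ R as (M b (E f)))
      R-last as b f y x = trans (cong (λ h → h y x) (R-++ as (b ∷ []) f)) (trans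
        (R-cong as (λ y x → trans (M-cong b (split-Y f) y x) (M-⊞ b (J f) (E f) y x)) y x)
        (R-⊞ as (M b (J f)) (M b (E f)) y x))

    -- Decompose according to the last step at which J is taken.
    N-J-R′ : ∀ as f → AllPairs _≢_ as → N (J (R as f)) ≤ sq (x (length as)) * N f
    N-J-R′ as f u = go as (reverseView as) f u
      where
      go : ∀ as → Reverse as → ∀ f → AllPairs _≢_ as → N (J (R as f)) ≤ sq (x (length as)) * N f
      go .[] [] f _ = subst (N (J f) ≤_) (sym (*-identityˡ (N f))) (N-J f)
      go .(as ∷ʳ b) (as ∶ rs ∶ʳ b) f u =
        subst₂ (λ s n → s ≤ sq (x n) * N f)
          (N-cong (λ y z → sym (trans (J-cong (R-last as b f) y z) (J-⊞ (R as (M b (J f))) (R as (M b (E f))) y z))))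
          (sym (trans (List.length-++ as) (ℕ.+-comm (length as) 1)))
          (N-⊞ (J (R as (M b (J f)))) (J (R as (M b (E f)))) (^-pos (suc n) 0<ε) (*-pos (x-pos n) 0<ε) first second)
        where
        open ℚ.≤-Reasoning
        n = length as
        first : N (J (R as (M b (J f)))) ≤ sq (ε ^ suc n) * N f
        first = begin
          N (J (R as (M b (J f))))
            -- `J f` does not depend on the position, so a walk step can be inserted and `b` becomes
            -- one more block for `N-J-R`.
            ≡⟨ N-cong (J-cong (R-cong as (M-cong b (λ y z → sym (Y-const (J f 𝟘) y z))))) ⟩
          N (J (R as (R (b ∷ []) (J f))))
            ≡⟨ cong (λ h → N (J h)) (sym (R-++ as (b ∷ []) (J f))) ⟩
          N (J (R (as ∷ʳ b) (J f)))
            ≤⟨ N-J-R (as ∷ʳ b) (J f) u (All.universal (λ _ _ _ _ → refl) (as ∷ʳ b)) ⟩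
          sq (ε ^ length (as ∷ʳ b)) * N (J (J f))
            ≡⟨ cong₂ (λ m t → sq (ε ^ m) * t) (trans (List.length-++ as) (ℕ.+-comm n 1)) (N-cong (J-const (J f 𝟘))) ⟩
          sq (ε ^ suc n) * N (J f)
            ≤⟨ *-monoˡ (sq-nonNeg (ε ^ suc n)) (N-J f) ⟩
          sq (ε ^ suc n) * N f ∎
        second : N (J (R as (M b (E f)))) ≤ sq (x n * ε) * N f
        second = compose (x n) ε (subst (λ t → N (J (R as (M b (E f)))) ≤ sq (x n) * t) (N-M b (E f))
          (go as rs (M b (E f)) (init-unique as u))) refl

    -- Decompose according to the first step at which J is taken.
    N-R : ∀ as f → AllPairs _≢_ as → N (R as f) ≤ sq (r (length as)) * N f
    N-R [] f _ = ≤-reflexive (sym (*-identityˡ (N f)))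
    N-R (a ∷ as) f (a∉ ∷ u) = begin
      N (M a (Y h)) ≡⟨ trans (N-M a (Y h)) (N-cong (split-Y h)) ⟩
      N (J h ⊞ E h) ≤⟨ N-⊞ (J h) (E h) (x-pos n) (*-pos (r-pos n) 0<ε) (N-J-R′ as f u) second ⟩
      sq (x n + r n * ε) * N f ∎
      where
      open ℚ.≤-Reasoning
      h = R as f
      n = length as
      shuffle : ∀ a b c → a * a * (b * b * c) ≡ b * a * (b * a) * c
      shuffle = solve-∀ ring
      second : N (E h) ≤ sq (r n * ε) * N f
      second = ≤-trans (N-E h) (subst (sq ε * N h ≤_) (shuffle ε (r n) (N f)) (*-monoˡ (sq-nonNeg ε) (N-R as f u)))

    -- Blocks are reused in the next round, but `N-R` holds for arbitrary functions, so the norms of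
    -- the rounds multiply.
    N-walk : ∀ as → AllPairs _≢_ as → ∀ m f → N (R (concat (replicate m as)) f) ≤ sq (r (length as) ^ m) * N f
    N-walk as u zero f = ≤-reflexive (sym (*-identityˡ (N f)))
    N-walk as u (suc m) f = begin
      N (R (as ++ ws) f) ≡⟨ cong N (R-++ as ws f) ⟩
      N (R as (R ws f)) ≤⟨ N-R as (R ws f) u ⟩
      sq ρ * N (R ws f) ≤⟨ *-monoˡ (sq-nonNeg ρ) (N-walk as u m f) ⟩
      sq ρ * (sq (ρ ^ m) * N f) ≡⟨ *-squares-assoc ρ (ρ ^ m) (N f) ⟩
      sq (ρ * ρ ^ m) * N f ∎
      where
      open ℚ.≤-Reasoning
      ws = concat (replicate m as)
      ρ = r (length as)

    walk-bound : ∀ as → AllPairs _≢_ as → ∀ m (v : X → ℚ) →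
      ∑ xs (λ x → sq (isize * ∑ elems (λ y → R (concat (replicate m as)) (λ _ → v) y x)))
        ≤ sq (r (length as) ^ m) * ∑ xs (λ x → sq (v x))
    walk-bound as u m v = cancelˡ size-pos (begin
      size * ∑ xs (λ x → sq (J w 𝟘 x)) ≡⟨ N-const (J w 𝟘) ⟨
      N (J w) ≤⟨ N-J w ⟩
      N w ≤⟨ N-walk as u m (λ _ → v) ⟩
      c * N (λ _ → v) ≡⟨ cong (c *_) (N-const v) ⟩
      c * (size * ∑ xs (λ x → sq (v x))) ≡⟨ *-exchange c size _ ⟩
      size * (c * ∑ xs (λ x → sq (v x))) ∎)
      where
      open ℚ.≤-Reasoning
      w = R (concat (replicate m as)) (λ _ → v)
      c = sq (r (length as) ^ m)

-- Small-bias generators by the method of conditional expectations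

2ℚ : ℚ
2ℚ = 1ℚ + 1ℚ

below-average : ∀ {A : Set} (f : A → ℚ) t xs → ∑ xs f ≤ ∑ xs (λ _ → t) → xs ≢ [] → ∃ λ x → f x ≤ t
below-average f t xs avg xs≢[] with search xs
  where
  search : ∀ xs → (∃ λ x → f x ≤ t) ⊎ (xs ≡ [] ⊎ ∑ xs (λ _ → t) < ∑ xs f)
  search [] = inj₂ (inj₁ refl)
  search (x ∷ xs) with f x ℚ.≤? t | search xs
  ... | yes p | _ = inj₁ (x , p)
  ... | no _ | inj₁ r = inj₁ r
  ... | no ¬p | inj₂ (inj₁ refl) = inj₂ (inj₂ (+-monoˡ-< 0ℚ (≰⇒> ¬p)))
  ... | no ¬p | inj₂ (inj₂ q) = inj₂ (inj₂ (+-mono-< (≰⇒> ¬p) q))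
... | inj₁ r = r
... | inj₂ (inj₁ e) = contradiction e xs≢[]
... | inj₂ (inj₂ q) = contradiction avg (<⇒≱ q)

∏ : ∀ n → (Pow Bit n → ℚ) → ℚ
∏ zero f = f tt
∏ (suc n) f = ∏ n (λ i → f (0b , i)) * ∏ n (λ i → f (1b , i))

∏-nonNeg : ∀ n {f} → (∀ i → 0ℚ ≤ f i) → 0ℚ ≤ ∏ n f
∏-nonNeg zero p = p tt
∏-nonNeg (suc n) p = *-nonNeg (∏-nonNeg n (λ i → p (0b , i))) (∏-nonNeg n (λ i → p (1b , i)))

∑-bit : ∀ n (f : Pow Bit (suc n) → ℚ) → ∑ (Group.elems (bits (suc n))) f ≡
  ∑ (Group.elems (bits n)) (λ i → f (0b , i)) + ∑ (Group.elems (bits n)) (λ i → f (1b , i))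
∑-bit n f = trans (∑-pairs (0b ∷ 1b ∷ []) (Group.elems (bits n)) f)
  (cong (∑ (Group.elems (bits n)) (λ i → f (0b , i)) +_) (+-identityʳ (∑ (Group.elems (bits n)) (λ i → f (1b , i)))))

-- Sum and product depend only on the numbers `a` of values 1 and `b` of values -1; this links the
-- potential, a product, to the bias, a sum.
count-signs : ∀ n (f : Pow Bit n → ℚ) → (∀ i → f i ≡ 1ℚ ⊎ f i ≡ - 1ℚ) →
  ∃ λ a → ∃ λ b → a ℕ.+ b ≡ 2 ℕ.^ n × ∑ (Group.elems (bits n)) f ≡ ι a - ι b ×
    (∀ τ → ∏ n (λ i → 1ℚ + τ * f i) ≡ (1ℚ + τ) ^ a * (1ℚ - τ) ^ b)
count-signs zero f s with s tt
... | inj₁ e = 1 , 0 , refl , trans (+-identityʳ (f tt)) e , λ τ → trans (cong (λ t → 1ℚ + τ * t) e) (lemma τ)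
  where
  lemma : ∀ τ → 1ℚ + τ * 1ℚ ≡ (1ℚ + τ) * 1ℚ * 1ℚ
  lemma = solve-∀ ring
... | inj₂ e = 0 , 1 , refl , trans (+-identityʳ (f tt)) e , λ τ → trans (cong (λ t → 1ℚ + τ * t) e) (lemma τ)
  where
  lemma : ∀ τ → 1ℚ + τ * (- 1ℚ) ≡ 1ℚ * ((1ℚ - τ) * 1ℚ)
  lemma = solve-∀ ring
count-signs (suc n) f s with count-signs n (λ i → f (0b , i)) (λ i → s (0b , i)) | count-signs n (λ i → f (1b , i)) (λ i → s (1b , i))
... | a , b , a+b , S , P | c , d , c+d , S′ , P′ =
  a ℕ.+ c , b ℕ.+ d , total ,
  trans (∑-bit n f) (trans (cong₂ _+_ S S′) (trans (regroup (ι a) (ι b) (ι c) (ι d)) (sym (cong₂ _-_ (ι-+ a c) (ι-+ b d))))) ,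
  λ τ → trans (cong₂ _*_ (P τ) (P′ τ)) (trans (*-interchange ((1ℚ + τ) ^ a) ((1ℚ - τ) ^ b) ((1ℚ + τ) ^ c) ((1ℚ - τ) ^ d))
          (sym (cong₂ _*_ (^-+ (1ℚ + τ) a c) (^-+ (1ℚ - τ) b d))))
  where
  regroup : ∀ a b c d → (a - b) + (c - d) ≡ (a + c) - (b + d)
  regroup = solve-∀ ring
  total : a ℕ.+ c ℕ.+ (b ℕ.+ d) ≡ 2 ℕ.^ n ℕ.+ (2 ℕ.^ n ℕ.+ 0)
  total = trans (ℕ-shuffle a c b d) (cong₂ ℕ._+_ a+b (trans c+d (sym (ℕ.+-identityʳ _))))
    where
    ℕ-shuffle : ∀ a c b d → a ℕ.+ c ℕ.+ (b ℕ.+ d) ≡ a ℕ.+ b ℕ.+ (c ℕ.+ d)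
    ℕ-shuffle a c b d = trans (ℕ.+-assoc a c (b ℕ.+ d)) (trans (cong (a ℕ.+_)
      (trans (sym (ℕ.+-assoc c b d)) (trans (cong (ℕ._+ d) (ℕ.+-comm c b)) (ℕ.+-assoc b c d)))) (sym (ℕ.+-assoc a b (c ℕ.+ d))))

½^-pos : ∀ n → 0ℚ < ½ ^ n
½^-pos n = ^-pos n (positive⁻¹ ½)

½^≤1 : ∀ n → ½ ^ n ≤ 1ℚ
½^≤1 n = ^≤1 n (<⇒≤ (positive⁻¹ ½)) (≤ᵇ⇒≤ _)

½^-2^ : ∀ n → ½ ^ n * 2ℚ ^ n ≡ 1ℚ
½^-2^ n = trans (sym (^-distrib-* ½ 2ℚ n)) (1^ n)

ι-2^ : ∀ n → ι (2 ℕ.^ n) ≡ 2ℚ ^ n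
ι-2^ n = trans (ι-^ 2 n) (cong (_^ n) refl)

module _ (k : ℕ) where
  private
    τ = ½ ^ k
    0≤τ = <⇒≤ (½^-pos k)
    d = 2 ℕ.^ (2 ℕ.* k)

    τ²d : sq τ * ι d ≡ 1ℚ
    τ²d = trans (cong₂ _*_ (sym (trans (^-+ ½ k (k ℕ.+ 0)) (cong (λ n → τ * ½ ^ n) (ℕ.+-identityʳ k)))) (ι-2^ (2 ℕ.* k))) (½^-2^ (2 ℕ.* k))

  2≤[1+τ]^2^k : 2ℚ ≤ (1ℚ + τ) ^ (2 ℕ.^ k)
  2≤[1+τ]^2^k = subst (λ t → 1ℚ + t ≤ (1ℚ + τ) ^ (2 ℕ.^ k))
    (trans (cong (_* τ) (ι-2^ k)) (trans (*-comm (2ℚ ^ k) τ) (½^-2^ k))) (bernoulli (2 ℕ.^ k) 0≤τ)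

  -- Since (1 + τ) ^ a (1 − τ) ^ b = (1 − τ²) ^ b (1 + τ) ^ (a − b) and b τ² ≤ ½, the excess a − b
  -- is controlled by the size of the product.
  excess-bound : ∀ m a b → a ℕ.+ b ≡ d → (1ℚ + τ) ^ a * (1ℚ - τ) ^ b ≤ 2ℚ ^ suc m →
                 ι a - ι b ≤ ι ((2 ℕ.+ m) ℕ.* 2 ℕ.^ k)
  excess-bound m a b a+b P with ℕ.≤-total a b
  ... | inj₁ a≤b = ≤-trans
          (subst (ι a - ι b ≤_) (+-inverseʳ (ι b)) (+-monoˡ-≤ (- ι b) (ι-mono a≤b)))
          (ι-nonNeg ((2 ℕ.+ m) ℕ.* 2 ℕ.^ k))
  ... | inj₂ b≤a with ℕ.m≤n⇒∃[o]m+o≡n b≤a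
  ... | s , refl = subst (_≤ ι e) (sym (trans (cong (_- ι b) (ι-+ b s)) (+-cancel (ι b) (ι s)))) (ι-mono (ℕ.≮⇒≥ tooLarge))
    where
    open ℚ.≤-Reasoning
    e = (2 ℕ.+ m) ℕ.* 2 ℕ.^ k
    0≤1-τ² : sq τ ≤ 1ℚ
    0≤1-τ² = *-mono 0≤τ 0≤1 (½^≤1 k) (½^≤1 k)
    2b≤d : b ℕ.+ b ℕ.≤ d
    2b≤d = subst (b ℕ.+ b ℕ.≤_) a+b (ℕ.+-monoˡ-≤ b b≤a)
    half : ½ ≤ (1ℚ - sq τ) ^ b
    half = begin
      ½ ≤⟨ diff⇒≤ (subst (0ℚ ≤_) (halve (sq τ) (ι b) (ι d) τ²d)
                                   (*-nonNeg (*-nonNeg (<⇒≤ (positive⁻¹ ½)) (sq-nonNeg τ)) (≤⇒diff (subst (_≤ ι d) (ι-+ b b) (ι-mono 2b≤d))))) ⟩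
      1ℚ - ι b * sq τ ≤⟨ bernoulli⁻ b (sq-nonNeg τ) 0≤1-τ² ⟩
      (1ℚ - sq τ) ^ b ∎
      where
      halve : ∀ t b d → t * d ≡ 1ℚ → ½ * t * (d - (b + b)) ≡ 1ℚ - b * t - ½
      halve t b d td = trans (lemma₁ t b d) (trans (cong (λ u → ½ * u - (½ + ½) * (b * t)) td) (lemma₂ t b))
        where
        lemma₁ : ∀ t b d → ½ * t * (d - (b + b)) ≡ ½ * (t * d) - (½ + ½) * (b * t)
        lemma₁ = solve-∀ ring
        lemma₂ : ∀ t b → ½ * 1ℚ - 1ℚ * (b * t) ≡ 1ℚ - b * t - ½
        lemma₂ = solve-∀ ring
    merge : (1ℚ - sq τ) ^ b * (1ℚ + τ) ^ s ≡ (1ℚ + τ) ^ (b ℕ.+ s) * (1ℚ - τ) ^ b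
    merge = trans (cong (λ t → t ^ b * (1ℚ + τ) ^ s) (factor τ))
      (trans (cong (_* (1ℚ + τ) ^ s) (^-distrib-* (1ℚ + τ) (1ℚ - τ) b))
      (trans (*-swapʳ ((1ℚ + τ) ^ b) ((1ℚ - τ) ^ b) ((1ℚ + τ) ^ s)) (cong (_* (1ℚ - τ) ^ b) (sym (^-+ (1ℚ + τ) b s)))))
      where
      factor : ∀ t → 1ℚ - t * t ≡ (1ℚ + t) * (1ℚ - t)
      factor = solve-∀ ring
    1≤1+τ : 1ℚ ≤ 1ℚ + τ
    1≤1+τ = subst (_≤ 1ℚ + τ) (+-identityʳ 1ℚ) (+-monoʳ-≤ 1ℚ 0≤τ)
    small : (1ℚ + τ) ^ s ≤ 2ℚ ^ (2 ℕ.+ m)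
    small = begin
      (1ℚ + τ) ^ s ≡⟨ double ((1ℚ + τ) ^ s) ⟩
      2ℚ * (½ * (1ℚ + τ) ^ s) ≤⟨ *-monoˡ {2ℚ} (≤ᵇ⇒≤ _) (*-monoʳ (^-nonNeg s (≤-trans 0≤1 1≤1+τ)) half) ⟩
      2ℚ * ((1ℚ - sq τ) ^ b * (1ℚ + τ) ^ s) ≡⟨ cong (2ℚ *_) merge ⟩
      2ℚ * ((1ℚ + τ) ^ (b ℕ.+ s) * (1ℚ - τ) ^ b) ≤⟨ *-monoˡ {2ℚ} (≤ᵇ⇒≤ _) P ⟩
      2ℚ ^ (2 ℕ.+ m) ∎
      where
      double : ∀ x → x ≡ 2ℚ * (½ * x)
      double x = trans (sym (*-identityˡ x)) (*-assoc 2ℚ ½ x)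
    -- Since `(1 + τ) ^ (2 ^ k)` is at least 2, an excess beyond `e` would push `(1 + τ) ^ s` above
    -- `2 ^ (2 + m)`.
    tooLarge : ¬ e ℕ.< s
    tooLarge e<s with ℕ.m≤n⇒∃[o]m+o≡n e<s
    ... | o , refl = <⇒≱ (≤-<-trans large larger) small
      where
      large : 2ℚ ^ (2 ℕ.+ m) ≤ (1ℚ + τ) ^ e
      large = subst (2ℚ ^ (2 ℕ.+ m) ≤_) (sym (^-* (1ℚ + τ) (2 ℕ.+ m) (2 ℕ.^ k))) (^-mono (2 ℕ.+ m) (≤ᵇ⇒≤ _) 2≤[1+τ]^2^k)
      larger : (1ℚ + τ) ^ e < (1ℚ + τ) ^ (suc e ℕ.+ o)
      larger = begin-strict
        (1ℚ + τ) ^ e ≡⟨ *-identityʳ ((1ℚ + τ) ^ e) ⟨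
        (1ℚ + τ) ^ e * 1ℚ <⟨ *-monoˡ-< (^-pos e (<-≤-trans 0<1 1≤1+τ)) 1<1+τ ⟩
        (1ℚ + τ) ^ e * (1ℚ + τ) ≡⟨ *-comm ((1ℚ + τ) ^ e) (1ℚ + τ) ⟩
        (1ℚ + τ) ^ suc e ≡⟨ *-identityʳ ((1ℚ + τ) ^ suc e) ⟨
        (1ℚ + τ) ^ suc e * 1ℚ ≤⟨ *-monoˡ (^-nonNeg (suc e) (≤-trans 0≤1 1≤1+τ)) (1≤^ o 1≤1+τ) ⟩
        (1ℚ + τ) ^ suc e * (1ℚ + τ) ^ o ≡⟨ ^-+ (1ℚ + τ) (suc e) o ⟨
        (1ℚ + τ) ^ (suc e ℕ.+ o) ∎
        where
        1<1+τ : 1ℚ < 1ℚ + τ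
        1<1+τ = subst (_< 1ℚ + τ) (+-identityʳ 1ℚ) (+-monoʳ-< 1ℚ (½^-pos k))

  module _ {G : Set} (GG : Group G) where
    open Group GG
    private
      D : Finite (G × Bit)
      D = finitePair finite (Group.finite bitGroup)
      ds = Finite.elems D

      -- Both signs of each character occur, so that an upper bound for every `ψ δ` bounds the
      -- character sums from both sides.
      ψ : G × Bit → G → ℚ
      ψ (c , b) g = sign b * χ c g

      ψ-sq : ∀ δ g → sq (ψ δ g) ≡ 1ℚ
      ψ-sq (c , b) g = trans (*-squares (sign b) (χ c g)) (cong₂ _*_ (sign-sq b) (χ-sq c g))
        where
        sign-sq : ∀ b → sq (sign b) ≡ 1ℚ
        sign-sq 0b = refl
        sign-sq 1b = refl

      root-of-1 : ∀ x → sq x ≡ 1ℚ → x ≡ 1ℚ ⊎ x ≡ - 1ℚ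
      root-of-1 x e with ℚ._≟_ x 1ℚ
      ... | yes p = inj₁ p
      ... | no x≢1 = inj₂ (trans (shift′ x) (cong (_- 1ℚ) zero′))
        where
        shift′ : ∀ x → x ≡ x + 1ℚ - 1ℚ
        shift′ = solve-∀ ring
        x-1≢0 : x - 1ℚ ≢ 0ℚ
        x-1≢0 q = x≢1 (trans (lemma x) (cong (_+ 1ℚ) q))
          where
          lemma : ∀ x → x ≡ x - 1ℚ + 1ℚ
          lemma = solve-∀ ring
        instance _ = ℚ.≢-nonZero x-1≢0
        inv = ℚ.1/ (x - 1ℚ)
        zero′ : x + 1ℚ ≡ 0ℚ
        zero′ = trans (sym (trans (cong (_* (x + 1ℚ)) (*-inverseˡ (x - 1ℚ))) (*-identityˡ (x + 1ℚ))))
          (trans (*-assoc inv (x - 1ℚ) (x + 1ℚ)) (trans (cong (inv *_) (trans (lemma x) (cong (_- 1ℚ) e))) (*-zeroʳ inv)))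
          where
          lemma : ∀ x → (x - 1ℚ) * (x + 1ℚ) ≡ x * x - 1ℚ
          lemma = solve-∀ ring

      ψ-sign : ∀ δ g → ψ δ g ≡ 1ℚ ⊎ ψ δ g ≡ - 1ℚ
      ψ-sign δ g = root-of-1 (ψ δ g) (ψ-sq δ g)

      factor-nonNeg : ∀ δ g → 0ℚ ≤ 1ℚ + τ * ψ δ g
      factor-nonNeg δ g = either (ψ δ g) (ψ-sign δ g)
        where
        lemma : ∀ t → 1ℚ - t ≡ 1ℚ + t * (- 1ℚ)
        lemma = solve-∀ ring
        either : ∀ x → x ≡ 1ℚ ⊎ x ≡ - 1ℚ → 0ℚ ≤ 1ℚ + τ * x
        either _ (inj₁ refl) = +-nonNeg 0≤1 (subst (0ℚ ≤_) (sym (*-identityʳ τ)) 0≤τ)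
        either _ (inj₂ refl) = subst (0ℚ ≤_) (lemma τ) (≤⇒diff (½^≤1 k))

      Supported : (G × Bit → ℚ) → Set
      Supported φ = (∀ δ → 0ℚ ≤ φ δ) × (∀ b → φ (𝟘 , b) ≡ 0ℚ)

      nonempty : elems ≢ []
      nonempty e = <⇒≢ size-pos (trans (sym (cong (λ xs → ∑ xs (λ _ → 1ℚ)) e)) card)

      -- Averaged over `g`, a nontrivial character vanishes and the factor becomes 1; hence some `g`
      -- does not increase the potential.
      choose : ∀ φ → Supported φ → ∃ λ g → ∑ ds (λ δ → φ δ * (1ℚ + τ * ψ δ g)) ≤ ∑ ds φ
      choose φ (_ , φ𝟘) = below-average (λ g → ∑ ds (λ δ → φ δ * (1ℚ + τ * ψ δ g))) (∑ ds φ) elems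
        (≤-reflexive (trans (∑-swap elems ds (λ g δ → φ δ * (1ℚ + τ * ψ δ g)))
          (trans (∑-cong ds mean) (sym (∑-swap elems ds (λ _ → φ)))))) nonempty
        where
        expand : ∀ p t s c → p * (1ℚ + t * (s * c)) ≡ p + (p * t * s) * c
        expand = solve-∀ ring
        vanish : ∀ c b → (φ (c , b) * τ * sign b) * ∑ elems (χ c) ≡ 0ℚ
        vanish c b with c ≟ 𝟘
        ... | yes refl = trans (cong (λ t → t * τ * sign b * ∑ elems (χ 𝟘)) (φ𝟘 b)) (lemma τ (sign b) (∑ elems (χ 𝟘)))
          where
          lemma : ∀ t s u → 0ℚ * t * s * u ≡ 0ℚ
          lemma = solve-∀ ring
        ... | no c≢𝟘 = trans (cong (φ (c , b) * τ * sign b *_) (trans (∑-cong elems (χ-sym c)) (orth c c≢𝟘))) (*-zeroʳ (φ (c , b) * τ * sign b))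
        mean : ∀ δ → ∑ elems (λ g → φ δ * (1ℚ + τ * ψ δ g)) ≡ ∑ elems (λ _ → φ δ)
        mean δ@(c , b) = trans (∑-cong elems λ g → expand (φ δ) τ (sign b) (χ c g))
          (trans (∑-+ elems (λ _ → φ δ) (λ g → (φ δ * τ * sign b) * χ c g))
          (trans (cong (∑ elems (λ _ → φ δ) +_) (trans (∑-*ˡ elems (φ δ * τ * sign b) (χ c)) (vanish c b))) (+-identityʳ _)))

      -- The factors chosen in the first half are absorbed into the weight `φ′`, which is again
      -- nonnegative and vanishes at `𝟘`, and the second half starts from this weight.
      greedy : ∀ n φ → Supported φ → ∃ λ (sh : Pow Bit n → G) →
        ∑ ds (λ δ → φ δ * ∏ n (λ i → 1ℚ + τ * ψ δ (sh i))) ≤ ∑ ds φ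
      greedy zero φ S = let g , p = choose φ S in (λ _ → g) , p
      greedy (suc n) φ S@(φ≥0 , φ𝟘) = sh , ≤-trans
        (≤-reflexive (∑-cong ds λ δ → sym (*-assoc (φ δ) (∏ n (λ i → 1ℚ + τ * ψ δ (sh₀ i))) (∏ n (λ i → 1ℚ + τ * ψ δ (sh₁ i))))))
        (≤-trans (proj₂ step₁) (proj₂ step₀))
        where
        step₀ = greedy n φ S
        sh₀ = proj₁ step₀
        φ′ : G × Bit → ℚ
        φ′ δ = φ δ * ∏ n (λ i → 1ℚ + τ * ψ δ (sh₀ i))
        step₁ = greedy n φ′ ((λ δ → *-nonNeg (φ≥0 δ) (∏-nonNeg n (λ i → factor-nonNeg δ (sh₀ i)))) ,
          λ b → trans (cong (_* ∏ n (λ i → 1ℚ + τ * ψ (𝟘 , b) (sh₀ i))) (φ𝟘 b)) (*-zeroˡ (∏ n (λ i → 1ℚ + τ * ψ (𝟘 , b) (sh₀ i)))))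
        sh₁ = proj₁ step₁
        sh : Pow Bit (suc n) → G
        sh (0b , i) = sh₀ i
        sh (1b , i) = sh₁ i

      φ₀ : G × Bit → ℚ
      φ₀ (c , b) = if does (c ≟ 𝟘) then 0ℚ else 1ℚ

      φ₀≥0 : ∀ δ → 0ℚ ≤ φ₀ δ
      φ₀≥0 (c , b) with does (c ≟ 𝟘)
      ... | true = ≤-refl
      ... | false = 0≤1

      φ₀≤1 : ∀ δ → φ₀ δ ≤ 1ℚ
      φ₀≤1 (c , b) with does (c ≟ 𝟘)
      ... | true = 0≤1
      ... | false = ≤-refl

      φ₀𝟘 : ∀ b → φ₀ (𝟘 , b) ≡ 0ℚ
      φ₀𝟘 b with 𝟘 ≟ 𝟘
      ... | yes _ = refl
      ... | no ¬ = contradiction refl ¬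

      φ₀-total : ∑ ds φ₀ ≤ 2ℚ ^ suc dim
      φ₀-total = ≤-trans (∑-mono ds φ₀≤1) (≤-reflexive (trans (∑-pairs elems (0b ∷ 1b ∷ []) (λ _ → 1ℚ)) (trans (∑-const 2ℚ) (*-comm size 2ℚ))))

    -- The potential starts at most at `2 ^ (dim + 1)`, one unit per signed nontrivial character,
    -- and never increases. Its terms are nonnegative, so every single product obeys this bound, and
    -- `excess-bound` converts it into a bound of size `(dim + 2) * 2 ^ k` for the sum of `4 ^ k`
    -- signs.
    small-bias : ∃ λ (sh : Pow Bit (2 ℕ.* k) → G) → ∀ c → c ≢ 𝟘 →
      sq (½ ^ (2 ℕ.* k) * ∑ (Group.elems (bits (2 ℕ.* k))) (λ i → χ c (sh i))) ≤ sq (ι (2 ℕ.+ dim) * τ)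
    small-bias = sh , λ c c≢𝟘 → bounded (upper c c≢𝟘 0b) (upper c c≢𝟘 1b)
      where
      result = greedy (2 ℕ.* k) φ₀ (φ₀≥0 , φ₀𝟘)
      sh = proj₁ result
      is = Group.elems (bits (2 ℕ.* k))
      e = (2 ℕ.+ dim) ℕ.* 2 ℕ.^ k
      product-bound : ∀ c → c ≢ 𝟘 → ∀ b → ∏ (2 ℕ.* k) (λ i → 1ℚ + τ * ψ (c , b) (sh i)) ≤ 2ℚ ^ suc dim
      product-bound c c≢𝟘 b = ≤-trans (subst (_≤ ∑ ds (λ δ → φ₀ δ * P δ)) weighted (term≤∑ D nonneg (c , b))) (≤-trans (proj₂ result) φ₀-total)
        where
        P : G × Bit → ℚ
        P δ = ∏ (2 ℕ.* k) (λ i → 1ℚ + τ * ψ δ (sh i))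
        nonneg : ∀ δ → 0ℚ ≤ φ₀ δ * P δ
        nonneg δ = *-nonNeg (φ₀≥0 δ) (∏-nonNeg (2 ℕ.* k) (λ i → factor-nonNeg δ (sh i)))
        weighted : φ₀ (c , b) * P (c , b) ≡ P (c , b)
        weighted with c ≟ 𝟘
        ... | yes p = contradiction p c≢𝟘
        ... | no _ = *-identityˡ (P (c , b))
      upper : ∀ c → c ≢ 𝟘 → ∀ b → ∑ is (λ i → ψ (c , b) (sh i)) ≤ ι e
      upper c c≢𝟘 b =
        let p , q , p+q , S , Π = count-signs (2 ℕ.* k) (λ i → ψ (c , b) (sh i)) (λ i → ψ-sign (c , b) (sh i)) in
        subst (_≤ ι e) (sym S) (excess-bound dim p q p+q (subst (_≤ 2ℚ ^ suc dim) (Π τ) (product-bound c c≢𝟘 b)))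
      bounded : ∀ {c} → ∑ is (λ i → 1ℚ * χ c (sh i)) ≤ ι e → ∑ is (λ i → - 1ℚ * χ c (sh i)) ≤ ι e →
        sq (½ ^ (2 ℕ.* k) * ∑ is (λ i → χ c (sh i))) ≤ sq (ι (2 ℕ.+ dim) * τ)
      bounded {c} u l = subst₂ _≤_ (square (½ ^ (2 ℕ.* k)) S) (trans (square (½ ^ (2 ℕ.* k)) (ι e)) (cong sq scale))
        -- The two one-sided bounds say that both factors of `(e - S) * (e + S)` are nonnegative.
        (*-monoˡ (sq-nonNeg (½ ^ (2 ℕ.* k))) (diff⇒≤ (subst (0ℚ ≤_) (lemma (ι e) S) (*-nonNeg (≤⇒diff (subst (_≤ ι e) e₁ u)) (≤⇒diff (subst (_≤ ι e) e₂ l))))))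
        where
        S = ∑ is (λ i → χ c (sh i))
        e₁ = trans (∑-*ˡ is 1ℚ (λ i → χ c (sh i))) (*-identityˡ S)
        e₂ = ∑-*ˡ is (- 1ℚ) (λ i → χ c (sh i))
        lemma : ∀ e s → (e - s) * (e - - 1ℚ * s) ≡ e * e - s * s
        lemma = solve-∀ ring
        square : ∀ a b → a * a * (b * b) ≡ a * b * (a * b)
        square = solve-∀ ring
        scale : ½ ^ (2 ℕ.* k) * ι e ≡ ι (2 ℕ.+ dim) * τ
        scale = trans (cong₂ _*_ (trans (^-+ ½ k (k ℕ.+ 0)) (cong (λ n → τ * ½ ^ n) (ℕ.+-identityʳ k))) (trans (ι-* (2 ℕ.+ dim) (2 ℕ.^ k)) (cong (ι (2 ℕ.+ dim) *_) (ι-2^ k))))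
          (trans (shuffle τ (ι (2 ℕ.+ dim)) (2ℚ ^ k)) (trans (cong (ι (2 ℕ.+ dim) * τ *_) (½^-2^ k)) (*-identityʳ (ι (2 ℕ.+ dim) * τ))))
          where
          shuffle : ∀ t m p → t * t * (m * p) ≡ m * t * (t * p)
          shuffle = solve-∀ ring

-- The chain of sites and its linear dynamics

Site : Set
Site = Bit × Bit

siteGroup : Group Site
siteGroup = pairGroup bitGroup bitGroup

module Site = Group siteGroup

∀Site : {P : Site → Set} → P (0b , 0b) → P (0b , 1b) → P (1b , 0b) → P (1b , 1b) → ∀ s → P s
∀Site a b c d (0b , 0b) = a
∀Site a b c d (0b , 1b) = b
∀Site a b c d (1b , 0b) = c
∀Site a b c d (1b , 1b) = d

-- The generator (p , q) ↦ (q , p + q) of the group of order three in GL₂(𝔽₂); its matrix is symmetric.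
cyc : Site → Site
cyc (p , q) = q , xor p q

cyc³ : ∀ s → cyc (cyc (cyc s)) ≡ s
cyc³ = ∀Site refl refl refl refl

cyc-⊕ : ∀ s t → cyc (s Site.⊕ t) ≡ cyc s Site.⊕ cyc t
cyc-⊕ = ∀Site (∀Site refl refl refl refl) (∀Site refl refl refl refl) (∀Site refl refl refl refl) (∀Site refl refl refl refl)

cyc-χ : ∀ s t → Site.χ s (cyc t) ≡ Site.χ (cyc s) t
cyc-χ = ∀Site (∀Site refl refl refl refl) (∀Site refl refl refl refl) (∀Site refl refl refl refl) (∀Site refl refl refl refl)

Choice : Set
Choice = Pow Bit 3

-- Uniform on eight elements, but with weights 3, 3, 2 on the powers of cyc.
exponent : Choice → Fin 3
exponent (0b , 0b , _ , _) = zero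
exponent (0b , 1b , 0b , _) = zero
exponent (0b , 1b , 1b , _) = suc zero
exponent (1b , 0b , _ , _) = suc zero
exponent (1b , 1b , _ , _) = suc (suc zero)

turn turn⁻ : Fin 3 → Site → Site
turn zero s = s
turn (suc zero) s = cyc s
turn (suc (suc zero)) s = cyc (cyc s)
turn⁻ zero s = s
turn⁻ (suc zero) s = cyc (cyc s)
turn⁻ (suc (suc zero)) s = cyc s

turn⁻-turn : ∀ e s → turn⁻ e (turn e s) ≡ s
turn⁻-turn zero s = refl
turn⁻-turn (suc zero) s = cyc³ s
turn⁻-turn (suc (suc zero)) s = cyc³ s

turn-turn⁻ : ∀ e s → turn e (turn⁻ e s) ≡ s
turn-turn⁻ zero s = refl
turn-turn⁻ (suc zero) s = cyc³ s
turn-turn⁻ (suc (suc zero)) s = cyc³ s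

turn-⊕ : ∀ e s t → turn e (s Site.⊕ t) ≡ turn e s Site.⊕ turn e t
turn-⊕ zero s t = refl
turn-⊕ (suc zero) s t = cyc-⊕ s t
turn-⊕ (suc (suc zero)) s t = trans (cong cyc (cyc-⊕ s t)) (cyc-⊕ (cyc s) (cyc t))

turn⁻-χ : ∀ e s t → Site.χ s (turn⁻ e t) ≡ Site.χ (turn⁻ e s) t
turn⁻-χ zero s t = refl
turn⁻-χ (suc zero) s t = trans (cyc-χ s (cyc t)) (cyc-χ (cyc s) t)
turn⁻-χ (suc (suc zero)) s t = cyc-χ s t

isZ : Site → Bool
isZ (0b , 0b) = true
isZ (0b , 1b) = false
isZ (1b , _) = false

isZ⇒ : ∀ s → isZ s ≡ true → s ≡ (0b , 0b)
isZ⇒ = ∀Site (λ _ → refl) (λ ()) (λ ()) (λ ())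

isZ-cyc : ∀ s → isZ (cyc s) ≡ isZ s
isZ-cyc = ∀Site refl refl refl refl

isZ-turn : ∀ e s → isZ (turn e s) ≡ isZ s
isZ-turn zero s = refl
isZ-turn (suc zero) s = isZ-cyc s
isZ-turn (suc (suc zero)) s = trans (isZ-cyc (cyc s)) (isZ-cyc s)

isZ-turn⁻ : ∀ e s → isZ (turn⁻ e s) ≡ isZ s
isZ-turn⁻ zero s = refl
isZ-turn⁻ (suc zero) s = trans (isZ-cyc (cyc s)) (isZ-cyc s)
isZ-turn⁻ (suc (suc zero)) s = isZ-cyc s

States : ℕ → Set
States = Pow Site

stateGroup : ∀ n → Group (States n)
stateGroup = powGroup siteGroup

module State (n : ℕ) = Group (stateGroup n)

mapS : (Site → Site) → ∀ n → States n → States n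
mapS f zero x = tt
mapS f (suc n) (s , x) = f s , mapS f n x

mapS-inverse : ∀ {f g} → (∀ s → g (f s) ≡ s) → ∀ n x → mapS g n (mapS f n x) ≡ x
mapS-inverse e zero x = refl
mapS-inverse e (suc n) (s , x) = cong₂ _,_ (e s) (mapS-inverse e n x)

mapS-⊕ : ∀ {f} → (∀ s t → f (s Site.⊕ t) ≡ f s Site.⊕ f t) → ∀ n x y → mapS f n (State._⊕_ n x y) ≡ State._⊕_ n (mapS f n x) (mapS f n y)
mapS-⊕ e zero x y = refl
mapS-⊕ e (suc n) (s , x) (t , y) = cong₂ _,_ (e s t) (mapS-⊕ e n x y)

mapS-χ : ∀ {f g} → (∀ s t → Site.χ s (f t) ≡ Site.χ (g s) t) → ∀ n x y → State.χ n x (mapS f n y) ≡ State.χ n (mapS g n x) y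
mapS-χ e zero x y = refl
mapS-χ e (suc n) (s , x) (t , y) = cong₂ _*_ (e s t) (mapS-χ e n x y)

-- p_j += q_{j-1}, with an incoming value for j = 0.
carry : Bit → ∀ n → States n → States n
carry c zero x = tt
carry c (suc n) ((p , q) , x) = (xor p c , q) , carry q n x

-- The part that `carry` adds to the identity; it is split off because its transpose is easy to see.
shift : Bit → ∀ n → States n → States n
shift c zero x = tt
shift c (suc n) ((p , q) , x) = (c , 0b) , shift q n x

step : ∀ n → States n → States n
step = carry 0b

firstP : ∀ n → States n → Bit
firstP zero x = 0b
firstP (suc n) ((p , q) , x) = p

shiftᵀ : ∀ n → States n → States n
shiftᵀ zero x = tt
shiftᵀ (suc n) ((p , q) , x) = (0b , firstP n x) , shiftᵀ n x

-- The transpose of `step` with respect to χ: `q_j += p_{j+1}`, with nothing entering the last site.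
stepᵀ : ∀ n → States n → States n
stepᵀ zero x = tt
stepᵀ (suc n) ((p , q) , x) = (p , xor q (firstP n x)) , stepᵀ n x

private
  xor-idʳ : ∀ b → xor b 0b ≡ b
  xor-idʳ = Group.⊕-idʳ bitGroup

  xor-cancel : ∀ a b → xor (xor a b) b ≡ a
  xor-cancel = Group.⊕-cancel bitGroup

carry-shift : ∀ c n x → carry c n x ≡ State._⊕_ n x (shift c n x)
carry-shift c zero x = refl
carry-shift c (suc n) ((p , q) , x) = cong₂ _,_ (cong (xor p c ,_) (sym (xor-idʳ q))) (carry-shift q n x)

stepᵀ-shiftᵀ : ∀ n x → stepᵀ n x ≡ State._⊕_ n x (shiftᵀ n x)
stepᵀ-shiftᵀ zero x = refl
stepᵀ-shiftᵀ (suc n) ((p , q) , x) = cong₂ _,_ (cong (_, xor q (firstP n x)) (sym (xor-idʳ p))) (stepᵀ-shiftᵀ n x)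

carry² : ∀ c n x → carry c n (carry c n x) ≡ x
carry² c zero x = refl
carry² c (suc n) ((p , q) , x) = cong₂ _,_ (cong (_, q) (xor-cancel p c)) (carry² q n x)

stepᵀ² : ∀ n x → stepᵀ n (stepᵀ n x) ≡ x
stepᵀ² zero x = refl
stepᵀ² (suc n) ((p , q) , x) = cong₂ _,_ (cong (p ,_) (trans (cong (xor (xor q (firstP n x))) (same n x)) (xor-cancel q (firstP n x)))) (stepᵀ² n x)
  where
  same : ∀ n x → firstP n (stepᵀ n x) ≡ firstP n x
  same zero x = refl
  same (suc n) x = refl

carry-⊕ : ∀ c d n x y → carry (xor c d) n (State._⊕_ n x y) ≡ State._⊕_ n (carry c n x) (carry d n y)
carry-⊕ c d zero x y = refl
carry-⊕ c d (suc n) ((p , q) , x) ((p′ , q′) , y) =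
  cong₂ _,_ (cong (_, xor q q′) (Group.⊕-interchange bitGroup p p′ c d)) (carry-⊕ q q′ n x y)

shift-χ : ∀ c n b x → State.χ n b (shift c n x) ≡ sign (and (firstP n b) c) * State.χ n (shiftᵀ n b) x
shift-χ c zero b x = refl
shift-χ c (suc n) ((P , Q) , b) ((p , q) , x) = trans
  (cong₂ _*_ (trans (cong (sign (and P c) *_) (cong sign (and-0 Q))) (*-identityʳ (sign (and P c)))) (shift-χ q n b x))
  (cong (λ t → sign (and P c) * (t * State.χ n (shiftᵀ n b) x)) (sym (*-identityˡ (sign (and (firstP n b) q)))))
  where
  and-0 : ∀ b → and b 0b ≡ 0b
  and-0 0b = refl
  and-0 1b = refl

step-χ : ∀ n b x → State.χ n b (step n x) ≡ State.χ n (stepᵀ n b) x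
step-χ n b x = begin
  χ b (step n x) ≡⟨ cong (χ b) (carry-shift 0b n x) ⟩
  χ b (x ⊕ shift 0b n x) ≡⟨ χ-⊕ b x (shift 0b n x) ⟩
  χ b x * χ b (shift 0b n x) ≡⟨ cong (χ b x *_) (trans (shift-χ 0b n b x) (trans (cong (λ t → sign t * χ (shiftᵀ n b) x) (and-0 (firstP n b))) (*-identityˡ (χ (shiftᵀ n b) x)))) ⟩
  χ b x * χ (shiftᵀ n b) x ≡⟨ sym (χ-⊕ˡ b (shiftᵀ n b) x) ⟩
  χ (b ⊕ shiftᵀ n b) x ≡⟨ cong (λ t → χ t x) (sym (stepᵀ-shiftᵀ n b)) ⟩
  χ (stepᵀ n b) x ∎
  where
  open ≡-Reasoning
  open State n
  and-0 : ∀ b → and b 0b ≡ 0b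
  and-0 0b = refl
  and-0 1b = refl

-- The head of the tuple is the bottom of the chain; the clauses for the empty chain are defaults.
top bot : ∀ n → States n → Site
top zero x = 0b , 0b
top (suc zero) (s , _) = s
top (suc (suc n)) (_ , x) = top (suc n) x
bot zero x = 0b , 0b
bot (suc n) (s , _) = s

atTop atBot : ∀ n → Site → States n
atTop zero z = tt
atTop (suc zero) z = z , tt
atTop (suc (suc n)) z = (0b , 0b) , atTop (suc n) z
atBot zero z = tt
atBot (suc n) z = z , State.𝟘 n

χ-atTop : ∀ n z x → State.χ n (atTop n z) x ≡ Site.χ z (top n x)
χ-atTop zero z x = sym (Site.χ-𝟘 z)
χ-atTop (suc zero) z (s , x) = *-identityʳ (Site.χ z s)
χ-atTop (suc (suc n)) z (s , x) = trans (cong (_* State.χ (suc n) (atTop (suc n) z) x) (Site.χ-𝟘ˡ s)) (trans (*-identityˡ _) (χ-atTop (suc n) z x))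

χ-atBot : ∀ n z x → State.χ n x (atBot n z) ≡ Site.χ z (bot n x)
χ-atBot zero z x = sym (Site.χ-𝟘 z)
χ-atBot (suc n) z (s , x) = trans (cong₂ _*_ (Site.χ-sym s z) (State.χ-𝟘 n x)) (*-identityʳ (Site.χ z s))

-- Weights for the Schur test

θ θ⁻ κ : ℚ
θ = ℤ.+ 3 / 4
θ⁻ = ℤ.+ 4 / 3
κ = ℤ.+ 31 / 32

gain : Bit → ℚ
gain 0b = θ⁻
gain 1b = θ

infixl 5 _◁_
_◁_ : Site → Site → Site
s ◁ (0b , 0b) = s
s ◁ (0b , 1b) = 0b , 1b
s ◁ (1b , q) = 1b , q

◁-nonzero : ∀ s t → isZ t ≡ false → s ◁ t ≡ t
◁-nonzero s = ∀Site (λ ()) (λ _ → refl) (λ _ → refl) (λ _ → refl)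

◁-zero : ∀ s t → isZ t ≡ true → s ◁ t ≡ s
◁-zero s = ∀Site (λ _ → refl) (λ ()) (λ ()) (λ ())

-- The last, respectively first, nonzero site of the chain, and the zero site if there is none.
leadA leadB : ∀ n → States n → Site
leadA zero x = 0b , 0b
leadA (suc n) (s , x) = s ◁ leadA n x
leadB zero x = 0b , 0b
leadB (suc n) (s , x) = leadB n x ◁ s

nil? : ∀ n → States n → Bool
nil? n x = isZ (leadA n x)

scale : ℚ → Bool → ℚ → ℚ
scale t true w = 1ℚ
scale t false w = t * w

-- On a nonzero chain `weightA` is `θ` to the number of sites up to the last nonzero one, and
-- `weightB` is `θ⁻` to the number of zero sites before the first nonzero one. Both decrease as the
-- leading site moves towards the end at which coefficients are masked. The superscript versions are
-- the reciprocals.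
weightA weightB weightA⁻ weightB⁻ : ∀ n → States n → ℚ
weightA zero x = 1ℚ
weightA (suc n) (s , x) = scale θ (nil? (suc n) (s , x)) (weightA n x)
weightB zero x = 1ℚ
weightB (suc n) (s , x) = scale θ⁻ (not (isZ s)) (weightB n x)
weightA⁻ zero x = 1ℚ
weightA⁻ (suc n) (s , x) = scale θ⁻ (nil? (suc n) (s , x)) (weightA⁻ n x)
weightB⁻ zero x = 1ℚ
weightB⁻ (suc n) (s , x) = scale θ (not (isZ s)) (weightB⁻ n x)

private
  swap-inner : ∀ a b c d → a * b * (c * d) ≡ a * c * (b * d)
  swap-inner = solve-∀ ring

scale-inverse : ∀ {t t⁻ w w⁻} b → t * t⁻ ≡ 1ℚ → w * w⁻ ≡ 1ℚ → scale t b w * scale t⁻ b w⁻ ≡ 1ℚ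
scale-inverse true e f = refl
scale-inverse {t} {t⁻} {w} {w⁻} false e f = trans (swap-inner t w t⁻ w⁻) (cong₂ _*_ e f)

scale-pos : ∀ {t w} b → 0ℚ < t → 0ℚ < w → 0ℚ < scale t b w
scale-pos true p q = 0<1
scale-pos false p q = *-pos p q

0<θ : 0ℚ < θ
0<θ = positive⁻¹ θ

0<θ⁻ : 0ℚ < θ⁻
0<θ⁻ = positive⁻¹ θ⁻

θθ⁻ : θ * θ⁻ ≡ 1ℚ
θθ⁻ = refl

θ⁻θ : θ⁻ * θ ≡ 1ℚ
θ⁻θ = refl

weightA-inverse : ∀ n x → weightA n x * weightA⁻ n x ≡ 1ℚ
weightA-inverse zero x = refl
weightA-inverse (suc n) (s , x) = scale-inverse (nil? (suc n) (s , x)) θθ⁻ (weightA-inverse n x)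

weightB-inverse : ∀ n x → weightB n x * weightB⁻ n x ≡ 1ℚ
weightB-inverse zero x = refl
weightB-inverse (suc n) (s , x) = scale-inverse (not (isZ s)) θ⁻θ (weightB-inverse n x)

weightA-pos : ∀ n x → 0ℚ < weightA n x
weightA-pos zero x = 0<1
weightA-pos (suc n) (s , x) = scale-pos (nil? (suc n) (s , x)) 0<θ (weightA-pos n x)

weightB-pos : ∀ n x → 0ℚ < weightB n x
weightB-pos zero x = 0<1
weightB-pos (suc n) (s , x) = scale-pos (not (isZ s)) 0<θ⁻ (weightB-pos n x)

weightA⁻-pos : ∀ n x → 0ℚ < weightA⁻ n x
weightA⁻-pos zero x = 0<1
weightA⁻-pos (suc n) (s , x) = scale-pos (nil? (suc n) (s , x)) 0<θ⁻ (weightA⁻-pos n x)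

weightB⁻-pos : ∀ n x → 0ℚ < weightB⁻ n x
weightB⁻-pos zero x = 0<1
weightB⁻-pos (suc n) (s , x) = scale-pos (not (isZ s)) 0<θ (weightB⁻-pos n x)

nil⇒𝟘 : ∀ n x → nil? n x ≡ true → x ≡ State.𝟘 n
nil⇒𝟘 zero x _ = refl
nil⇒𝟘 (suc n) (s , x) e = split (nil? n x) refl
  where
  split : ∀ b → nil? n x ≡ b → (s , x) ≡ State.𝟘 (suc n)
  split true eq = cong₂ _,_ (isZ⇒ s (trans (cong isZ (sym (◁-zero s (leadA n x) eq))) e)) (nil⇒𝟘 n x eq)
  split false eq with () ← trans (sym eq) (trans (cong isZ (sym (◁-nonzero s (leadA n x) eq))) e)

lead-𝟘 : ∀ n → leadA n (State.𝟘 n) ≡ (0b , 0b)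
lead-𝟘 zero = refl
lead-𝟘 (suc n) = cong ((0b , 0b) ◁_) (lead-𝟘 n)

nil-𝟘 : ∀ n {x} → x ≡ State.𝟘 n → nil? n x ≡ true
nil-𝟘 n refl = cong isZ (lead-𝟘 n)

carry-𝟘 : ∀ n → carry 0b n (State.𝟘 n) ≡ State.𝟘 n
carry-𝟘 zero = refl
carry-𝟘 (suc n) = cong (_ ,_) (carry-𝟘 n)

nil-step : ∀ n x → nil? n (step n x) ≡ true → nil? n x ≡ true
nil-step n x e = nil-𝟘 n (trans (sym (carry² 0b n x)) (trans (cong (step n) (nil⇒𝟘 n (step n x) e)) (carry-𝟘 n)))

step-nil : ∀ n x → nil? n (step n x) ≡ nil? n x
step-nil n x = split (nil? n x) (nil? n (step n x)) refl refl
  where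
  split : ∀ b b′ → nil? n x ≡ b → nil? n (step n x) ≡ b′ → b′ ≡ b
  split true true _ _ = refl
  split false false _ _ = refl
  split false true e e′ = trans (sym (nil-step n x e′)) e
  split true false e e′ = trans (sym e′) (nil-𝟘 n (trans (cong (step n) (nil⇒𝟘 n x e)) (carry-𝟘 n)))

weightA-𝟘 : ∀ n → weightA n (State.𝟘 n) ≡ 1ℚ
weightA-𝟘 zero = refl
weightA-𝟘 (suc n) = cong (λ b → scale θ b (weightA n (State.𝟘 n))) (nil-𝟘 (suc n) refl)

private
  0≤θ = <⇒≤ 0<θ
  0≤θ⁻ = <⇒≤ 0<θ⁻

  down : ∀ b → scale θ b 1ℚ ≤ θ⁻ * (θ * 1ℚ)
  down true = ≤ᵇ⇒≤ _
  down false = ≤ᵇ⇒≤ _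

  up : θ * (θ * 1ℚ) ≤ θ * (θ * 1ℚ)
  up = ≤-refl

  exchange : ∀ a b c → a * (b * c) ≡ b * (a * c)
  exchange = solve-∀ ring

-- One step raises the index of the last nonzero site when the q-component of
-- that site is set, and lowers it by at most one otherwise.
weightA-step : ∀ c n x → nil? n x ≡ false → proj₂ (top n x) ≡ 0b →
  weightA n (carry c n x) ≤ gain (proj₂ (leadA n x)) * weightA n x
weightA-step c (suc n) (s@(p , q) , x) nz good = split (nil? n x) refl
  where
  s′ : Site
  s′ = xor p c , q
  g : ℚ
  g = gain (proj₂ (leadA (suc n) (s , x)))
  w≡ : weightA (suc n) (s , x) ≡ θ * weightA n x
  w≡ = cong (λ b → scale θ b (weightA n x)) nz
  finish : ∀ {u v} → weightA (suc n) (carry c (suc n) (s , x)) ≡ u → g ≡ v → u ≤ v * (θ * weightA n x) →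
           weightA (suc n) (carry c (suc n) (s , x)) ≤ g * weightA (suc n) (s , x)
  finish {u} {v} e f le = subst₂ _≤_ (sym e) (cong₂ _*_ (sym f) (sym w≡)) le
  split : ∀ b → nil? n x ≡ b → weightA (suc n) (carry c (suc n) (s , x)) ≤ g * weightA (suc n) (s , x)
  split false eq = finish (cong (λ b → scale θ b (weightA n (carry q n x))) notNil) (cong (λ s → gain (proj₂ s)) (◁-nonzero s (leadA n x) eq))
    (subst (θ * weightA n (carry q n x) ≤_) (exchange θ (gain (proj₂ (leadA n x))) (weightA n x)) (*-monoˡ 0≤θ (weightA-step q n x eq (good′ n x eq good))))
    where
    good′ : ∀ n x → nil? n x ≡ false → proj₂ (top (suc n) (s , x)) ≡ 0b → proj₂ (top n x) ≡ 0b
    good′ (suc n) x _ g = g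
    notNil : nil? (suc n) (carry c (suc n) (s , x)) ≡ false
    notNil = decide (nil? (suc n) (carry c (suc n) (s , x))) refl
      where
      decide : ∀ b → nil? (suc n) (carry c (suc n) (s , x)) ≡ b → b ≡ false
      decide false _ = refl
      decide true e = contradiction (trans (sym eq) (nil-step n x (nil-𝟘 n (trans (cong (λ b → carry b n x) (sym q≡0)) (cong proj₂ whole))))) λ ()
        where
        whole = nil⇒𝟘 (suc n) (carry c (suc n) (s , x)) e
        q≡0 : q ≡ 0b
        q≡0 = cong (λ s → proj₂ (proj₁ s)) whole
  split true eq = zeroTail (nil⇒𝟘 n x eq) q refl
    where
    g≡ : g ≡ gain q
    g≡ = cong (λ s → gain (proj₂ s)) (◁-zero s (leadA n x) eq)
    -- `good` rules out that a last nonzero site with q set is the top one, so there is a further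
    -- site to carry into.
    top-last : ∀ n x → x ≡ State.𝟘 n → q ≡ 1b → proj₂ (top (suc n) (s , x)) ≡ 0b → ∃ λ m → n ≡ suc m
    top-last zero x _ q≡1 g with () ← trans (sym q≡1) g
    top-last (suc m) x _ q≡1 g = m , refl
    zeroTail : x ≡ State.𝟘 n → ∀ q′ → q ≡ q′ → weightA (suc n) (carry c (suc n) (s , x)) ≤ g * weightA (suc n) (s , x)
    zeroTail x≡0 0b q≡ = finish (cong (scale θ (nil? (suc n) (carry c (suc n) (s , x))))
        (trans (cong (weightA n) (trans (cong₂ (λ b y → carry b n y) q≡ x≡0) (carry-𝟘 n))) (weightA-𝟘 n)))
      (trans g≡ (cong gain q≡))
      (subst (λ w → scale θ (nil? (suc n) (carry c (suc n) (s , x))) 1ℚ ≤ θ⁻ * (θ * w)) (sym (trans (cong (weightA n) x≡0) (weightA-𝟘 n)))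
        (down (nil? (suc n) (carry c (suc n) (s , x)))))
    zeroTail x≡0 1b q≡ with top-last n x x≡0 q≡ good
    ... | m , refl = finish
      (trans (cong₂ (λ y z → weightA (suc n) ((xor p c , y) , carry y n z)) q≡ x≡0) raised)
      (trans g≡ (cong gain q≡))
      (subst (λ w → θ * (θ * 1ℚ) ≤ θ * (θ * w)) (sym (trans (cong (weightA n) x≡0) (weightA-𝟘 n))) up)
      where
      one : leadA (suc m) (carry 1b (suc m) (State.𝟘 (suc m))) ≡ (1b , 0b)
      one = trans (cong (λ y → (1b , 0b) ◁ leadA m y) (carry-𝟘 m)) (cong ((1b , 0b) ◁_) (lead-𝟘 m))
      raised : weightA (suc (suc m)) ((xor p c , 1b) , carry 1b (suc m) (State.𝟘 (suc m))) ≡ θ * (θ * 1ℚ)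
      raised = trans (cong (λ l → scale θ (isZ ((xor p c , 1b) ◁ l)) (weightA (suc m) (carry 1b (suc m) (State.𝟘 (suc m))))) one)
        (cong (θ *_) (trans (cong (λ l → scale θ (isZ l) (weightA m (carry 0b m (State.𝟘 m)))) one)
          (cong (θ *_) (trans (cong (weightA m) (carry-𝟘 m)) (weightA-𝟘 m)))))

private
  gain-up : θ * (θ⁻ * 1ℚ) ≡ 1ℚ
  gain-up = refl

-- The mirror image of `weightA-step`: `stepᵀ` copies the p of the first nonzero site into the q of
-- the site below, which moves the lead down by one. If that p is 0, at worst the leading site is
-- cancelled by the p of the next one, which then leads.
weightB-step : ∀ n x → isZ (leadB n x) ≡ false → firstP n x ≡ 0b →
  weightB n (stepᵀ n x) ≤ gain (proj₁ (leadB n x)) * weightB n x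
weightB-step (suc n) ((0b , 1b) , x) nz good = split (firstP n x) refl
  where
  second : ∀ n x → firstP n x ≡ 1b → weightB n (stepᵀ n x) ≡ 1ℚ
  second (suc n) ((1b , q) , x) refl = refl
  split : ∀ b → firstP n x ≡ b → scale θ⁻ (not (isZ (0b , xor 1b (firstP n x)))) (weightB n (stepᵀ n x)) ≤ θ⁻ * 1ℚ
  split 0b eq = subst (_≤ θ⁻ * 1ℚ) (sym (cong (λ b → scale θ⁻ (not (isZ (0b , xor 1b b))) (weightB n (stepᵀ n x))) eq)) (≤ᵇ⇒≤ _)
  split 1b eq = ≤-reflexive (trans (cong (λ b → scale θ⁻ (not (isZ (0b , xor 1b b))) (weightB n (stepᵀ n x))) eq) (cong (θ⁻ *_) (second n x eq)))
weightB-step (suc n) ((0b , 0b) , x) nz good = split (firstP n x) refl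
  where
  g = gain (proj₁ (leadB n x ◁ (0b , 0b)))
  first : ∀ n x → firstP n x ≡ 1b → gain (proj₁ (leadB n x)) * (θ⁻ * weightB n x) ≡ 1ℚ
  first (suc n) ((1b , q) , x) refl = gain-up
  split : ∀ b → firstP n x ≡ b → scale θ⁻ (not (isZ (0b , firstP n x))) (weightB n (stepᵀ n x)) ≤ g * (θ⁻ * weightB n x)
  split 0b eq = subst₂ _≤_ (sym (cong (λ b → scale θ⁻ (not (isZ (0b , b))) (weightB n (stepᵀ n x))) eq)) (exchange θ⁻ g (weightB n x))
    (*-monoˡ 0≤θ⁻ (weightB-step n x nz eq))
  split 1b eq = ≤-reflexive (trans (cong (λ b → scale θ⁻ (not (isZ (0b , b))) (weightB n (stepᵀ n x))) eq) (sym (first n x eq)))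

module _ {A : Set} where

  ∑-filter : ∀ (P : A → Bool) xs f → ∑ (filterᵇ P xs) f ≡ ∑ xs (λ x → if P x then f x else 0ℚ)
  ∑-filter P [] f = refl
  ∑-filter P (x ∷ xs) f with P x
  ... | true = cong (f x +_) (∑-filter P xs f)
  ... | false = trans (∑-filter P xs f) (sym (+-identityˡ _))

  ∑-filter-mono : ∀ (P : A → Bool) xs {f g} → (∀ x → P x ≡ true → f x ≤ g x) → ∑ (filterᵇ P xs) f ≤ ∑ (filterᵇ P xs) g
  ∑-filter-mono P [] e = ≤-refl
  ∑-filter-mono P (x ∷ xs) e with P x in eq
  ... | true = +-mono-≤ (e x eq) (∑-filter-mono P xs e)
  ... | false = ∑-filter-mono P xs e

Invertible : ∀ {A : Set} → (A → A) → Set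
Invertible {A} φ = Σ (A → A) λ ψ → (∀ x → ψ (φ x) ≡ x) × (∀ x → φ (ψ x) ≡ x)

module NonZero {A : Set} (G : Group A) where
  open Group G

  nonzero : A → Bool
  nonzero x = not (does (x ≟ 𝟘))

  nonzeros : List A
  nonzeros = filterᵇ nonzero elems

  nonzero⇒≢ : ∀ x → nonzero x ≡ true → x ≢ 𝟘
  nonzero⇒≢ x e x≡𝟘 with x ≟ 𝟘
  nonzero⇒≢ x () x≡𝟘 | yes _
  ... | no x≢𝟘 = x≢𝟘 x≡𝟘

  ∑-nonzeros : ∀ (φ : A → A) → Invertible φ → φ 𝟘 ≡ 𝟘 → ∀ f → ∑ nonzeros (f ∘ φ) ≡ ∑ nonzeros f
  ∑-nonzeros φ (ψ , ψφ , φψ) φ𝟘 f = trans (∑-filter nonzero elems (f ∘ φ)) (trans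
    (∑-cong elems λ x → cong (if_then f (φ x) else 0ℚ) (same x))
    (trans (reindex finite finite φ ψ ψφ φψ (λ x → if nonzero x then f x else 0ℚ)) (sym (∑-filter nonzero elems f))))
    where
    same : ∀ x → nonzero x ≡ nonzero (φ x)
    same x with x ≟ 𝟘
    ... | yes refl = cong not (sym (dec-true (φ 𝟘 ≟ 𝟘) φ𝟘))
    ... | no x≢𝟘 = cong not (sym (dec-false (φ x ≟ 𝟘) λ e → x≢𝟘 (trans (sym (ψφ x)) (trans (cong ψ (trans e (sym φ𝟘))) (ψφ 𝟘)))))

  ∑-nonzeros-mono : ∀ {f g} → (∀ x → x ≢ 𝟘 → f x ≤ g x) → ∑ nonzeros f ≤ ∑ nonzeros g
  ∑-nonzeros-mono e = ∑-filter-mono nonzero elems λ x p → e x (nonzero⇒≢ x p)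

  ∑-split : ∀ f → ∑ elems f ≡ f 𝟘 + ∑ nonzeros f
  ∑-split f = trans (∑-cong elems part) (trans (∑-+ elems (λ x → if does (x ≟ 𝟘) then f x else 0ℚ) (λ x → if nonzero x then f x else 0ℚ))
    (cong₂ _+_ (pick 𝟘 f) (sym (∑-filter nonzero elems f))))
    where
    part : ∀ x → f x ≡ (if does (x ≟ 𝟘) then f x else 0ℚ) + (if nonzero x then f x else 0ℚ)
    part x with does (x ≟ 𝟘)
    ... | true = sym (+-identityʳ (f x))
    ... | false = sym (+-identityˡ (f x))

-- The action of letters on Pauli coefficients and the Schur test

Letter : Set
Letter = (Site × Site) × Choice

choiceGroup : Group Choice
choiceGroup = bits 3

-- Opaque, so that sums over all letters are never unfolded during conversion checking.
opaque
  letterGroup : Group Letter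
  letterGroup = pairGroup (pairGroup siteGroup siteGroup) choiceGroup

  letterGroup-isize : Group.isize letterGroup ≡ Site.isize * Site.isize * Group.isize choiceGroup
  letterGroup-isize = refl

  letterGroup-dim : Group.dim letterGroup ≡ 7
  letterGroup-dim = refl

  ∑-letters : ∀ (f : Letter → ℚ) → ∑ (Group.elems letterGroup) f ≡
    ∑ Site.elems (λ z → ∑ Site.elems (λ ξ → ∑ (Group.elems choiceGroup) (λ r → f ((z , ξ) , r))))
  ∑-letters f = trans (∑-pairs (pairs Site.elems Site.elems) (Group.elems choiceGroup) f)
    (∑-pairs Site.elems Site.elems (λ p → ∑ (Group.elems choiceGroup) (λ r → f (p , r))))

δ : Site → ℚ
δ s = if isZ s then 1ℚ else 0ℚ

δ-average : ∀ s → Site.isize * ∑ Site.elems (λ z → Site.χ z s) ≡ δ s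
δ-average = ∀Site refl refl refl refl

module _ (n : ℕ) where
  private module S = State n

  -- Labels of Pauli matrices: `a` is the translation part, `b` the character part.
  Ω : Set
  Ω = States n × States n

  ΩGroup : Group Ω
  ΩGroup = pairGroup (stateGroup n) (stateGroup n)

  open NonZero ΩGroup
  private module Ω = Group ΩGroup

  -- Characters transform by the inverse transpose. The matrix of `cyc` is symmetric and `step` is
  -- an involution, hence `turn⁻` here and `stepᵀ` in `Stp` on the second component.
  Rot Rot⁻ : Fin 3 → Ω → Ω
  Rot e (a , b) = mapS (turn e) n a , mapS (turn⁻ e) n b
  Rot⁻ e (a , b) = mapS (turn⁻ e) n a , mapS (turn e) n b

  Stp : Ω → Ω
  Stp (a , b) = step n a , stepᵀ n b

  Rot⁻-Rot : ∀ e v → Rot⁻ e (Rot e v) ≡ v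
  Rot⁻-Rot e (a , b) = cong₂ _,_ (mapS-inverse (turn⁻-turn e) n a) (mapS-inverse (turn-turn⁻ e) n b)

  Rot-Rot⁻ : ∀ e v → Rot e (Rot⁻ e v) ≡ v
  Rot-Rot⁻ e (a , b) = cong₂ _,_ (mapS-inverse (turn-turn⁻ e) n a) (mapS-inverse (turn⁻-turn e) n b)

  Stp² : ∀ v → Stp (Stp v) ≡ v
  Stp² (a , b) = cong₂ _,_ (carry² 0b n a) (stepᵀ² n b)

  private
    mapS-𝟘 : ∀ f → f (0b , 0b) ≡ (0b , 0b) → ∀ n → mapS f n (State.𝟘 n) ≡ State.𝟘 n
    mapS-𝟘 f e zero = refl
    mapS-𝟘 f e (suc n) = cong₂ _,_ e (mapS-𝟘 f e n)

    turn-0 : ∀ e → turn e (0b , 0b) ≡ (0b , 0b)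
    turn-0 zero = refl
    turn-0 (suc zero) = refl
    turn-0 (suc (suc zero)) = refl

    turn⁻-0 : ∀ e → turn⁻ e (0b , 0b) ≡ (0b , 0b)
    turn⁻-0 zero = refl
    turn⁻-0 (suc zero) = refl
    turn⁻-0 (suc (suc zero)) = refl

    firstP-𝟘 : ∀ n → firstP n (State.𝟘 n) ≡ 0b
    firstP-𝟘 zero = refl
    firstP-𝟘 (suc n) = refl

    stepᵀ-𝟘 : ∀ n → stepᵀ n (State.𝟘 n) ≡ State.𝟘 n
    stepᵀ-𝟘 zero = refl
    stepᵀ-𝟘 (suc n) = cong₂ _,_ (cong (0b ,_) (firstP-𝟘 n)) (stepᵀ-𝟘 n)

  Rot-𝟘 : ∀ e → Rot e Ω.𝟘 ≡ Ω.𝟘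
  Rot-𝟘 e = cong₂ _,_ (mapS-𝟘 (turn e) (turn-0 e) n) (mapS-𝟘 (turn⁻ e) (turn⁻-0 e) n)

  Rot⁻-𝟘 : ∀ e → Rot⁻ e Ω.𝟘 ≡ Ω.𝟘
  Rot⁻-𝟘 e = cong₂ _,_ (mapS-𝟘 (turn⁻ e) (turn⁻-0 e) n) (mapS-𝟘 (turn e) (turn-0 e) n)

  Stp-𝟘 : Stp Ω.𝟘 ≡ Ω.𝟘
  Stp-𝟘 = cong₂ _,_ (carry-𝟘 n) (stepᵀ-𝟘 n)

  private
    ◁-map : ∀ f → (∀ s → isZ (f s) ≡ isZ s) → ∀ s t → f s ◁ f t ≡ f (s ◁ t)
    ◁-map f f-isZ s t = split (isZ t) refl
      where
      split : ∀ b → isZ t ≡ b → f s ◁ f t ≡ f (s ◁ t)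
      split true e = trans (◁-zero (f s) (f t) (trans (f-isZ t) e)) (cong f (sym (◁-zero s t e)))
      split false e = trans (◁-nonzero (f s) (f t) (trans (f-isZ t) e)) (cong f (sym (◁-nonzero s t e)))

    module _ (f : Site → Site) (f-isZ : ∀ s → isZ (f s) ≡ isZ s) where
      f0 : f (0b , 0b) ≡ (0b , 0b)
      f0 = isZ⇒ (f (0b , 0b)) (f-isZ (0b , 0b))

      leadA-map : ∀ n x → leadA n (mapS f n x) ≡ f (leadA n x)
      leadA-map zero x = sym f0
      leadA-map (suc n) (s , x) = trans (cong (f s ◁_) (leadA-map n x)) (◁-map f f-isZ s (leadA n x))

      leadB-map : ∀ n x → leadB n (mapS f n x) ≡ f (leadB n x)
      leadB-map zero x = sym f0
      leadB-map (suc n) (s , x) = trans (cong (_◁ f s) (leadB-map n x)) (◁-map f f-isZ (leadB n x) s)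

      weightA-map : ∀ n x → weightA n (mapS f n x) ≡ weightA n x
      weightA-map zero x = refl
      weightA-map (suc n) (s , x) = cong₂ (scale θ) (trans (cong isZ (leadA-map (suc n) (s , x))) (f-isZ (leadA (suc n) (s , x)))) (weightA-map n x)

      weightB-map : ∀ n x → weightB n (mapS f n x) ≡ weightB n x
      weightB-map zero x = refl
      weightB-map (suc n) (s , x) = cong₂ (λ b → scale θ⁻ (not b)) (f-isZ s) (weightB-map n x)

  choose : ∀ {X : Set} → Bool → X → X → X
  choose true b a = b
  choose false b a = a

  -- The character part counts only when the translation part vanishes, a property that rotations
  -- and steps preserve.
  weight weight⁻ : Ω → ℚ
  weight (a , b) = choose (nil? n a) (weightB n b) (weightA n a)
  weight⁻ (a , b) = choose (nil? n a) (weightB⁻ n b) (weightA⁻ n a)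

  leading : Ω → Bit
  leading (a , b) = choose (nil? n a) (proj₁ (leadB n b)) (proj₂ (leadA n a))

  weight-inverse : ∀ v → weight v * weight⁻ v ≡ 1ℚ
  weight-inverse (a , b) = split (nil? n a)
    where
    split : ∀ c → choose c (weightB n b) (weightA n a) * choose c (weightB⁻ n b) (weightA⁻ n a) ≡ 1ℚ
    split true = weightB-inverse n b
    split false = weightA-inverse n a

  weight-pos : ∀ v → 0ℚ < weight v
  weight-pos (a , b) = split (nil? n a)
    where
    split : ∀ c → 0ℚ < choose c (weightB n b) (weightA n a)
    split true = weightB-pos n b
    split false = weightA-pos n a

  weight⁻-pos : ∀ v → 0ℚ < weight⁻ v
  weight⁻-pos (a , b) = split (nil? n a)
    where
    split : ∀ c → 0ℚ < choose c (weightB⁻ n b) (weightA⁻ n a)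
    split true = weightB⁻-pos n b
    split false = weightA⁻-pos n a

  private
    nil-map : ∀ f → (∀ s → isZ (f s) ≡ isZ s) → ∀ a → nil? n (mapS f n a) ≡ nil? n a
    nil-map f e a = trans (cong isZ (leadA-map f e n a)) (e (leadA n a))

    weight-map : ∀ f g → (∀ s → isZ (f s) ≡ isZ s) → (∀ s → isZ (g s) ≡ isZ s) → ∀ a b →
                 weight (mapS f n a , mapS g n b) ≡ weight (a , b)
    weight-map f g e e′ a b = trans (cong (λ c → choose c (weightB n (mapS g n b)) (weightA n (mapS f n a))) (nil-map f e a))
      (cong₂ (choose (nil? n a)) (weightB-map g e′ n b) (weightA-map f e n a))

    leading-map : ∀ f g → (∀ s → isZ (f s) ≡ isZ s) → (∀ s → isZ (g s) ≡ isZ s) → ∀ a b →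
                  leading (mapS f n a , mapS g n b) ≡ choose (nil? n a) (proj₁ (g (leadB n b))) (proj₂ (f (leadA n a)))
    leading-map f g e e′ a b = trans (cong (λ c → choose c (proj₁ (leadB n (mapS g n b))) (proj₂ (leadA n (mapS f n a)))) (nil-map f e a))
      (cong₂ (choose (nil? n a)) (cong proj₁ (leadB-map g e′ n b)) (cong proj₂ (leadA-map f e n a)))

  weight-Rot : ∀ e v → weight (Rot e v) ≡ weight v
  weight-Rot e (a , b) = weight-map (turn e) (turn⁻ e) (isZ-turn e) (isZ-turn⁻ e) a b

  weight-Rot⁻ : ∀ e v → weight (Rot⁻ e v) ≡ weight v
  weight-Rot⁻ e (a , b) = weight-map (turn⁻ e) (turn e) (isZ-turn⁻ e) (isZ-turn e) a b

  private
    leadB⇒𝟘 : ∀ n x → isZ (leadB n x) ≡ true → x ≡ State.𝟘 n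
    leadB⇒𝟘 zero x e = refl
    leadB⇒𝟘 (suc n) (s , x) e = split (isZ s) refl
      where
      split : ∀ b → isZ s ≡ b → (s , x) ≡ State.𝟘 (suc n)
      split true z = cong₂ _,_ (isZ⇒ s z) (leadB⇒𝟘 n x (trans (cong isZ (sym (◁-zero (leadB n x) s z))) e))
      split false z = contradiction (trans (sym z) (trans (cong isZ (sym (◁-nonzero (leadB n x) s z))) e)) λ ()

    not-true : ∀ b → b ≢ true → b ≡ false
    not-true true p = contradiction refl p
    not-true false p = refl

    leadB-nonzero : ∀ a b → (a , b) ≢ Ω.𝟘 → nil? n a ≡ true → isZ (leadB n b) ≡ false
    leadB-nonzero a b v≢𝟘 z = not-true _ λ e → v≢𝟘 (cong₂ _,_ (nil⇒𝟘 n a z) (leadB⇒𝟘 n b e))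

  Good : Ω → Set
  Good (a , b) = proj₂ (top n a) ≡ 0b × firstP n b ≡ 0b

  weight-step : ∀ v → v ≢ Ω.𝟘 → Good v → weight (Stp v) ≤ gain (leading v) * weight v
  weight-step (a , b) v≢𝟘 (ga , gb) = split (nil? n a) refl
    where
    split : ∀ c → nil? n a ≡ c → weight (Stp (a , b)) ≤ gain (leading (a , b)) * weight (a , b)
    split true e = subst₂ _≤_ (cong (λ c → choose c (weightB n (stepᵀ n b)) (weightA n (step n a))) (sym (trans (step-nil n a) e)))
      (cong₂ (λ c d → gain (choose c (proj₁ (leadB n b)) (proj₂ (leadA n a))) * choose d (weightB n b) (weightA n a)) (sym e) (sym e))
      (weightB-step n b (leadB-nonzero a b v≢𝟘 e) gb)
    split false e = subst₂ _≤_ (cong (λ c → choose c (weightB n (stepᵀ n b)) (weightA n (step n a))) (sym (trans (step-nil n a) e)))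
      (cong₂ (λ c d → gain (choose c (proj₁ (leadB n b)) (proj₂ (leadA n a))) * choose d (weightB n b) (weightA n a)) (sym e) (sym e))
      (weightA-step 0b n a e ga)

  -- What orthogonality leaves of a coefficient after averaging over the phase at the top and the
  -- shift at the bottom.
  mask : Ω → ℚ
  mask (a , b) = δ (top n a) * δ (bot n (stepᵀ n b))

  private
    data Indicator (P : Set) : ℚ → Set where
      off : Indicator P 0ℚ
      on : P → Indicator P 1ℚ

    indicator-map : ∀ {P Q t} → (P → Q) → Indicator P t → Indicator Q t
    indicator-map f off = off
    indicator-map f (on p) = on (f p)

    δ-indicator : ∀ s → Indicator (s ≡ (0b , 0b)) (δ s)
    δ-indicator = ∀Site (on refl) off off off

    both : ∀ {P Q t u} → Indicator P t → Indicator Q u → Indicator (P × Q) (t * u)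
    both off off = off
    both off (on q) = off
    both (on p) off = off
    both (on p) (on q) = on (p , q)

    top-carry : ∀ c n x → proj₂ (top n (carry c n x)) ≡ proj₂ (top n x)
    top-carry c zero x = refl
    top-carry c (suc zero) x = refl
    top-carry c (suc (suc n)) ((p , q) , x) = top-carry q (suc n) x

    bot-firstP : ∀ n x → firstP n x ≡ proj₁ (bot n x)
    bot-firstP zero x = refl
    bot-firstP (suc n) x = refl

    bot-stepᵀ : ∀ n x → proj₁ (bot n (stepᵀ n x)) ≡ proj₁ (bot n x)
    bot-stepᵀ zero x = refl
    bot-stepᵀ (suc n) x = refl

  mask-indicator : ∀ v → Indicator (Good v) (mask v)
  mask-indicator (a , b) = indicator-map (λ (p , q) → cong proj₂ p , trans (bot-firstP n b) (trans (sym (bot-stepᵀ n b)) (cong proj₁ q)))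
    (both (δ-indicator (top n a)) (δ-indicator (bot n (stepᵀ n b))))

  mask-Stp-indicator : ∀ v → Indicator (Good v) (mask (Stp v))
  mask-Stp-indicator (a , b) = indicator-map
    (λ (p , q) → trans (sym (top-carry 0b n a)) (cong proj₂ p) , trans (bot-firstP n b) (cong proj₁ (trans (cong (bot n) (sym (stepᵀ² n b))) q)))
    (both (δ-indicator (top n (step n a))) (δ-indicator (bot n (stepᵀ n (stepᵀ n b)))))

  mask-nonNeg : ∀ v → 0ℚ ≤ mask v
  mask-nonNeg v = cases (mask-indicator v)
    where
    cases : ∀ {t} → Indicator (Good v) t → 0ℚ ≤ t
    cases off = ≤-refl
    cases (on _) = 0≤1

  mask-sq : ∀ v → sq (mask v) ≤ 1ℚ
  mask-sq v = cases (mask-indicator v)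
    where
    cases : ∀ {t} → Indicator (Good v) t → sq t ≤ 1ℚ
    cases off = 0≤1
    cases (on _) = ≤-refl

  private
    gain-nonNeg : ∀ b → 0ℚ ≤ gain b
    gain-nonNeg 0b = <⇒≤ 0<θ⁻
    gain-nonNeg 1b = <⇒≤ 0<θ

    masked-step : ∀ {t} v → v ≢ Ω.𝟘 → Indicator (Good v) t → t * weight (Stp v) ≤ gain (leading v) * weight v
    masked-step v v≢𝟘 off = subst (_≤ gain (leading v) * weight v) (sym (*-zeroˡ (weight (Stp v))))
      (*-nonNeg (gain-nonNeg (leading v)) (<⇒≤ (weight-pos v)))
    masked-step v v≢𝟘 (on g) = subst (_≤ gain (leading v) * weight v) (sym (*-identityˡ (weight (Stp v)))) (weight-step v v≢𝟘 g)

    rs = Group.elems choiceGroup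

    c : ℚ
    c = Group.isize choiceGroup

    -- At least five of the eight choices make the leading bit equal to one: 5 · ¾ + 3 · 4/3 = 8 κ.
    gainA : ∀ s → isZ s ≡ false → c * ∑ rs (λ r → gain (proj₂ (turn (exponent r) s))) ≤ κ
    gainA = ∀Site (λ ()) (λ _ → ≤ᵇ⇒≤ _) (λ _ → ≤ᵇ⇒≤ _) (λ _ → ≤ᵇ⇒≤ _)
    gain-proj₁ : ∀ s → isZ s ≡ false → c * ∑ rs (λ r → gain (proj₁ (turn (exponent r) s))) ≤ κ
    gain-proj₁ = ∀Site (λ ()) (λ _ → ≤ᵇ⇒≤ _) (λ _ → ≤ᵇ⇒≤ _) (λ _ → ≤ᵇ⇒≤ _)
    gain⁻-proj₁ : ∀ s → isZ s ≡ false → c * ∑ rs (λ r → gain (proj₁ (turn⁻ (exponent r) s))) ≤ κ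
    gain⁻-proj₁ = ∀Site (λ ()) (λ _ → ≤ᵇ⇒≤ _) (λ _ → ≤ᵇ⇒≤ _) (λ _ → ≤ᵇ⇒≤ _)
    gain⁻-proj₂ : ∀ s → isZ s ≡ false → c * ∑ rs (λ r → gain (proj₂ (turn⁻ (exponent r) s))) ≤ κ
    gain⁻-proj₂ = ∀Site (λ ()) (λ _ → ≤ᵇ⇒≤ _) (λ _ → ≤ᵇ⇒≤ _) (λ _ → ≤ᵇ⇒≤ _)

    total-gain : ∀ (f g : Fin 3 → Site → Site) (f-isZ : ∀ e s → isZ (f e s) ≡ isZ s) (g-isZ : ∀ e s → isZ (g e s) ≡ isZ s) →
      (∀ s → isZ s ≡ false → c * ∑ rs (λ r → gain (proj₂ (f (exponent r) s))) ≤ κ) →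
      (∀ s → isZ s ≡ false → c * ∑ rs (λ r → gain (proj₁ (g (exponent r) s))) ≤ κ) →
      ∀ a b → (a , b) ≢ Ω.𝟘 → c * ∑ rs (λ r → gain (leading (mapS (f (exponent r)) n a , mapS (g (exponent r)) n b))) ≤ κ
    total-gain f g f-isZ g-isZ boundA boundB a b v≢𝟘 = subst (_≤ κ) (cong (c *_) (∑-cong rs λ r →
        cong gain (sym (leading-map (f (exponent r)) (g (exponent r)) (f-isZ (exponent r)) (g-isZ (exponent r)) a b)))) (split (nil? n a) refl)
      where
      split : ∀ t → nil? n a ≡ t → c * ∑ rs (λ r → gain (choose (nil? n a) (proj₁ (g (exponent r) (leadB n b))) (proj₂ (f (exponent r) (leadA n a))))) ≤ κ
      split true e = subst (λ t → c * ∑ rs (λ r → gain (choose t (proj₁ (g (exponent r) (leadB n b))) (proj₂ (f (exponent r) (leadA n a))))) ≤ κ) (sym e) (boundB (leadB n b) (leadB-nonzero a b v≢𝟘 e))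
      split false e = subst (λ t → c * ∑ rs (λ r → gain (choose t (proj₁ (g (exponent r) (leadB n b))) (proj₂ (f (exponent r) (leadA n a))))) ≤ κ) (sym e) (boundA (leadA n a) e)

    0≤c : 0ℚ ≤ c
    0≤c = <⇒≤ (Group.isize-pos choiceGroup)

    -- Rotations keep the weight and only randomise the bit that decides between a gain of `θ` and a
    -- loss of `θ⁻`; labels at which the weight estimate could fail are masked. This is one Schur
    -- condition, stated so as to serve in both directions.
    average-bound : ∀ (ρ : Choice → Ω → Ω) → (∀ r v → weight (ρ r v) ≡ weight v) → (∀ r v → v ≢ Ω.𝟘 → ρ r v ≢ Ω.𝟘) →
      (∀ v → v ≢ Ω.𝟘 → c * ∑ rs (λ r → gain (leading (ρ r v))) ≤ κ) →
      (m : Ω → ℚ) → (∀ v → Indicator (Good v) (m v)) →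
      ∀ v → v ≢ Ω.𝟘 → c * ∑ rs (λ r → m (ρ r v) * weight (Stp (ρ r v))) ≤ κ * weight v
    average-bound ρ ρ-weight ρ-nonzero total m ind v v≢𝟘 = begin
      c * ∑ rs (λ r → m (ρ r v) * weight (Stp (ρ r v)))
        ≤⟨ *-monoˡ 0≤c (∑-mono rs λ r → subst (m (ρ r v) * weight (Stp (ρ r v)) ≤_) (cong (gain (leading (ρ r v)) *_) (ρ-weight r v))
             (masked-step (ρ r v) (ρ-nonzero r v v≢𝟘) (ind (ρ r v)))) ⟩
      c * ∑ rs (λ r → gain (leading (ρ r v)) * weight v)
        ≡⟨ trans (cong (c *_) (∑-*ʳ rs (weight v) (λ r → gain (leading (ρ r v))))) (sym (*-assoc c (∑ rs (λ r → gain (leading (ρ r v)))) (weight v))) ⟩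
      c * ∑ rs (λ r → gain (leading (ρ r v))) * weight v
        ≤⟨ *-monoʳ (<⇒≤ (weight-pos v)) (total v v≢𝟘) ⟩
      κ * weight v ∎
      where open ℚ.≤-Reasoning

  rot rot⁻ : Choice → Ω → Ω
  rot r = Rot (exponent r)
  rot⁻ r = Rot⁻ (exponent r)

  private
    rot-nonzero : ∀ r v → v ≢ Ω.𝟘 → rot r v ≢ Ω.𝟘
    rot-nonzero r v v≢𝟘 e = v≢𝟘 (trans (sym (Rot⁻-Rot (exponent r) v)) (trans (cong (rot⁻ r) e) (Rot⁻-𝟘 (exponent r))))

    rot⁻-nonzero : ∀ r v → v ≢ Ω.𝟘 → rot⁻ r v ≢ Ω.𝟘
    rot⁻-nonzero r v v≢𝟘 e = v≢𝟘 (trans (sym (Rot-Rot⁻ (exponent r) v)) (trans (cong (rot r) e) (Rot-𝟘 (exponent r))))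

    -- This and `backward` are the row and column conditions of the Schur test: the first averages
    -- over the turn before a step, the second over the turn after it, run backwards.
    forward : ∀ v → v ≢ Ω.𝟘 → c * ∑ rs (λ r → mask (rot r v) * weight (Stp (rot r v))) ≤ κ * weight v
    forward = average-bound rot (λ r → weight-Rot (exponent r)) rot-nonzero
      (λ (a , b) → total-gain turn turn⁻ isZ-turn isZ-turn⁻ gainA gain⁻-proj₁ a b) mask mask-indicator

    backward : ∀ v → v ≢ Ω.𝟘 → c * ∑ rs (λ r → mask (Stp (rot⁻ r v)) * weight (Stp (rot⁻ r v))) ≤ κ * weight v
    backward = average-bound rot⁻ (λ r → weight-Rot⁻ (exponent r)) rot⁻-nonzero
      (λ (a , b) → total-gain turn⁻ turn isZ-turn⁻ isZ-turn gain⁻-proj₂ gain-proj₁ a b) (mask ∘ Stp) mask-Stp-indicator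

  -- Two letters without the outermost mask and step, neither of which increases the norm. The
  -- remaining step has a random turn on either side, one for each condition of the Schur test.
  core : (Ω → ℚ) → Ω → ℚ
  core g u = c * ∑ rs (λ r → mask (rot r u) * (c * ∑ rs (λ r′ → g (rot r′ (Stp (rot r u))))))

  private
    κ⁻ : ℚ
    κ⁻ = ℤ.+ 32 / 31

    0≤κ : 0ℚ ≤ κ
    0≤κ = ≤ᵇ⇒≤ _

    0≤κ⁻ : 0ℚ ≤ κ⁻
    0≤κ⁻ = ≤ᵇ⇒≤ _

    κκ⁻ : κ⁻ * κ ≡ 1ℚ
    κκ⁻ = refl

    -- The difference of the two brackets is `k * ρ⁻ * sq (g - k⁻ * ρ * h)`; below, `ρ` is a ratio
    -- of weights and `k` is `κ`.
    am-gm : ∀ h g ρ ρ⁻ k k⁻ m → ρ * ρ⁻ ≡ 1ℚ → k⁻ * k ≡ 1ℚ → 0ℚ ≤ ρ⁻ → 0ℚ ≤ k → 0ℚ ≤ m →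
            m * (h * g + h * g) ≤ m * (k⁻ * ρ * sq h + k * ρ⁻ * sq g)
    am-gm h g ρ ρ⁻ k k⁻ m ρρ⁻ kk⁻ 0≤ρ⁻ 0≤k 0≤m = *-monoˡ 0≤m (diff⇒≤ (subst (0ℚ ≤_) complete
      (*-nonNeg (*-nonNeg 0≤k 0≤ρ⁻) (sq-nonNeg (g - k⁻ * ρ * h)))))
      where
      lemma₁ : ∀ h g ρ ρ⁻ k k⁻ → k * ρ⁻ * ((g - k⁻ * ρ * h) * (g - k⁻ * ρ * h)) ≡
        ((k⁻ * k) * (ρ * ρ⁻)) * (k⁻ * ρ) * (h * h) + k * ρ⁻ * (g * g) - ((k⁻ * k) * (ρ * ρ⁻)) * (h * g + h * g)
      lemma₁ = solve-∀ ring
      lemma₂ : ∀ a x y z → 1ℚ * 1ℚ * a * x + y - 1ℚ * 1ℚ * z ≡ a * x + y - z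
      lemma₂ = solve-∀ ring
      complete : k * ρ⁻ * sq (g - k⁻ * ρ * h) ≡ k⁻ * ρ * sq h + k * ρ⁻ * sq g - (h * g + h * g)
      complete = trans (lemma₁ h g ρ ρ⁻ k k⁻) (trans (cong₂ (λ s t → s * t * (k⁻ * ρ) * (h * h) + k * ρ⁻ * (g * g) - s * t * (h * g + h * g)) kk⁻ ρρ⁻)
        (lemma₂ (k⁻ * ρ) (h * h) (k * ρ⁻ * (g * g)) (h * g + h * g)))

  module _ (g : Ω → ℚ) where
    private
      h : Ω → ℚ
      h = core g

      τ : Choice → Choice → Ω → Ω
      τ r r′ u = rot r′ (Stp (rot r u))

      H : ℚ
      H = ∑ nonzeros (λ u → sq (h u))

      Γ : ℚ
      Γ = ∑ nonzeros (λ u → sq (g u))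

      ∑∑ : (Choice → Choice → ℚ) → ℚ
      ∑∑ f = c * ∑ rs (λ r → c * ∑ rs (λ r′ → f r r′))

      ∑∑-cong : ∀ {f f′} → (∀ r r′ → f r r′ ≡ f′ r r′) → ∑∑ f ≡ ∑∑ f′
      ∑∑-cong e = cong (c *_) (∑-cong rs λ r → cong (c *_) (∑-cong rs (e r)))

      ∑∑-mono : ∀ {f f′} → (∀ r r′ → f r r′ ≤ f′ r r′) → ∑∑ f ≤ ∑∑ f′
      ∑∑-mono e = *-monoˡ 0≤c (∑-mono rs λ r → *-monoˡ 0≤c (∑-mono rs (e r)))

      ∑∑-+ : ∀ f f′ → ∑∑ (λ r r′ → f r r′ + f′ r r′) ≡ ∑∑ f + ∑∑ f′
      ∑∑-+ f f′ = trans (cong (c *_) (trans (∑-cong rs λ r → trans (cong (c *_) (∑-+ rs (f r) (f′ r))) (*-distribˡ-+ c (∑ rs (f r)) (∑ rs (f′ r))))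
        (∑-+ rs (λ r → c * ∑ rs (f r)) (λ r → c * ∑ rs (f′ r))))) (*-distribˡ-+ c (∑ rs (λ r → c * ∑ rs (f r))) (∑ rs (λ r → c * ∑ rs (f′ r))))

      ∑∑-*ˡ : ∀ t f → ∑∑ (λ r r′ → t * f r r′) ≡ t * ∑∑ f
      ∑∑-*ˡ t f = trans (cong (c *_) (trans (∑-cong rs λ r → trans (cong (c *_) (∑-*ˡ rs t (f r))) (*-exchange c t (∑ rs (f r)))) (∑-*ˡ rs t (λ r → c * ∑ rs (f r)))))
        (*-exchange c t (∑ rs (λ r → c * ∑ rs (f r))))
        where

      ∑∑-∑ : ∀ (f : Choice → Choice → Ω → ℚ) → ∑ nonzeros (λ u → ∑∑ (λ r r′ → f r r′ u)) ≡ ∑∑ (λ r r′ → ∑ nonzeros (f r r′))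
      ∑∑-∑ f = trans (∑-*ˡ nonzeros c (λ u → ∑ rs (λ r → c * ∑ rs (λ r′ → f r r′ u)))) (cong (c *_) (trans (∑-swap nonzeros rs (λ u r → c * ∑ rs (λ r′ → f r r′ u)))
        (∑-cong rs λ r → trans (∑-*ˡ nonzeros c (λ u → ∑ rs (λ r′ → f r r′ u))) (cong (c *_) (∑-swap nonzeros rs (λ u r′ → f r r′ u))))))

      const-∑ : ∀ t → c * ∑ rs (λ _ → t) ≡ t
      const-∑ t = trans (cong (c *_) (Group.∑-const choiceGroup t)) (trans (sym (*-assoc c (Group.size choiceGroup) t)) (trans (cong (_* t) (Group.size-inv choiceGroup)) (*-identityˡ t)))

      m : Choice → Ω → ℚ
      m r u = mask (rot r u)

      first second : Choice → Choice → Ω → ℚ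
      first r r′ u = m r u * (κ⁻ * (weight (τ r r′ u) * weight⁻ u) * sq (h u))
      second r r′ u = m r u * (κ * (weight⁻ (τ r r′ u) * weight u) * sq (g (τ r r′ u)))

      expand : ∀ u → sq (h u) + sq (h u) ≤ ∑∑ (λ r r′ → first r r′ u) + ∑∑ (λ r r′ → second r r′ u)
      expand u = begin
        h u * h u + h u * h u
          ≡⟨ cong₂ _+_ product product ⟩
        ∑∑ (λ r r′ → m r u * (h u * g (τ r r′ u))) + ∑∑ (λ r r′ → m r u * (h u * g (τ r r′ u)))
          ≡⟨ ∑∑-+ (λ r r′ → m r u * (h u * g (τ r r′ u))) (λ r r′ → m r u * (h u * g (τ r r′ u))) ⟨
        ∑∑ (λ r r′ → m r u * (h u * g (τ r r′ u)) + m r u * (h u * g (τ r r′ u)))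
          ≡⟨ ∑∑-cong (λ r r′ → sym (*-distribˡ-+ (m r u) (h u * g (τ r r′ u)) (h u * g (τ r r′ u)))) ⟩
        ∑∑ (λ r r′ → m r u * (h u * g (τ r r′ u) + h u * g (τ r r′ u)))
          ≤⟨ ∑∑-mono (λ r r′ → am-gm (h u) (g (τ r r′ u)) (weight (τ r r′ u) * weight⁻ u) (weight⁻ (τ r r′ u) * weight u) κ κ⁻ (m r u)
               (ratio (weight (τ r r′ u)) (weight⁻ u) (weight⁻ (τ r r′ u)) (weight u) (weight-inverse (τ r r′ u)) (weight-inverse u)) κκ⁻
               (<⇒≤ (*-pos (weight⁻-pos (τ r r′ u)) (weight-pos u))) 0≤κ (mask-nonNeg (rot r u))) ⟩
        ∑∑ (λ r r′ → m r u * (κ⁻ * (weight (τ r r′ u) * weight⁻ u) * sq (h u) + κ * (weight⁻ (τ r r′ u) * weight u) * sq (g (τ r r′ u))))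
          ≡⟨ ∑∑-cong (λ r r′ → *-distribˡ-+ (m r u) (κ⁻ * (weight (τ r r′ u) * weight⁻ u) * sq (h u)) (κ * (weight⁻ (τ r r′ u) * weight u) * sq (g (τ r r′ u)))) ⟩
        ∑∑ (λ r r′ → first r r′ u + second r r′ u)
          ≡⟨ ∑∑-+ (λ r r′ → first r r′ u) (λ r r′ → second r r′ u) ⟩
        ∑∑ (λ r r′ → first r r′ u) + ∑∑ (λ r r′ → second r r′ u) ∎
        where
        open ℚ.≤-Reasoning
        ratio : ∀ a b⁻ a⁻ b → a * a⁻ ≡ 1ℚ → b * b⁻ ≡ 1ℚ → a * b⁻ * (a⁻ * b) ≡ 1ℚ
        ratio a b⁻ a⁻ b p q = trans (lemma a b⁻ a⁻ b) (cong₂ _*_ p q)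
          where
          lemma : ∀ a b⁻ a⁻ b → a * b⁻ * (a⁻ * b) ≡ a * a⁻ * (b * b⁻)
          lemma = solve-∀ ring
        product : h u * h u ≡ ∑∑ (λ r r′ → m r u * (h u * g (τ r r′ u)))
        product = trans (*-exchange (h u) c (∑ rs outer)) (cong (c *_) (trans (sym (∑-*ˡ rs (h u) outer)) (∑-cong rs λ r →
          trans (inside (h u) (m r u) c (∑ rs (λ r′ → g (τ r r′ u)))) (cong (c *_) (trans (sym (∑-*ˡ rs (m r u * h u) (λ r′ → g (τ r r′ u))))
            (∑-cong rs λ r′ → *-assoc (m r u) (h u) (g (τ r r′ u))))))))
          where
          outer : Choice → ℚ
          outer r = m r u * (c * ∑ rs (λ r′ → g (τ r r′ u)))
          inside : ∀ h m c s → h * (m * (c * s)) ≡ c * (m * h * s)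
          inside = solve-∀ ring

      -- The turn after the step leaves the weight unchanged, so its average is trivial and
      -- `forward` applies to the other one.
      first-bound : ∀ u → u ≢ Ω.𝟘 → ∑∑ (λ r r′ → first r r′ u) ≤ sq (h u)
      first-bound u u≢𝟘 = begin
        ∑∑ (λ r r′ → first r r′ u)
          ≡⟨ ∑∑-cong (λ r r′ → trans (cong (λ w → m r u * (κ⁻ * (w * weight⁻ u) * sq (h u))) (weight-Rot (exponent r′) (Stp (rot r u))))
               (collect (m r u) κ⁻ (weight (Stp (rot r u))) (weight⁻ u) (sq (h u)))) ⟩
        ∑∑ (λ r r′ → t * (m r u * weight (Stp (rot r u))))
          ≡⟨ ∑∑-*ˡ t (λ r _ → m r u * weight (Stp (rot r u))) ⟩
        t * ∑∑ (λ r r′ → m r u * weight (Stp (rot r u)))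
          ≡⟨ cong (λ z → t * (c * z)) (∑-cong rs λ r → const-∑ (m r u * weight (Stp (rot r u)))) ⟩
        t * (c * ∑ rs (λ r → m r u * weight (Stp (rot r u))))
          ≤⟨ *-monoˡ (*-nonNeg (*-nonNeg 0≤κ⁻ (<⇒≤ (weight⁻-pos u))) (sq-nonNeg (h u))) (forward u u≢𝟘) ⟩
        t * (κ * weight u)
          ≡⟨ cancel κ⁻ (weight⁻ u) (sq (h u)) κ (weight u) κκ⁻ (weight-inverse u) ⟩
        sq (h u) ∎
        where
        open ℚ.≤-Reasoning
        t = κ⁻ * weight⁻ u * sq (h u)
        collect : ∀ m k w v s → m * (k * (w * v) * s) ≡ k * v * s * (m * w)
        collect = solve-∀ ring
        cancel : ∀ k⁻ w⁻ s k w → k⁻ * k ≡ 1ℚ → w * w⁻ ≡ 1ℚ → k⁻ * w⁻ * s * (k * w) ≡ s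
        cancel k⁻ w⁻ s k w p q = trans (lemma k⁻ w⁻ s k w) (trans (cong₂ (λ a b → a * b * s) p q) (*-identityˡ s))
          where
          lemma : ∀ k⁻ w⁻ s k w → k⁻ * w⁻ * s * (k * w) ≡ k⁻ * k * (w * w⁻) * s
          lemma = solve-∀ ring

      second-bound : ∑ nonzeros (λ u → ∑∑ (λ r r′ → second r r′ u)) ≤ sq κ * Γ
      second-bound = begin
        ∑ nonzeros (λ u → ∑∑ (λ r r′ → second r r′ u))
          ≡⟨ ∑∑-∑ second ⟩
        ∑∑ (λ r r′ → ∑ nonzeros (second r r′))
          -- Substitution of `w = τ r r′ u`, a bijection that fixes `𝟘`; in the new variable the
          -- first turn `r` has disappeared and `backward` applies.
          ≡⟨ ∑∑-cong (λ r r′ → trans (∑-cong nonzeros (back r r′)) (∑-nonzeros (τ r r′) (τ⁻ r r′ , τ⁻τ r r′ , ττ⁻ r r′) (τ𝟘 r r′) (third r′))) ⟩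
        ∑∑ (λ r r′ → ∑ nonzeros (third r′))
          ≡⟨ const-∑ (c * ∑ rs (λ r′ → ∑ nonzeros (third r′))) ⟩
        c * ∑ rs (λ r′ → ∑ nonzeros (third r′))
          ≡⟨ trans (cong (c *_) (∑-swap rs nonzeros third)) (sym (∑-*ˡ nonzeros c (λ w → ∑ rs (λ r′ → third r′ w)))) ⟩
        ∑ nonzeros (λ w → c * ∑ rs (λ r′ → third r′ w))
          ≤⟨ ∑-nonzeros-mono each ⟩
        ∑ nonzeros (λ w → sq κ * sq (g w))
          ≡⟨ ∑-*ˡ nonzeros (sq κ) (λ w → sq (g w)) ⟩
        sq κ * Γ ∎
        where
        open ℚ.≤-Reasoning
        τ⁻ : Choice → Choice → Ω → Ω
        τ⁻ r r′ w = rot⁻ r (Stp (rot⁻ r′ w))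
        τ⁻τ : ∀ r r′ u → τ⁻ r r′ (τ r r′ u) ≡ u
        τ⁻τ r r′ u = trans (cong (λ v → rot⁻ r (Stp v)) (Rot⁻-Rot (exponent r′) (Stp (rot r u)))) (trans (cong (rot⁻ r) (Stp² (rot r u))) (Rot⁻-Rot (exponent r) u))
        ττ⁻ : ∀ r r′ u → τ r r′ (τ⁻ r r′ u) ≡ u
        ττ⁻ r r′ u = trans (cong (λ v → rot r′ (Stp v)) (Rot-Rot⁻ (exponent r) (Stp (rot⁻ r′ u)))) (trans (cong (rot r′) (Stp² (rot⁻ r′ u))) (Rot-Rot⁻ (exponent r′) u))
        τ𝟘 : ∀ r r′ → τ r r′ Ω.𝟘 ≡ Ω.𝟘
        τ𝟘 r r′ = trans (cong (λ v → rot r′ (Stp v)) (Rot-𝟘 (exponent r))) (trans (cong (rot r′) Stp-𝟘) (Rot-𝟘 (exponent r′)))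
        third : Choice → Ω → ℚ
        third r′ w = mask (Stp (rot⁻ r′ w)) * (κ * (weight⁻ w * weight (Stp (rot⁻ r′ w))) * sq (g w))
        back : ∀ r r′ u → second r r′ u ≡ third r′ (τ r r′ u)
        back r r′ u = cong₂ (λ v w → mask v * (κ * (weight⁻ (τ r r′ u) * w) * sq (g (τ r r′ u)))) (sym middle)
          (trans (sym (weight-Rot (exponent r) u)) (cong weight (sym middle)))
          where
          middle : Stp (rot⁻ r′ (τ r r′ u)) ≡ rot r u
          middle = trans (cong Stp (Rot⁻-Rot (exponent r′) (Stp (rot r u)))) (Stp² (rot r u))
        each : ∀ w → w ≢ Ω.𝟘 → c * ∑ rs (λ r′ → third r′ w) ≤ sq κ * sq (g w)
        each w w≢𝟘 = begin
          c * ∑ rs (λ r′ → third r′ w)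
            ≡⟨ cong (c *_) (trans (∑-cong rs λ r′ → collect (mask (Stp (rot⁻ r′ w))) κ (weight⁻ w) (weight (Stp (rot⁻ r′ w))) (sq (g w)))
                 (∑-*ˡ rs (κ * weight⁻ w * sq (g w)) (λ r′ → mask (Stp (rot⁻ r′ w)) * weight (Stp (rot⁻ r′ w))))) ⟩
          c * (κ * weight⁻ w * sq (g w) * ∑ rs (λ r′ → mask (Stp (rot⁻ r′ w)) * weight (Stp (rot⁻ r′ w))))
            ≡⟨ *-exchange c (κ * weight⁻ w * sq (g w)) _ ⟩
          κ * weight⁻ w * sq (g w) * (c * ∑ rs (λ r′ → mask (Stp (rot⁻ r′ w)) * weight (Stp (rot⁻ r′ w))))
            ≤⟨ *-monoˡ (*-nonNeg (*-nonNeg 0≤κ (<⇒≤ (weight⁻-pos w))) (sq-nonNeg (g w))) (backward w w≢𝟘) ⟩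
          κ * weight⁻ w * sq (g w) * (κ * weight w)
            ≡⟨ cancel κ (weight⁻ w) (sq (g w)) (weight w) (weight-inverse w) ⟩
          sq κ * sq (g w) ∎
          where
          collect : ∀ m k v w s → m * (k * (v * w) * s) ≡ k * v * s * (m * w)
          collect = solve-∀ ring
          cancel : ∀ k w⁻ s w → w * w⁻ ≡ 1ℚ → k * w⁻ * s * (k * w) ≡ k * k * s
          cancel k w⁻ s w q = trans (lemma k w⁻ s w) (trans (cong (λ b → k * k * b * s) q) (cong (_* s) (*-identityʳ (k * k))))
            where
            lemma : ∀ k w⁻ s w → k * w⁻ * s * (k * w) ≡ k * k * (w * w⁻) * s
            lemma = solve-∀ ring

    -- Schur test: `2 H` is twice the inner product of `h` with `core g`. The weighted mean
    -- inequality splits it into a part of size at most `H` and a part of size at most `sq κ * Γ`.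
    core-bound : H ≤ sq κ * Γ
    core-bound = cancel-half (begin
      H + H
        ≡⟨ sym (∑-+ nonzeros (λ u → sq (h u)) (λ u → sq (h u))) ⟩
      ∑ nonzeros (λ u → sq (h u) + sq (h u))
        ≤⟨ ∑-nonzeros-mono (λ u u≢𝟘 → ≤-trans (expand u) (+-monoˡ-≤ (∑∑ (λ r r′ → second r r′ u)) (first-bound u u≢𝟘))) ⟩
      ∑ nonzeros (λ u → sq (h u) + ∑∑ (λ r r′ → second r r′ u))
        ≡⟨ ∑-+ nonzeros (λ u → sq (h u)) (λ u → ∑∑ (λ r r′ → second r r′ u)) ⟩
      H + ∑ nonzeros (λ u → ∑∑ (λ r r′ → second r r′ u))
        ≤⟨ +-monoʳ-≤ H second-bound ⟩
      H + sq κ * Γ ∎)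
      where
      open ℚ.≤-Reasoning
      cancel-half : ∀ {x y} → x + x ≤ x + y → x ≤ y
      cancel-half {x} {y} p = diff⇒≤ (subst (0ℚ ≤_) (lemma x y) (≤⇒diff p))
        where
        lemma : ∀ x y → x + y - (x + x) ≡ y - x
        lemma = solve-∀ ring

  -- The sign that the coefficient acquires under conjugation by a letter: the first factor stems
  -- from the phase at the top, the second from the translation at the bottom.
  signΩ : Letter → Ω → ℚ
  signΩ ((z , ξ) , r) (a , b) = S.χ (atTop n z) a * S.χ (mapS (turn⁻ (exponent r)) n (stepᵀ n b)) (atBot n ξ)

  moveΩ : Letter → Ω → Ω
  moveΩ (_ , r) v = rot r (Stp v)

  signΩ-sq : ∀ l v → sq (signΩ l v) ≡ 1ℚ
  signΩ-sq ((z , ξ) , r) (a , b) = trans (*-squares x y) (cong₂ _*_ (S.χ-sq (atTop n z) a) (S.χ-sq (mapS (turn⁻ (exponent r)) n (stepᵀ n b)) (atBot n ξ)))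
    where
    x = S.χ (atTop n z) a
    y = S.χ (mapS (turn⁻ (exponent r)) n (stepᵀ n b)) (atBot n ξ)

  moveΩ-invertible : ∀ l → Invertible (moveΩ l)
  moveΩ-invertible (_ , r) = (λ v → Stp (rot⁻ r v)) ,
    (λ v → trans (cong Stp (Rot⁻-Rot (exponent r) (Stp v))) (Stp² v)) ,
    (λ v → trans (cong (rot r) (Stp² (rot⁻ r v))) (Rot-Rot⁻ (exponent r) v))

  moveΩ-𝟘 : ∀ l → moveΩ l Ω.𝟘 ≡ Ω.𝟘
  moveΩ-𝟘 (_ , r) = trans (cong (rot r) Stp-𝟘) (Rot-𝟘 (exponent r))

  private module L = Group letterGroup

  -- The sums over `z` and `ξ` are complete character sums at one site each. A turn maps nonzero
  -- sites to nonzero sites, so the second indicator does not depend on `r` and leaves the sum over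
  -- `r`.
  average-mask : ∀ g v → letterAverage letterGroup signΩ moveΩ g v ≡ mask v * (c * ∑ rs (λ r → g (rot r (Stp v))))
  average-mask g (a , b) = begin
    L.isize * ∑ L.elems (λ l → signΩ l (a , b) * g (moveΩ l (a , b)))
      ≡⟨ cong₂ _*_ letterGroup-isize (∑-letters (λ l → signΩ l (a , b) * g (moveΩ l (a , b)))) ⟩
    k₀ * ∑ Site.elems (λ z → ∑ Site.elems (λ ξ → ∑ rs (λ r → signΩ ((z , ξ) , r) (a , b) * g (rot r v))))
      ≡⟨ cong (k₀ *_) (∑-cong Site.elems λ z → ∑-cong Site.elems λ ξ → ∑-cong rs λ r →
           trans (cong (_* g (rot r v)) (cong₂ _*_ (χ-atTop n z a) (χ-atBot n ξ (β r)))) (*-assoc (Site.χ z (top n a)) (Site.χ ξ (bot n (β r))) (g (rot r v)))) ⟩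
    k₀ * ∑ Site.elems (λ z → ∑ Site.elems (λ ξ → ∑ rs (λ r → Site.χ z (top n a) * (Site.χ ξ (bot n (β r)) * g (rot r v)))))
      ≡⟨ cong (k₀ *_) (∑-cong Site.elems λ z → trans (∑-swap Site.elems rs (λ ξ r → Site.χ z (top n a) * (Site.χ ξ (bot n (β r)) * g (rot r v))))
           (trans (∑-cong rs λ r → trans (∑-*ˡ Site.elems (Site.χ z (top n a)) (λ ξ → Site.χ ξ (bot n (β r)) * g (rot r v)))
             (cong (Site.χ z (top n a) *_) (∑-*ʳ Site.elems (g (rot r v)) (λ ξ → Site.χ ξ (bot n (β r))))))
             (∑-*ˡ rs (Site.χ z (top n a)) (λ r → X r * g (rot r v))))) ⟩
    k₀ * ∑ Site.elems (λ z → Site.χ z (top n a) * ∑ rs (λ r → X r * g (rot r v)))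
      ≡⟨ cong (k₀ *_) (∑-*ʳ Site.elems (∑ rs (λ r → X r * g (rot r v))) (λ z → Site.χ z (top n a))) ⟩
    Site.isize * Site.isize * c * (Z * ∑ rs (λ r → X r * g (rot r v)))
      ≡⟨ distribute Site.isize c Z (∑ rs (λ r → X r * g (rot r v))) ⟩
    Site.isize * Z * (c * (Site.isize * ∑ rs (λ r → X r * g (rot r v))))
      ≡⟨ cong₂ (λ s t → s * (c * t)) (δ-average (top n a)) (trans (sym (∑-*ˡ rs Site.isize (λ r → X r * g (rot r v))))
           (∑-cong rs λ r → trans (sym (*-assoc Site.isize (X r) (g (rot r v)))) (cong (_* g (rot r v)) (trans (δ-average (bot n (β r))) (δ-bot r))))) ⟩
    δ (top n a) * (c * ∑ rs (λ r → δ (bot n (stepᵀ n b)) * g (rot r v)))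
      ≡⟨ cong (λ t → δ (top n a) * (c * t)) (∑-*ˡ rs (δ (bot n (stepᵀ n b))) (λ r → g (rot r v))) ⟩
    δ (top n a) * (c * (δ (bot n (stepᵀ n b)) * ∑ rs (λ r → g (rot r v))))
      ≡⟨ regroup (δ (top n a)) c (δ (bot n (stepᵀ n b))) (∑ rs (λ r → g (rot r v))) ⟩
    mask (a , b) * (c * ∑ rs (λ r → g (rot r v))) ∎
    where
    open ≡-Reasoning
    k₀ : ℚ
    k₀ = Site.isize * Site.isize * c
    v = Stp (a , b)
    β : Choice → States n
    β r = mapS (turn⁻ (exponent r)) n (stepᵀ n b)
    X : Choice → ℚ
    X r = ∑ Site.elems (λ ξ → Site.χ ξ (bot n (β r)))
    Z : ℚ
    Z = ∑ Site.elems (λ z → Site.χ z (top n a))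
    distribute : ∀ i c Z T → i * i * c * (Z * T) ≡ i * Z * (c * (i * T))
    distribute = solve-∀ ring
    regroup : ∀ a c b t → a * (c * (b * t)) ≡ a * b * (c * t)
    regroup = solve-∀ ring
    isZ-bot : ∀ f → (∀ s → isZ (f s) ≡ isZ s) → ∀ n x → isZ (bot n (mapS f n x)) ≡ isZ (bot n x)
    isZ-bot f e zero x = refl
    isZ-bot f e (suc n) (s , x) = e s
    δ-bot : ∀ r → δ (bot n (β r)) ≡ δ (bot n (stepᵀ n b))
    δ-bot r = cong (if_then 1ℚ else 0ℚ) (isZ-bot (turn⁻ (exponent r)) (isZ-turn⁻ (exponent r)) n (stepᵀ n b))

  two-step-bound : ∀ g → ∑ nonzeros (λ v → sq (letterAverage letterGroup signΩ moveΩ (letterAverage letterGroup signΩ moveΩ g) v)) ≤ sq κ * ∑ nonzeros (λ v → sq (g v))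
  two-step-bound g = begin
    ∑ nonzeros (λ v → sq (letterAverage letterGroup signΩ moveΩ (letterAverage letterGroup signΩ moveΩ g) v))
      ≡⟨ ∑-cong nonzeros (λ v → cong sq (trans (average-mask (letterAverage letterGroup signΩ moveΩ g) v)
           (cong (λ t → mask v * (c * t)) (∑-cong rs λ r → average-mask g (rot r (Stp v)))))) ⟩
    ∑ nonzeros (λ v → sq (mask v * core g (Stp v)))
      ≤⟨ ∑-mono nonzeros (λ v → subst₂ _≤_ (sym (*-squares (mask v) (core g (Stp v)))) (*-identityˡ (sq (core g (Stp v)))) (*-monoʳ (sq-nonNeg (core g (Stp v))) (mask-sq v))) ⟩
    ∑ nonzeros (λ v → sq (core g (Stp v)))
      ≡⟨ ∑-nonzeros Stp (Stp , Stp² , Stp²) Stp-𝟘 (λ v → sq (core g v)) ⟩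
    ∑ nonzeros (λ v → sq (core g v))
      ≤⟨ core-bound g ⟩
    sq κ * ∑ nonzeros (λ v → sq (g v)) ∎
    where
    open ℚ.≤-Reasoning

  signΩ-isometry : ∀ l (f : Ω → ℚ) → ∑ nonzeros (λ v → sq (signΩ l v * f (moveΩ l v))) ≡ ∑ nonzeros (λ v → sq (f v))
  signΩ-isometry l f = begin
    ∑ nonzeros (λ v → sq (signΩ l v * f (moveΩ l v)))
      ≡⟨ ∑-cong nonzeros each ⟩
    ∑ nonzeros (λ v → sq (f (moveΩ l v)))
      ≡⟨ ∑-nonzeros (moveΩ l) (moveΩ-invertible l) (moveΩ-𝟘 l) (λ v → sq (f v)) ⟩
    ∑ nonzeros (λ v → sq (f v)) ∎
    where
    open ≡-Reasoning
    unit : ∀ a b → sq a ≡ 1ℚ → sq (a * b) ≡ sq b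
    unit a b e = trans (*-squares a b) (trans (cong (_* sq b) e) (*-identityˡ (sq b)))
      where
    each : ∀ v → sq (signΩ l v * f (moveΩ l v)) ≡ sq (f (moveΩ l v))
    each v = unit (signΩ l v) (f (moveΩ l v)) (signΩ-sq l v)

-- Parametrisation by bit strings

-- The Kraus index must range over plain bit strings, both for the degree and for the control
-- register; a parametrisation is recorded only through the sums it preserves.
Flat : ∀ {A} → Group A → Set
Flat {A} G = Σ (Pow Bit (Group.dim G) → A) λ to → ∀ f → ∑ (Group.elems (bits (Group.dim G))) (λ w → f (to w)) ≡ ∑ (Group.elems G) f

splitPow : ∀ {A : Set} m n → Pow A (m ℕ.+ n) → Pow A m × Pow A n
splitPow zero n w = tt , w
splitPow (suc m) n (b , w) = (b , proj₁ (splitPow m n w)) , proj₂ (splitPow m n w)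

∑-splitPow : ∀ m n f → ∑ (Group.elems (bits (m ℕ.+ n))) (λ w → f (splitPow m n w)) ≡
             ∑ (Group.elems (bits m)) (λ u → ∑ (Group.elems (bits n)) (λ v → f (u , v)))
∑-splitPow zero n f = sym (+-identityʳ _)
∑-splitPow (suc m) n f = begin
  ∑ (pairs B (Group.elems (bits (m ℕ.+ n)))) (λ w → f (splitPow (suc m) n w))
    ≡⟨ ∑-pairs B (Group.elems (bits (m ℕ.+ n))) (λ w → f (splitPow (suc m) n w)) ⟩
  ∑ B (λ b → ∑ (Group.elems (bits (m ℕ.+ n))) (λ w → f (splitPow (suc m) n (b , w))))
    ≡⟨ ∑-cong B (λ b → ∑-splitPow m n (λ (u , v) → f ((b , u) , v))) ⟩
  ∑ B (λ b → ∑ (Group.elems (bits m)) (λ u → ∑ (Group.elems (bits n)) (λ v → f ((b , u) , v))))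
    ≡⟨ ∑-pairs B (Group.elems (bits m)) (λ u → ∑ (Group.elems (bits n)) (λ v → f (u , v))) ⟨
  ∑ (pairs B (Group.elems (bits m))) (λ u → ∑ (Group.elems (bits n)) (λ v → f (u , v))) ∎
  where
  open ≡-Reasoning
  B = Group.elems bitGroup

flatBit : Flat bitGroup
flatBit = proj₁ , λ f → ∑-pairs (Group.elems bitGroup) (tt ∷ []) (λ w → f (proj₁ w)) ■ ∑-cong (Group.elems bitGroup) (λ b → +-identityʳ (f b))
  where
  _■_ : ∀ {a b c : ℚ} → a ≡ b → b ≡ c → a ≡ c
  _■_ = trans

flatUnit : Flat unitGroup
flatUnit = (λ w → w) , λ f → refl

flatPair : ∀ {A B} {G : Group A} {H : Group B} → Flat G → Flat H → Flat (pairGroup G H)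
flatPair {A} {B} {G} {H} (toG , sumG) (toH , sumH) = to , sum
  where
  m = Group.dim G
  n = Group.dim H
  both : Pow Bit m × Pow Bit n → A × B
  both (u , v) = toG u , toH v
  to : Pow Bit (m ℕ.+ n) → A × B
  to w = both (splitPow m n w)
  sum : ∀ f → ∑ (Group.elems (bits (m ℕ.+ n))) (λ w → f (to w)) ≡ ∑ (pairs (Group.elems G) (Group.elems H)) f
  sum f = trans (∑-splitPow m n (λ p → f (both p))) (trans
    (∑-cong (Group.elems (bits m)) λ u → sumH (λ b → f (toG u , b)))
    (trans (sumG (λ a → ∑ (Group.elems H) (λ b → f (a , b)))) (sym (∑-pairs (Group.elems G) (Group.elems H) f))))

flatPow : ∀ {A} {G : Group A} → Flat G → ∀ n → Flat (powGroup G n)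
flatPow F zero = flatUnit
flatPow {G = G} F (suc n) = flatPair {G = G} {H = powGroup G n} F (flatPow F n)

flatSite : Flat siteGroup
flatSite = flatPair {G = bitGroup} {H = bitGroup} flatBit flatBit

opaque
  unfolding letterGroup

  flatLetter : Flat letterGroup
  flatLetter = flatPair {G = pairGroup siteGroup siteGroup} {H = choiceGroup}
    (flatPair {G = siteGroup} {H = siteGroup} flatSite flatSite) (flatPow {G = bitGroup} flatBit 3)

toList : ∀ {A : Set} n → Pow A n → List A
toList zero x = []
toList (suc n) (a , x) = a ∷ toList n x

length-toList : ∀ {A : Set} n (x : Pow A n) → length (toList n x) ≡ n
length-toList zero x = refl
length-toList (suc n) (a , x) = cong suc (length-toList n x)

module WordAverages {A V : Set} (GA : Group A) (sg : A → V → ℚ) (mv : A → V → V) where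
  private module A = Group GA

  signsBy : List A → V → ℚ
  signsBy [] v = 1ℚ
  signsBy (l ∷ ls) v = sg l v * signsBy ls (mv l v)

  movesBy : List A → V → V
  movesBy [] v = v
  movesBy (l ∷ ls) v = movesBy ls (mv l v)

  signsBy-++ : ∀ ls ms v → signsBy (ls ++ ms) v ≡ signsBy ls v * signsBy ms (movesBy ls v)
  signsBy-++ [] ms v = sym (*-identityˡ (signsBy ms v))
  signsBy-++ (l ∷ ls) ms v = trans (cong (sg l v *_) (signsBy-++ ls ms (mv l v)))
    (sym (*-assoc (sg l v) (signsBy ls (mv l v)) (signsBy ms (movesBy ls (mv l v)))))

  movesBy-++ : ∀ ls ms v → movesBy (ls ++ ms) v ≡ movesBy ms (movesBy ls v)
  movesBy-++ [] ms v = refl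
  movesBy-++ (l ∷ ls) ms v = movesBy-++ ls ms (mv l v)

  word-isometry : ∀ (xs : List V) → (∀ l (g : V → ℚ) → ∑ xs (λ v → sq (sg l v * g (mv l v))) ≡ ∑ xs (λ v → sq (g v))) →
    ∀ ls (g : V → ℚ) → ∑ xs (λ v → sq (signsBy ls v * g (movesBy ls v))) ≡ ∑ xs (λ v → sq (g v))
  word-isometry xs e [] g = ∑-cong xs λ v → cong sq (*-identityˡ (g v))
  word-isometry xs e (l ∷ ls) g = trans (∑-cong xs λ v → cong sq (*-assoc (sg l v) (signsBy ls (mv l v)) (g (movesBy ls (mv l v)))))
    (trans (e l (λ v → signsBy ls v * g (movesBy ls v))) (word-isometry xs e ls g))

  averages : ∀ m → (V → ℚ) → V → ℚ
  averages m g v = Group.isize (powGroup GA m) * ∑ (Group.elems (powGroup GA m)) (λ w → signsBy (toList m w) v * g (movesBy (toList m w) v))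

  averages-zero : ∀ g v → averages 0 g v ≡ g v
  averages-zero g v = lemma (g v)
    where
    lemma : ∀ x → 1ℚ * (1ℚ * x + 0ℚ) ≡ x
    lemma = solve-∀ ring

  averages-suc : ∀ m g v → averages (suc m) g v ≡ letterAverage GA sg mv (averages m g) v
  averages-suc m g v = begin
    ½ ^ (A.dim ℕ.+ P.dim) * ∑ (pairs A.elems P.elems) (λ w → signsBy (toList (suc m) w) v * g (movesBy (toList (suc m) w) v))
      ≡⟨ cong₂ _*_ (^-+ ½ A.dim P.dim) (∑-pairs A.elems P.elems (λ w → signsBy (toList (suc m) w) v * g (movesBy (toList (suc m) w) v))) ⟩
    i * j * ∑ A.elems (λ l → ∑ P.elems (λ w → sg l v * signsBy (toList m w) (mv l v) * g (movesBy (toList m w) (mv l v))))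
      ≡⟨ cong (i * j *_) (∑-cong A.elems λ l → trans (∑-cong P.elems λ w → *-assoc (sg l v) (signsBy (toList m w) (mv l v)) (g (movesBy (toList m w) (mv l v))))
           (∑-*ˡ P.elems (sg l v) (λ w → signsBy (toList m w) (mv l v) * g (movesBy (toList m w) (mv l v))))) ⟩
    i * j * ∑ A.elems (λ l → sg l v * S l)
      ≡⟨ trans (*-assoc i j (∑ A.elems (λ l → sg l v * S l))) (cong (i *_) (trans (sym (∑-*ˡ A.elems j (λ l → sg l v * S l))) (∑-cong A.elems λ l → *-exchange j (sg l v) (S l)))) ⟩
    i * ∑ A.elems (λ l → sg l v * (j * S l)) ∎
    where
    open ≡-Reasoning
    module P = Group (powGroup GA m)
    i = A.isize
    j = P.isize
    S : A → ℚ
    S l = ∑ P.elems (λ w → signsBy (toList m w) (mv l v) * g (movesBy (toList m w) (mv l v)))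

  letterAverage-cong : ∀ {f g : V → ℚ} → (∀ v → f v ≡ g v) → ∀ v → letterAverage GA sg mv f v ≡ letterAverage GA sg mv g v
  letterAverage-cong e v = cong (A.isize *_) (∑-cong A.elems λ l → cong (sg l v *_) (e (mv l v)))

  module _ (xs : List V) (c : ℚ)
    (two-letters : ∀ g → ∑ xs (λ v → sq (letterAverage GA sg mv (letterAverage GA sg mv g) v)) ≤ sq c * ∑ xs (λ v → sq (g v))) where

    -- Letters are consumed in pairs, because the contraction is available for two letters; hence
    -- the words of length `m * 2`.
    averages-bound : ∀ m g → ∑ xs (λ v → sq (averages (m ℕ.* 2) g v)) ≤ sq (c ^ m) * ∑ xs (λ v → sq (g v))
    averages-bound zero g = ≤-reflexive (trans (∑-cong xs λ v → cong sq (averages-zero g v)) (sym (*-identityˡ (∑ xs (λ v → sq (g v))))))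
    averages-bound (suc m) g = begin
      ∑ xs (λ v → sq (averages (suc (suc (m ℕ.* 2))) g v))
        ≡⟨ ∑-cong xs (λ v → cong sq (trans (averages-suc (suc (m ℕ.* 2)) g v) (letterAverage-cong (averages-suc (m ℕ.* 2) g) v))) ⟩
      ∑ xs (λ v → sq (letterAverage GA sg mv (letterAverage GA sg mv (averages (m ℕ.* 2) g)) v))
        ≤⟨ two-letters (averages (m ℕ.* 2) g) ⟩
      sq c * ∑ xs (λ v → sq (averages (m ℕ.* 2) g v))
        ≤⟨ *-monoˡ (sq-nonNeg c) (averages-bound m g) ⟩
      sq c * (sq (c ^ m) * ∑ xs (λ v → sq (g v)))
        ≡⟨ *-squares-assoc c (c ^ m) (∑ xs (λ v → sq (g v))) ⟩
      sq (c ^ suc m) * ∑ xs (λ v → sq (g v)) ∎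
      where
      open ℚ.≤-Reasoning

-- The action of words on states and on matrices

module _ (n : ℕ) where
  open State n

  move : Letter → States n → States n
  move ((z , ξ) , r) x = mapS (turn (exponent r)) n (step n x) ⊕ atBot n ξ

  move⁻ : Letter → States n → States n
  move⁻ ((z , ξ) , r) x = step n (mapS (turn⁻ (exponent r)) n (x ⊕ atBot n ξ))

  move⁻-move : ∀ l x → move⁻ l (move l x) ≡ x
  move⁻-move ((z , ξ) , r) x = trans (cong (λ y → step n (mapS (turn⁻ (exponent r)) n y)) (⊕-cancel (mapS (turn (exponent r)) n (step n x)) (atBot n ξ)))
    (trans (cong (step n) (mapS-inverse (turn⁻-turn (exponent r)) n (step n x))) (carry² 0b n x))

  move-move⁻ : ∀ l x → move l (move⁻ l x) ≡ x
  move-move⁻ ((z , ξ) , r) x = trans (cong (λ y → mapS (turn (exponent r)) n y ⊕ atBot n ξ) (carry² 0b n (mapS (turn⁻ (exponent r)) n (x ⊕ atBot n ξ))))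
    (trans (cong (_⊕ atBot n ξ) (mapS-inverse (turn-turn⁻ (exponent r)) n (x ⊕ atBot n ξ))) (⊕-cancel x (atBot n ξ)))

  phase : Letter → States n → ℚ
  phase ((z , ξ) , r) x = χ (atTop n z) x

  moves : List Letter → States n → States n
  moves [] x = x
  moves (l ∷ ls) x = moves ls (move l x)

  moves⁻ : List Letter → States n → States n
  moves⁻ [] x = x
  moves⁻ (l ∷ ls) x = move⁻ l (moves⁻ ls x)

  moves⁻-moves : ∀ ls x → moves⁻ ls (moves ls x) ≡ x
  moves⁻-moves [] x = refl
  moves⁻-moves (l ∷ ls) x = trans (cong (move⁻ l) (moves⁻-moves ls (move l x))) (move⁻-move l x)

  moves-moves⁻ : ∀ ls x → moves ls (moves⁻ ls x) ≡ x
  moves-moves⁻ [] x = refl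
  moves-moves⁻ (l ∷ ls) x = trans (cong (moves ls) (move-move⁻ l (moves⁻ ls x))) (moves-moves⁻ ls x)

  phases : List Letter → States n → ℚ
  phases [] x = 1ℚ
  phases (l ∷ ls) x = phase l x * phases ls (move l x)

  phases-sq : ∀ ls x → sq (phases ls x) ≡ 1ℚ
  phases-sq [] x = refl
  phases-sq (l@((z , _) , _) ∷ ls) x = trans (*-squares (phase l x) (phases ls (move l x))) (cong₂ _*_ (χ-sq (atTop n z) x) (phases-sq ls (move l x)))
    where

  Matrix : Set
  Matrix = States n → States n → ℚ

  conjugate : List Letter → Matrix → Matrix
  conjugate ls ρ x y = phases ls x * phases ls y * ρ (moves ls x) (moves ls y)

  open WordAverages letterGroup (signΩ n) (moveΩ n) public using () renaming (signsBy to signs; movesBy to movesΩ)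

  -- Unnormalised Pauli coefficients: the Fourier transform along each generalised diagonal of `ρ`.
  coefficients : Matrix → Ω n → ℚ
  coefficients ρ (a , b) = hat (λ x → ρ x (x ⊕ a)) b

  coefficients-cong : ∀ {ρ τ} → (∀ x y → ρ x y ≡ τ x y) → ∀ v → coefficients ρ v ≡ coefficients τ v
  coefficients-cong e (a , b) = ∑-cong elems λ x → cong (χ b x *_) (e x (x ⊕ a))

  -- A letter is an affine permutation together with a character. On the diagonal of offset `a` the
  -- two phases combine to a constant; the linear part moves the offset by itself and the character
  -- by its inverse transpose, and the translation contributes another sign.
  coefficients-letter : ∀ l ρ v → coefficients (λ x y → phase l x * phase l y * ρ (move l x) (move l y)) v ≡ signΩ n l v * coefficients ρ (moveΩ n l v)
  coefficients-letter l@((z , ξ) , r) ρ (a , b) = begin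
    ∑ elems (λ x → χ b x * (phase l x * phase l (x ⊕ a) * ρ (move l x) (move l (x ⊕ a))))
      ≡⟨ ∑-cong elems (λ x → cong₂ (λ s y → χ b x * (s * ρ (move l x) y)) (signs-cancel x) (move-⊕ x)) ⟩
    ∑ elems (λ x → χ b x * (χ t a * ρ (move l x) (move l x ⊕ a′)))
      ≡⟨ ∑-cong elems (λ x → trans (cong (_* (χ t a * ρ (move l x) (move l x ⊕ a′))) (dual x)) (regroup (χ b′ (atBot n ξ)) (χ b′ (move l x)) (χ t a) (ρ (move l x) (move l x ⊕ a′)))) ⟩
    ∑ elems (λ x → χ t a * χ b′ (atBot n ξ) * (χ b′ (move l x) * ρ (move l x) (move l x ⊕ a′)))
      ≡⟨ ∑-*ˡ elems (χ t a * χ b′ (atBot n ξ)) (λ x → χ b′ (move l x) * ρ (move l x) (move l x ⊕ a′)) ⟩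
    χ t a * χ b′ (atBot n ξ) * ∑ elems (λ x → χ b′ (move l x) * ρ (move l x) (move l x ⊕ a′))
      ≡⟨ cong (χ t a * χ b′ (atBot n ξ) *_) (reindex finite finite (move l) (move⁻ l) (move⁻-move l) (move-move⁻ l) (λ x → χ b′ x * ρ x (x ⊕ a′))) ⟩
    signΩ n l (a , b) * coefficients ρ (a′ , b′) ∎
    where
    open ≡-Reasoning
    e = exponent r
    t = atTop n z
    a′ = mapS (turn e) n (step n a)
    b′ = mapS (turn⁻ e) n (stepᵀ n b)
    signs-cancel : ∀ x → phase l x * phase l (x ⊕ a) ≡ χ t a
    signs-cancel x = trans (cong (χ t x *_) (χ-⊕ t x a)) (trans (sym (*-assoc (χ t x) (χ t x) (χ t a))) (trans (cong (_* χ t a) (χ-sq t x)) (*-identityˡ (χ t a))))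
    move-⊕ : ∀ x → move l (x ⊕ a) ≡ move l x ⊕ a′
    move-⊕ x = begin
      mapS (turn e) n (step n (x ⊕ a)) ⊕ atBot n ξ
        ≡⟨ cong (λ y → mapS (turn e) n y ⊕ atBot n ξ) (carry-⊕ 0b 0b n x a) ⟩
      mapS (turn e) n (step n x ⊕ step n a) ⊕ atBot n ξ
        ≡⟨ cong (_⊕ atBot n ξ) (mapS-⊕ (turn-⊕ e) n (step n x) (step n a)) ⟩
      mapS (turn e) n (step n x) ⊕ a′ ⊕ atBot n ξ
        ≡⟨ trans (⊕-assoc u a′ (atBot n ξ)) (trans (cong (u ⊕_) (⊕-comm a′ (atBot n ξ))) (sym (⊕-assoc u (atBot n ξ) a′))) ⟩
      mapS (turn e) n (step n x) ⊕ atBot n ξ ⊕ a′ ∎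
      where u = mapS (turn e) n (step n x)
    back : ∀ x → mapS (turn⁻ e) n (move l x ⊕ atBot n ξ) ≡ step n x
    back x = trans (cong (mapS (turn⁻ e) n) (⊕-cancel (mapS (turn e) n (step n x)) (atBot n ξ))) (mapS-inverse (turn⁻-turn e) n (step n x))
    dual : ∀ x → χ b x ≡ χ b′ (atBot n ξ) * χ b′ (move l x)
    dual x = begin
      χ b x ≡⟨ cong (χ b) (carry² 0b n x) ⟨
      χ b (step n (step n x)) ≡⟨ step-χ n b (step n x) ⟩
      χ (stepᵀ n b) (step n x) ≡⟨ cong (χ (stepᵀ n b)) (back x) ⟨
      χ (stepᵀ n b) (mapS (turn⁻ e) n (move l x ⊕ atBot n ξ)) ≡⟨ mapS-χ (turn⁻-χ e) n (stepᵀ n b) (move l x ⊕ atBot n ξ) ⟩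
      χ b′ (move l x ⊕ atBot n ξ) ≡⟨ trans (χ-⊕ b′ (move l x) (atBot n ξ)) (*-comm (χ b′ (move l x)) (χ b′ (atBot n ξ))) ⟩
      χ b′ (atBot n ξ) * χ b′ (move l x) ∎
    regroup : ∀ p q s ρ → p * q * (s * ρ) ≡ s * p * (q * ρ)
    regroup = solve-∀ ring

  coefficients-word : ∀ ls ρ v → coefficients (conjugate ls ρ) v ≡ signs ls v * coefficients ρ (movesΩ ls v)
  coefficients-word [] ρ v = trans (coefficients-cong {conjugate [] ρ} {ρ} (λ x y → one (ρ x y)) v) (sym (*-identityˡ (coefficients ρ v)))
    where
    one : ∀ r → 1ℚ * 1ℚ * r ≡ r
    one = solve-∀ ring
  coefficients-word (l ∷ ls) ρ v = begin
    coefficients (conjugate (l ∷ ls) ρ) v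
      ≡⟨ coefficients-cong {conjugate (l ∷ ls) ρ} {λ x y → phase l x * phase l y * conjugate ls ρ (move l x) (move l y)}
           (λ x y → regroup (phase l x) (phases ls (move l x)) (phase l y) (phases ls (move l y)) (ρ (moves ls (move l x)) (moves ls (move l y)))) v ⟩
    coefficients (λ x y → phase l x * phase l y * conjugate ls ρ (move l x) (move l y)) v
      ≡⟨ coefficients-letter l (conjugate ls ρ) v ⟩
    signΩ n l v * coefficients (conjugate ls ρ) (moveΩ n l v)
      ≡⟨ cong (signΩ n l v *_) (coefficients-word ls ρ (moveΩ n l v)) ⟩
    signΩ n l v * (signs ls (moveΩ n l v) * coefficients ρ (movesΩ ls (moveΩ n l v)))
      ≡⟨ *-assoc (signΩ n l v) (signs ls (moveΩ n l v)) (coefficients ρ (movesΩ ls (moveΩ n l v))) ⟨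
    signs (l ∷ ls) v * coefficients ρ (movesΩ (l ∷ ls) v) ∎
    where
    open ≡-Reasoning
    regroup : ∀ a b c d r → a * b * (c * d) * r ≡ a * c * (b * d * r)
    regroup = solve-∀ ring

  entries : Matrix → ℚ
  entries ρ = ∑ elems (λ x → ∑ elems (λ y → sq (ρ x y)))

  trace : Matrix → ℚ
  trace ρ = ∑ elems (λ x → ρ x x)

  coefficients-parseval : ∀ ρ → ∑ (Group.elems (ΩGroup n)) (λ v → sq (coefficients ρ v)) ≡ size * entries ρ
  coefficients-parseval ρ = begin
    ∑ (pairs elems elems) (λ v → sq (coefficients ρ v))
      ≡⟨ ∑-pairs elems elems (λ v → sq (coefficients ρ v)) ⟩
    ∑ elems (λ a → ∑ elems (λ b → sq (hat (λ x → ρ x (x ⊕ a)) b)))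
      ≡⟨ ∑-cong elems (λ a → parseval (λ x → ρ x (x ⊕ a))) ⟩
    ∑ elems (λ a → size * ∑ elems (λ x → sq (ρ x (x ⊕ a))))
      ≡⟨ ∑-*ˡ elems size (λ a → ∑ elems (λ x → sq (ρ x (x ⊕ a)))) ⟩
    size * ∑ elems (λ a → ∑ elems (λ x → sq (ρ x (x ⊕ a))))
      ≡⟨ cong (size *_) (∑-swap elems elems (λ a x → sq (ρ x (x ⊕ a)))) ⟩
    size * ∑ elems (λ x → ∑ elems (λ a → sq (ρ x (x ⊕ a))))
      ≡⟨ cong (size *_) (∑-cong elems λ x → trans (∑-cong elems λ a → cong (λ y → sq (ρ x y)) (⊕-comm x a)) (∑-shift x (λ y → sq (ρ x y)))) ⟩
    size * entries ρ ∎
    where open ≡-Reasoning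

  coefficients-𝟘 : ∀ ρ → coefficients ρ (𝟘 , 𝟘) ≡ trace ρ
  coefficients-𝟘 ρ = ∑-cong elems λ x → trans (cong (_* ρ x (x ⊕ 𝟘)) (χ-𝟘ˡ x)) (trans (*-identityˡ (ρ x (x ⊕ 𝟘))) (cong (ρ x) (⊕-idʳ x)))

  signΩ-𝟘 : ∀ l → signΩ n l (𝟘 , 𝟘) ≡ 1ℚ
  signΩ-𝟘 l@((z , ξ) , r) = cong₂ _*_ (χ-𝟘 (atTop n z)) (trans (cong (λ b → χ b (atBot n ξ)) (cong proj₂ (moveΩ-𝟘 n l))) (χ-𝟘ˡ (atBot n ξ)))

  word-𝟘 : ∀ ls → signs ls (𝟘 , 𝟘) ≡ 1ℚ × movesΩ ls (𝟘 , 𝟘) ≡ (𝟘 , 𝟘)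
  word-𝟘 [] = refl , refl
  word-𝟘 (l ∷ ls) = trans (cong₂ _*_ (signΩ-𝟘 l) (cong (signs ls) (moveΩ-𝟘 n l))) (trans (*-identityˡ (signs ls (𝟘 , 𝟘))) (proj₁ (word-𝟘 ls))) ,
    trans (cong (movesΩ ls) (moveΩ-𝟘 n l)) (proj₂ (word-𝟘 ls))

-- Words read along the walk

module Blocks {K : Set} (GK : Group K) where
  private module K = Group GK

  block : ∀ {s} → Fin s → Pow K s → K
  block zero (k , _) = k
  block (suc a) (_ , y) = block a y

  insert : ∀ {s} → Fin s → K → Pow K s
  insert {suc s} zero k = k , Group.𝟘 (powGroup GK s)
  insert {suc s} (suc a) k = K.𝟘 , insert a k

  block-insert : ∀ {s} (a : Fin s) y k → block a (Group._⊕_ (powGroup GK s) y (insert a k)) ≡ block a y K.⊕ k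
  block-insert zero y k = refl
  block-insert (suc a) (_ , y) k = block-insert a y k

  block-other : ∀ {s} {a b : Fin s} y k → a ≢ b → block b (Group._⊕_ (powGroup GK s) y (insert a k)) ≡ block b y
  block-other {suc s} {zero} {zero} y k a≢b = contradiction refl a≢b
  block-other {suc s} {zero} {suc b} (_ , y) k a≢b = cong (block b) (Group.⊕-idʳ (powGroup GK s) y)
  block-other {suc s} {suc a} {zero} (x , _) k a≢b = K.⊕-idʳ x
  block-other {suc s} {suc a} {suc b} (_ , y) k a≢b = block-other y k λ e → a≢b (cong suc e)

-- `2 ^ (2 k)` is the number of generators, `m` the number of letter pairs in a block, `s` the
-- number of blocks and `t` the number of rounds. A word is determined by the start of the walk and
-- the generators used.
module Amplified {A : Set} (GA : Group A) (flatA : Flat GA) (k m s t : ℕ) where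
  private
    GK : Group (Pow A (m ℕ.* 2))
    GK = powGroup GA (m ℕ.* 2)
    G = Pow (Pow A (m ℕ.* 2)) s
    Ix = Pow Bit (2 ℕ.* k)
    GG : Group G
    GG = powGroup GK s
    GI : Group Ix
    GI = bits (2 ℕ.* k)
    module G = Group GG
    module I = Group GI
    open Blocks GK

    letters : Pow A (m ℕ.* 2) → List A
    letters = toList (m ℕ.* 2)

  bias-rate : ℚ
  bias-rate = ι (2 ℕ.+ G.dim) * ½ ^ k

  bias-rate-pos : 0ℚ < bias-rate
  bias-rate-pos = *-pos (<-≤-trans 0<1 (subst (_≤ ι (2 ℕ.+ G.dim)) (+-identityʳ 1ℚ) (+-monoʳ-≤ 1ℚ (ι-nonNeg (suc G.dim))))) (½^-pos k)

  open Rates bias-rate bias-rate-pos public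

  private
    step-of : Ix → G
    step-of = proj₁ (small-bias k GG)

    -- `T` is the number of generators in `w`. It equals the length of the list of blocks in every
    -- use, so the second clause is a default.
    spell : List (Fin s) → ∀ T → G → Pow Ix T → List A
    spell [] T y w = []
    spell (a ∷ as) zero y w = []
    spell (a ∷ as) (suc T) y (i , w) = letters (block a y) ++ spell as T (y G.⊕ step-of i) w

    length-spell : ∀ as y w → length (spell as (length as) y w) ≡ length as ℕ.* (m ℕ.* 2)
    length-spell [] y w = refl
    length-spell (a ∷ as) y (i , w) = trans (List.length-++ (letters (block a y)))
      (cong₂ ℕ._+_ (length-toList (m ℕ.* 2) (block a y)) (length-spell as (y G.⊕ step-of i) w))

    ws : List (Fin s)
    ws = concat (replicate t (allFin s))

    T : ℕ
    T = length ws

    IT : Group (Pow Ix T)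
    IT = powGroup GI T

    WG : Group (G × Pow Ix T)
    WG = pairGroup GG IT

    bits-dim : ∀ n → Group.dim (bits n) ≡ n
    bits-dim n = trans (powDim bitGroup n) (ℕ.*-identityʳ n)

    invd-inv : ½ ^ (2 ℕ.* k) * ∑ I.elems (λ _ → 1ℚ) ≡ 1ℚ
    invd-inv = trans (cong₂ (λ d u → ½ ^ d * u) (sym (bits-dim (2 ℕ.* k))) I.card) I.size-inv

  width wordLength : ℕ
  width = Group.dim WG
  wordLength = T ℕ.* (m ℕ.* 2)

  dim-eq : G.dim ≡ s ℕ.* (m ℕ.* 2 ℕ.* Group.dim GA)
  dim-eq = trans (powDim GK s) (cong (s ℕ.*_) (powDim GA (m ℕ.* 2)))

  width-eq : width ≡ s ℕ.* (m ℕ.* 2 ℕ.* Group.dim GA) ℕ.+ (t ℕ.* s) ℕ.* (2 ℕ.* k)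
  width-eq = cong₂ ℕ._+_ dim-eq (trans (powDim GI T) (cong₂ ℕ._*_ (length-walk t) (bits-dim (2 ℕ.* k))))
    where
    length-walk : ∀ t → length (concat (replicate t (allFin s))) ≡ t ℕ.* s
    length-walk zero = refl
    length-walk (suc t) = trans (List.length-++ (allFin s)) (cong₂ ℕ._+_ (List.length-tabulate (λ i → i)) (length-walk t))

  private
    flat : Flat WG
    flat = flatPair {G = GG} {H = IT} (flatPow {G = GK} (flatPow {G = GA} flatA (m ℕ.* 2)) s)
      (flatPow {G = GI} (flatPow {G = bitGroup} flatBit (2 ℕ.* k)) T)

    wordOf : G × Pow Ix T → List A
    wordOf (y , w) = spell ws T y w

  word : Pow Bit width → List A
  word w = wordOf (proj₁ flat w)

  length-word : ∀ w → length (word w) ≡ wordLength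
  length-word w = length-spell ws (proj₁ (proj₁ flat w)) (proj₂ (proj₁ flat w))

  module _ {V : Set} (sg : A → V → ℚ) (mv : A → V → V) where
    private
      module WA = WordAverages GA sg mv
      open WA

    wordAverage : (V → ℚ) → V → ℚ
    wordAverage g v = ½ ^ width * ∑ (Group.elems (bits width)) (λ w → signsBy (word w) v * g (movesBy (word w) v))

    module _ (xs : List V)
      (isometry : ∀ l (g : V → ℚ) → ∑ xs (λ v → sq (sg l v * g (mv l v))) ≡ ∑ xs (λ v → sq (g v)))
      (c : ℚ) (0≤c : 0ℚ ≤ c) (c-small : c ^ m ≤ bias-rate)
      (two-letters : ∀ g → ∑ xs (λ v → sq (letterAverage GA sg mv (letterAverage GA sg mv g) v)) ≤ sq c * ∑ xs (λ v → sq (g v)))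
      where

      private
        block-isometry : ∀ b (v : V → ℚ) → ∑ xs (λ x → sq (signsBy (letters b) x * v (movesBy (letters b) x))) ≡ ∑ xs (λ x → sq (v x))
        block-isometry b v = word-isometry xs isometry (letters b) v

        block-contraction : ∀ (v : V → ℚ) → ∑ xs (λ x → sq (averages (m ℕ.* 2) v x)) ≤ sq bias-rate * ∑ xs (λ x → sq (v x))
        block-contraction v = ≤-trans (averages-bound xs c two-letters m v)
          (*-monoʳ (∑-nonNeg xs (λ x → sq-nonNeg (v x))) (*-mono (^-nonNeg m 0≤c) (<⇒≤ bias-rate-pos) c-small c-small))

        module W = Walk {C = Fin s} GK GG block insert block-insert block-other I.elems step-of (½ ^ (2 ℕ.* k)) invd-inv
          bias-rate bias-rate-pos (proj₂ (small-bias k GG))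
          xs (λ b → signsBy (letters b)) (λ b → movesBy (letters b)) block-isometry block-contraction

        -- Unfolds the product of operators into an average over all walks from `y`, with signs and
        -- moves composed along the word that the walk spells.
        walk-words : ∀ as g y v → W.R as (λ _ → g) y v ≡
          Group.isize (powGroup GI (length as)) * ∑ (Group.elems (powGroup GI (length as))) (λ w → signsBy (spell as (length as) y w) v * g (movesBy (spell as (length as) y w) v))
        walk-words [] g y v = sym (averages-zero g v)
        walk-words (a ∷ as) g y v = begin
          sg₁ * (½ ^ (2 ℕ.* k) * ∑ I.elems (λ i → W.R as (λ _ → g) (y G.⊕ step-of i) v′))
            ≡⟨ cong (λ z → sg₁ * (½ ^ (2 ℕ.* k) * z)) (∑-cong I.elems λ i → walk-words as g (y G.⊕ step-of i) v′) ⟩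
          sg₁ * (½ ^ (2 ℕ.* k) * ∑ I.elems (λ i → j * S i))
            ≡⟨ cong (λ z → sg₁ * (½ ^ (2 ℕ.* k) * z)) (∑-*ˡ I.elems j S) ⟩
          sg₁ * (½ ^ (2 ℕ.* k) * (j * ∑ I.elems S))
            ≡⟨ shuffle sg₁ (½ ^ (2 ℕ.* k)) j (∑ I.elems S) ⟩
          ½ ^ (2 ℕ.* k) * j * (sg₁ * ∑ I.elems S)
            ≡⟨ cong₂ _*_ (trans (cong (λ d → ½ ^ d * j) (sym (bits-dim (2 ℕ.* k)))) (sym (^-+ ½ I.dim P.dim)))
                 (trans (sym (∑-*ˡ I.elems sg₁ S)) (∑-cong I.elems λ i → trans (sym (∑-*ˡ P.elems sg₁ (F i))) (∑-cong P.elems λ w → joined i w))) ⟩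
          ½ ^ (I.dim ℕ.+ P.dim) * ∑ I.elems (λ i → ∑ P.elems (λ w → F′ (i , w)))
            ≡⟨ cong (½ ^ (I.dim ℕ.+ P.dim) *_) (sym (∑-pairs I.elems P.elems F′)) ⟩
          ½ ^ (I.dim ℕ.+ P.dim) * ∑ (pairs I.elems P.elems) F′ ∎
          where
          open ≡-Reasoning
          front : List A
          front = letters (block a y)
          sg₁ : ℚ
          sg₁ = signsBy front v
          v′ : V
          v′ = movesBy front v
          module P = Group (powGroup GI (length as))
          j : ℚ
          j = P.isize
          rest : Ix → Pow Ix (length as) → List A
          rest i w = spell as (length as) (y G.⊕ step-of i) w
          F : Ix → Pow Ix (length as) → ℚ
          F i w = signsBy (rest i w) v′ * g (movesBy (rest i w) v′)
          F′ : Ix × Pow Ix (length as) → ℚ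
          F′ w = signsBy (spell (a ∷ as) (suc (length as)) y w) v * g (movesBy (spell (a ∷ as) (suc (length as)) y w) v)
          S : Ix → ℚ
          S i = ∑ P.elems (F i)
          joined : ∀ i w → sg₁ * F i w ≡ F′ (i , w)
          joined i w = trans (sym (*-assoc sg₁ (signsBy (rest i w) v′) (g (movesBy (rest i w) v′))))
            (cong₂ _*_ (sym (signsBy-++ front (rest i w) v)) (cong g (sym (movesBy-++ front (rest i w) v))))
          shuffle : ∀ a b c d → a * (b * (c * d)) ≡ b * c * (a * d)
          shuffle = solve-∀ ring

        average-words : ∀ g v → G.isize * ∑ G.elems (λ y → W.R ws (λ _ → g) y v) ≡ wordAverage g v
        average-words g v = begin
          G.isize * ∑ G.elems (λ y → W.R ws (λ _ → g) y v)
            ≡⟨ cong (G.isize *_) (trans (∑-cong G.elems λ y → walk-words ws g y v) (∑-*ˡ G.elems P.isize (λ y → ∑ P.elems (λ w → F (y , w))))) ⟩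
          G.isize * (P.isize * ∑ G.elems (λ y → ∑ P.elems (λ w → F (y , w))))
            ≡⟨ *-assoc G.isize P.isize (∑ G.elems (λ y → ∑ P.elems (λ w → F (y , w)))) ⟨
          G.isize * P.isize * ∑ G.elems (λ y → ∑ P.elems (λ w → F (y , w)))
            ≡⟨ cong₂ _*_ (sym (^-+ ½ G.dim P.dim)) (trans (sym (∑-pairs G.elems P.elems F)) (sym (proj₂ flat F))) ⟩
          ½ ^ width * ∑ (Group.elems (bits width)) (λ w → F (proj₁ flat w)) ∎
          where
          open ≡-Reasoning
          module P = Group IT
          F : G × Pow Ix T → ℚ
          F w = signsBy (wordOf w) v * g (movesBy (wordOf w) v)

      wordAverage-bound : ∀ (g : V → ℚ) → ∑ xs (λ v → sq (wordAverage g v)) ≤ sq (r s ^ t) * ∑ xs (λ v → sq (g v))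
      wordAverage-bound g = subst₂ _≤_ (∑-cong xs λ v → cong sq (average-words g v))
        (cong (λ l → sq (r l ^ t) * ∑ xs (λ v → sq (g v))) (List.length-tabulate {n = s} (λ i → i)))
        (W.walk-bound (allFin s) (allFin⁺ s) t g)

-- The trace term is there because a complex matrix of trace zero has rational approximations whose
-- traces only tend to zero. The contraction is uniform in the number of sites.
record WordSystem (ν : ℚ) (h L : ℕ) : Set where
  field
    word : Pow Bit h → List Letter
    word-length : ∀ w → length (word w) ≡ L
    contraction : ∀ n (ρ : Matrix n) →
      entries n (λ x y → ½ ^ h * ∑ (Group.elems (bits h)) (λ w → conjugate n (word w) ρ x y)) ≤ sq ν * entries n ρ + sq (trace n ρ)

module _ (k m s t : ℕ) where
  open Amplified letterGroup flatLetter k m s t using (width; wordLength; word; length-word; bias-rate; r; wordAverage; wordAverage-bound)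

  -- Parseval turns the claim into one about coefficients. The one at `𝟘` is the trace and is fixed
  -- by all words; the others are contracted by the walk.
  amplified : κ ^ m ≤ bias-rate → WordSystem (r s ^ t) width wordLength
  amplified κ-small = record { word = word ; word-length = length-word ; contraction = bound }
    where
    ws : List (Pow Bit width)
    ws = Group.elems (bits width)
    c : ℚ
    c = sq (r s ^ t)
    bound : ∀ n (ρ : Matrix n) → entries n (λ x y → ½ ^ width * ∑ ws (λ w → conjugate n (word w) ρ x y)) ≤ c * entries n ρ + sq (trace n ρ)
    bound n ρ = cancelˡ S.size-pos (begin
      S.size * entries n Φρ
        ≡⟨ coefficients-parseval n Φρ ⟨
      ∑ Ω.elems (λ v → sq (coefficients n Φρ v))
        ≡⟨ ∑-cong Ω.elems (λ v → cong sq (transformed v)) ⟩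
      ∑ Ω.elems (λ v → sq (avg v))
        ≡⟨ ∑-split (λ v → sq (avg v)) ⟩
      sq (avg Ω.𝟘) + ∑ nonzeros (λ v → sq (avg v))
        ≤⟨ +-monoʳ-≤ (sq (avg Ω.𝟘)) (wordAverage-bound (signΩ n) (moveΩ n) nonzeros (signΩ-isometry n) κ (≤ᵇ⇒≤ _) κ-small (two-step-bound n) g) ⟩
      sq (avg Ω.𝟘) + c * ∑ nonzeros (λ v → sq (g v))
        ≤⟨ +-monoʳ-≤ (sq (avg Ω.𝟘)) (*-monoˡ (sq-nonNeg (r s ^ t)) rest≤all) ⟩
      sq (avg Ω.𝟘) + c * ∑ Ω.elems (λ v → sq (g v))
        ≡⟨ cong₂ (λ p q → sq p + c * q) at-𝟘 (coefficients-parseval n ρ) ⟩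
      sq (trace n ρ) + c * (S.size * entries n ρ)
        -- The trace term is enlarged by the factor `size`; this is affordable since the trace will
        -- tend to zero.
        ≤⟨ +-monoˡ-≤ (c * (S.size * entries n ρ)) (subst (_≤ S.size * sq (trace n ρ)) (*-identityˡ (sq (trace n ρ)))
             (*-monoʳ (sq-nonNeg (trace n ρ)) (1≤^ S.dim (≤ᵇ⇒≤ _)))) ⟩
      S.size * sq (trace n ρ) + c * (S.size * entries n ρ)
        ≡⟨ factor S.size (sq (trace n ρ)) c (entries n ρ) ⟩
      S.size * (c * entries n ρ + sq (trace n ρ)) ∎)
      where
      open ℚ.≤-Reasoning
      open NonZero (ΩGroup n)
      module Ω = Group (ΩGroup n)
      module S = State n
      Φρ : Matrix n
      Φρ x y = ½ ^ width * ∑ ws (λ w → conjugate n (word w) ρ x y)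
      g : Ω n → ℚ
      g = coefficients n ρ
      avg : Ω n → ℚ
      avg = wordAverage (signΩ n) (moveΩ n) g
      factor : ∀ z t c e → z * t + c * (z * e) ≡ z * (c * e + t)
      factor = solve-∀ ring
      rest≤all : ∑ nonzeros (λ v → sq (g v)) ≤ ∑ Ω.elems (λ v → sq (g v))
      rest≤all = subst₂ _≤_ (+-identityˡ (∑ nonzeros (λ v → sq (g v)))) (sym (∑-split (λ v → sq (g v)))) (+-monoˡ-≤ (∑ nonzeros (λ v → sq (g v))) (sq-nonNeg (g Ω.𝟘)))
      transformed : ∀ v → coefficients n Φρ v ≡ avg v
      transformed v@(a , b) = trans (∑-cong S.elems λ x → trans (*-exchange (S.χ b x) (½ ^ width) (∑ ws (λ w → conjugate n (word w) ρ x (x S.⊕ a))))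
          (cong (½ ^ width *_) (sym (∑-*ˡ ws (S.χ b x) (λ w → conjugate n (word w) ρ x (x S.⊕ a))))))
        (trans (∑-*ˡ S.elems (½ ^ width) (λ x → ∑ ws (λ w → S.χ b x * conjugate n (word w) ρ x (x S.⊕ a))))
        (cong (½ ^ width *_) (trans (∑-swap S.elems ws (λ x w → S.χ b x * conjugate n (word w) ρ x (x S.⊕ a)))
          (∑-cong ws λ w → coefficients-word n (word w) ρ v))))
        where
      at-𝟘 : avg Ω.𝟘 ≡ trace n ρ
      at-𝟘 = trans (cong (½ ^ width *_) (trans (∑-cong ws λ w → trans (cong₂ (λ p q → p * g q) (proj₁ (word-𝟘 n (word w))) (proj₂ (word-𝟘 n (word w)))) (*-identityˡ (g Ω.𝟘)))
          (Group.∑-const (bits width) (g Ω.𝟘))))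
        (trans (sym (*-assoc (½ ^ width) (Group.size (bits width)) (g Ω.𝟘))) (trans (cong (_* g Ω.𝟘) unit) (trans (*-identityˡ (g Ω.𝟘)) (coefficients-𝟘 n ρ))))
        where
        unit : ½ ^ width * Group.size (bits width) ≡ 1ℚ
        unit = trans (cong (λ d → ½ ^ d * Group.size (bits width)) (sym (trans (powDim bitGroup width) (ℕ.*-identityʳ width)))) (Group.size-inv (bits width))

-- Choice of parameters

ℕ-^-distrib-* : ∀ n a b → (a ℕ.* b) ℕ.^ n ≡ a ℕ.^ n ℕ.* b ℕ.^ n
ℕ-^-distrib-* zero a b = refl
ℕ-^-distrib-* (suc n) a b = trans (cong (a ℕ.* b ℕ.*_) (ℕ-^-distrib-* n a b)) (interchange a b (a ℕ.^ n) (b ℕ.^ n))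
  where
  interchange : ∀ a b c d → a ℕ.* b ℕ.* (c ℕ.* d) ≡ a ℕ.* c ℕ.* (b ℕ.* d)
  interchange = solveℕ

suc≤2^ : ∀ h → suc h ℕ.≤ 2 ℕ.^ h
suc≤2^ zero = ℕ.≤-refl
suc≤2^ (suc h) = ℕ.≤-trans (ℕ.+-mono-≤ (ℕ.m^n>0 2 h) (suc≤2^ h)) (ℕ.≤-reflexive (cong (2 ℕ.^ h ℕ.+_) (sym (ℕ.+-identityʳ (2 ℕ.^ h)))))

-- With `h + 1 = A (e + 1) ^ e` and `k = (e + 1) h`, the left side is at most `(h + 1) ^ (e + 1)`,
-- and `h + 1 ≤ 2 ^ h`. The leading coefficient is at least 2 to ensure `h ≥ 1`.
exponential-dominates : ∀ a e → ∃ λ k → 1 ℕ.≤ k × suc (suc a) ℕ.* k ℕ.^ e ℕ.≤ 2 ℕ.^ k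
exponential-dominates a e = suc e ℕ.* h , ℕ.*-mono-≤ (s≤s (z≤n {e})) 1≤h , (begin
  A ℕ.* (suc e ℕ.* h) ℕ.^ e ≤⟨ ℕ.*-monoʳ-≤ A (ℕ.^-monoˡ-≤ e (ℕ.*-monoʳ-≤ (suc e) (ℕ.n≤1+n h))) ⟩
  A ℕ.* (suc e ℕ.* suc h) ℕ.^ e ≡⟨ cong (A ℕ.*_) (ℕ-^-distrib-* e (suc e) (suc h)) ⟩
  A ℕ.* (suc e ℕ.^ e ℕ.* suc h ℕ.^ e) ≡⟨ ℕ.*-assoc A (suc e ℕ.^ e) (suc h ℕ.^ e) ⟨
  A ℕ.* suc e ℕ.^ e ℕ.* suc h ℕ.^ e ≡⟨ cong (ℕ._* suc h ℕ.^ e) suc-h ⟨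
  suc h ℕ.^ suc e ≤⟨ ℕ.^-monoˡ-≤ (suc e) (suc≤2^ h) ⟩
  (2 ℕ.^ h) ℕ.^ suc e ≡⟨ ℕ.^-*-assoc 2 h (suc e) ⟩
  2 ℕ.^ (h ℕ.* suc e) ≡⟨ cong (2 ℕ.^_) (ℕ.*-comm h (suc e)) ⟩
  2 ℕ.^ (suc e ℕ.* h) ∎)
  where
  open ℕ.≤-Reasoning
  A = suc (suc a)
  X = A ℕ.* suc e ℕ.^ e
  2≤X : 2 ℕ.≤ X
  2≤X = ℕ.*-mono-≤ {2} {A} (s≤s (s≤s z≤n)) (ℕ.m^n>0 (suc e) e)
  h = ℕ.pred X
  suc-h : suc h ≡ X
  suc-h = ℕ.suc-pred X {{ℕ.>-nonZero (ℕ.≤-trans (s≤s z≤n) 2≤X)}}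
  1≤h : 1 ℕ.≤ h
  1≤h = ℕ.s≤s⁻¹ (subst (2 ℕ.≤_) (sym suc-h) 2≤X)

module _ (ε : ℚ) (0<ε : 0ℚ < ε) (ε≤1 : ε ≤ 1ℚ) where
  open Rates ε 0<ε

  x-closed : ∀ n → x n ≡ ι (suc n) * ε ^ n
  x-closed zero = refl
  x-closed (suc n) = trans (cong (λ t → ε ^ suc n + t * ε) (x-closed n)) (lemma ε (ε ^ n) (ι n))
    where
    lemma : ∀ e p m → e * p + (1ℚ + m) * p * e ≡ (1ℚ + (1ℚ + m)) * (e * p)
    lemma = solve-∀ ring

  -- A round of `suc n` steps gains only `n` factors ε; this loss is what separates the exponent
  -- from 2.
  r-bound : ∀ n → r (suc n) ≤ sq (ι (2 ℕ.+ n)) * ε ^ n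
  r-bound zero = ≤-trans (+-monoʳ-≤ 1ℚ (≤-trans (≤-reflexive (*-identityˡ ε)) ε≤1)) (≤ᵇ⇒≤ _)
  r-bound (suc n) = begin
    x (suc n) + r (suc n) * ε
      ≤⟨ +-mono-≤ (≤-reflexive (x-closed (suc n))) (*-monoʳ (<⇒≤ 0<ε) (r-bound n)) ⟩
    ι (2 ℕ.+ n) * ε ^ suc n + sq (ι (2 ℕ.+ n)) * ε ^ n * ε
      ≤⟨ diff⇒≤ (subst (0ℚ ≤_) (lemma (ι (2 ℕ.+ n)) ε (ε ^ n)) (*-nonNeg (+-nonNeg 0≤1 (ι-nonNeg (2 ℕ.+ n))) (<⇒≤ (^-pos (suc n) 0<ε)))) ⟩
    sq (ι (3 ℕ.+ n)) * ε ^ suc n ∎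
    where
    open ℚ.≤-Reasoning
    lemma : ∀ m e p → (1ℚ + m) * (e * p) ≡ (1ℚ + m) * (1ℚ + m) * (e * p) - (m * (e * p) + m * m * p * e)
    lemma = solve-∀ ring

κ³²≤½ : κ ^ 32 ≤ ½
κ³²≤½ = ≤ᵇ⇒≤ _

-- After `t` rounds the degree is 2 to the power `2 (offset + t slope)` and the contraction `ν ^ t`.
-- `efficient` says that a round beats the trade-off degree = contraction to the power `-(2 + 1/q)`,
-- with a factor ½ to spare after taking q-th powers.
record Gadget (q : ℕ) : Set where
  field
    offset slope : ℕ
    ν : ℚ
    0<ν : 0ℚ < ν
    efficient : (2ℚ ^ (slope ℕ.* 2)) ^ q * ν ^ (suc (q ℕ.+ q)) ≤ ½
    lengthOf : ℕ → ℕ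
    system : ∀ t → WordSystem (ν ^ t) ((offset ℕ.+ t ℕ.* slope) ℕ.* 2) (lengthOf t)

gadget : ∀ q → Gadget q
gadget q = record
  -- There are `2 (q + 1)` blocks of `64 k` letters of 7 bits each, and `2 k` bits per walk step;
  -- offset and slope record half of the bits.
  { offset = suc q ℕ.* (k ℕ.* 32 ℕ.* 2 ℕ.* 7)
  ; slope = suc q ℕ.* (2 ℕ.* k)
  ; ν = ν
  ; 0<ν = R.r-pos (suc p)
  ; efficient = efficient
  ; lengthOf = λ t → Amplified.wordLength letterGroup flatLetter k (k ℕ.* 32) (suc p) t
  ; system = λ t → subst (λ h → WordSystem (ν ^ t) h (Amplified.wordLength letterGroup flatLetter k (k ℕ.* 32) (suc p) t)) (width-even t)
      (amplified k (k ℕ.* 32) (suc p) t small) }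
  where
  open ℚ.≤-Reasoning
  p e c : ℕ
  p = suc (q ℕ.+ q)
  e = p ℕ.* p
  -- The walk group has dimension `448 k (p + 1)`, and the additional 2 in the bias is at most
  -- `2 k (p + 1)`.
  c = 450 ℕ.* suc p
  -- `k` is so large that `2 ^ k` absorbs all polynomial factors in the bound for `ν ^ p`, including
  -- a factor 2 for the spare ½.
  choice = exponential-dominates (ℕ.pred (ℕ.pred (2 ℕ.* ((2 ℕ.+ p) ℕ.^ (2 ℕ.* p) ℕ.* c ℕ.^ e)))) e
  k : ℕ
  k = proj₁ choice
  1≤k : 1 ℕ.≤ k
  1≤k = proj₁ (proj₂ choice)
  module P = Amplified letterGroup flatLetter k (k ℕ.* 32) (suc p) 0
  ε : ℚ
  ε = P.bias-rate
  module R = Rates ε P.bias-rate-pos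
  ν : ℚ
  ν = R.r (suc p)
  dim : ℕ
  dim = Group.dim (powGroup (powGroup letterGroup (k ℕ.* 32 ℕ.* 2)) (suc p))

  big : 2 ℕ.≤ 2 ℕ.* ((2 ℕ.+ p) ℕ.^ (2 ℕ.* p) ℕ.* c ℕ.^ e)
  big = ℕ.*-monoʳ-≤ 2 (ℕ.*-mono-≤ {1} {_} {1} (ℕ.m^n>0 (2 ℕ.+ p) (2 ℕ.* p)) (ℕ.m^n>0 c e))

  restore : ∀ {n} → 2 ℕ.≤ n → suc (suc (ℕ.pred (ℕ.pred n))) ≡ n
  restore (s≤s (s≤s _)) = refl

  exponential : 2 ℕ.* ((2 ℕ.+ p) ℕ.^ (2 ℕ.* p) ℕ.* c ℕ.^ e) ℕ.* k ℕ.^ e ℕ.≤ 2 ℕ.^ k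
  exponential = subst (λ a → a ℕ.* k ℕ.^ e ℕ.≤ 2 ℕ.^ k) (restore big) (proj₂ (proj₂ choice))

  exponential′ : 2 ℕ.* ((2 ℕ.+ p) ℕ.^ (2 ℕ.* p) ℕ.* (c ℕ.* k) ℕ.^ e) ℕ.≤ 2 ℕ.^ k
  exponential′ = ℕ.≤-trans (ℕ.≤-reflexive (trans (cong (λ t → 2 ℕ.* ((2 ℕ.+ p) ℕ.^ (2 ℕ.* p) ℕ.* t)) (ℕ-^-distrib-* e c k))
    (regroup ((2 ℕ.+ p) ℕ.^ (2 ℕ.* p)) (c ℕ.^ e) (k ℕ.^ e)))) exponential
    where
    regroup : ∀ a b d → 2 ℕ.* (a ℕ.* (b ℕ.* d)) ≡ 2 ℕ.* (a ℕ.* b) ℕ.* d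
    regroup = solveℕ

  1≤ck : 1 ℕ.≤ c ℕ.* k
  1≤ck = ℕ.*-mono-≤ {1} {c} (s≤s z≤n) 1≤k

  ck≤2^k : c ℕ.* k ℕ.≤ 2 ℕ.^ k
  ck≤2^k = ℕ.≤-trans (ℕ.≤-trans (ℕ.≤-reflexive (sym (ℕ.*-identityʳ (c ℕ.* k))))
      (ℕ.*-monoʳ-≤ (c ℕ.* k) (ℕ.m^n>0 (c ℕ.* k) {{ℕ.>-nonZero 1≤ck}} (ℕ.pred e))))
    (ℕ.≤-trans (ℕ.≤-trans (ℕ.m≤n*m ((c ℕ.* k) ℕ.^ e) ((2 ℕ.+ p) ℕ.^ (2 ℕ.* p)) {{ℕ.>-nonZero (ℕ.m^n>0 (2 ℕ.+ p) (2 ℕ.* p))}})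
      (ℕ.m≤n*m ((2 ℕ.+ p) ℕ.^ (2 ℕ.* p) ℕ.* (c ℕ.* k) ℕ.^ e) 2)) exponential′)

  dim≤ : 2 ℕ.+ dim ℕ.≤ c ℕ.* k
  dim≤ = ℕ.≤-trans (ℕ.≤-reflexive (cong (2 ℕ.+_) (trans P.dim-eq (cong (λ d → suc p ℕ.* (k ℕ.* 32 ℕ.* 2 ℕ.* d)) letterGroup-dim))))
    (ℕ.≤-trans (ℕ.+-monoˡ-≤ (suc p ℕ.* (k ℕ.* 32 ℕ.* 2 ℕ.* 7)) (ℕ.*-monoʳ-≤ 2 (ℕ.*-mono-≤ {1} {suc p} (s≤s z≤n) 1≤k)))
    (ℕ.≤-reflexive (collect (suc p) k)))
    where
    collect : ∀ s k → 2 ℕ.* (s ℕ.* k) ℕ.+ s ℕ.* (k ℕ.* 32 ℕ.* 2 ℕ.* 7) ≡ 450 ℕ.* s ℕ.* k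
    collect = solveℕ

  ε≤ : ε ≤ ι (c ℕ.* k) * ½ ^ k
  ε≤ = *-monoʳ (<⇒≤ (½^-pos k)) (ι-mono dim≤)

  ε≤1 : ε ≤ 1ℚ
  ε≤1 = ≤-trans ε≤ (≤-trans (*-monoʳ (<⇒≤ (½^-pos k)) (ι-mono ck≤2^k))
    (≤-reflexive (trans (cong (_* ½ ^ k) (ι-2^ k)) (trans (*-comm (2ℚ ^ k) (½ ^ k)) (½^-2^ k)))))

  -- 32 pairs of letters contract by at least ½, so blocks of `32 k` pairs contract as strongly as
  -- the walk.
  small : κ ^ (k ℕ.* 32) ≤ ε
  small = begin
    κ ^ (k ℕ.* 32) ≡⟨ ^-* κ k 32 ⟩
    (κ ^ 32) ^ k ≤⟨ ^-mono k (^-nonNeg 32 (≤ᵇ⇒≤ {0ℚ} {κ} _)) κ³²≤½ ⟩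
    ½ ^ k ≡⟨ *-identityˡ (½ ^ k) ⟨
    1ℚ * ½ ^ k ≤⟨ *-monoʳ (<⇒≤ (½^-pos k)) (ι-mono {1} {2 ℕ.+ dim} (s≤s z≤n)) ⟩
    ε ∎

  width-even : ∀ t → Amplified.width letterGroup flatLetter k (k ℕ.* 32) (suc p) t ≡
               (suc q ℕ.* (k ℕ.* 32 ℕ.* 2 ℕ.* 7) ℕ.+ t ℕ.* (suc q ℕ.* (2 ℕ.* k))) ℕ.* 2
  width-even t = trans (Amplified.width-eq letterGroup flatLetter k (k ℕ.* 32) (suc p) t)
    (trans (cong (λ d → suc p ℕ.* (k ℕ.* 32 ℕ.* 2 ℕ.* d) ℕ.+ t ℕ.* suc p ℕ.* (2 ℕ.* k)) letterGroup-dim) (halve q t k))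
    where
    halve : ∀ q t k → suc (suc (q ℕ.+ q)) ℕ.* (k ℕ.* 32 ℕ.* 2 ℕ.* 7) ℕ.+ t ℕ.* suc (suc (q ℕ.+ q)) ℕ.* (2 ℕ.* k) ≡
      (suc q ℕ.* (k ℕ.* 32 ℕ.* 2 ℕ.* 7) ℕ.+ t ℕ.* (suc q ℕ.* (2 ℕ.* k))) ℕ.* 2
    halve = solveℕ

  M : ℚ
  M = ι (2 ℕ.+ p)

  0≤ν : 0ℚ ≤ ν
  0≤ν = <⇒≤ (R.r-pos (suc p))

  ν^p≤ : ν ^ p ≤ M ^ (2 ℕ.* p) * (ι (c ℕ.* k) ^ e * (½ ^ k) ^ e)
  ν^p≤ = begin
    ν ^ p
      ≤⟨ ^-mono p 0≤ν (≤-trans (r-bound ε P.bias-rate-pos ε≤1 p) (*-monoˡ (sq-nonNeg M) (^-mono p (<⇒≤ P.bias-rate-pos) ε≤))) ⟩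
    (sq M * (ι (c ℕ.* k) * ½ ^ k) ^ p) ^ p
      ≡⟨ ^-distrib-* (sq M) ((ι (c ℕ.* k) * ½ ^ k) ^ p) p ⟩
    sq M ^ p * ((ι (c ℕ.* k) * ½ ^ k) ^ p) ^ p
      ≡⟨ cong₂ _*_ (trans (cong (_^ p) (cong (M *_) (sym (*-identityʳ M)))) (trans (sym (^-* M p 2)) (cong (M ^_) (ℕ.*-comm p 2)))) (sym (^-* (ι (c ℕ.* k) * ½ ^ k) p p)) ⟩
    M ^ (2 ℕ.* p) * (ι (c ℕ.* k) * ½ ^ k) ^ e
      ≡⟨ cong (M ^ (2 ℕ.* p) *_) (^-distrib-* (ι (c ℕ.* k)) (½ ^ k) e) ⟩
    M ^ (2 ℕ.* p) * (ι (c ℕ.* k) ^ e * (½ ^ k) ^ e) ∎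

  -- 2 s q = p² − 1 for s = p + 1 and p = 2 q + 1
  degree-power : (2ℚ ^ (suc q ℕ.* (2 ℕ.* k) ℕ.* 2)) ^ q * (½ ^ k) ^ e ≡ ½ ^ k
  degree-power = begin-equality
    (2ℚ ^ (suc q ℕ.* (2 ℕ.* k) ℕ.* 2)) ^ q * (½ ^ k) ^ e
      ≡⟨ cong₂ _*_ (trans (sym (^-* 2ℚ q (suc q ℕ.* (2 ℕ.* k) ℕ.* 2))) (cong (2ℚ ^_) (exponents q k)))
           (cong ((½ ^ k) ^_) (square q)) ⟩
    2ℚ ^ (u ℕ.* k) * (½ ^ k * (½ ^ k) ^ u)
      ≡⟨ cong₂ _*_ (^-* 2ℚ u k) refl ⟩
    (2ℚ ^ k) ^ u * (½ ^ k * (½ ^ k) ^ u)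
      ≡⟨ shuffle ((2ℚ ^ k) ^ u) (½ ^ k) ((½ ^ k) ^ u) ⟩
    ½ ^ k * ((½ ^ k) ^ u * (2ℚ ^ k) ^ u)
      ≡⟨ cong (½ ^ k *_) (trans (sym (^-distrib-* (½ ^ k) (2ℚ ^ k) u)) (trans (cong (_^ u) (½^-2^ k)) (1^ u))) ⟩
    ½ ^ k * 1ℚ
      ≡⟨ *-identityʳ (½ ^ k) ⟩
    ½ ^ k ∎
    where
    u : ℕ
    u = q ℕ.* (suc q ℕ.* 4)
    exponents : ∀ q k → q ℕ.* (suc q ℕ.* (2 ℕ.* k) ℕ.* 2) ≡ q ℕ.* (suc q ℕ.* 4) ℕ.* k
    exponents = solveℕ
    square : ∀ q → suc (q ℕ.+ q) ℕ.* suc (q ℕ.+ q) ≡ suc (q ℕ.* (suc q ℕ.* 4))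
    square = solveℕ
    shuffle : ∀ a b c → a * (b * c) ≡ b * (c * a)
    shuffle = solve-∀ ring

  efficient : (2ℚ ^ (suc q ℕ.* (2 ℕ.* k) ℕ.* 2)) ^ q * ν ^ p ≤ ½
  efficient = begin
    D * ν ^ p
      ≤⟨ *-monoˡ (^-nonNeg q (^-nonNeg (suc q ℕ.* (2 ℕ.* k) ℕ.* 2) (≤ᵇ⇒≤ _))) ν^p≤ ⟩
    D * (M ^ (2 ℕ.* p) * (ι (c ℕ.* k) ^ e * (½ ^ k) ^ e))
      ≡⟨ shuffle D (M ^ (2 ℕ.* p)) (ι (c ℕ.* k) ^ e) ((½ ^ k) ^ e) ⟩
    M ^ (2 ℕ.* p) * ι (c ℕ.* k) ^ e * (D * (½ ^ k) ^ e)
      ≡⟨ cong (M ^ (2 ℕ.* p) * ι (c ℕ.* k) ^ e *_) degree-power ⟩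
    M ^ (2 ℕ.* p) * ι (c ℕ.* k) ^ e * ½ ^ k
      ≤⟨ *-monoʳ (<⇒≤ (½^-pos k)) numerator ⟩
    ½ * 2ℚ ^ k * ½ ^ k
      ≡⟨ trans (*-assoc ½ (2ℚ ^ k) (½ ^ k)) (trans (cong (½ *_) (trans (*-comm (2ℚ ^ k) (½ ^ k)) (½^-2^ k))) refl) ⟩
    ½ ∎
    where
    D : ℚ
    D = (2ℚ ^ (suc q ℕ.* (2 ℕ.* k) ℕ.* 2)) ^ q
    shuffle : ∀ a b c d → a * (b * (c * d)) ≡ b * c * (a * d)
    shuffle = solve-∀ ring
    numerator : M ^ (2 ℕ.* p) * ι (c ℕ.* k) ^ e ≤ ½ * 2ℚ ^ k
    numerator = cancelˡ {2ℚ} (positive⁻¹ 2ℚ) (subst₂ _≤_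
      (trans (ι-* 2 ((2 ℕ.+ p) ℕ.^ (2 ℕ.* p) ℕ.* (c ℕ.* k) ℕ.^ e)) (cong (ι 2 *_) (trans (ι-* ((2 ℕ.+ p) ℕ.^ (2 ℕ.* p)) ((c ℕ.* k) ℕ.^ e)) (cong₂ _*_ (ι-^ (2 ℕ.+ p) (2 ℕ.* p)) (ι-^ (c ℕ.* k) e)))))
      (trans (ι-2^ k) (trans (sym (*-identityˡ (2ℚ ^ k))) (*-assoc 2ℚ ½ (2ℚ ^ k))))
      (ι-mono exponential′))

-- Rational estimates: Archimedean property, approximate roots, comparison of powers

ι-toℚᵘ : ∀ n → toℚᵘ (ι n) ℚᵘ.≃ ℚᵘ.mkℚᵘ (ℤ.+ n) 0
ι-toℚᵘ zero = ℚᵘ.*≡* refl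
ι-toℚᵘ (suc n) = ℚᵘ.≃-trans (toℚᵘ-homo-+ 1ℚ (ι n)) (ℚᵘ.≃-trans (ℚᵘ.+-congʳ (toℚᵘ 1ℚ) (ι-toℚᵘ n))
  (ℚᵘ.*≡* (cong (ℤ._* ℤ.+ 1) (cong (λ t → ℤ.+ 1 ℤ.+ t) (ℤ.*-identityʳ (ℤ.+ n))))))

frac-ι : ∀ p q → (ℤ.+ p / suc q) * ι (suc q) ≡ ι p
frac-ι p q = toℚᵘ-injective (ℚᵘ.≃-trans (toℚᵘ-homo-* (ℤ.+ p / suc q) (ι (suc q)))
  (ℚᵘ.≃-trans (ℚᵘ.*-cong (toℚᵘ-fromℚᵘ (ℚᵘ.mkℚᵘ (ℤ.+ p) q)) (ι-toℚᵘ (suc q)))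
  (ℚᵘ.≃-trans (ℚᵘ.*≡* (trans (ℤ.*-identityʳ (ℤ.+ p ℤ.* ℤ.+ suc q)) (cong (λ d → ℤ.+ p ℤ.* ℤ.+ d) (sym (ℕ.*-identityʳ (suc q))))))
    (ℚᵘ.≃-sym (ι-toℚᵘ p)))))

fromℕ-ι : ∀ n → ℤ.+ n / 1 ≡ ι n
fromℕ-ι n = trans (sym (*-identityʳ (ℤ.+ n / 1))) (frac-ι n 0)

ι-pos : ∀ n → 0ℚ < ι (suc n)
ι-pos n = <-≤-trans 0<1 (subst (_≤ ι (suc n)) (+-identityʳ 1ℚ) (+-monoʳ-≤ 1ℚ (ι-nonNeg n)))

n<1+n : ∀ n → ι n < ι (suc n)
n<1+n n = subst (_< 1ℚ + ι n) (+-identityˡ (ι n)) (+-monoˡ-< (ι n) 0<1)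

ι-reflect : ∀ {m n} → ι m ≤ ι n → m ℕ.≤ n
ι-reflect {m} {n} p with m ℕ.≤? n
... | yes q = q
... | no ¬q = contradiction p (<⇒≱ (<-≤-trans (n<1+n n) (ι-mono (ℕ.≰⇒> ¬q))))

archimedes : ∀ q → ∃ λ n → q < ι n
archimedes q with ≤-total q 0ℚ
... | inj₁ q≤0 = 1 , ≤-<-trans q≤0 (ι-pos 0)
archimedes (mkℚ (ℤ.+ a) d c) | inj₂ 0≤q = suc a , ≤-<-trans bound (n<1+n a)
  where
  q : ℚ
  q = mkℚ (ℤ.+ a) d c
  bound : q ≤ ι a
  bound = subst₂ _≤_ (*-identityʳ q) (trans (cong (_* ι (suc d)) (sym (↥p/↧p≡p q))) (frac-ι a d))
    (*-monoˡ 0≤q (ι-mono {1} {suc d} (s≤s z≤n)))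
archimedes q@(mkℚ ℤ.-[1+ _ ] _ _) | inj₂ 0≤q = 1 , <-trans (negative⁻¹ q) (ι-pos 0)

-- A discrete intermediate value principle, used to find grid points next to roots, integer parts,
-- numbers of rounds and levels of `Δ`.
switch : ∀ {P : ℕ → Set} → (∀ n → Dec (P n)) → P 0 → ∀ N → ¬ P N → ∃ λ n → n ℕ.< N × P n × ¬ P (suc n)
switch P? P0 zero ¬PN = contradiction P0 ¬PN
switch P? P0 (suc N) ¬PN with P? N
... | yes PN = N , ℕ.≤-refl , PN , ¬PN
... | no ¬P  = let n , n<N , Pn , ¬Pn = switch P? P0 N ¬P in n , ℕ.m≤n⇒m≤1+n n<N , Pn , ¬Pn

recip : ∀ q → 0ℚ < q → ℚ
recip q 0<q = (ℚ.1/ q) {{pos⇒nonZero q {{ℚ.positive 0<q}}}}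

recip-inv : ∀ q (0<q : 0ℚ < q) → recip q 0<q * q ≡ 1ℚ
recip-inv q 0<q = *-inverseˡ q {{pos⇒nonZero q {{ℚ.positive 0<q}}}}

recip-pos : ∀ q (0<q : 0ℚ < q) → 0ℚ < recip q 0<q
recip-pos q 0<q = positive⁻¹ _ {{1/pos⇒pos q {{ℚ.positive 0<q}}}}

recip-≤ : ∀ {a b} q (0<q : 0ℚ < q) → b ≤ a * q → recip q 0<q * b ≤ a
recip-≤ {a} {b} q 0<q p = cancelˡ 0<q (subst₂ _≤_
  (trans (sym (*-identityˡ b)) (trans (cong (_* b) (trans (sym (recip-inv q 0<q)) (*-comm (recip q 0<q) q))) (*-assoc q (recip q 0<q) b)))
  (*-comm a q) p)

inv : ℕ → ℚ
inv n = recip (ι (suc n)) (ι-pos n)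

inv-pos : ∀ n → 0ℚ < inv n
inv-pos n = recip-pos (ι (suc n)) (ι-pos n)

inv-ι : ∀ n → inv n * ι (suc n) ≡ 1ℚ
inv-ι n = recip-inv (ι (suc n)) (ι-pos n)

inv-small : ∀ ε → 0ℚ < ε → ∃ λ N → ∀ n → N ℕ.≤ n → inv n ≤ ε
inv-small ε 0<ε = N , λ n N≤n → subst (_≤ ε) (*-identityʳ (inv n)) (recip-≤ (ι (suc n)) (ι-pos n) (bound n N≤n))
  where
  N = proj₁ (archimedes (recip ε 0<ε))
  bound : ∀ n → N ℕ.≤ n → 1ℚ ≤ ε * ι (suc n)
  bound n N≤n = subst (_≤ ε * ι (suc n)) (trans (*-comm ε (recip ε 0<ε)) (recip-inv ε 0<ε))
    (*-monoˡ (<⇒≤ 0<ε) (≤-trans (<⇒≤ (proj₂ (archimedes (recip ε 0<ε)))) (ι-mono (ℕ.m≤n⇒m≤1+n N≤n))))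

half-sum : ∀ ε → ½ * ε + ½ * ε ≡ ε
half-sum ε = trans (sym (*-distribʳ-+ ε ½ ½)) (*-identityˡ ε)

½-pos : ∀ {ε} → 0ℚ < ε → 0ℚ < ½ * ε
½-pos = *-pos (positive⁻¹ ½)

½^-small : ∀ ε → 0ℚ < ε → ∃ λ n → ½ ^ n ≤ ε
½^-small ε 0<ε = N , cancelˡ (^-pos N (positive⁻¹ 2ℚ)) (subst (_≤ 2ℚ ^ N * ε) (trans (sym (½^-2^ N)) (*-comm (½ ^ N) (2ℚ ^ N))) (begin
  1ℚ ≡⟨ recip-inv ε 0<ε ⟨
  recip ε 0<ε * ε ≤⟨ *-monoʳ (<⇒≤ 0<ε) (<⇒≤ (proj₂ (archimedes (recip ε 0<ε)))) ⟩
  ι N * ε ≤⟨ *-monoʳ (<⇒≤ 0<ε) (≤-trans (ι-mono (ℕ.n≤1+n N)) (subst (ι (suc N) ≤_) refl (growth N))) ⟩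
  2ℚ ^ N * ε ∎))
  where
  open ℚ.≤-Reasoning
  N = proj₁ (archimedes (recip ε 0<ε))
  growth : ∀ n → ι (suc n) ≤ 2ℚ ^ n
  growth n = subst (_≤ 2ℚ ^ n) (cong (1ℚ +_) (*-identityʳ (ι n))) (bernoulli n 0≤1)

∣∣⇒≤ : ∀ {x y ε} → ∣ x - y ∣ ≤ ε → x ≤ y + ε
∣∣⇒≤ {x} {y} {ε} p = subst (_≤ y + ε) (lemma x y) (+-monoʳ-≤ y (≤-trans (p≤∣p∣ (x - y)) p))
  where
  lemma : ∀ x y → y + (x - y) ≡ x
  lemma = solve-∀ ring
  p≤∣p∣ : ∀ p → p ≤ ∣ p ∣
  p≤∣p∣ p with ≤-total 0ℚ p
  ... | inj₁ 0≤p = ≤-reflexive (sym (0≤p⇒∣p∣≡p 0≤p))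
  ... | inj₂ p≤0 = ≤-trans p≤0 (0≤∣p∣ p)

≤⇒∣∣ : ∀ {x y ε} → x ≤ y + ε → y ≤ x + ε → ∣ x - y ∣ ≤ ε
≤⇒∣∣ {x} {y} {ε} p q with ∣p∣≡p∨∣p∣≡-p (x - y)
... | inj₁ e = subst (_≤ ε) (sym e) (diff⇒≤ (subst (0ℚ ≤_) (lemma x y ε) (≤⇒diff p)))
  where
  lemma : ∀ x y ε → y + ε - x ≡ ε - (x - y)
  lemma = solve-∀ ring
... | inj₂ e = subst (_≤ ε) (sym e) (diff⇒≤ (subst (0ℚ ≤_) (lemma x y ε) (≤⇒diff q)))
  where
  lemma : ∀ x y ε → x + ε - y ≡ ε - (- (x - y))
  lemma = solve-∀ ring

^-< : ∀ {x y} n → 0ℚ ≤ x → x < y → x ^ suc n < y ^ suc n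
^-< {x} {y} zero 0≤x x<y = subst₂ _<_ (sym (*-identityʳ x)) (sym (*-identityʳ y)) x<y
^-< {x} {y} (suc n) 0≤x x<y = ≤-<-trans (*-monoˡ 0≤x (<⇒≤ (^-< n 0≤x x<y)))
  (*-monoˡ-<-pos (y ^ suc n) {{ℚ.positive (^-pos (suc n) (≤-<-trans 0≤x x<y))}} x<y)

^-cancel : ∀ {x y} n → 0ℚ ≤ y → x ^ suc n ≤ y ^ suc n → x ≤ y
^-cancel {x} {y} n 0≤y p with x ℚ.≤? y
... | yes q = q
... | no ¬q = contradiction p (<⇒≱ (^-< n 0≤y (≰⇒> ¬q)))

^-antitone : ∀ {x} m n → 0ℚ ≤ x → x ≤ 1ℚ → m ℕ.≤ n → x ^ n ≤ x ^ m
^-antitone {x} m n 0≤x x≤1 m≤n with ℕ.m≤n⇒∃[o]m+o≡n m≤n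
... | o , refl = subst₂ _≤_ (sym (^-+ x m o)) (*-identityʳ (x ^ m)) (*-monoˡ (^-nonNeg m 0≤x) (^≤1 o 0≤x x≤1))

^-difference : ∀ {a b} n → 0ℚ ≤ a → a ≤ b → b ≤ 1ℚ → b ^ n ≤ a ^ n + ι n * (b - a)
^-difference {a} {b} zero 0≤a a≤b b≤1 = ≤-reflexive (sym (lemma (b - a)))
  where
  lemma : ∀ d → 1ℚ + 0ℚ * d ≡ 1ℚ
  lemma = solve-∀ ring
^-difference {a} {b} (suc n) 0≤a a≤b b≤1 = begin
  b * b ^ n
    ≡⟨ lemma₁ a b (b ^ n) ⟩
  a * b ^ n + (b - a) * b ^ n
    ≤⟨ +-mono-≤ (*-monoˡ 0≤a (^-difference n 0≤a a≤b b≤1)) (*-monoˡ (≤⇒diff a≤b) (^≤1 n (≤-trans 0≤a a≤b) b≤1)) ⟩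
  a * (a ^ n + ι n * (b - a)) + (b - a) * 1ℚ
    ≤⟨ +-monoˡ-≤ ((b - a) * 1ℚ) (diff⇒≤ {a * (a ^ n + ι n * (b - a))} {a * a ^ n + ι n * (b - a)} (subst (0ℚ ≤_) (lemma₂ a b (a ^ n) (ι n)) (*-nonNeg (≤⇒diff (≤-trans a≤b b≤1)) (*-nonNeg (ι-nonNeg n) (≤⇒diff a≤b))))) ⟩
  a * a ^ n + ι n * (b - a) + (b - a) * 1ℚ
    ≡⟨ lemma₃ a b (a ^ n) (ι n) ⟩
  a * a ^ n + ι (suc n) * (b - a) ∎
  where
  open ℚ.≤-Reasoning
  lemma₁ : ∀ a b p → b * p ≡ a * p + (b - a) * p
  lemma₁ = solve-∀ ring
  lemma₂ : ∀ a b p n → (1ℚ - a) * (n * (b - a)) ≡ a * p + n * (b - a) - a * (p + n * (b - a))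
  lemma₂ = solve-∀ ring
  lemma₃ : ∀ a b p n → a * p + n * (b - a) + (b - a) * 1ℚ ≡ a * p + (1ℚ + n) * (b - a)
  lemma₃ = solve-∀ ring

-- Approximate square roots and approximate roots of higher order

sqrt-approx : ∀ n x → 0ℚ ≤ x → ∃ λ s → 0ℚ ≤ s × sq s ≤ x × x < sq (s + inv n)
sqrt-approx n x 0≤x with archimedes (1ℚ + x)
... | B , x<B = ι i * h , *-nonNeg (ι-nonNeg i) 0≤h , proj₁ (proj₂ (proj₂ found)) ,
                subst (x <_) (cong sq (next (ι i) h)) (≰⇒> (proj₂ (proj₂ (proj₂ found))))
  where
  h : ℚ
  h = inv n
  0≤h : 0ℚ ≤ h
  0≤h = <⇒≤ (inv-pos n)
  large : ¬ (sq (ι (suc n ℕ.* B) * h) ≤ x)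
  large p = <⇒≱ (<-≤-trans (≤-<-trans x≤1+x x<B) (≤-reflexive (sym scaled)))
    (≤-trans (subst₂ _≤_ (trans (*-identityˡ b) refl) refl (*-monoʳ 0≤b 1≤b)) p)
    where
    b : ℚ
    b = ι (suc n ℕ.* B) * h
    x≤1+x : x ≤ 1ℚ + x
    x≤1+x = subst (_≤ 1ℚ + x) (+-identityˡ x) (+-monoˡ-≤ x 0≤1)
    scaled : b ≡ ι B
    scaled = trans (cong (_* h) (ι-* (suc n) B)) (trans (shuffle (ι (suc n)) (ι B) h) (trans (cong (_* ι B) (inv-ι n)) (*-identityˡ (ι B))))
      where
      shuffle : ∀ a b c → a * b * c ≡ c * a * b
      shuffle = solve-∀ ring
    1≤b : 1ℚ ≤ b
    1≤b = subst (1ℚ ≤_) (sym scaled) (<⇒≤ (≤-<-trans (subst (_≤ 1ℚ + x) (+-identityʳ 1ℚ) (+-monoʳ-≤ 1ℚ 0≤x)) x<B))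
    0≤b : 0ℚ ≤ b
    0≤b = ≤-trans 0≤1 1≤b
  found = switch (λ i → sq (ι i * h) ℚ.≤? x) (subst (_≤ x) (sym (lemma h)) 0≤x) (suc n ℕ.* B) large
    where
    lemma : ∀ h → 0ℚ * h * (0ℚ * h) ≡ 0ℚ
    lemma = solve-∀ ring
  i : ℕ
  i = proj₁ found
  next : ∀ i h → (1ℚ + i) * h ≡ i * h + h
  next = solve-∀ ring

root-approx : ∀ Q n x → 0ℚ ≤ x → x < 1ℚ → ∃ λ r → 0ℚ ≤ r × r ≤ 1ℚ × r ^ suc Q ≤ x × x ≤ r ^ suc Q + inv n
root-approx Q n x 0≤x x<1 = ι i * h , 0≤r , ≤-trans r≤r+h r+h≤1 , proj₁ (proj₂ (proj₂ found)) , ≤-trans above close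
  where
  open ℚ.≤-Reasoning
  H : ℕ
  -- `suc H` is `suc Q * suc n`: on the unit interval the power `suc Q` stretches distances at most
  -- by `suc Q`, so this mesh gives accuracy `inv n`.
  H = n ℕ.+ Q ℕ.* suc n
  h : ℚ
  h = inv H
  0≤h : 0ℚ ≤ h
  0≤h = <⇒≤ (inv-pos H)
  one : ι (suc H) * h ≡ 1ℚ
  one = trans (*-comm (ι (suc H)) h) (inv-ι H)
  found = switch (λ i → (ι i * h) ^ suc Q ℚ.≤? x)
    (subst (_≤ x) (sym (trans (cong (λ t → t * t ^ Q) (*-zeroˡ h)) (*-zeroˡ (0ℚ ^ Q)))) 0≤x) (suc H)
    (λ p → <⇒≱ x<1 (subst (_≤ x) (trans (cong (_^ suc Q) one) (1^ (suc Q))) p))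
  i : ℕ
  i = proj₁ found
  0≤r : 0ℚ ≤ ι i * h
  0≤r = *-nonNeg (ι-nonNeg i) 0≤h
  next : ∀ i h → (1ℚ + i) * h ≡ i * h + h
  next = solve-∀ ring
  r+h≤1 : ι (suc i) * h ≤ 1ℚ
  r+h≤1 = subst (ι (suc i) * h ≤_) one (*-monoʳ 0≤h (ι-mono (proj₁ (proj₂ found))))
  r≤r+h : ι i * h ≤ ι (suc i) * h
  r≤r+h = *-monoʳ 0≤h (ι-mono (ℕ.n≤1+n i))
  above : x ≤ (ι (suc i) * h) ^ suc Q
  above = <⇒≤ (≰⇒> (proj₂ (proj₂ (proj₂ found))))
  close : (ι (suc i) * h) ^ suc Q ≤ (ι i * h) ^ suc Q + inv n
  close = begin
    (ι (suc i) * h) ^ suc Q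
      ≤⟨ ^-difference (suc Q) 0≤r r≤r+h r+h≤1 ⟩
    (ι i * h) ^ suc Q + ι (suc Q) * (ι (suc i) * h - ι i * h)
      ≡⟨ cong (λ t → (ι i * h) ^ suc Q + ι (suc Q) * t) (gap (ι i) h) ⟩
    (ι i * h) ^ suc Q + ι (suc Q) * h
      ≡⟨ cong ((ι i * h) ^ suc Q +_) step′ ⟩
    (ι i * h) ^ suc Q + inv n ∎
    where
    gap : ∀ i h → (1ℚ + i) * h - i * h ≡ h
    gap = solve-∀ ring
    step′ : ι (suc Q) * h ≡ inv n
    step′ = trans (sym (*-identityˡ (ι (suc Q) * h))) (trans (cong (_* (ι (suc Q) * h)) (sym (inv-ι n)))
      (trans (regroup (inv n) (ι (suc n)) (ι (suc Q)) h) (trans (cong (inv n *_) (trans (cong (_* h) (sym (ι-* (suc Q) (suc n)))) one)) (*-identityʳ (inv n)))))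
      where
      regroup : ∀ a b c d → a * b * (c * d) ≡ a * (c * b * d)
      regroup = solve-∀ ring

exceeds-2 : ∀ ε ℓ → 0ℚ < ε → 0ℚ < ℓ → ∃ λ M → 2ℚ < (1ℚ + ε) ^ M * ℓ
exceeds-2 ε ℓ 0<ε 0<ℓ = large (archimedes (recip (ε * ℓ) 0<εℓ * 2ℚ))
  where
  open ℚ.≤-Reasoning
  0<εℓ = *-pos 0<ε 0<ℓ
  shuffle : ∀ a b c → a * b * c ≡ c * a * b
  shuffle = solve-∀ ring
  large : (∃ λ M → recip (ε * ℓ) 0<εℓ * 2ℚ < ι M) → ∃ λ M → 2ℚ < (1ℚ + ε) ^ M * ℓ
  large (M , p) = M , (begin-strict
    2ℚ ≡⟨ trans (cong (_* 2ℚ) (trans (sym (recip-inv (ε * ℓ) 0<εℓ)) (*-comm (recip (ε * ℓ) 0<εℓ) (ε * ℓ)))) (*-assoc (ε * ℓ) (recip (ε * ℓ) 0<εℓ) 2ℚ) ⟩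
    ε * ℓ * (recip (ε * ℓ) 0<εℓ * 2ℚ) <⟨ *-monoˡ-< 0<εℓ p ⟩
    ε * ℓ * ι M ≡⟨ shuffle ε ℓ (ι M) ⟩
    ι M * ε * ℓ ≤⟨ *-monoʳ (<⇒≤ 0<ℓ) (≤-trans (subst (_≤ 1ℚ + ι M * ε) (+-identityˡ (ι M * ε)) (+-monoˡ-≤ (ι M * ε) 0≤1)) (bernoulli M (<⇒≤ 0<ε))) ⟩
    (1ℚ + ε) ^ M * ℓ ∎)

-- Comparison of powers with slightly perturbed bases and exponents: if z = ξ^(a/Q) exceeded
-- z′ = ξ′^(a′/Q) by ε, then (1 + ε)^(QM) ℓ^Q ≤ (1 + ζ)^(BQM) ≤ 2^Q, against the choice of M.
module Comparison (ε ℓ : ℚ) (0<ε : 0ℚ < ε) (0<ℓ : 0ℚ < ℓ) (B M : ℕ) (M-large : 2ℚ < (1ℚ + ε) ^ M * ℓ) where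
  private
    n : ℕ
    n = B ℕ.* M

    ζ : ℚ
    -- Bernoulli gives `(1 - ζ) ^ n ≥ ½`, and `(1 + ζ) * (1 - ζ) ≤ 1` then gives `(1 + ζ) ^ n ≤ 2`.
    ζ = ½ * inv n

    0<ζ : 0ℚ < ζ
    0<ζ = ½-pos (inv-pos n)

    1≤1+ζ : 1ℚ ≤ 1ℚ + ζ
    1≤1+ζ = subst (_≤ 1ℚ + ζ) (+-identityʳ 1ℚ) (+-monoʳ-≤ 1ℚ (<⇒≤ 0<ζ))

  η : ℚ
  η = ζ * ℓ

  0<η : 0ℚ < η
  0<η = *-pos 0<ζ 0<ℓ

  private
    open ℚ.≤-Reasoning

    1≤1+ε : 1ℚ ≤ 1ℚ + ε
    1≤1+ε = subst (_≤ 1ℚ + ε) (+-identityʳ 1ℚ) (+-monoʳ-≤ 1ℚ (<⇒≤ 0<ε))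

    ζ-small : (1ℚ + ζ) ^ n ≤ 2ℚ
    ζ-small = begin
      (1ℚ + ζ) ^ n ≡⟨ *-identityʳ ((1ℚ + ζ) ^ n) ⟨
      (1ℚ + ζ) ^ n * 1ℚ ≤⟨ *-monoˡ (^-nonNeg n 0≤1+ζ) (subst (_≤ (1ℚ - ζ) ^ n * 2ℚ) half (*-monoʳ (≤ᵇ⇒≤ {0ℚ} {2ℚ} _) lower)) ⟩
      (1ℚ + ζ) ^ n * ((1ℚ - ζ) ^ n * 2ℚ) ≡⟨ *-assoc ((1ℚ + ζ) ^ n) ((1ℚ - ζ) ^ n) 2ℚ ⟨
      (1ℚ + ζ) ^ n * (1ℚ - ζ) ^ n * 2ℚ ≡⟨ cong (_* 2ℚ) (^-distrib-* (1ℚ + ζ) (1ℚ - ζ) n) ⟨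
      ((1ℚ + ζ) * (1ℚ - ζ)) ^ n * 2ℚ ≤⟨ *-monoʳ (≤ᵇ⇒≤ {0ℚ} {2ℚ} _) (^≤1 n (*-nonNeg 0≤1+ζ (≤⇒diff ζ≤1)) below-one) ⟩
      1ℚ * 2ℚ ≡⟨ *-identityˡ 2ℚ ⟩
      2ℚ ∎
      where
      0≤1+ζ : 0ℚ ≤ 1ℚ + ζ
      0≤1+ζ = ≤-trans 0≤1 1≤1+ζ
      ζn≤½ : ι n * ζ ≤ ½
      ζn≤½ = begin
        ι n * (½ * inv n) ≤⟨ *-monoʳ (<⇒≤ 0<ζ) (<⇒≤ (n<1+n n)) ⟩
        ι (suc n) * (½ * inv n) ≡⟨ shuffle (ι (suc n)) (inv n) ⟩
        ½ * (inv n * ι (suc n)) ≡⟨ cong (½ *_) (inv-ι n) ⟩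
        ½ ∎
        where
        shuffle : ∀ a b → a * (½ * b) ≡ ½ * (b * a)
        shuffle = solve-∀ ring
      ζ≤1 : ζ ≤ 1ℚ
      ζ≤1 = begin
        ½ * inv n ≡⟨ *-identityʳ (½ * inv n) ⟨
        ½ * inv n * 1ℚ ≤⟨ *-monoˡ (<⇒≤ 0<ζ) (ι-mono {1} {suc n} (s≤s z≤n)) ⟩
        ½ * inv n * ι (suc n) ≡⟨ trans (*-assoc ½ (inv n) (ι (suc n))) (cong (½ *_) (inv-ι n)) ⟩
        ½ ≤⟨ ≤ᵇ⇒≤ _ ⟩
        1ℚ ∎
      lower : ½ ≤ (1ℚ - ζ) ^ n
      lower = ≤-trans (diff⇒≤ (subst (0ℚ ≤_) (lemma (ι n * ζ)) (≤⇒diff ζn≤½))) (bernoulli⁻ n (<⇒≤ 0<ζ) ζ≤1)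
        where
        lemma : ∀ t → ½ - t ≡ (½ + ½) - t - ½
        lemma = solve-∀ ring
      half : ½ * 2ℚ ≡ 1ℚ
      half = refl
      below-one : (1ℚ + ζ) * (1ℚ - ζ) ≤ 1ℚ
      below-one = diff⇒≤ (subst (0ℚ ≤_) (lemma ζ) (sq-nonNeg ζ))
        where
        lemma : ∀ z → z * z ≡ 1ℚ - (1ℚ + z) * (1ℚ - z)
        lemma = solve-∀ ring

  -- The exponent `a′ / Q` may exceed `a / Q` by at most `1 / M`. Only this direction needs a bound,
  -- since for bases at most 1 a smaller exponent only enlarges `z′`.
  compare : ∀ Q′ a a′ {ξ ξ′ z z′} (let Q = suc Q′) → 0ℚ ≤ ξ → ℓ ≤ ξ′ → ξ′ ≤ 1ℚ → ξ ≤ ξ′ + η →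
    a ℕ.≤ B ℕ.* Q → M ℕ.* a′ ℕ.≤ M ℕ.* a ℕ.+ Q → 0ℚ ≤ z′ → z′ ≤ 1ℚ → z ^ Q ≡ ξ ^ a → z′ ^ Q ≡ ξ′ ^ a′ → z ≤ z′ + ε
  compare Q′ a a′ {ξ} {ξ′} {z} {z′} 0≤ξ ℓ≤ξ′ ξ′≤1 close a≤BQ near 0≤z′ z′≤1 zQ z′Q =
    ≮⇒≥ λ above → <⇒≱ (^-< Q′ (≤ᵇ⇒≤ {0ℚ} {2ℚ} _) M-large) (impossible above)
    where
    Q : ℕ
    Q = suc Q′
    0<ξ′ : 0ℚ < ξ′
    0<ξ′ = <-≤-trans 0<ℓ ℓ≤ξ′
    0≤ξ′ : 0ℚ ≤ ξ′
    0≤ξ′ = <⇒≤ 0<ξ′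
    0≤1+ε : 0ℚ ≤ 1ℚ + ε
    0≤1+ε = ≤-trans 0≤1 1≤1+ε
    0≤1+ζ : 0ℚ ≤ 1ℚ + ζ
    0≤1+ζ = ≤-trans 0≤1 1≤1+ζ
    step₁ : z′ + ε < z → (1ℚ + ε) * z′ ≤ z
    step₁ above = begin
      (1ℚ + ε) * z′ ≡⟨ *-distribʳ-+ z′ 1ℚ ε ⟩
      1ℚ * z′ + ε * z′ ≤⟨ +-mono-≤ (≤-reflexive (*-identityˡ z′)) (*-monoˡ (<⇒≤ 0<ε) z′≤1) ⟩
      z′ + ε * 1ℚ ≡⟨ cong (z′ +_) (*-identityʳ ε) ⟩
      z′ + ε <⟨ above ⟩
      z ∎
    step₂ : ξ ≤ ξ′ * (1ℚ + ζ)
    step₂ = begin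
      ξ ≤⟨ close ⟩
      ξ′ + ζ * ℓ ≤⟨ +-monoʳ-≤ ξ′ (*-monoˡ (<⇒≤ 0<ζ) ℓ≤ξ′) ⟩
      ξ′ + ζ * ξ′ ≡⟨ lemma ξ′ ζ ⟩
      ξ′ * (1ℚ + ζ) ∎
      where
      lemma : ∀ x z → x + z * x ≡ x * (1ℚ + z)
      lemma = solve-∀ ring
    step₃ : z′ + ε < z → (1ℚ + ε) ^ Q * ξ′ ^ a′ ≤ ξ′ ^ a * (1ℚ + ζ) ^ (B ℕ.* Q)
    step₃ above = begin
      (1ℚ + ε) ^ Q * ξ′ ^ a′ ≡⟨ cong ((1ℚ + ε) ^ Q *_) z′Q ⟨
      (1ℚ + ε) ^ Q * z′ ^ Q ≡⟨ ^-distrib-* (1ℚ + ε) z′ Q ⟨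
      ((1ℚ + ε) * z′) ^ Q ≤⟨ ^-mono Q (*-nonNeg 0≤1+ε 0≤z′) (step₁ above) ⟩
      z ^ Q ≡⟨ zQ ⟩
      ξ ^ a ≤⟨ ^-mono a 0≤ξ step₂ ⟩
      (ξ′ * (1ℚ + ζ)) ^ a ≡⟨ ^-distrib-* ξ′ (1ℚ + ζ) a ⟩
      ξ′ ^ a * (1ℚ + ζ) ^ a ≤⟨ *-monoˡ (^-nonNeg a 0≤ξ′) (raise a≤BQ) ⟩
      ξ′ ^ a * (1ℚ + ζ) ^ (B ℕ.* Q) ∎
      where
      raise : ∀ {m o} → m ℕ.≤ o → (1ℚ + ζ) ^ m ≤ (1ℚ + ζ) ^ o
      raise {m} m≤o with ℕ.m≤n⇒∃[o]m+o≡n m≤o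
      ... | o , refl = subst₂ _≤_ (*-identityʳ ((1ℚ + ζ) ^ m)) (sym (^-+ (1ℚ + ζ) m o)) (*-monoˡ (^-nonNeg m 0≤1+ζ) (1≤^ o 1≤1+ζ))
    impossible : z′ + ε < z → ((1ℚ + ε) ^ M * ℓ) ^ Q ≤ 2ℚ ^ Q
    impossible above = cancelˡ (^-pos (M ℕ.* a) 0<ξ′) (begin
      ξ′ ^ (M ℕ.* a) * ((1ℚ + ε) ^ M * ℓ) ^ Q
        ≡⟨ cong (ξ′ ^ (M ℕ.* a) *_) (trans (^-distrib-* ((1ℚ + ε) ^ M) ℓ Q) (cong (_* ℓ ^ Q) (trans (sym (^-* (1ℚ + ε) Q M)) (trans (cong ((1ℚ + ε) ^_) (ℕ.*-comm Q M)) (^-* (1ℚ + ε) M Q))))) ⟩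
      ξ′ ^ (M ℕ.* a) * (((1ℚ + ε) ^ Q) ^ M * ℓ ^ Q)
        ≡⟨ *-exchange (ξ′ ^ (M ℕ.* a)) (((1ℚ + ε) ^ Q) ^ M) (ℓ ^ Q) ⟩
      ((1ℚ + ε) ^ Q) ^ M * (ξ′ ^ (M ℕ.* a) * ℓ ^ Q)
        ≤⟨ *-monoˡ (^-nonNeg M (^-nonNeg Q 0≤1+ε)) (≤-trans (*-monoˡ (^-nonNeg (M ℕ.* a) 0≤ξ′) (^-mono Q (<⇒≤ 0<ℓ) ℓ≤ξ′))
             (≤-trans (≤-reflexive (sym (^-+ ξ′ (M ℕ.* a) Q))) (^-antitone (M ℕ.* a′) (M ℕ.* a ℕ.+ Q) 0≤ξ′ ξ′≤1 near))) ⟩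
      ((1ℚ + ε) ^ Q) ^ M * ξ′ ^ (M ℕ.* a′)
        ≡⟨ cong (((1ℚ + ε) ^ Q) ^ M *_) (^-* ξ′ M a′) ⟩
      ((1ℚ + ε) ^ Q) ^ M * (ξ′ ^ a′) ^ M
        ≡⟨ ^-distrib-* ((1ℚ + ε) ^ Q) (ξ′ ^ a′) M ⟨
      ((1ℚ + ε) ^ Q * ξ′ ^ a′) ^ M
        ≤⟨ ^-mono M (*-nonNeg (^-nonNeg Q 0≤1+ε) (^-nonNeg a′ 0≤ξ′)) (step₃ above) ⟩
      (ξ′ ^ a * (1ℚ + ζ) ^ (B ℕ.* Q)) ^ M
        ≡⟨ ^-distrib-* (ξ′ ^ a) ((1ℚ + ζ) ^ (B ℕ.* Q)) M ⟩
      (ξ′ ^ a) ^ M * ((1ℚ + ζ) ^ (B ℕ.* Q)) ^ M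
        ≡⟨ cong₂ _*_ (sym (^-* ξ′ M a)) (trans (sym (^-* (1ℚ + ζ) M (B ℕ.* Q))) (trans (cong ((1ℚ + ζ) ^_) (rearrange M B Q)) (^-* (1ℚ + ζ) Q n))) ⟩
      ξ′ ^ (M ℕ.* a) * ((1ℚ + ζ) ^ n) ^ Q
        ≤⟨ *-monoˡ (^-nonNeg (M ℕ.* a) 0≤ξ′) (^-mono Q (^-nonNeg n 0≤1+ζ) ζ-small) ⟩
      ξ′ ^ (M ℕ.* a) * 2ℚ ^ Q ∎)
      where
      rearrange : ∀ m b q → m ℕ.* (b ℕ.* q) ≡ q ℕ.* (b ℕ.* m)
      rearrange m b q = trans (ℕ.*-comm m (b ℕ.* q)) (trans (cong (ℕ._* m) (ℕ.*-comm b q)) (ℕ.*-assoc q b m))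

≤⇒∃+ : ∀ {m n} → m ℕ.≤ n → ∃ λ o → o ℕ.+ m ≡ n
≤⇒∃+ {m} m≤n = let o , e = ℕ.m≤n⇒∃[o]m+o≡n m≤n in o , trans (ℕ.+-comm o m) e

open import Defs hiding (word; move) renaming (∑ to ∑ᶜ)

open ℝ

-- Real numbers: roots and powers through their rational approximations

seq-+ : ∀ x y n → seq (x +ᴿ y) n ≡ seq x n + seq y n
seq-+ (mkℝ _ _) (mkℝ _ _) n = refl

seq-* : ∀ x y n → seq (x *ᴿ y) n ≡ seq x n * seq y n
seq-* (mkℝ _ _) (mkℝ _ _) n = refl

seq-neg : ∀ x n → seq (-ᴿ x) n ≡ - seq x n
seq-neg (mkℝ _ _) n = refl

seq-^ : ∀ x p n → seq (x ^ᴿ p) n ≡ seq x n ^ p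
seq-^ x zero n = refl
seq-^ x (suc p) n = trans (seq-* x (x ^ᴿ p) n) (cong (seq x n *_) (seq-^ x p n))

cauchy-≤ : ∀ x ε → 0ℚ < ε → ∃ λ N → ∀ m n → N ℕ.≤ m → N ℕ.≤ n → seq x m ≤ seq x n + ε
cauchy-≤ x ε 0<ε = let N , close = cauchy x ε 0<ε in N , λ m n p q → ∣∣⇒≤ (close m n p q)

mk : (f : ℕ → ℚ) → (∀ ε → 0ℚ < ε → ∃ λ N → ∀ m n → N ℕ.≤ m → N ℕ.≤ n → f m ≤ f n + ε) → ℝ
mk f close = mkℝ f λ ε 0<ε → let N , le = close ε 0<ε in N , λ m n p q → ≤⇒∣∣ (le m n p q) (le n m q p)

-- Square roots

root-compare : ∀ {s u y h τ ε} → 0ℚ ≤ u → 0ℚ < ε → 0ℚ ≤ h → h ≤ ½ * ε → τ ≤ ½ * ½ * sq ε →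
  sq s ≤ y → y ≤ sq (u + h) + τ → s ≤ u + ε
root-compare {s} {u} {y} {h} {τ} {ε} 0≤u 0<ε 0≤h h≤ τ≤ s²≤y y≤ = ≮⇒≥ λ u+ε<s → <⇒≱ (larger u+ε<s) (≤-trans s²≤y (≤-trans y≤ smaller))
  where
  open ℚ.≤-Reasoning
  0≤ε = <⇒≤ 0<ε
  mid : ℚ
  -- Half of ε is spent on `h` and a quarter of its square on `τ`; what is left below `sq (u + ε)`
  -- is `ε * (u + ½ * ε)`.
  mid = sq (u + ½ * ε) + ½ * ½ * sq ε
  smaller : sq (u + h) + τ ≤ mid
  smaller = +-mono-≤ (*-mono (+-nonNeg 0≤u 0≤h) (+-nonNeg 0≤u (≤-trans 0≤h h≤)) (+-monoʳ-≤ u h≤) (+-monoʳ-≤ u h≤)) τ≤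
  mid≤ : mid ≤ sq (u + ε)
  mid≤ = diff⇒≤ (subst (0ℚ ≤_) (lemma u ε) (*-nonNeg 0≤ε (+-nonNeg 0≤u (<⇒≤ (½-pos 0<ε)))))
    where
    lemma : ∀ u e → e * (u + ½ * e) ≡ (u + e) * (u + e) - ((u + ½ * e) * (u + ½ * e) + ½ * ½ * (e * e))
    lemma u e = trans (halves u e) (sym (expanded u e))
      where
      halves : ∀ u e → e * (u + ½ * e) ≡ e * u + ½ * (e * e)
      halves = solve-∀ ring
      expanded : ∀ u e → (u + e) * (u + e) - ((u + ½ * e) * (u + ½ * e) + ½ * ½ * (e * e)) ≡ e * u + ½ * (e * e)
      expanded u e = trans (one u e) (cong₂ (λ a b → a * (u * e) + b * (e * e)) {1ℚ + 1ℚ - (½ + ½)} {1ℚ} {1ℚ - (½ * ½ + ½ * ½)} {½} refl refl ■ tidy u e)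
        where
        _■_ : ∀ {a b c : ℚ} → a ≡ b → b ≡ c → a ≡ c
        _■_ = trans
        one : ∀ u e → (u + e) * (u + e) - ((u + ½ * e) * (u + ½ * e) + ½ * ½ * (e * e)) ≡ (1ℚ + 1ℚ - (½ + ½)) * (u * e) + (1ℚ - (½ * ½ + ½ * ½)) * (e * e)
        one = solve-∀ ring
        tidy : ∀ u e → 1ℚ * (u * e) + ½ * (e * e) ≡ e * u + ½ * (e * e)
        tidy = solve-∀ ring
  larger : u + ε < s → mid < sq s
  larger p = ≤-<-trans mid≤ (subst₂ _<_ (cong ((u + ε) *_) (*-identityʳ (u + ε))) (cong (s *_) (*-identityʳ s)) (^-< 1 (+-nonNeg 0≤u 0≤ε) p))

-- The bounds hold for every index, so an inequality between squares can be transferred to the roots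
-- term by term.
record Root (x : ℕ → ℚ) : Set where
  field
    root : ℝ
    nonNeg : ∀ n → 0ℚ ≤ seq root n
    lower : ∀ n → sq (seq root n) ≤ x n
    upper : ∀ n → x n ≤ sq (seq root n + inv n)

squareRoot : ∀ x → (∀ n → 0ℚ ≤ seq x n) → Root (seq x)
squareRoot x 0≤x = record { root = mk s close ; nonNeg = 0≤s ; lower = s²≤x ; upper = λ n → <⇒≤ (x<s² n) }
  where
  approx = λ n → sqrt-approx n (seq x n) (0≤x n)
  s : ℕ → ℚ
  s n = proj₁ (approx n)
  0≤s : ∀ n → 0ℚ ≤ s n
  0≤s n = proj₁ (proj₂ (approx n))
  s²≤x : ∀ n → sq (s n) ≤ seq x n
  s²≤x n = proj₁ (proj₂ (proj₂ (approx n)))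
  x<s² : ∀ n → seq x n < sq (s n + inv n)
  x<s² n = proj₂ (proj₂ (proj₂ (approx n)))
  close : ∀ ε → 0ℚ < ε → ∃ λ N → ∀ m n → N ℕ.≤ m → N ℕ.≤ n → s m ≤ s n + ε
  close ε 0<ε =
    let τ = ½ * ½ * sq ε
        0<τ = *-pos (positive⁻¹ (½ * ½)) (*-pos 0<ε 0<ε)
        N₁ , small = inv-small (½ * ε) (½-pos 0<ε)
        N₂ , near = cauchy-≤ x τ 0<τ in
    N₁ ℕ.+ N₂ , λ m n p q → root-compare (0≤s n) 0<ε (<⇒≤ (inv-pos n)) (small n (ℕ.m+n≤o⇒m≤o N₁ q)) (≤-refl {τ}) (s²≤x m)
      (≤-trans (near m n (ℕ.m+n≤o⇒n≤o N₁ p) (ℕ.m+n≤o⇒n≤o N₁ q)) (+-monoˡ-≤ τ (<⇒≤ (x<s² n))))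

root-square : ∀ x (R : Root (seq x)) → (Root.root R *ᴿ Root.root R) ≈ᴿ x
root-square x R = (λ ε 0<ε → 0 , λ n _ → begin
    seq (s *ᴿ s) n ≡⟨ seq-* s s n ⟩
    sq (seq s n) ≤⟨ lower n ⟩
    seq x n ≤⟨ slack 0<ε ⟩
    seq x n + ε ∎) ,
  λ ε 0<ε →
    let N₀ , B , B-pos , bounded = eventuallyBounded s
        0<B = positive⁻¹ B {{B-pos}}
        0<C = +-pos (+-pos 0<B 0<B) 0<1
        δ = recip (B + B + 1ℚ) 0<C * ε
        0<δ = *-pos (recip-pos (B + B + 1ℚ) 0<C) 0<ε
        N₁ , small = inv-small δ 0<δ
        N₂ , small′ = inv-small 1ℚ 0<1 in
    N₀ ℕ.+ (N₁ ℕ.+ N₂) , λ n p →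
      let p₀ = ℕ.m+n≤o⇒m≤o N₀ p
          p₁ = ℕ.m+n≤o⇒m≤o N₁ (ℕ.m+n≤o⇒n≤o N₀ p)
          p₂ = ℕ.m+n≤o⇒n≤o N₁ (ℕ.m+n≤o⇒n≤o N₀ p)
          t = seq s n
          t≤B = subst (_≤ B) (0≤p⇒∣p∣≡p (nonNeg n)) (bounded n p₀) in begin
      seq x n ≤⟨ upper n ⟩
      sq (t + inv n) ≡⟨ expand t (inv n) ⟩
      sq t + (t + t + inv n) * inv n ≤⟨ +-monoʳ-≤ (sq t) (*-mono (+-nonNeg (+-nonNeg (nonNeg n) (nonNeg n)) (<⇒≤ (inv-pos n))) (<⇒≤ 0<δ)
                                               (+-mono-≤ (+-mono-≤ t≤B t≤B) (small′ n p₂)) (small n p₁)) ⟩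
      sq t + (B + B + 1ℚ) * δ ≡⟨ cong₂ _+_ (sym (seq-* s s n)) (cancel (B + B + 1ℚ) 0<C ε) ⟩
      seq (s *ᴿ s) n + ε ∎
  where
  open ℚ.≤-Reasoning
  open Root R renaming (root to s)
  slack : ∀ {y ε} → 0ℚ < ε → y ≤ y + ε
  slack {y} {ε} 0<ε = subst (_≤ y + ε) (+-identityʳ y) (+-monoʳ-≤ y (<⇒≤ 0<ε))
  expand : ∀ t h → (t + h) * (t + h) ≡ t * t + (t + t + h) * h
  expand = solve-∀ ring
  cancel : ∀ c 0<c e → c * (recip c 0<c * e) ≡ e
  cancel c 0<c e = trans (sym (*-assoc c (recip c 0<c) e)) (trans (cong (_* e) (trans (*-comm c (recip c 0<c)) (recip-inv c 0<c))) (*-identityˡ e))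

-- `ν` is a rational number eventually below `lam`, and the defect `τ` of the contraction at the
-- n-th approximation tends to zero; both are absorbed by `root-compare`.
root-contraction : ∀ {x′ x} (R′ : Root x′) (R : Root x) lam ν N → 0ℚ ≤ ν → ν ≤ 1ℚ → (∀ n → N ℕ.≤ n → ν ≤ seq lam n) →
  (τ : ℕ → ℚ) → (∀ ε → 0ℚ < ε → ∃ λ M → ∀ n → M ℕ.≤ n → τ n ≤ ε) → (∀ n → x′ n ≤ sq ν * x n + τ n) →
  Root.root R′ ≤ᴿ lam *ᴿ Root.root R
root-contraction {x′} {x} R′ R lam ν N 0≤ν ν≤1 ν≤lam τ τ→0 bound ε 0<ε =
  let N₁ , small = inv-small (½ * ε) (½-pos 0<ε)
      N₂ , τ-small = τ→0 (½ * ½ * sq ε) (*-pos (positive⁻¹ (½ * ½)) (*-pos 0<ε 0<ε)) in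
  N ℕ.+ (N₁ ℕ.+ N₂) , λ n p →
    let p₀ = ℕ.m+n≤o⇒m≤o N p
        p₁ = ℕ.m+n≤o⇒m≤o N₁ (ℕ.m+n≤o⇒n≤o N p)
        p₂ = ℕ.m+n≤o⇒n≤o N₁ (ℕ.m+n≤o⇒n≤o N p) in
    ≤-trans (root-compare {u = ν * seq s n} {h = ν * inv n} (*-nonNeg 0≤ν (nonNeg n)) 0<ε (*-nonNeg 0≤ν (<⇒≤ (inv-pos n)))
        (≤-trans (subst (ν * inv n ≤_) (*-identityˡ (inv n)) (*-monoʳ (<⇒≤ (inv-pos n)) ν≤1)) (small n p₁)) (τ-small n p₂)
        (Root.lower R′ n) (≤-trans (bound n) (+-monoˡ-≤ (τ n) (subst (sq ν * x n ≤_) (square ν (seq s n) (inv n)) (*-monoˡ (sq-nonNeg ν) (upper n))))))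
      (+-monoˡ-≤ ε (subst (ν * seq s n ≤_) (sym (seq-* lam s n)) (*-monoʳ (nonNeg n) (ν≤lam n p₀))))
  where
  open Root R renaming (root to s)
  square : ∀ v t h → v * v * ((t + h) * (t + h)) ≡ (v * t + v * h) * (v * t + v * h)
  square = solve-∀ ring

-- Real powers

floor : ∀ v → 0ℚ ≤ v → ∃ λ a → ι a ≤ v × v < ι (suc a)
floor v 0≤v =
  let B , v<B = archimedes v
      a , _ , below , above = switch (λ i → ι i ℚ.≤? v) 0≤v B (<⇒≱ v<B) in
  a , below , ≰⇒> above

-- The drift `V′ - V` of the exponents and the rounding error `D` may each use up half of `q`.
near-exponents : ∀ M A A′ q {V V′ D} → ι A′ ≤ V′ → V ≤ ι A + D → ι M * (V′ - V) ≤ ½ * ι q → ι M * D ≤ ½ * ι q →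
  M ℕ.* A′ ℕ.≤ M ℕ.* A ℕ.+ q
near-exponents M A A′ q {V} {V′} {D} A′≤ V≤ close small = ι-reflect (begin
  ι (M ℕ.* A′) ≡⟨ ι-* M A′ ⟩
  ι M * ι A′ ≤⟨ *-monoˡ (ι-nonNeg M) A′≤ ⟩
  ι M * V′ ≡⟨ split (ι M) V V′ ⟩
  ι M * V + ι M * (V′ - V) ≤⟨ +-mono-≤ (*-monoˡ (ι-nonNeg M) V≤) close ⟩
  ι M * (ι A + D) + ½ * ι q ≡⟨ cong (_+ ½ * ι q) (*-distribˡ-+ (ι M) (ι A) D) ⟩
  ι M * ι A + ι M * D + ½ * ι q ≤⟨ +-monoˡ-≤ (½ * ι q) (+-monoʳ-≤ (ι M * ι A) small) ⟩
  ι M * ι A + ½ * ι q + ½ * ι q ≡⟨ trans (+-assoc (ι M * ι A) (½ * ι q) (½ * ι q)) (cong₂ _+_ (sym (ι-* M A)) (half-sum (ι q))) ⟩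
  ι (M ℕ.* A) + ι q ≡⟨ ι-+ (M ℕ.* A) q ⟨
  ι (M ℕ.* A ℕ.+ q) ∎)
  where
  open ℚ.≤-Reasoning
  split : ∀ m v v′ → m * v′ ≡ m * v + m * (v′ - v)
  split = solve-∀ ring

-- The n-th approximation to `x ^ y` is `r n ^ a n`, with `r n` an approximate root of order `n + 1`
-- of `x` and `a n` the integer part of `y (n + 1)`. The Cauchy property and both clauses of
-- `IsPower` are instances of `Comparison` after clearing denominators in the exponents.
module PowerSequence
  (x y : ℝ) (N₀ : ℕ) (ℓ : ℚ) (0<ℓ : 0ℚ < ℓ) (B : ℕ)
  (ℓ≤x : ∀ n → N₀ ℕ.≤ n → ℓ ≤ seq x n) (x<1 : ∀ n → N₀ ℕ.≤ n → seq x n < 1ℚ)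
  (Y≤B : ∀ n → seq y (N₀ ℕ.+ n) ≤ ι B)
  (a : ℕ → ℕ) (r : ℕ → ℚ) (0≤r : ∀ n → 0ℚ ≤ r n) (r≤1 : ∀ n → r n ≤ 1ℚ)
  (rX : ∀ n → r n ^ suc n ≤ seq x (N₀ ℕ.+ n)) (Xr : ∀ n → seq x (N₀ ℕ.+ n) ≤ r n ^ suc n + inv n)
  (aY : ∀ n → ι (a n) ≤ seq y (N₀ ℕ.+ n) * ι (suc n)) (Ya : ∀ n → seq y (N₀ ℕ.+ n) * ι (suc n) < ι (suc (a n)))
  where
  open ℚ.≤-Reasoning

  private
    X Y ξ z : ℕ → ℚ
    X n = seq x (N₀ ℕ.+ n)
    Y n = seq y (N₀ ℕ.+ n)
    ξ n = r n ^ suc n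
    z n = r n ^ a n

    0≤ξ : ∀ n → 0ℚ ≤ ξ n
    0≤ξ n = ^-nonNeg (suc n) (0≤r n)

    0≤z : ∀ n → 0ℚ ≤ z n
    0≤z n = ^-nonNeg (a n) (0≤r n)

    z≤1 : ∀ n → z n ≤ 1ℚ
    z≤1 n = ^≤1 (a n) (0≤r n) (r≤1 n)

    ξ≤1 : ∀ n → ξ n ≤ 1ℚ
    ξ≤1 n = ^≤1 (suc n) (0≤r n) (r≤1 n)

    swap-powers : ∀ b c d e (t : ℚ) → d ℕ.* b ≡ e ℕ.* c → (t ^ b) ^ d ≡ (t ^ c) ^ e
    swap-powers b c d e t eq = trans (sym (^-* t d b)) (trans (cong (t ^_) eq) (^-* t e c))

    a≤ : ∀ n → a n ℕ.≤ B ℕ.* suc n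
    a≤ n = ι-reflect (≤-trans (aY n) (≤-trans (*-monoʳ (ι-nonNeg (suc n)) (Y≤B n)) (≤-reflexive (sym (ι-* B (suc n))))))

    below : ∀ n → Y n * ι (suc n) ≤ ι (a n) + 1ℚ
    below n = subst (Y n * ι (suc n) ≤_) (+-comm 1ℚ (ι (a n))) (<⇒≤ (Ya n))

    x-ξ : ∀ η → 0ℚ < η → ∃ λ N → ∀ m n → N ℕ.≤ m → N ℕ.≤ n → seq x m ≤ ξ n + η
    x-ξ η 0<η =
      let N₁ , near = cauchy-≤ x (½ * η) (½-pos 0<η)
          N₂ , small = inv-small (½ * η) (½-pos 0<η) in
      N₁ ℕ.+ N₂ , λ m n p q → begin
        seq x m ≤⟨ near m (N₀ ℕ.+ n) (ℕ.m+n≤o⇒m≤o N₁ p) (ℕ.≤-trans (ℕ.m+n≤o⇒m≤o N₁ q) (ℕ.m≤n+m n N₀)) ⟩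
        X n + ½ * η ≤⟨ +-monoˡ-≤ (½ * η) (≤-trans (Xr n) (+-monoʳ-≤ (ξ n) (small n (ℕ.m+n≤o⇒n≤o N₁ q)))) ⟩
        ξ n + ½ * η + ½ * η ≡⟨ trans (+-assoc (ξ n) (½ * η) (½ * η)) (cong (ξ n +_) (half-sum η)) ⟩
        ξ n + η ∎

    ξ-x : ∀ η → 0ℚ < η → ∃ λ N → ∀ m n → N ℕ.≤ m → N ℕ.≤ n → ξ m ≤ seq x n + η
    ξ-x η 0<η =
      let N₁ , near = cauchy-≤ x η 0<η in
      N₁ , λ m n p q → ≤-trans (rX m) (near (N₀ ℕ.+ m) n (ℕ.≤-trans p (ℕ.m≤n+m m N₀)) q)

    ξ-ξ : ∀ η → 0ℚ < η → ∃ λ N → ∀ m n → N ℕ.≤ m → N ℕ.≤ n → ξ m ≤ ξ n + η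
    ξ-ξ η 0<η =
      let N₁ , near = x-ξ η 0<η in
      N₁ , λ m n p q → ≤-trans (rX m) (near (N₀ ℕ.+ m) n (ℕ.≤-trans p (ℕ.m≤n+m m N₀)) q)

    ℓ′ : ℚ
    ℓ′ = ½ * ℓ

    0<ℓ′ : 0ℚ < ℓ′
    0<ℓ′ = ½-pos 0<ℓ

    ℓ′≤ℓ : ℓ′ ≤ ℓ
    ℓ′≤ℓ = subst (½ * ℓ ≤_) (*-identityˡ ℓ) (*-monoʳ {ℓ} {½} {1ℚ} (<⇒≤ 0<ℓ) (≤ᵇ⇒≤ _))

    ℓ′≤ξ : ∃ λ N → ∀ n → N ℕ.≤ n → ℓ′ ≤ ξ n
    ℓ′≤ξ = let N , small = inv-small ℓ′ 0<ℓ′ in N , λ n p → diff⇒≤ (subst (0ℚ ≤_) (lemma (ξ n) ℓ ℓ′ (half-sum ℓ))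
             (≤⇒diff (≤-trans (ℓ≤x (N₀ ℕ.+ n) (ℕ.m≤m+n N₀ n)) (≤-trans (Xr n) (+-monoʳ-≤ (ξ n) (small n p))))))
      where
      lemma : ∀ u l h → h + h ≡ l → u + h - l ≡ u - h
      lemma u .(h + h) h refl = identity u h
        where
        identity : ∀ u h → u + h - (h + h) ≡ u - h
        identity = solve-∀ ring

    scaled-inv : ∀ M → ι M * (½ * inv M) ≤ ½
    scaled-inv M = begin
      ι M * (½ * inv M) ≤⟨ *-monoʳ (<⇒≤ (½-pos (inv-pos M))) (<⇒≤ (n<1+n M)) ⟩
      ι (suc M) * (½ * inv M) ≡⟨ lemma (ι (suc M)) (inv M) ⟩
      ½ * (inv M * ι (suc M)) ≡⟨ cong (½ *_) (inv-ι M) ⟩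
      ½ ∎
      where
      lemma : ∀ a b → a * (½ * b) ≡ ½ * (b * a)
      lemma = solve-∀ ring

    double-≤ : ∀ M n → M ℕ.+ M ℕ.≤ n → ι M ≤ ½ * ι n
    double-≤ M n p = subst (_≤ ½ * ι n) (trans (cong (½ *_) (ι-+ M M)) (trans (*-distribˡ-+ ½ (ι M) (ι M)) (half-sum (ι M))))
      (*-monoˡ {½} (≤ᵇ⇒≤ _) (ι-mono p))

    close : ∀ ε → 0ℚ < ε → ∃ λ N → ∀ m n → N ℕ.≤ m → N ℕ.≤ n → z m ≤ z n + ε
    close ε 0<ε = with-M (exceeds-2 ε ℓ′ 0<ε 0<ℓ′)
      where
      with-M : (∃ λ M → 2ℚ < (1ℚ + ε) ^ M * ℓ′) → ∃ λ N → ∀ m n → N ℕ.≤ m → N ℕ.≤ n → z m ≤ z n + ε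
      with-M (M , large) =
        let N₁ , ξ-near = ξ-ξ C.η C.0<η
            N₂ , ℓ′≤ = ℓ′≤ξ
            N₃ , y-near = cauchy-≤ y (½ * inv M) (½-pos (inv-pos M)) in
        N₁ ℕ.+ (N₂ ℕ.+ (N₃ ℕ.+ (M ℕ.+ M))) , λ m n p q →
          let p₁ = ℕ.m+n≤o⇒m≤o N₁ p
              q₁ = ℕ.m+n≤o⇒m≤o N₁ q
              q₂ = ℕ.m+n≤o⇒m≤o N₂ (ℕ.m+n≤o⇒n≤o N₁ q)
              p₃ = ℕ.m+n≤o⇒m≤o N₃ (ℕ.m+n≤o⇒n≤o N₂ (ℕ.m+n≤o⇒n≤o N₁ p))
              q₃ = ℕ.m+n≤o⇒m≤o N₃ (ℕ.m+n≤o⇒n≤o N₂ (ℕ.m+n≤o⇒n≤o N₁ q))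
              p₄ = ℕ.m+n≤o⇒n≤o N₃ (ℕ.m+n≤o⇒n≤o N₂ (ℕ.m+n≤o⇒n≤o N₁ p)) in
          -- The common power `suc m * suc n`, whose predecessor is passed, clears both
          -- denominators.
          C.compare (n ℕ.+ m ℕ.* suc n) (a m ℕ.* suc n) (a n ℕ.* suc m) (0≤ξ m) (ℓ′≤ n q₂) (ξ≤1 n) (ξ-near m n p₁ q₁)
            (ℕ.≤-trans (ℕ.*-monoˡ-≤ (suc n) (a≤ m)) (ℕ.≤-reflexive (ℕ.*-assoc B (suc m) (suc n))))
            (near-exponents M (a m ℕ.* suc n) (a n ℕ.* suc m) (suc m ℕ.* suc n) {Y m * (ι (suc m) * ι (suc n))} {Y n * (ι (suc m) * ι (suc n))} {ι (suc n)}
              (subst₂ _≤_ (sym (ι-* (a n) (suc m))) (regroup₁ (Y n) (ι (suc n)) (ι (suc m))) (*-monoʳ (ι-nonNeg (suc m)) (aY n)))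
              (subst₂ _≤_ (*-assoc (Y m) (ι (suc m)) (ι (suc n))) (trans (regroup₂ (ι (a m)) (ι (suc n))) (cong (_+ ι (suc n)) (sym (ι-* (a m) (suc n))))) (*-monoʳ (ι-nonNeg (suc n)) (below m)))
              (≤-trans (≤-reflexive (regroup₃ (ι M) (Y n) (Y m) (ι (suc m) * ι (suc n))))
                (≤-trans (*-monoʳ (*-nonNeg (ι-nonNeg (suc m)) (ι-nonNeg (suc n)))
                  (≤-trans (*-monoˡ (ι-nonNeg M) (≤-trans (+-monoˡ-≤ (- Y m) (y-near (N₀ ℕ.+ n) (N₀ ℕ.+ m) (ℕ.≤-trans q₃ (ℕ.m≤n+m n N₀)) (ℕ.≤-trans p₃ (ℕ.m≤n+m m N₀)))) (≤-reflexive (+-cancel (Y m) (½ * inv M))))) (scaled-inv M)))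
                  (≤-reflexive (cong (½ *_) (sym (ι-* (suc m) (suc n)))))))
              (≤-trans (*-monoʳ (ι-nonNeg (suc n)) (double-≤ M (suc m) (ℕ.m≤n⇒m≤1+n p₄)))
                (≤-reflexive (trans (*-assoc ½ (ι (suc m)) (ι (suc n))) (cong (½ *_) (sym (ι-* (suc m) (suc n))))))))
            (0≤z n) (z≤1 n)
            (swap-powers (a m) (suc m) (suc m ℕ.* suc n) (a m ℕ.* suc n) (r m) (exponents₁ (a m) (suc m) (suc n)))
            (swap-powers (a n) (suc n) (suc m ℕ.* suc n) (a n ℕ.* suc m) (r n) (exponents₂ (a n) (suc m) (suc n)))
        where
        module C = Comparison ε ℓ′ 0<ε 0<ℓ′ B M large
        regroup₁ : ∀ y p q → y * p * q ≡ y * (q * p)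
        regroup₁ = solve-∀ ring
        regroup₂ : ∀ a q → (a + 1ℚ) * q ≡ a * q + q
        regroup₂ = solve-∀ ring
        regroup₃ : ∀ m u v w → m * (u * w - v * w) ≡ m * (u - v) * w
        regroup₃ = solve-∀ ring
        exponents₁ : ∀ a m n → m ℕ.* n ℕ.* a ≡ a ℕ.* n ℕ.* m
        exponents₁ = solveℕ
        exponents₂ : ∀ a m n → m ℕ.* n ℕ.* a ≡ a ℕ.* m ℕ.* n
        exponents₂ = solveℕ

  power : ℝ
  power = mk z close

  private
    -- υ R M is small enough for M · υ · (R + 1) ≤ ½.
    υ : ℕ → ℕ → ℚ
    υ R M = ½ * inv M * inv R

    0<υ : ∀ R M → 0ℚ < υ R M
    0<υ R M = *-pos (½-pos (inv-pos M)) (inv-pos R)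

    υ-small : ∀ R M → ι M * (υ R M * ι (suc R)) ≤ ½
    υ-small R M = ≤-trans (≤-reflexive (cong (ι M *_) (trans (*-assoc (½ * inv M) (inv R) (ι (suc R))) (trans (cong (½ * inv M *_) (inv-ι R)) (*-identityʳ (½ * inv M)))))) (scaled-inv M)

    x≤1 : ∀ n → N₀ ℕ.≤ n → seq x n ≤ 1ℚ
    x≤1 n p = <⇒≤ (x<1 n p)

    0≤x : ∀ n → N₀ ℕ.≤ n → 0ℚ ≤ seq x n
    0≤x n p = ≤-trans (<⇒≤ 0<ℓ) (ℓ≤x n p)

    eventually-above : ∀ P R → y ≤ᴿ fromℚ (ℤ.+ P / suc R) → ∀ ε → 0ℚ < ε → ∃ λ N → ∀ n → N ℕ.≤ n → seq x n ^ P ≤ z n ^ suc R + ε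
    eventually-above P R y≤ ε 0<ε = with-M (exceeds-2 ε ℓ′ 0<ε 0<ℓ′)
      where
      f : ℚ
      f = ℤ.+ P / suc R
      with-M : (∃ λ M → 2ℚ < (1ℚ + ε) ^ M * ℓ′) → ∃ λ N → ∀ n → N ℕ.≤ n → seq x n ^ P ≤ z n ^ suc R + ε
      with-M (M , large) =
        let N₁ , near = x-ξ C.η C.0<η
            N₂ , ℓ′≤ = ℓ′≤ξ
            N₃ , y-near = y≤ (υ R M) (0<υ R M) in
        N₀ ℕ.+ (N₁ ℕ.+ (N₂ ℕ.+ N₃)) , λ n p →
          let p₀ = ℕ.m+n≤o⇒m≤o N₀ p
              p₁ = ℕ.m+n≤o⇒m≤o N₁ (ℕ.m+n≤o⇒n≤o N₀ p)
              p₂ = ℕ.m+n≤o⇒m≤o N₂ (ℕ.m+n≤o⇒n≤o N₁ (ℕ.m+n≤o⇒n≤o N₀ p))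
              p₃ = ℕ.m+n≤o⇒n≤o N₂ (ℕ.m+n≤o⇒n≤o N₁ (ℕ.m+n≤o⇒n≤o N₀ p)) in
          C.compare n (P ℕ.* suc n) (a n ℕ.* suc R) (0≤x n p₀) (ℓ′≤ n p₂) (ξ≤1 n) (near n n p₁ p₁) ℕ.≤-refl
            (near-exponents M (P ℕ.* suc n) (a n ℕ.* suc R) (suc n) {f * ι (suc R) * ι (suc n)} {Y n * ι (suc R) * ι (suc n)} {0ℚ}
              (subst₂ _≤_ (sym (ι-* (a n) (suc R))) (*-swapʳ (Y n) (ι (suc n)) (ι (suc R))) (*-monoʳ (ι-nonNeg (suc R)) (aY n)))
              (≤-reflexive (trans (cong (_* ι (suc n)) (frac-ι P R)) (trans (sym (ι-* P (suc n))) (sym (+-identityʳ (ι (P ℕ.* suc n)))))))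
              (≤-trans (≤-reflexive (regroup₂ (ι M) (Y n) f (ι (suc R)) (ι (suc n))))
                (*-monoʳ (ι-nonNeg (suc n)) (≤-trans (*-monoˡ (ι-nonNeg M) (*-monoʳ (ι-nonNeg (suc R))
                  (≤-trans (+-monoˡ-≤ (- f) (y-near (N₀ ℕ.+ n) (ℕ.≤-trans p₃ (ℕ.m≤n+m n N₀)))) (≤-reflexive (+-cancel f (υ R M)))))) (υ-small R M))))
              (subst (_≤ ½ * ι (suc n)) (sym (*-zeroʳ (ι M))) (*-nonNeg {½} (≤ᵇ⇒≤ _) (ι-nonNeg (suc n)))))
            (^-nonNeg (suc R) (0≤z n)) (^≤1 (suc R) (0≤z n) (z≤1 n))
            (trans (sym (^-* (seq x n) (suc n) P)) (cong (seq x n ^_) (ℕ.*-comm (suc n) P)))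
            (trans (cong (_^ suc n) (sym (^-* (r n) (suc R) (a n)))) (swap-powers (suc R ℕ.* a n) (suc n) (suc n) (a n ℕ.* suc R) (r n) (exponents (suc R) (a n) (suc n))))
        where
        module C = Comparison ε ℓ′ 0<ε 0<ℓ′ P M large
        regroup₂ : ∀ m y f r n → m * (y * r * n - f * r * n) ≡ m * ((y - f) * r) * n
        regroup₂ = solve-∀ ring
        exponents : ∀ R a n → n ℕ.* (R ℕ.* a) ≡ a ℕ.* R ℕ.* n
        exponents = solveℕ

    eventually-below : ∀ P R → fromℚ (ℤ.+ P / suc R) ≤ᴿ y → ∀ ε → 0ℚ < ε → ∃ λ N → ∀ n → N ℕ.≤ n → z n ^ suc R ≤ seq x n ^ P + ε
    eventually-below P R ≤y ε 0<ε = with-M (exceeds-2 ε ℓ′ 0<ε 0<ℓ′)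
      where
      f : ℚ
      f = ℤ.+ P / suc R
      with-M : (∃ λ M → 2ℚ < (1ℚ + ε) ^ M * ℓ′) → ∃ λ N → ∀ n → N ℕ.≤ n → z n ^ suc R ≤ seq x n ^ P + ε
      with-M (M , large) =
        let N₁ , near = ξ-x C.η C.0<η
            N₂ , y-near = ≤y (υ R M) (0<υ R M)
            K = M ℕ.* suc R in
        N₀ ℕ.+ (N₁ ℕ.+ (N₂ ℕ.+ (K ℕ.+ K))) , λ n p →
          let p₀ = ℕ.m+n≤o⇒m≤o N₀ p
              p₁ = ℕ.m+n≤o⇒m≤o N₁ (ℕ.m+n≤o⇒n≤o N₀ p)
              p₂ = ℕ.m+n≤o⇒m≤o N₂ (ℕ.m+n≤o⇒n≤o N₁ (ℕ.m+n≤o⇒n≤o N₀ p))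
              p₃ = ℕ.m+n≤o⇒n≤o N₂ (ℕ.m+n≤o⇒n≤o N₁ (ℕ.m+n≤o⇒n≤o N₀ p)) in
          C.compare n (a n ℕ.* suc R) (P ℕ.* suc n) (0≤ξ n) (≤-trans ℓ′≤ℓ (ℓ≤x n p₀)) (x≤1 n p₀) (near n n p₁ p₁)
            (ℕ.≤-trans (ℕ.*-monoˡ-≤ (suc R) (a≤ n)) (ℕ.≤-reflexive (exponents₁ B (suc n) (suc R))))
            (near-exponents M (a n ℕ.* suc R) (P ℕ.* suc n) (suc n) {Y n * ι (suc R) * ι (suc n)} {f * ι (suc R) * ι (suc n)} {ι (suc R)}
              (≤-reflexive (trans (ι-* P (suc n)) (cong (_* ι (suc n)) (sym (frac-ι P R)))))
              (subst₂ _≤_ (*-swapʳ (Y n) (ι (suc n)) (ι (suc R))) (trans (regroup₃ (ι (a n)) (ι (suc R))) (cong (_+ ι (suc R)) (sym (ι-* (a n) (suc R))))) (*-monoʳ (ι-nonNeg (suc R)) (below n)))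
              (≤-trans (≤-reflexive (regroup₂ (ι M) f (Y n) (ι (suc R)) (ι (suc n))))
                (*-monoʳ (ι-nonNeg (suc n)) (≤-trans (*-monoˡ (ι-nonNeg M) (*-monoʳ (ι-nonNeg (suc R))
                  (≤-trans (+-monoˡ-≤ (- Y n) (y-near (N₀ ℕ.+ n) (ℕ.≤-trans p₂ (ℕ.m≤n+m n N₀)))) (≤-reflexive (+-cancel (Y n) (υ R M)))))) (υ-small R M))))
              (subst (_≤ ½ * ι (suc n)) (ι-* M (suc R)) (double-≤ K (suc n) (ℕ.m≤n⇒m≤1+n p₃))))
            (^-nonNeg P (0≤x n p₀)) (^≤1 P (0≤x n p₀) (x≤1 n p₀))
            (trans (cong (_^ suc n) (sym (^-* (r n) (suc R) (a n)))) (swap-powers (suc R ℕ.* a n) (suc n) (suc n) (a n ℕ.* suc R) (r n) (exponents (suc R) (a n) (suc n))))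
            (trans (sym (^-* (seq x n) (suc n) P)) (cong (seq x n ^_) (ℕ.*-comm (suc n) P)))
        where
        module C = Comparison ε ℓ′ 0<ε 0<ℓ′ (B ℕ.* suc R) M large
        regroup₂ : ∀ m y f r n → m * (y * r * n - f * r * n) ≡ m * ((y - f) * r) * n
        regroup₂ = solve-∀ ring
        regroup₃ : ∀ a q → (a + 1ℚ) * q ≡ a * q + q
        regroup₃ = solve-∀ ring
        exponents : ∀ R a n → n ℕ.* (R ℕ.* a) ≡ a ℕ.* R ℕ.* n
        exponents = solveℕ
        exponents₁ : ∀ B n R → B ℕ.* n ℕ.* R ≡ B ℕ.* R ℕ.* n
        exponents₁ = solveℕ

  isPower : IsPower x y power
  isPower = record
    { nonNegative = λ ε 0<ε → 0 , λ n _ → +-nonNeg (0≤z n) (<⇒≤ 0<ε)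
    ; above = above
    ; below = below′ }
    where
    above : ∀ p q .{{_ : ℕ.NonZero q}} → y ≤ᴿ fromℚ (ℤ.+ p / q) → x ^ᴿ p ≤ᴿ power ^ᴿ q
    above p zero le = contradiction refl (ℕ.≢-nonZero⁻¹ 0)
    above p (suc q) le ε 0<ε = let N , le′ = eventually-above p q le ε 0<ε in
      N , λ n k → subst₂ _≤_ (sym (seq-^ x p n)) (cong (_+ ε) (sym (seq-^ power (suc q) n))) (le′ n k)
    below′ : ∀ p q .{{_ : ℕ.NonZero q}} → fromℚ (ℤ.+ p / q) ≤ᴿ y → power ^ᴿ q ≤ᴿ x ^ᴿ p
    below′ p zero le = contradiction refl (ℕ.≢-nonZero⁻¹ 0)
    below′ p (suc q) le ε 0<ε = let N , le′ = eventually-below p q le ε 0<ε in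
      N , λ n k → subst₂ _≤_ (sym (seq-^ power (suc q) n)) (cong (_+ ε) (sym (seq-^ x p n))) (le′ n k)

power-exists : ∀ x y N₀ ℓ → 0ℚ < ℓ → ∀ B → (∀ n → N₀ ℕ.≤ n → ℓ ≤ seq x n) → (∀ n → N₀ ℕ.≤ n → seq x n < 1ℚ) →
  (∀ n → N₀ ℕ.≤ n → 0ℚ ≤ seq y n × seq y n ≤ ι B) → ∃ (IsPower x y)
power-exists x y N₀ ℓ 0<ℓ B ℓ≤x x<1 bounds = P.power , P.isPower
  where
  start : ∀ n → N₀ ℕ.≤ N₀ ℕ.+ n
  start n = ℕ.m≤m+n N₀ n
  fl = λ n → floor (seq y (N₀ ℕ.+ n) * ι (suc n)) (*-nonNeg (proj₁ (bounds (N₀ ℕ.+ n) (start n))) (ι-nonNeg (suc n)))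
  ra = λ n → root-approx n n (seq x (N₀ ℕ.+ n)) (≤-trans (<⇒≤ 0<ℓ) (ℓ≤x (N₀ ℕ.+ n) (start n))) (x<1 (N₀ ℕ.+ n) (start n))
  module P = PowerSequence x y N₀ ℓ 0<ℓ B ℓ≤x x<1 (λ n → proj₂ (bounds (N₀ ℕ.+ n) (start n)))
    (λ n → proj₁ (fl n)) (λ n → proj₁ (ra n)) (λ n → proj₁ (proj₂ (ra n))) (λ n → proj₁ (proj₂ (proj₂ (ra n))))
    (λ n → proj₁ (proj₂ (proj₂ (proj₂ (ra n))))) (λ n → proj₂ (proj₂ (proj₂ (proj₂ (ra n)))))
    (λ n → proj₁ (proj₂ (fl n))) (λ n → proj₂ (proj₂ (fl n)))

open ℝ

-- The exponent function

½^-antitone : ∀ {m n} → m ℕ.≤ n → ½ ^ n ≤ ½ ^ m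
½^-antitone {m} {n} = ^-antitone m n (≤ᵇ⇒≤ _) (≤ᵇ⇒≤ _)

½^-half : ∀ n → ½ ^ suc n + ½ ^ suc n ≡ ½ ^ n
½^-half n = half-sum (½ ^ n)

-- β(λ) = Σ_i 2^(-i-1) min(1, λ / Δ_(i+1)), truncated after n terms in the n-th approximation.
module Exponent (Δ : ℕ → ℚ) (Δ-pos : ∀ n → 0ℚ < Δ n) (Δ-antitone : ∀ {m n} → m ℕ.≤ n → Δ n ≤ Δ m) (Δ-small : ∀ n → Δ n ≤ ½ ^ n) where
  open ℚ.≤-Reasoning

  Δ⁻ : ℕ → ℚ
  Δ⁻ n = recip (Δ n) (Δ-pos n)

  0≤Δ⁻ : ∀ n → 0ℚ ≤ Δ⁻ n
  0≤Δ⁻ n = <⇒≤ (recip-pos (Δ n) (Δ-pos n))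

  term : ℕ → ℚ → ℚ
  term i x = 1ℚ ⊓ (x * Δ⁻ (suc i))

  partial : ℕ → ℚ → ℚ
  partial zero x = 0ℚ
  partial (suc n) x = partial n x + ½ ^ suc n * term n x

  term≤1 : ∀ i x → term i x ≤ 1ℚ
  term≤1 i x = p⊓q≤p 1ℚ (x * Δ⁻ (suc i))

  0≤term : ∀ i {x} → 0ℚ ≤ x → 0ℚ ≤ term i x
  0≤term i 0≤x = ⊓-glb 0≤1 (*-nonNeg 0≤x (0≤Δ⁻ (suc i)))

  -- A modulus of continuity: each of the first `J` terms has slope at most the reciprocal of `Δ J`,
  -- so within this distance it changes by at most `½ ^ J`.
  gap : ℕ → ℚ
  gap J = Δ J * ½ ^ J

  gap-pos : ∀ J → 0ℚ < gap J
  gap-pos J = *-pos (Δ-pos J) (½^-pos J)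

  term-close : ∀ i J {x y} → i ℕ.< J → x ≤ y + gap J → term i x ≤ term i y + ½ ^ J
  term-close i J {x} {y} i<J close = subst (_≤ term i y + ½ ^ J) (cancel (term i x) (½ ^ J)) (+-monoˡ-≤ (½ ^ J) (⊓-glb first second))
    where
    cancel : ∀ a b → a - b + b ≡ a
    cancel = solve-∀ ring
    first : term i x - ½ ^ J ≤ 1ℚ
    first = ≤-trans (+-mono-≤ (term≤1 i x) (neg-antimono-≤ (<⇒≤ (½^-pos J)))) (≤-reflexive (+-identityʳ 1ℚ))
    second : term i x - ½ ^ J ≤ y * Δ⁻ (suc i)
    second = begin
      term i x - ½ ^ J ≤⟨ +-monoˡ-≤ (- ½ ^ J) (p⊓q≤q 1ℚ (x * Δ⁻ (suc i))) ⟩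
      x * Δ⁻ (suc i) - ½ ^ J ≤⟨ +-monoˡ-≤ (- ½ ^ J) (*-monoʳ (0≤Δ⁻ (suc i)) close) ⟩
      (y + Δ J * ½ ^ J) * Δ⁻ (suc i) - ½ ^ J ≡⟨ expand y (Δ J) (½ ^ J) (Δ⁻ (suc i)) ⟩
      y * Δ⁻ (suc i) + (Δ⁻ (suc i) * Δ J * ½ ^ J - ½ ^ J) ≤⟨ +-monoʳ-≤ (y * Δ⁻ (suc i)) (+-monoˡ-≤ (- ½ ^ J) (*-monoʳ (<⇒≤ (½^-pos J)) unit)) ⟩
      y * Δ⁻ (suc i) + (1ℚ * ½ ^ J - ½ ^ J) ≡⟨ vanish (y * Δ⁻ (suc i)) (½ ^ J) ⟩
      y * Δ⁻ (suc i) ∎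
      where
      expand : ∀ y d h r → (y + d * h) * r - h ≡ y * r + (r * d * h - h)
      expand = solve-∀ ring
      vanish : ∀ a h → a + (1ℚ * h - h) ≡ a
      vanish = solve-∀ ring
      unit : Δ⁻ (suc i) * Δ J ≤ 1ℚ
      unit = subst (Δ⁻ (suc i) * Δ J ≤_) (recip-inv (Δ (suc i)) (Δ-pos (suc i))) (*-monoˡ (0≤Δ⁻ (suc i)) (Δ-antitone i<J))

  partial-nonNeg : ∀ n {x} → 0ℚ ≤ x → 0ℚ ≤ partial n x
  partial-nonNeg zero 0≤x = ≤-refl
  partial-nonNeg (suc n) 0≤x = +-nonNeg (partial-nonNeg n 0≤x) (*-nonNeg (<⇒≤ (½^-pos (suc n))) (0≤term n 0≤x))

  partial-mono : ∀ J k {x} → 0ℚ ≤ x → partial J x ≤ partial (k ℕ.+ J) x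
  partial-mono J zero 0≤x = ≤-refl
  partial-mono J (suc k) {x} 0≤x = ≤-trans (partial-mono J k 0≤x)
    (subst (_≤ partial (suc k ℕ.+ J) x) (+-identityʳ (partial (k ℕ.+ J) x))
      (+-monoʳ-≤ (partial (k ℕ.+ J) x) (*-nonNeg (<⇒≤ (½^-pos (suc (k ℕ.+ J)))) (0≤term (k ℕ.+ J) 0≤x))))

  -- The weights still to come sum to `½ ^ n`, so the truncations with this bound added can only
  -- decrease.
  partial-tail : ∀ J k x → partial (k ℕ.+ J) x + ½ ^ (k ℕ.+ J) ≤ partial J x + ½ ^ J
  partial-tail J zero x = ≤-refl
  partial-tail J (suc k) x = ≤-trans (begin
    partial n x + ½ ^ suc n * term n x + ½ ^ suc n ≤⟨ +-monoˡ-≤ (½ ^ suc n) (+-monoʳ-≤ (partial n x) (*-monoˡ (<⇒≤ (½^-pos (suc n))) (term≤1 n x))) ⟩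
    partial n x + ½ ^ suc n * 1ℚ + ½ ^ suc n ≡⟨ collect (partial n x) (½ ^ suc n) ⟩
    partial n x + (½ ^ suc n + ½ ^ suc n) ≡⟨ cong (partial n x +_) (½^-half n) ⟩
    partial n x + ½ ^ n ∎) (partial-tail J k x)
    where
    n = k ℕ.+ J
    collect : ∀ a h → a + h * 1ℚ + h ≡ a + (h + h)
    collect = solve-∀ ring

  partial≤1 : ∀ n x → partial n x ≤ 1ℚ
  partial≤1 n x = ≤-trans (subst (_≤ partial n x + ½ ^ n) (+-identityʳ (partial n x)) (+-monoʳ-≤ (partial n x) (<⇒≤ (½^-pos n))))
    (subst (λ m → partial m x + ½ ^ m ≤ 1ℚ) (ℕ.+-identityʳ n) (partial-tail 0 n x))

  partial-close : ∀ J n {x y} → n ℕ.≤ J → x ≤ y + gap J → partial n x ≤ partial n y + (1ℚ - ½ ^ n) * ½ ^ J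
  partial-close J zero {x} {y} _ close = ≤-reflexive (sym (lemma (½ ^ J)))
    where
    lemma : ∀ h → 0ℚ + (1ℚ - 1ℚ) * h ≡ 0ℚ
    lemma = solve-∀ ring
  partial-close J (suc n) {x} {y} n<J close = begin
    partial n x + ½ ^ suc n * term n x
      ≤⟨ +-mono-≤ (partial-close J n (ℕ.<⇒≤ n<J) close) (*-monoˡ (<⇒≤ (½^-pos (suc n))) (term-close n J {x} {y} n<J close)) ⟩
    partial n y + (1ℚ - ½ ^ n) * ½ ^ J + ½ ^ suc n * (term n y + ½ ^ J)
      ≡⟨ cong (λ t → partial n y + (1ℚ - t) * ½ ^ J + ½ ^ suc n * (term n y + ½ ^ J)) (sym (½^-half n)) ⟩
    partial n y + (1ℚ - (½ ^ suc n + ½ ^ suc n)) * ½ ^ J + ½ ^ suc n * (term n y + ½ ^ J)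
      ≡⟨ collect (partial n y) (½ ^ suc n) (½ ^ J) (term n y) ⟩
    partial n y + ½ ^ suc n * term n y + (1ℚ - ½ ^ suc n) * ½ ^ J ∎
    where
    collect : ∀ a h g t → a + (1ℚ - (h + h)) * g + h * (t + g) ≡ a + h * t + (1ℚ - h) * g
    collect = solve-∀ ring

  partial-lipschitz : ∀ J m n {x y} → J ℕ.≤ m → J ℕ.≤ n → 0ℚ ≤ y → x ≤ y + gap J → partial m x ≤ partial n y + (½ ^ J + ½ ^ J)
  partial-lipschitz J m n {x} {y} J≤m J≤n 0≤y close with ≤⇒∃+ J≤m | ≤⇒∃+ J≤n
  ... | k , refl | l , refl = begin
    partial (k ℕ.+ J) x ≤⟨ subst (_≤ partial (k ℕ.+ J) x + ½ ^ (k ℕ.+ J)) (+-identityʳ (partial (k ℕ.+ J) x)) (+-monoʳ-≤ (partial (k ℕ.+ J) x) (<⇒≤ (½^-pos (k ℕ.+ J)))) ⟩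
    partial (k ℕ.+ J) x + ½ ^ (k ℕ.+ J) ≤⟨ partial-tail J k x ⟩
    partial J x + ½ ^ J ≤⟨ +-monoˡ-≤ (½ ^ J) (partial-close J J ℕ.≤-refl close) ⟩
    partial J y + (1ℚ - ½ ^ J) * ½ ^ J + ½ ^ J ≤⟨ +-monoˡ-≤ (½ ^ J) (+-mono-≤ (partial-mono J l 0≤y) (*-monoʳ (<⇒≤ (½^-pos J)) tail≤1)) ⟩
    partial (l ℕ.+ J) y + 1ℚ * ½ ^ J + ½ ^ J ≡⟨ collect (partial (l ℕ.+ J) y) (½ ^ J) ⟩
    partial (l ℕ.+ J) y + (½ ^ J + ½ ^ J) ∎
    where
    collect : ∀ a h → a + 1ℚ * h + h ≡ a + (h + h)
    collect = solve-∀ ring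
    tail≤1 : 1ℚ - ½ ^ J ≤ 1ℚ
    tail≤1 = subst (1ℚ - ½ ^ J ≤_) (+-identityʳ 1ℚ) (+-monoʳ-≤ 1ℚ (neg-antimono-≤ (<⇒≤ (½^-pos J))))

  partial-0 : ∀ n → partial n 0ℚ ≡ 0ℚ
  partial-0 zero = refl
  partial-0 (suc n) = trans (cong₂ _+_ (partial-0 n) (trans (cong (½ ^ suc n *_) (trans (cong (1ℚ ⊓_) (*-zeroˡ (Δ⁻ (suc n)))) (p≥q⇒p⊓q≡q 0≤1))) (*-zeroʳ (½ ^ suc n)))) (+-identityʳ 0ℚ)

  -- For such `x` all terms from index `j` on are saturated, and their weights add up to `½ ^ j` up
  -- to the truncation.
  partial-lower : ∀ j k {x} → 0ℚ ≤ x → Δ (suc j) ≤ x → ½ ^ j ≤ partial (k ℕ.+ j) x + ½ ^ (k ℕ.+ j)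
  partial-lower j zero {x} 0≤x le = subst (_≤ partial j x + ½ ^ j) (+-identityˡ (½ ^ j)) (+-monoˡ-≤ (½ ^ j) (partial-nonNeg j 0≤x))
  partial-lower j (suc k) {x} 0≤x le = ≤-trans (partial-lower j k 0≤x le) (≤-reflexive (begin-equality
    partial n x + ½ ^ n ≡⟨ cong (partial n x +_) (sym (½^-half n)) ⟩
    partial n x + (½ ^ suc n + ½ ^ suc n) ≡⟨ collect (partial n x) (½ ^ suc n) ⟩
    partial n x + ½ ^ suc n * 1ℚ + ½ ^ suc n ≡⟨ cong (λ t → partial n x + ½ ^ suc n * t + ½ ^ suc n) (sym saturated) ⟩
    partial n x + ½ ^ suc n * term n x + ½ ^ suc n ∎))
    where
    n = k ℕ.+ j
    collect : ∀ a h → a + (h + h) ≡ a + h * 1ℚ + h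
    collect = solve-∀ ring
    saturated : term n x ≡ 1ℚ
    saturated = p≤q⇒p⊓q≡p (subst (_≤ x * Δ⁻ (suc n)) (trans (*-comm (Δ (suc n)) (Δ⁻ (suc n))) (recip-inv (Δ (suc n)) (Δ-pos (suc n))))
      (*-monoʳ (0≤Δ⁻ (suc n)) (≤-trans (Δ-antitone (s≤s (ℕ.m≤n+m j k))) le)))

  small-tail : ∀ ε → 0ℚ < ε → ∃ λ J → ½ ^ J + ½ ^ J ≤ ε
  small-tail ε 0<ε = let J , le = ½^-small (½ * ε) (½-pos 0<ε) in J , ≤-trans (+-mono-≤ le le) (≤-reflexive (half-sum ε))

  eventually-positive : ∀ lam → ∃ λ ε → 0ℚ < ε × ∃ λ N → ∀ n → N ℕ.≤ n → ε ≤ seq (value lam) n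
  eventually-positive lam = let ε , 0<ε , N , p = positive lam in ε , 0<ε , N , λ n k → subst (_≤ seq (value lam) n) (+-identityˡ ε) (p n k)

  eventually-nonNeg : ∀ lam → ∃ λ N → ∀ n → N ℕ.≤ n → 0ℚ ≤ seq (value lam) n
  eventually-nonNeg lam = let ε , 0<ε , N , p = eventually-positive lam in N , λ n k → ≤-trans (<⇒≤ 0<ε) (p n k)

  βseq : OpenUnitInterval → ℕ → ℚ
  βseq lam n = partial n (seq (value lam) n)

  β-compare : ∀ lam mu → (∀ ε → 0ℚ < ε → ∃ λ N → ∀ m n → N ℕ.≤ m → N ℕ.≤ n → seq (value lam) m ≤ seq (value mu) n + ε) →
    ∀ ε → 0ℚ < ε → ∃ λ N → ∀ m n → N ℕ.≤ m → N ℕ.≤ n → βseq lam m ≤ βseq mu n + ε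
  β-compare lam mu close ε 0<ε =
    let J , tail = small-tail ε 0<ε
        N₁ , near = close (gap J) (gap-pos J)
        N₂ , nonNeg = eventually-nonNeg mu in
    J ℕ.+ (N₁ ℕ.+ N₂) , λ m n p q →
      ≤-trans (partial-lipschitz J m n (ℕ.m+n≤o⇒m≤o J p) (ℕ.m+n≤o⇒m≤o J q) (nonNeg n (ℕ.m+n≤o⇒n≤o N₁ (ℕ.m+n≤o⇒n≤o J q)))
          (near m n (ℕ.m+n≤o⇒m≤o N₁ (ℕ.m+n≤o⇒n≤o J p)) (ℕ.m+n≤o⇒m≤o N₁ (ℕ.m+n≤o⇒n≤o J q))))
        (+-monoʳ-≤ (βseq mu n) tail)

  β : OpenUnitInterval → ℝ
  β lam = mk (βseq lam) (β-compare lam lam (cauchy-≤ (value lam)))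

  β-≤ : ∀ lam mu → value lam ≤ᴿ value mu → β lam ≤ᴿ β mu
  β-≤ lam mu le ε 0<ε =
    let N , near = β-compare lam mu close ε 0<ε in N , λ n k → near n n k k
    where
    close : ∀ ε → 0ℚ < ε → ∃ λ N → ∀ m n → N ℕ.≤ m → N ℕ.≤ n → seq (value lam) m ≤ seq (value mu) n + ε
    close ε 0<ε =
      let N₁ , near = cauchy-≤ (value lam) (½ * ε) (½-pos 0<ε)
          N₂ , below = le (½ * ε) (½-pos 0<ε) in
      N₁ ℕ.+ N₂ , λ m n p q → begin
        seq (value lam) m ≤⟨ near m n (ℕ.m+n≤o⇒m≤o N₁ p) (ℕ.m+n≤o⇒m≤o N₁ q) ⟩
        seq (value lam) n + ½ * ε ≤⟨ +-monoˡ-≤ (½ * ε) (below n (ℕ.m+n≤o⇒n≤o N₁ q)) ⟩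
        seq (value mu) n + ½ * ε + ½ * ε ≡⟨ trans (+-assoc (seq (value mu) n) (½ * ε) (½ * ε)) (cong (seq (value mu) n +_) (half-sum ε)) ⟩
        seq (value mu) n + ε ∎

  β-extensional : Extensional β
  β-extensional lam mu (p , q) = β-≤ lam mu p , β-≤ mu lam q

  β-lower : ∀ lam j lo N → Δ (suc j) ≤ lo → (∀ n → N ℕ.≤ n → lo ≤ seq (value lam) n) → ∀ n → N ℕ.+ j ℕ.≤ n → ½ ^ j ≤ βseq lam n + ½ ^ n
  β-lower lam j lo N Δ≤lo lo≤ n p with ≤⇒∃+ (ℕ.m+n≤o⇒n≤o N p)
  ... | k , refl = partial-lower j k (≤-trans (<⇒≤ (Δ-pos (suc j))) le) le
    where
    le : Δ (suc j) ≤ seq (value lam) (k ℕ.+ j)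
    le = ≤-trans Δ≤lo (lo≤ (k ℕ.+ j) (ℕ.m+n≤o⇒m≤o N p))

  β-positive : ∀ lam → 0ᴿ <ᴿ β lam
  β-positive lam =
    let ε , 0<ε , N , p = eventually-positive lam
        j , small = ½^-small ε 0<ε in
    ½ ^ suc j , ½^-pos (suc j) , N ℕ.+ suc j , λ n k →
      let half = ½^-antitone {suc j} {n} (ℕ.m+n≤o⇒n≤o N k)
          le = β-lower lam j ε N (≤-trans (Δ-small (suc j)) (≤-trans (½^-antitone (ℕ.n≤1+n j)) small)) p n (ℕ.≤-trans (ℕ.+-monoʳ-≤ N (ℕ.n≤1+n j)) k) in
      diff⇒≤ (subst (0ℚ ≤_) (lemma (½ ^ suc j) (½ ^ n) (βseq lam n)) (+-nonNeg (≤⇒diff (subst (_≤ βseq lam n + ½ ^ n) (sym (½^-half j)) le)) (≤⇒diff half)))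
    where
    lemma : ∀ h t b → b + t - (h + h) + (h - t) ≡ b - (0ℚ + h)
    lemma = solve-∀ ring

  β-tends : TendsTo0At0⁺ β
  β-tends ε (e , 0<e , N , e≤) = from-tail (small-tail (½ * e) (½-pos 0<e))
    where
    e≤′ : ∀ n → N ℕ.≤ n → e ≤ seq ε n
    e≤′ n k = subst (_≤ seq ε n) (+-identityˡ e) (e≤ n k)
    from-tail : (∃ λ J → ½ ^ J + ½ ^ J ≤ ½ * e) → ∃ λ δ → 0ᴿ <ᴿ δ × (∀ x → value x <ᴿ δ → β x <ᴿ ε × -ᴿ ε <ᴿ β x)
    from-tail (J , tail) = fromℚ (gap J) , (gap J , gap-pos J , 0 , λ n _ → ≤-reflexive (+-identityˡ (gap J))) , near
      where
      near : ∀ x → value x <ᴿ fromℚ (gap J) → β x <ᴿ ε × -ᴿ ε <ᴿ β x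
      near lam (g , 0<g , N₁ , below) =
        (½ * e , ½-pos 0<e , N ℕ.+ (J ℕ.+ N₁) , λ n k →
          let k₀ = ℕ.m+n≤o⇒m≤o N k
              k₁ = ℕ.m+n≤o⇒m≤o J (ℕ.m+n≤o⇒n≤o N k)
              k₂ = ℕ.m+n≤o⇒n≤o J (ℕ.m+n≤o⇒n≤o N k) in begin
          βseq lam n + ½ * e ≤⟨ +-monoˡ-≤ (½ * e) (partial-lipschitz J n n k₁ k₁ (≤-refl {0ℚ}) (x≤gap n k₂)) ⟩
          partial n 0ℚ + (½ ^ J + ½ ^ J) + ½ * e ≤⟨ +-monoˡ-≤ (½ * e) (+-mono-≤ (≤-reflexive (partial-0 n)) tail) ⟩
          0ℚ + ½ * e + ½ * e ≡⟨ trans (cong (_+ ½ * e) (+-identityˡ (½ * e))) (half-sum e) ⟩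
          e ≤⟨ e≤′ n k₀ ⟩
          seq ε n ∎) ,
        (e , 0<e , N ℕ.+ N₂ , λ n k → begin
          seq (-ᴿ ε) n + e ≡⟨ cong (_+ e) (seq-neg ε n) ⟩
          - seq ε n + e ≤⟨ +-monoˡ-≤ e (neg-antimono-≤ (e≤′ n (ℕ.m+n≤o⇒m≤o N k))) ⟩
          - e + e ≡⟨ +-inverseˡ e ⟩
          0ℚ ≤⟨ partial-nonNeg n (nonNeg n (ℕ.m+n≤o⇒n≤o N k)) ⟩
          βseq lam n ∎)
        where
        N₂ = proj₁ (eventually-nonNeg lam)
        nonNeg = proj₂ (eventually-nonNeg lam)
        x≤gap : ∀ n → N₁ ℕ.≤ n → seq (value lam) n ≤ 0ℚ + gap J
        x≤gap n k = ≤-trans (subst (_≤ seq (value lam) n + g) (+-identityʳ (seq (value lam) n)) (+-monoʳ-≤ (seq (value lam) n) (<⇒≤ 0<g)))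
          (≤-trans (below n k) (≤-reflexive (sym (+-identityˡ (gap J)))))

-- Thresholds and the choice of a gadget

module Gadgetⱼ (j : ℕ) (g : Gadget (2 ℕ.^ j)) where
  open Gadget g public

  q p : ℕ
  q = 2 ℕ.^ j
  p = suc (q ℕ.+ q)

  0≤ν : 0ℚ ≤ ν
  0≤ν = <⇒≤ 0<ν

  ν^p≤½ : ν ^ p ≤ ½
  ν^p≤½ = ≤-trans (subst (_≤ (2ℚ ^ (slope ℕ.* 2)) ^ q * ν ^ p) (*-identityˡ (ν ^ p))
    (*-monoʳ (^-nonNeg p 0≤ν) (1≤^ q (1≤^ (slope ℕ.* 2) (≤ᵇ⇒≤ _))))) efficient

  ν≤1 : ν ≤ 1ℚ
  ν≤1 = ^-cancel (q ℕ.+ q) 0≤1 (subst (ν ^ p ≤_) (sym (1^ p)) (≤-trans ν^p≤½ (≤ᵇ⇒≤ _)))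

  -- Collects the costs that do not grow with the number of rounds: the start of the walk, one
  -- surplus round, and the factor 2 by which `lo` may miss the real number.
  E : ℕ
  E = q ℕ.* ((offset ℕ.+ slope) ℕ.* 2) ℕ.+ p

  threshold : ℚ
  threshold = ν ^ E

  threshold-pos : 0ℚ < threshold
  threshold-pos = ^-pos E 0<ν

  width : ℕ → ℕ
  width t = (offset ℕ.+ t ℕ.* slope) ℕ.* 2

  steps : ∀ lo → 0ℚ < lo → lo < 1ℚ → ∃ λ t → lo < ν ^ t × ν ^ suc t ≤ lo
  steps lo 0<lo lo<1 =
    let N , small = ½^-small lo 0<lo
        t , _ , above , below = switch (λ t → lo ℚ.<? ν ^ t) lo<1 (N ℕ.* p)
          (λ lo< → <⇒≱ lo< (≤-trans (≤-reflexive (^-* ν N p)) (≤-trans (^-mono N (^-nonNeg p 0≤ν) ν^p≤½) small))) in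
    t , above , ≮⇒≥ below

  -- The `t` rounds with `lo < ν ^ t` each contribute the factor ½ from `efficient`; everything else
  -- is in `E`.
  cost : ∀ lo t → 0ℚ ≤ lo → lo < ν ^ t → (2ℚ ^ width (suc t)) ^ q * (2ℚ * lo) ^ p ≤ 2ℚ ^ E * ½ ^ t
  cost lo t 0≤lo lo<ν^t = begin
    (2ℚ ^ width (suc t)) ^ q * (2ℚ * lo) ^ p
      ≤⟨ *-monoˡ (^-nonNeg q (^-nonNeg (width (suc t)) 0≤2)) (^-mono p (*-nonNeg 0≤2 0≤lo) (*-monoˡ 0≤2 (<⇒≤ lo<ν^t))) ⟩
    (2ℚ ^ width (suc t)) ^ q * (2ℚ * ν ^ t) ^ p
      ≡⟨ cong₂ _*_ (sym (^-* 2ℚ q (width (suc t)))) (^-distrib-* 2ℚ (ν ^ t) p) ⟩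
    2ℚ ^ (q ℕ.* width (suc t)) * (2ℚ ^ p * (ν ^ t) ^ p)
      ≡⟨ *-assoc (2ℚ ^ (q ℕ.* width (suc t))) (2ℚ ^ p) ((ν ^ t) ^ p) ⟨
    2ℚ ^ (q ℕ.* width (suc t)) * 2ℚ ^ p * (ν ^ t) ^ p
      ≡⟨ cong (_* (ν ^ t) ^ p) (trans (sym (^-+ 2ℚ (q ℕ.* width (suc t)) p)) (trans (cong (2ℚ ^_) (exponents q offset slope p t)) (^-+ 2ℚ E (t ℕ.* (q ℕ.* (slope ℕ.* 2)))))) ⟩
    2ℚ ^ E * 2ℚ ^ (t ℕ.* (q ℕ.* (slope ℕ.* 2))) * (ν ^ t) ^ p
      ≡⟨ trans (cong₂ (λ a b → 2ℚ ^ E * a * b) (trans (^-* 2ℚ t (q ℕ.* (slope ℕ.* 2))) (cong (_^ t) (^-* 2ℚ q (slope ℕ.* 2)))) (trans (sym (^-* ν p t)) (trans (cong (ν ^_) (ℕ.*-comm p t)) (^-* ν t p))))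
           (trans (*-assoc (2ℚ ^ E) (((2ℚ ^ (slope ℕ.* 2)) ^ q) ^ t) ((ν ^ p) ^ t)) (cong (2ℚ ^ E *_) (sym (^-distrib-* ((2ℚ ^ (slope ℕ.* 2)) ^ q) (ν ^ p) t)))) ⟩
    2ℚ ^ E * ((2ℚ ^ (slope ℕ.* 2)) ^ q * ν ^ p) ^ t
      ≤⟨ *-monoˡ (^-nonNeg E 0≤2) (^-mono t (*-nonNeg (^-nonNeg q (^-nonNeg (slope ℕ.* 2) 0≤2)) (^-nonNeg p 0≤ν)) efficient) ⟩
    2ℚ ^ E * ½ ^ t ∎
    where
    open ℚ.≤-Reasoning
    0≤2 : 0ℚ ≤ 2ℚ
    0≤2 = ≤ᵇ⇒≤ _
    exponents : ∀ q o s p t → q ℕ.* ((o ℕ.+ suc t ℕ.* s) ℕ.* 2) ℕ.+ p ≡ q ℕ.* ((o ℕ.+ s) ℕ.* 2) ℕ.+ p ℕ.+ t ℕ.* (q ℕ.* (s ℕ.* 2))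
    exponents = solveℕ

  -- Below `ν ^ E` at least `E` rounds are made, and their spare factors pay for `2 ^ E`.
  cost-below-threshold : ∀ lo t → 0ℚ ≤ lo → lo < ν ^ t → ν ^ suc t ≤ lo → lo < threshold → (2ℚ ^ width (suc t)) ^ q * (2ℚ * lo) ^ p ≤ 1ℚ
  cost-below-threshold lo t 0≤lo above below lo<threshold = ≤-trans (cost lo t 0≤lo above)
    (≤-trans (*-monoˡ (^-nonNeg E (≤ᵇ⇒≤ _)) (½^-antitone E≤t)) (≤-reflexive (trans (*-comm (2ℚ ^ E) (½ ^ E)) (½^-2^ E))))
    where
    E≤t : E ℕ.≤ t
    E≤t with E ℕ.≤? t
    ... | yes p = p
    ... | no ¬p = contradiction (≤-trans (^-antitone (suc t) E 0≤ν ν≤1 (ℕ.≰⇒> ¬p)) below) (<⇒≱ lo<threshold)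

-- Opaque, so that the large numerical parameters of the gadgets stay symbolic.
opaque
  gadgets : ∀ j → Gadget (2 ℕ.^ j)
  gadgets j = gadget (2 ℕ.^ j)

threshold : ℕ → ℚ
threshold j = Gadgetⱼ.threshold j (gadgets j)

-- The minimum keeps the sequence decreasing and below the thresholds; the factor ½ makes it tend to
-- zero.
Δ : ℕ → ℚ
Δ zero = 1ℚ
Δ (suc j) = ½ * (Δ j ⊓ threshold (suc j))

Δ-pos : ∀ j → 0ℚ < Δ j
Δ-pos zero = 0<1
Δ-pos (suc j) = ½-pos (min-pos (Δ-pos j) (Gadgetⱼ.threshold-pos (suc j) (gadgets (suc j))))
  where
  min-pos : ∀ {a b} → 0ℚ < a → 0ℚ < b → 0ℚ < a ⊓ b
  min-pos {a} {b} p q with ⊓-sel a b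
  ... | inj₁ e = subst (0ℚ <_) (sym e) p
  ... | inj₂ e = subst (0ℚ <_) (sym e) q

private
  half-≤ : ∀ {a} → 0ℚ ≤ a → ½ * a ≤ a
  half-≤ {a} 0≤a = subst (½ * a ≤_) (*-identityˡ a) (*-monoʳ {a} {½} {1ℚ} 0≤a (≤ᵇ⇒≤ _))

  Δ-suc≤ : ∀ j → Δ (suc j) ≤ Δ j ⊓ threshold (suc j)
  Δ-suc≤ j = half-≤ (⊓-glb (<⇒≤ (Δ-pos j)) (<⇒≤ (Gadgetⱼ.threshold-pos (suc j) (gadgets (suc j)))))

Δ≤threshold : ∀ j → Δ (suc j) ≤ threshold (suc j)
Δ≤threshold j = ≤-trans (Δ-suc≤ j) (p⊓q≤q (Δ j) (threshold (suc j)))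

Δ-antitone : ∀ {m n} → m ℕ.≤ n → Δ n ≤ Δ m
Δ-antitone {m} m≤n with ≤⇒∃+ m≤n
... | o , refl = go o
  where
  go : ∀ o → Δ (o ℕ.+ m) ≤ Δ m
  go zero = ≤-refl
  go (suc o) = ≤-trans (Δ-suc≤ (o ℕ.+ m)) (≤-trans (p⊓q≤p (Δ (o ℕ.+ m)) (threshold (suc (o ℕ.+ m)))) (go o))

Δ-small : ∀ j → Δ j ≤ ½ ^ j
Δ-small zero = ≤-refl
Δ-small (suc j) = *-monoˡ {½} (≤ᵇ⇒≤ _) (≤-trans (p⊓q≤p (Δ j) (threshold (suc j))) (Δ-small j))

open Exponent Δ Δ-pos Δ-antitone Δ-small public using (β; β-extensional; β-positive; β-tends; βseq; β-lower; partial-nonNeg; partial≤1)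

-- The cost of gadget 0, which serves all `lam` from level 0 without a threshold; the other gadgets
-- are used where their cost is at most 1.
C₀ : ℚ
C₀ = 2ℚ ^ Gadgetⱼ.E 0 (gadgets 0)

1≤C₀ : 1ℚ ≤ C₀
1≤C₀ = 1≤^ (Gadgetⱼ.E 0 (gadgets 0)) (≤ᵇ⇒≤ _)

-- All choices are made from a rational `lo` that approximates `lam` from below up to a factor 2,
-- since `lam` itself cannot be compared with thresholds decidably.
record Selection (lam : OpenUnitInterval) : Set where
  field
    lo : ℚ
    0<lo : 0ℚ < lo
    lo<1 : lo < 1ℚ
    N : ℕ
    lo≤ : ∀ n → N ℕ.≤ n → lo ≤ seq (value lam) n
    ≤2lo : ∀ n → N ℕ.≤ n → seq (value lam) n ≤ 2ℚ * lo
    <1 : ∀ n → N ℕ.≤ n → seq (value lam) n < 1ℚ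
    j t : ℕ
    Δ≤lo : Δ (suc j) ≤ lo
    contracts : Gadget.ν (gadgets j) ^ suc t ≤ lo
    bounded : (2ℚ ^ Gadgetⱼ.width j (gadgets j) (suc t)) ^ (2 ℕ.^ j) * (2ℚ * lo) ^ Gadgetⱼ.p j (gadgets j) ≤ C₀ ^ (2 ℕ.^ j)

select : ∀ lam → Selection lam
select lam = record { lo = lo ; 0<lo = 0<lo ; lo<1 = lo<1 ; N = N ; lo≤ = lo≤ ; ≤2lo = ≤2lo ; <1 = <1
                    ; j = j ; t = t ; Δ≤lo = ≮⇒≥ (proj₂ (proj₂ (proj₂ level))) ; contracts = proj₂ (proj₂ step′) ; bounded = bounded j (proj₁ (proj₂ (proj₂ level))) step′ }
  where
  open ℚ.≤-Reasoning
  x = seq (value lam)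
  ε = proj₁ (positive lam)
  0<ε = proj₁ (proj₂ (positive lam))
  N₀ = proj₁ (proj₂ (proj₂ (positive lam)))
  ε≤ : ∀ n → N₀ ℕ.≤ n → ε ≤ x n
  ε≤ n k = subst (_≤ x n) (+-identityˡ ε) (proj₂ (proj₂ (proj₂ (positive lam))) n k)
  η : ℚ
  -- `lam` is eventually at least `4 η`, so for an approximation `v` within `η` the value `v - η` is
  -- positive and `v + η ≤ 2 (v - η)`.
  η = ½ * (½ * ε)
  0<η = ½-pos (½-pos 0<ε)
  η4 : η + η + (η + η) ≡ ε
  η4 = trans (cong₂ _+_ (half-sum (½ * ε)) (half-sum (½ * ε))) (half-sum ε)
  near = cauchy-≤ (value lam) η 0<η
  N₁ = proj₁ near
  below = proj₂ (proj₂ (below-1 lam))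
  N₂ = proj₁ below
  N = N₀ ℕ.+ (N₁ ℕ.+ N₂)
  N₁≤ : ∀ {n} → N ℕ.≤ n → N₁ ℕ.≤ n
  N₁≤ k = ℕ.m+n≤o⇒m≤o N₁ (ℕ.m+n≤o⇒n≤o N₀ k)
  v = x N
  lo = v - η
  v≥ : η + η + (η + η) ≤ v
  v≥ = subst (_≤ v) (sym η4) (ε≤ N (ℕ.m≤m+n N₀ (N₁ ℕ.+ N₂)))
  0<lo : 0ℚ < lo
  0<lo = <-≤-trans 0<η (diff⇒≤ (subst (0ℚ ≤_) (lemma v η) (+-nonNeg (≤⇒diff v≥) (+-nonNeg (<⇒≤ 0<η) (<⇒≤ 0<η)))))
    where
    lemma : ∀ v e → v - (e + e + (e + e)) + (e + e) ≡ v - e - e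
    lemma = solve-∀ ring
  lo≤ : ∀ n → N ℕ.≤ n → lo ≤ x n
  lo≤ n k = diff⇒≤ (subst (0ℚ ≤_) (lemma (x n) v η) (≤⇒diff (proj₂ near N n (N₁≤ ℕ.≤-refl) (N₁≤ k))))
    where
    lemma : ∀ x v e → x + e - v ≡ x - (v - e)
    lemma = solve-∀ ring
  ≤2lo : ∀ n → N ℕ.≤ n → x n ≤ 2ℚ * lo
  ≤2lo n k = ≤-trans (proj₂ near n N (N₁≤ k) (N₁≤ ℕ.≤-refl))
    (diff⇒≤ (subst (0ℚ ≤_) (lemma v η) (+-nonNeg (≤⇒diff v≥) (<⇒≤ 0<η))))
    where
    lemma : ∀ v e → v - (e + e + (e + e)) + e ≡ (1ℚ + 1ℚ) * (v - e) - (v + e)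
    lemma = solve-∀ ring
  <1 : ∀ n → N ℕ.≤ n → x n < 1ℚ
  <1 n k = <-≤-trans (subst (_< x n + proj₁ (below-1 lam)) (+-identityʳ (x n)) (+-monoʳ-< (x n) (proj₁ (proj₂ (below-1 lam)))))
    (proj₂ below n (ℕ.m+n≤o⇒n≤o N₁ (ℕ.m+n≤o⇒n≤o N₀ k)))
  lo<1 : lo < 1ℚ
  lo<1 = ≤-<-trans (lo≤ N ℕ.≤-refl) (<1 N ℕ.≤-refl)
  deep = ½^-small lo 0<lo
  -- The search starts at `Δ 0 = 1` and stops by `Δ-small`; the level found satisfies
  -- `Δ (suc j) ≤ lo < Δ j`.
  level = switch (λ j → lo ℚ.<? Δ j) lo<1 (proj₁ deep) (λ lo<Δ → <⇒≱ lo<Δ (≤-trans (Δ-small (proj₁ deep)) (proj₂ deep)))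
  j = proj₁ level
  step′ = Gadgetⱼ.steps j (gadgets j) lo 0<lo lo<1
  t = proj₁ step′
  0≤lo = <⇒≤ 0<lo
  bounded : ∀ j → lo < Δ j → (s : ∃ λ t → lo < Gadget.ν (gadgets j) ^ t × Gadget.ν (gadgets j) ^ suc t ≤ lo) →
    (2ℚ ^ Gadgetⱼ.width j (gadgets j) (suc (proj₁ s))) ^ (2 ℕ.^ j) * (2ℚ * lo) ^ Gadgetⱼ.p j (gadgets j) ≤ C₀ ^ (2 ℕ.^ j)
  bounded zero _ (t , above , _) = ≤-trans (Gadgetⱼ.cost 0 (gadgets 0) lo t 0≤lo above)
    (*-monoˡ (≤-trans 0≤1 1≤C₀) (½^≤1 t))
  bounded (suc j) lo<Δ (t , above , below) = ≤-trans
    (Gadgetⱼ.cost-below-threshold (suc j) (gadgets (suc j)) lo t 0≤lo above below (<-≤-trans lo<Δ (Δ≤threshold j)))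
    (1≤^ (2 ℕ.^ suc j) 1≤C₀)

superadditive : ∀ {a b} n → 0ℚ ≤ a → 0ℚ ≤ b → a ^ suc n + b ^ suc n ≤ (a + b) ^ suc n
superadditive {a} {b} zero 0≤a 0≤b = ≤-reflexive (lemma a b)
  where
  lemma : ∀ a b → a * 1ℚ + b * 1ℚ ≡ (a + b) * 1ℚ
  lemma = solve-∀ ring
superadditive {a} {b} (suc n) 0≤a 0≤b = ≤-trans
  (diff⇒≤ (subst (0ℚ ≤_) (lemma a b (a ^ suc n) (b ^ suc n)) (+-nonNeg (*-nonNeg 0≤a (^-nonNeg (suc n) 0≤b)) (*-nonNeg 0≤b (^-nonNeg (suc n) 0≤a)))))
  (*-monoˡ (+-nonNeg 0≤a 0≤b) (superadditive n 0≤a 0≤b))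
  where
  lemma : ∀ a b x y → a * y + b * x ≡ (a + b) * (x + y) - (a * x + b * y)
  lemma = solve-∀ ring

frac-ι′ : ∀ p q .{{_ : ℕ.NonZero q}} → (ℤ.+ p / q) * ι q ≡ ι p
frac-ι′ p (suc q) = frac-ι p q

module _ (lam : OpenUnitInterval) where
  private
    open module S = Selection (select lam)
    module G = Gadgetⱼ j (gadgets j)
    y : ℝ
    y = fromℕ 2 +ᴿ β lam

    y-seq : ∀ n → seq y n ≡ 2ℚ + βseq lam n
    y-seq n = trans (seq-+ (fromℕ 2) (β lam) n) (cong (_+ βseq lam n) two)
      where
      two : ℤ.+ 2 / 1 ≡ 2ℚ
      two = refl

    0≤x : ∀ n → N ℕ.≤ n → 0ℚ ≤ seq (value lam) n
    0≤x n k = ≤-trans (<⇒≤ 0<lo) (lo≤ n k)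

    power-z : ∃ (IsPower (value lam) y)
    -- 3 bounds the exponent because `β` is at most 1.
    power-z = power-exists (value lam) y N lo 0<lo 3 lo≤ <1 λ n k →
      subst (0ℚ ≤_) (sym (y-seq n)) (+-nonNeg (≤ᵇ⇒≤ {0ℚ} {2ℚ} _) (partial-nonNeg n (0≤x n k))) ,
      subst (_≤ ι 3) (sym (y-seq n)) (+-monoʳ-≤ 2ℚ (partial≤1 n (seq (value lam) n)))

    instance
      q-nonZero : ℕ.NonZero (2 ℕ.^ j)
      q-nonZero = ℕ.>-nonZero (ℕ.m^n>0 2 j)

    p/q : ℤ.+ G.p / (2 ℕ.^ j) ≡ 2ℚ + ½ ^ j
    p/q = cancel (trans (frac-ι′ G.p (2 ℕ.^ j)) (sym (begin-equality
      (2ℚ + ½ ^ j) * ι (2 ℕ.^ j) ≡⟨ *-distribʳ-+ (ι (2 ℕ.^ j)) 2ℚ (½ ^ j) ⟩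
      2ℚ * ι (2 ℕ.^ j) + ½ ^ j * ι (2 ℕ.^ j) ≡⟨ cong (2ℚ * ι (2 ℕ.^ j) +_) (trans (cong (½ ^ j *_) (ι-2^ j)) (½^-2^ j)) ⟩
      2ℚ * ι (2 ℕ.^ j) + 1ℚ ≡⟨ lemma (ι (2 ℕ.^ j)) ⟩
      1ℚ + (ι (2 ℕ.^ j) + ι (2 ℕ.^ j)) ≡⟨ cong (1ℚ +_) (ι-+ (2 ℕ.^ j) (2 ℕ.^ j)) ⟨
      ι G.p ∎)))
      where
      open ℚ.≤-Reasoning
      lemma : ∀ i → (1ℚ + 1ℚ) * i + 1ℚ ≡ 1ℚ + (i + i)
      lemma = solve-∀ ring
      0<ι : 0ℚ < ι (2 ℕ.^ j)
      0<ι = subst (0ℚ <_) (sym (ι-2^ j)) (^-pos j (positive⁻¹ 2ℚ))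
      cancel : ∀ {a b} → a * ι (2 ℕ.^ j) ≡ b * ι (2 ℕ.^ j) → a ≡ b
      cancel {a} {b} e = ≤-antisym
        (cancelˡ 0<ι (≤-reflexive (trans (*-comm (ι (2 ℕ.^ j)) a) (trans e (*-comm b (ι (2 ℕ.^ j)))))))
        (cancelˡ 0<ι (≤-reflexive (trans (*-comm (ι (2 ℕ.^ j)) b) (trans (sym e) (*-comm a (ι (2 ℕ.^ j)))))))

    p/q≤y : fromℚ (ℤ.+ G.p / (2 ℕ.^ j)) ≤ᴿ y
    p/q≤y ε 0<ε =
      let K , small = ½^-small ε 0<ε in
      N ℕ.+ j ℕ.+ K , λ n k → begin
        ℤ.+ G.p / (2 ℕ.^ j) ≡⟨ p/q ⟩
        2ℚ + ½ ^ j ≤⟨ +-monoʳ-≤ 2ℚ (β-lower lam j lo N Δ≤lo lo≤ n (ℕ.m+n≤o⇒m≤o (N ℕ.+ j) k)) ⟩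
        2ℚ + (βseq lam n + ½ ^ n) ≡⟨ +-assoc 2ℚ (βseq lam n) (½ ^ n) ⟨
        2ℚ + βseq lam n + ½ ^ n ≤⟨ +-mono-≤ {2ℚ + βseq lam n} {seq y n} (≤-reflexive (sym (y-seq n))) (≤-trans (½^-antitone (ℕ.m+n≤o⇒n≤o (N ℕ.+ j) k)) small) ⟩
        seq y n + ε ∎
      where open ℚ.≤-Reasoning

    z : ℝ
    z = proj₁ power-z

    d : ℕ
    d = 2 ℕ.^ G.width (suc t)

    D : ℚ
    D = 2ℚ ^ G.width (suc t)

    0<D : 0ℚ < D
    0<D = ^-pos (G.width (suc t)) (positive⁻¹ 2ℚ)

    d≡D : ℤ.+ d / 1 ≡ D
    d≡D = trans (fromℕ-ι d) (ι-2^ (G.width (suc t)))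

    -- Compared after taking q-th powers with `q = 2 ^ j`: as `p / q = 2 + ½ ^ j` is at most the
    -- exponent, `z ^ q` is at most `lam ^ p`, hence at most `(2 lo) ^ p` up to an error, and
    -- `bounded` applies.
    bound : fromℕ d *ᴿ z ≤ᴿ fromℚ C₀
    bound ε 0<ε = conclude (ℕ.pred (2 ℕ.^ j)) (ℕ.suc-pred (2 ℕ.^ j))
      where
      open ℚ.≤-Reasoning
      conclude : ∀ q′ → suc q′ ≡ 2 ℕ.^ j → ∃ λ K → ∀ n → K ℕ.≤ n → seq (fromℕ d *ᴿ z) n ≤ C₀ + ε
      conclude q′ q≡ =
        let K , below = IsPower.below (proj₂ power-z) G.p (2 ℕ.^ j) p/q≤y ε′ 0<ε′ in
        N ℕ.+ K , λ n k → subst (_≤ C₀ + ε) (sym (trans (seq-* (fromℕ d) z n) (cong (_* seq z n) d≡D)))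
          (^-cancel q′ (+-nonNeg 0≤C₀ (<⇒≤ 0<ε)) (begin
            (D * seq z n) ^ suc q′ ≡⟨ ^-distrib-* D (seq z n) (suc q′) ⟩
            D ^ suc q′ * seq z n ^ suc q′ ≤⟨ *-monoˡ (^-nonNeg (suc q′) (<⇒≤ 0<D)) (zq n k (below n (ℕ.m+n≤o⇒n≤o N k))) ⟩
            D ^ suc q′ * ((2ℚ * lo) ^ G.p + ε′) ≡⟨ *-distribˡ-+ (D ^ suc q′) ((2ℚ * lo) ^ G.p) ε′ ⟩
            D ^ suc q′ * (2ℚ * lo) ^ G.p + D ^ suc q′ * ε′ ≤⟨ +-mono-≤ (subst (λ m → D ^ m * (2ℚ * lo) ^ G.p ≤ C₀ ^ m) (sym q≡) bounded) (≤-reflexive unit) ⟩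
            C₀ ^ suc q′ + ε ^ suc q′ ≤⟨ superadditive q′ 0≤C₀ (<⇒≤ 0<ε) ⟩
            (C₀ + ε) ^ suc q′ ∎))
        where
        0≤C₀ : 0ℚ ≤ C₀
        0≤C₀ = ≤-trans 0≤1 1≤C₀
        0<Dq : 0ℚ < D ^ suc q′
        0<Dq = ^-pos (suc q′) 0<D
        ε′ : ℚ
        -- Chosen so that the error multiplied by `D ^ q` is exactly `ε ^ q`, which superadditivity
        -- of the power merges with `C₀ ^ q`.
        ε′ = recip (D ^ suc q′) 0<Dq * ε ^ suc q′
        0<ε′ : 0ℚ < ε′
        0<ε′ = *-pos (recip-pos (D ^ suc q′) 0<Dq) (^-pos (suc q′) 0<ε)
        unit : D ^ suc q′ * ε′ ≡ ε ^ suc q′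
        unit = trans (sym (*-assoc (D ^ suc q′) (recip (D ^ suc q′) 0<Dq) (ε ^ suc q′)))
          (trans (cong (_* ε ^ suc q′) (trans (*-comm (D ^ suc q′) (recip (D ^ suc q′) 0<Dq)) (recip-inv (D ^ suc q′) 0<Dq))) (*-identityˡ (ε ^ suc q′)))
        zq : ∀ n → N ℕ.+ proj₁ (IsPower.below (proj₂ power-z) G.p (2 ℕ.^ j) p/q≤y ε′ 0<ε′) ℕ.≤ n → seq (z ^ᴿ (2 ℕ.^ j)) n ≤ seq (value lam ^ᴿ G.p) n + ε′ → seq z n ^ suc q′ ≤ (2ℚ * lo) ^ G.p + ε′
        zq n k le = subst (λ m → seq z n ^ m ≤ (2ℚ * lo) ^ G.p + ε′) (sym q≡)
          (≤-trans (subst₂ (λ a b → a ≤ b + ε′) (seq-^ z (2 ℕ.^ j) n) (seq-^ (value lam) G.p n) le)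
            (+-monoˡ-≤ ε′ (^-mono G.p (0≤x n (ℕ.m+n≤o⇒m≤o N k)) (≤2lo n (ℕ.m+n≤o⇒m≤o N k)))))

  degree-bound : DegreeBound d (fromℚ C₀) (value lam) y
  degree-bound = z , proj₂ power-z , bound

-- The channels as complex matrices

open ℝ
open ℂ

-- Finite index types

finElems : ∀ n → List (Fin n)
finElems zero = []
finElems (suc n) = zero ∷ map suc (finElems n)

finiteFin : ∀ n → Finite (Fin n)
finiteFin n = record { elems = finElems n ; _≟_ = Fin._≟_ ; pick = pickFin n }
  where
  pickFin : ∀ n a (f : Fin n → ℚ) → ∑ (finElems n) (λ x → if does (x Fin.≟ a) then f x else 0ℚ) ≡ f a
  pickFin (suc n) zero f = trans (cong (f zero +_) (trans (∑-map suc (finElems n) (λ x → if does (x Fin.≟ zero) then f x else 0ℚ)) (∑-0 (finElems n)))) (+-identityʳ (f zero))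
  pickFin (suc n) (suc a) f = trans (+-identityˡ _) (trans (∑-map suc (finElems n) (λ x → if does (x Fin.≟ suc a) then f x else 0ℚ)) (pickFin n a (f ∘ suc)))

Bits : ℕ → Set
Bits n = Fin n → Fin 2

fromPow : ∀ n → Pow (Fin 2) n → Bits n
fromPow (suc n) (b , w) zero = b
fromPow (suc n) (b , w) (suc i) = fromPow n w i

toPow : ∀ n → Bits n → Pow (Fin 2) n
toPow zero f = tt
toPow (suc n) f = f zero , toPow n (f ∘ suc)

toPow-fromPow : ∀ n w → toPow n (fromPow n w) ≡ w
toPow-fromPow zero w = refl
toPow-fromPow (suc n) (b , w) = cong (b ,_) (toPow-fromPow n w)

fromPow-toPow : ∀ n f i → fromPow n (toPow n f) i ≡ f i
fromPow-toPow (suc n) f zero = refl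
fromPow-toPow (suc n) f (suc i) = fromPow-toPow n (f ∘ suc) i

toPow-cong : ∀ n {f g} → (∀ i → f i ≡ g i) → toPow n f ≡ toPow n g
toPow-cong zero e = refl
toPow-cong (suc n) e = cong₂ _,_ (e zero) (toPow-cong n (e ∘ suc))

funToFin-cong : ∀ {n} {f g : Bits n} → (∀ i → f i ≡ g i) → funToFin f ≡ funToFin g
funToFin-cong {zero} e = refl
funToFin-cong {suc n} e = cong₂ Fin.combine (e zero) (funToFin-cong (e ∘ suc))

finToFun-injective : ∀ {n} (x y : Fin (2 ℕ.^ n)) → (∀ i → finToFun {2} x i ≡ finToFun y i) → x ≡ y
finToFun-injective {n} x y e = trans (sym (Fin.funToFin-finToFin {n} x)) (trans (funToFin-cong {n} {finToFun {2} x} {finToFun y} e) (Fin.funToFin-finToFin {n} y))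

bitsOf : ∀ n → Fin (2 ℕ.^ n) → Pow (Fin 2) n
bitsOf n x = toPow n (finToFun x)

ofBits : ∀ n → Pow (Fin 2) n → Fin (2 ℕ.^ n)
ofBits n w = funToFin (fromPow n w)

ofBits-bitsOf : ∀ n x → ofBits n (bitsOf n x) ≡ x
ofBits-bitsOf n x = trans (funToFin-cong (fromPow-toPow n (finToFun x))) (Fin.funToFin-finToFin {n} x)

bitsOf-ofBits : ∀ n w → bitsOf n (ofBits n w) ≡ w
bitsOf-ofBits n w = trans (toPow-cong n (Fin.finToFun-funToFin (fromPow n w))) (toPow-fromPow n w)

bitAt : ∀ n → States n → Bits (n ℕ.* 2)
bitAt (suc n) ((p , q) , x) zero = p
bitAt (suc n) ((p , q) , x) (suc zero) = q
bitAt (suc n) ((p , q) , x) (suc (suc i)) = bitAt n x i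

ofBitAt : ∀ n → Bits (n ℕ.* 2) → States n
ofBitAt zero f = tt
ofBitAt (suc n) f = (f zero , f (suc zero)) , ofBitAt n (λ i → f (suc (suc i)))

ofBitAt-bitAt : ∀ n x → ofBitAt n (bitAt n x) ≡ x
ofBitAt-bitAt zero x = refl
ofBitAt-bitAt (suc n) (s , x) = cong (s ,_) (ofBitAt-bitAt n x)

bitAt-ofBitAt : ∀ n f i → bitAt n (ofBitAt n f) i ≡ f i
bitAt-ofBitAt (suc n) f zero = refl
bitAt-ofBitAt (suc n) f (suc zero) = refl
bitAt-ofBitAt (suc n) f (suc (suc i)) = bitAt-ofBitAt n (λ i → f (suc (suc i))) i

ofBitAt-cong : ∀ n {f g} → (∀ i → f i ≡ g i) → ofBitAt n f ≡ ofBitAt n g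
ofBitAt-cong zero e = refl
ofBitAt-cong (suc n) e = cong₂ _,_ (cong₂ _,_ (e zero) (e (suc zero))) (ofBitAt-cong n (λ i → e (suc (suc i))))

code : ∀ n → States n → Fin (2 ℕ.^ (n ℕ.* 2))
code n x = funToFin (bitAt n x)

decode : ∀ n → Fin (2 ℕ.^ (n ℕ.* 2)) → States n
decode n u = ofBitAt n (finToFun u)

decode-code : ∀ n x → decode n (code n x) ≡ x
decode-code n x = trans (ofBitAt-cong n (Fin.finToFun-funToFin (bitAt n x))) (ofBitAt-bitAt n x)

code-decode : ∀ n u → code n (decode n u) ≡ u
code-decode n u = trans (funToFin-cong (bitAt-ofBitAt n (finToFun u))) (Fin.funToFin-finToFin {n ℕ.* 2} u)

-- Evaluation of the n-th rational approximations

Re Im : ℂ → ℕ → ℚ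
Re z n = seq (re z) n
Im z n = seq (im z) n

re-+ : ∀ z w n → Re (z +ᶜ w) n ≡ Re z n + Re w n
re-+ (a +i b) (c +i d) n = seq-+ a c n

im-+ : ∀ z w n → Im (z +ᶜ w) n ≡ Im z n + Im w n
im-+ (a +i b) (c +i d) n = seq-+ b d n

re-* : ∀ z w n → Re (z *ᶜ w) n ≡ Re z n * Re w n - Im z n * Im w n
re-* (a +i b) (c +i d) n = trans (seq-+ (a *ᴿ c) (-ᴿ (b *ᴿ d)) n) (cong₂ _+_ (seq-* a c n) (trans (seq-neg (b *ᴿ d) n) (cong -_ (seq-* b d n))))

im-* : ∀ z w n → Im (z *ᶜ w) n ≡ Re z n * Im w n + Im z n * Re w n
im-* (a +i b) (c +i d) n = trans (seq-+ (a *ᴿ d) (b *ᴿ c) n) (cong₂ _+_ (seq-* a d n) (seq-* b c n))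

re-conj : ∀ z n → Re (conj z) n ≡ Re z n
re-conj (a +i b) n = refl

im-conj : ∀ z n → Im (conj z) n ≡ - Im z n
im-conj (a +i b) n = seq-neg b n

re-∑ : ∀ {m} (F : Vector ℂ m) n → Re (∑ᶜ F) n ≡ ∑ (finElems m) (λ i → Re (F i) n)
re-∑ {zero} F n = refl
re-∑ {suc m} F n = trans (re-+ (F zero) (∑ᶜ (F ∘ suc)) n) (cong (Re (F zero) n +_) (trans (re-∑ (F ∘ suc) n) (sym (∑-map suc (finElems m) (λ i → Re (F i) n)))))

im-∑ : ∀ {m} (F : Vector ℂ m) n → Im (∑ᶜ F) n ≡ ∑ (finElems m) (λ i → Im (F i) n)
im-∑ {zero} F n = refl
im-∑ {suc m} F n = trans (im-+ (F zero) (∑ᶜ (F ∘ suc)) n) (cong (Im (F zero) n +_) (trans (im-∑ (F ∘ suc) n) (sym (∑-map suc (finElems m) (λ i → Im (F i) n)))))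

infix 4 _≐_
_≐_ : ℂ → ℂ → Set
z ≐ w = ∀ n → Re z n ≡ Re w n × Im z n ≡ Im w n

≡⇒≤ᴿ : ∀ x y → (∀ n → seq x n ≡ seq y n) → x ≤ᴿ y
≡⇒≤ᴿ x y e ε 0<ε = 0 , λ n _ → subst (_≤ seq y n + ε) (trans (+-identityʳ (seq y n)) (sym (e n))) (+-monoʳ-≤ (seq y n) (<⇒≤ 0<ε))

≡⇒≈ᴿ : ∀ x y → (∀ n → seq x n ≡ seq y n) → x ≈ᴿ y
≡⇒≈ᴿ x y e = ≡⇒≤ᴿ x y e , ≡⇒≤ᴿ y x (λ n → sym (e n))

≐⇒≈ : ∀ z w → z ≐ w → z ≈ᶜ w
≐⇒≈ z w e = ≡⇒≈ᴿ (re z) (re w) (λ n → proj₁ (e n)) , ≡⇒≈ᴿ (im z) (im w) (λ n → proj₂ (e n))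

-- Every approximation of `z` is the rational `q`, so matrix identities with rational entries are
-- proved by equations in ℚ instead of estimates.
Rep : ℂ → ℚ → Set
Rep z q = ∀ n → Re z n ≡ q × Im z n ≡ 0ℚ

rep⇒≐ : ∀ z w {q} → Rep z q → Rep w q → z ≐ w
rep⇒≐ z w r s n = trans (proj₁ (r n)) (sym (proj₁ (s n))) , trans (proj₂ (r n)) (sym (proj₂ (s n)))

rep-const : ∀ q → Rep (fromℝ (fromℚ q)) q
rep-const q n = refl , refl

rep-* : ∀ {z w a b} → Rep z a → Rep w b → Rep (z *ᶜ w) (a * b)
rep-* {z} {w} {a} {b} r s n =
  trans (re-* z w n) (trans (cong₂ _-_ (cong₂ _*_ (proj₁ (r n)) (proj₁ (s n))) (cong₂ _*_ (proj₂ (r n)) (proj₂ (s n)))) (lemma₁ a b)) ,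
  trans (im-* z w n) (trans (cong₂ _+_ (cong₂ _*_ (proj₁ (r n)) (proj₂ (s n))) (cong₂ _*_ (proj₂ (r n)) (proj₁ (s n)))) (lemma₂ a b))
  where
  lemma₁ : ∀ a b → a * b - 0ℚ * 0ℚ ≡ a * b
  lemma₁ = solve-∀ ring
  lemma₂ : ∀ a b → a * 0ℚ + 0ℚ * b ≡ 0ℚ
  lemma₂ = solve-∀ ring

rep-0* : ∀ {z} w → Rep z 0ℚ → Rep (z *ᶜ w) 0ℚ
rep-0* {z} w r n =
  trans (re-* z w n) (trans (cong₂ (λ a b → a * Re w n - b * Im w n) (proj₁ (r n)) (proj₂ (r n))) (lemma₁ (Re w n) (Im w n))) ,
  trans (im-* z w n) (trans (cong₂ (λ a b → a * Im w n + b * Re w n) (proj₁ (r n)) (proj₂ (r n))) (lemma₂ (Im w n) (Re w n)))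
  where
  lemma₁ : ∀ a b → 0ℚ * a - 0ℚ * b ≡ 0ℚ
  lemma₁ = solve-∀ ring
  lemma₂ : ∀ a b → 0ℚ * a + 0ℚ * b ≡ 0ℚ
  lemma₂ = solve-∀ ring

rep-conj : ∀ {z a} → Rep z a → Rep (conj z) a
rep-conj {z} r n = trans (re-conj z n) (proj₁ (r n)) , trans (im-conj z n) (cong -_ (proj₂ (r n)))

rep-∑ : ∀ {m} {F : Vector ℂ m} {f : Fin m → ℚ} → (∀ i → Rep (F i) (f i)) → Rep (∑ᶜ F) (∑ (finElems m) f)
rep-∑ {m} {F} r n = trans (re-∑ F n) (∑-cong (finElems m) λ i → proj₁ (r i n)) ,
  trans (im-∑ F n) (trans (∑-cong (finElems m) λ i → proj₂ (r i n)) (∑-0 (finElems m)))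

rep-≡ : ∀ {z a b} → a ≡ b → Rep z a → Rep z b
rep-≡ refl r = r

rep-if : ∀ b {z w p q} → Rep z p → Rep w q → Rep (if b then z else w) (if b then p else q)
rep-if true r s = r
rep-if false r s = s

-- Kraus maps with real rational coefficients

module _ {d N : ℕ} (B : Vector (Mat N) d) (b : Fin d → Fin N → Fin N → ℚ) (rep : ∀ w i j → Rep (B w i j) (b w i j)) where

  krausℚ : (Fin N → Fin N → ℚ) → Fin N → Fin N → ℚ
  krausℚ ρ i j = ∑ (finElems d) λ w → ∑ (finElems N) λ k → ∑ (finElems N) (λ l → b w i l * ρ l k) * b w j k

  private
    re-inner : ∀ (ρ : Mat N) w i k n → Re ((B w · ρ) i k) n ≡ ∑ (finElems N) (λ l → b w i l * Re (ρ l k) n)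
    re-inner ρ w i k n = trans (re-∑ (λ l → B w i l *ᶜ ρ l k) n) (∑-cong (finElems N) λ l →
      trans (re-* (B w i l) (ρ l k) n) (trans (cong₂ (λ s t → s * Re (ρ l k) n - t * Im (ρ l k) n) (proj₁ (rep w i l n)) (proj₂ (rep w i l n))) (lemma (b w i l) (Re (ρ l k) n) (Im (ρ l k) n))))
      where
      lemma : ∀ b r i → b * r - 0ℚ * i ≡ b * r
      lemma = solve-∀ ring

    im-inner : ∀ (ρ : Mat N) w i k n → Im ((B w · ρ) i k) n ≡ ∑ (finElems N) (λ l → b w i l * Im (ρ l k) n)
    im-inner ρ w i k n = trans (im-∑ (λ l → B w i l *ᶜ ρ l k) n) (∑-cong (finElems N) λ l →
      trans (im-* (B w i l) (ρ l k) n) (trans (cong₂ (λ s t → s * Im (ρ l k) n + t * Re (ρ l k) n) (proj₁ (rep w i l n)) (proj₂ (rep w i l n))) (lemma (b w i l) (Im (ρ l k) n) (Re (ρ l k) n))))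
      where
      lemma : ∀ b r i → b * r + 0ℚ * i ≡ b * r
      lemma = solve-∀ ring

  re-kraus : ∀ ρ i j n → Re (kraus B ρ i j) n ≡ krausℚ (λ l k → Re (ρ l k) n) i j
  re-kraus ρ i j n = trans (re-∑ (λ w → (B w · ρ · B w †) i j) n) (∑-cong (finElems d) λ w →
    trans (re-∑ (λ k → (B w · ρ) i k *ᶜ conj (B w j k)) n) (∑-cong (finElems N) λ k →
      trans (re-* ((B w · ρ) i k) (conj (B w j k)) n) (trans
        (cong₂ (λ s t → Re ((B w · ρ) i k) n * s - Im ((B w · ρ) i k) n * t) (proj₁ (rep-conj {B w j k} (rep w j k) n)) (proj₂ (rep-conj {B w j k} (rep w j k) n)))
        (trans (lemma (Re ((B w · ρ) i k) n) (Im ((B w · ρ) i k) n) (b w j k)) (cong (_* b w j k) (re-inner ρ w i k n))))))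
    where
    lemma : ∀ r i b → r * b - i * 0ℚ ≡ r * b
    lemma = solve-∀ ring

  im-kraus : ∀ ρ i j n → Im (kraus B ρ i j) n ≡ krausℚ (λ l k → Im (ρ l k) n) i j
  im-kraus ρ i j n = trans (im-∑ (λ w → (B w · ρ · B w †) i j) n) (∑-cong (finElems d) λ w →
    trans (im-∑ (λ k → (B w · ρ) i k *ᶜ conj (B w j k)) n) (∑-cong (finElems N) λ k →
      trans (im-* ((B w · ρ) i k) (conj (B w j k)) n) (trans
        (cong₂ (λ s t → Re ((B w · ρ) i k) n * t + Im ((B w · ρ) i k) n * s) (proj₁ (rep-conj {B w j k} (rep w j k) n)) (proj₂ (rep-conj {B w j k} (rep w j k) n)))
        (trans (lemma (Re ((B w · ρ) i k) n) (Im ((B w · ρ) i k) n) (b w j k)) (cong (_* b w j k) (im-inner ρ w i k n))))))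
    where
    lemma : ∀ r i b → r * 0ℚ + i * b ≡ i * b
    lemma = solve-∀ ring

-- Two families of Kraus operators with the same rational entries give the same approximations; this
-- will identify the circuit with the channel.
kraus-≐ : ∀ {d N} (B B′ : Vector (Mat N) d) (b : Fin d → Fin N → Fin N → ℚ) (rep : ∀ w i j → Rep (B w i j) (b w i j)) (rep′ : ∀ w i j → Rep (B′ w i j) (b w i j)) →
  ∀ (ρ ρ′ : Mat N) → (∀ i j → ρ i j ≐ ρ′ i j) → ∀ i j → kraus B ρ i j ≐ kraus B′ ρ′ i j
kraus-≐ {d} {N} B B′ b rep rep′ ρ ρ′ e i j n =
  trans (re-kraus B b rep ρ i j n) (trans (congruent (λ l k → proj₁ (e l k n))) (sym (re-kraus B′ b rep′ ρ′ i j n))) ,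
  trans (im-kraus B b rep ρ i j n) (trans (congruent (λ l k → proj₂ (e l k n))) (sym (im-kraus B′ b rep′ ρ′ i j n)))
  where
  congruent : ∀ {r r′ : Fin N → Fin N → ℚ} → (∀ l k → r l k ≡ r′ l k) → krausℚ B b rep r i j ≡ krausℚ B′ b rep′ r′ i j
  congruent e = ∑-cong (finElems d) λ w → ∑-cong (finElems N) λ k → cong (_* b w j k) (∑-cong (finElems N) λ l → cong (b w i l *_) (e l k))

-- The Frobenius norm

module _ {N : ℕ} (ρ : Mat N) where

  frobenius : ℕ → ℚ
  frobenius n = ∑ (finElems N) λ i → ∑ (finElems N) λ k → sq (Re (ρ k i) n) + sq (Im (ρ k i) n)

  re-Tr : ∀ n → Re (Tr (ρ † · ρ)) n ≡ frobenius n
  re-Tr n = trans (re-∑ (λ i → (ρ † · ρ) i i) n) (∑-cong (finElems N) λ i → trans (re-∑ (λ k → conj (ρ k i) *ᶜ ρ k i) n) (∑-cong (finElems N) λ k →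
    trans (re-* (conj (ρ k i)) (ρ k i) n) (trans (cong₂ (λ s t → s * Re (ρ k i) n - t * Im (ρ k i) n) (re-conj (ρ k i) n) (im-conj (ρ k i) n)) (lemma (Re (ρ k i) n) (Im (ρ k i) n)))))
    where
    lemma : ∀ r i → r * r - (- i) * i ≡ r * r + i * i
    lemma = solve-∀ ring

  im-Tr : ∀ n → Im (Tr (ρ † · ρ)) n ≡ 0ℚ
  im-Tr n = trans (im-∑ (λ i → (ρ † · ρ) i i) n) (trans (∑-cong (finElems N) λ i → trans (im-∑ (λ k → conj (ρ k i) *ᶜ ρ k i) n) (trans (∑-cong (finElems N) λ k →
    trans (im-* (conj (ρ k i)) (ρ k i) n) (trans (cong₂ (λ s t → s * Im (ρ k i) n + t * Re (ρ k i) n) (re-conj (ρ k i) n) (im-conj (ρ k i) n)) (lemma (Re (ρ k i) n) (Im (ρ k i) n))))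
      (∑-0 (finElems N)))) (∑-0 (finElems N)))
    where
    lemma : ∀ r i → r * i + (- i) * r ≡ 0ℚ
    lemma = solve-∀ ring

  frobenius-nonNeg : ∀ n → 0ℚ ≤ frobenius n
  frobenius-nonNeg n = ∑-nonNeg (finElems N) λ i → ∑-nonNeg (finElems N) λ k → +-nonNeg (sq-nonNeg (Re (ρ k i) n)) (sq-nonNeg (Im (ρ k i) n))

  normSquared : ℝ
  normSquared = re (Tr (ρ † · ρ))

  normRoot : Root (seq normSquared)
  normRoot = squareRoot normSquared (λ n → subst (0ℚ ≤_) (sym (re-Tr n)) (frobenius-nonNeg n))

  isNorm₂ : IsNorm₂ ρ (Root.root normRoot)
  isNorm₂ = (λ ε 0<ε → 0 , λ n _ → +-nonNeg (Root.nonNeg normRoot n) (<⇒≤ 0<ε)) ,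
    root-square normSquared normRoot , ≡⇒≈ᴿ 0ᴿ (im (Tr (ρ † · ρ))) (λ n → sym (im-Tr n))

-- The channel of a word system

module Channel {ν : ℚ} {h₂ L : ℕ} (W : WordSystem ν (h₂ ℕ.* 2) L) (n : ℕ) where
  open WordSystem W

  h d N : ℕ
  h = h₂ ℕ.* 2
  d = 2 ℕ.^ h
  N = 2 ℕ.^ (n ℕ.* 2)

  letters : Fin d → List Letter
  letters w = word (bitsOf h w)

  target : Fin d → Fin N → Fin N
  target w u = code n (moves n (letters w) (decode n u))

  -- The evenness of `h` makes the amplitude, a square root of the probability `½ ^ h`, rational.
  amplitude : Fin d → Fin N → ℚ
  amplitude w u = ½ ^ h₂ * phases n (letters w) (decode n u)

  coefficient : Fin d → Fin N → Fin N → ℚ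
  coefficient w u v = if does (v Fin.≟ target w u) then amplitude w u else 0ℚ

  operators : Vector (Mat N) d
  operators w u v = fromℝ (fromℚ (coefficient w u v))

  represented : ∀ w u v → Rep (operators w u v) (coefficient w u v)
  represented w u v = rep-const (coefficient w u v)

  Φ : SuperOperator N
  Φ = kraus operators

  private
    module FN = Finite (finiteFin N)

    if-* : ∀ (b : Bool) (p q : ℚ) → (if b then p else 0ℚ) * q ≡ (if b then p * q else 0ℚ)
    if-* true p q = refl
    if-* false p q = *-zeroˡ q

    *-if : ∀ (b : Bool) (p q : ℚ) → q * (if b then p else 0ℚ) ≡ (if b then q * p else 0ℚ)
    *-if true p q = refl
    *-if false p q = *-zeroʳ q

    ½^h : ½ ^ h₂ * ½ ^ h₂ ≡ ½ ^ h
    ½^h = trans (sym (^-+ ½ h₂ h₂)) (cong (½ ^_) (trans (cong (h₂ ℕ.+_) (sym (ℕ.+-identityʳ h₂))) (ℕ.*-comm 2 h₂)))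

    pulled : (Fin N → Fin N → ℚ) → Matrix n
    pulled ρ x y = ρ (code n x) (code n y)

  -- Each Kraus operator has one nonzero entry per row, so the two inner sums collapse and the
  -- average of conjugations remains.
  krausℚ-words : ∀ (ρ : Fin N → Fin N → ℚ) i j → krausℚ operators coefficient represented ρ i j ≡
    ½ ^ h * ∑ (Group.elems (bits h)) (λ w → conjugate n (word w) (pulled ρ) (decode n i) (decode n j))
  krausℚ-words ρ i j = begin
    ∑ (finElems d) (λ w → ∑ (finElems N) λ k → ∑ (finElems N) (λ l → coefficient w i l * ρ l k) * coefficient w j k)
      ≡⟨ ∑-cong (finElems d) (λ w → trans (∑-cong (finElems N) λ k → trans
           (cong (_* coefficient w j k) (trans (∑-cong (finElems N) λ l → if-* (does (l Fin.≟ target w i)) (amplitude w i) (ρ l k)) (FN.pick (target w i) (λ l → amplitude w i * ρ l k))))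
           (*-if (does (k Fin.≟ target w j)) (amplitude w j) (amplitude w i * ρ (target w i) k)))
           (FN.pick (target w j) (λ k → amplitude w i * ρ (target w i) k * amplitude w j))) ⟩
    ∑ (finElems d) (λ w → amplitude w i * ρ (target w i) (target w j) * amplitude w j)
      ≡⟨ ∑-cong (finElems d) (λ w → trans (regroup (½ ^ h₂) (phases n (letters w) (decode n i)) (phases n (letters w) (decode n j)) (ρ (target w i) (target w j)))
           (cong (_* conjugate n (letters w) (pulled ρ) (decode n i) (decode n j)) ½^h)) ⟩
    ∑ (finElems d) (λ w → ½ ^ h * conjugate n (letters w) (pulled ρ) (decode n i) (decode n j))
      ≡⟨ ∑-*ˡ (finElems d) (½ ^ h) (λ w → conjugate n (letters w) (pulled ρ) (decode n i) (decode n j)) ⟩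
    ½ ^ h * ∑ (finElems d) (λ w → conjugate n (word (bitsOf h w)) (pulled ρ) (decode n i) (decode n j))
      ≡⟨ cong (½ ^ h *_) (reindex (finiteFin d) (Group.finite (bits h)) (bitsOf h) (ofBits h) (ofBits-bitsOf h) (bitsOf-ofBits h)
           (λ w → conjugate n (word w) (pulled ρ) (decode n i) (decode n j))) ⟩
    ½ ^ h * ∑ (Group.elems (bits h)) (λ w → conjugate n (word w) (pulled ρ) (decode n i) (decode n j)) ∎
    where
    open ≡-Reasoning
    regroup : ∀ a p q r → a * p * r * (a * q) ≡ a * a * (p * q * r)
    regroup = solve-∀ ring

  private
    total : (Fin N → Fin N → ℚ) → ℚ
    total ρ = ∑ (finElems N) λ i → ∑ (finElems N) λ k → sq (ρ k i)

    diagonal : (Fin N → Fin N → ℚ) → ℚ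
    diagonal ρ = ∑ (finElems N) λ i → ρ i i

    over-states : ∀ (f : Fin N → ℚ) → ∑ (finElems N) f ≡ ∑ (State.elems n) (λ x → f (code n x))
    over-states f = sym (reindex (State.finite n) (finiteFin N) (code n) (decode n) (decode-code n) (code-decode n) f)

    total-entries : ∀ ρ → total ρ ≡ entries n (pulled ρ)
    total-entries ρ = trans (over-states (λ i → ∑ (finElems N) λ k → sq (ρ k i))) (trans (∑-cong (State.elems n) λ y → over-states (λ k → sq (ρ k (code n y))))
      (∑-swap (State.elems n) (State.elems n) (λ y x → sq (ρ (code n x) (code n y)))))

    contracts : ∀ ρ → total (krausℚ operators coefficient represented ρ) ≤ sq ν * total ρ + sq (diagonal ρ)
    contracts ρ = subst₂ _≤_
      (sym (trans (total-entries (krausℚ operators coefficient represented ρ)) (∑-cong (State.elems n) λ x → ∑-cong (State.elems n) λ y → cong sq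
        (trans (krausℚ-words ρ (code n x) (code n y)) (cong (½ ^ h *_) (∑-cong (Group.elems (bits h)) λ w → cong₂ (conjugate n (word w) (pulled ρ)) (decode-code n x) (decode-code n y)))))))
      (cong₂ (λ s t → sq ν * s + sq t) (sym (total-entries ρ)) (sym (over-states (λ i → ρ i i))))
      (contraction n (pulled ρ))

  -- The Kraus coefficients are real, so real and imaginary parts of `ρ` are transformed separately,
  -- each by the rational estimate.
  frobenius-bound : ∀ (ρ : Mat N) m → frobenius (Φ ρ) m ≤ sq ν * frobenius ρ m + (sq (Re (Tr ρ) m) + sq (Im (Tr ρ) m))
  frobenius-bound ρ m = begin
    frobenius (Φ ρ) m
      ≡⟨ trans (∑-cong (finElems N) λ i → ∑-+ (finElems N) (λ k → sq (Re (Φ ρ k i) m)) (λ k → sq (Im (Φ ρ k i) m)))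
           (∑-+ (finElems N) (λ i → ∑ (finElems N) λ k → sq (Re (Φ ρ k i) m)) (λ i → ∑ (finElems N) λ k → sq (Im (Φ ρ k i) m))) ⟩
    total (λ k i → Re (Φ ρ k i) m) + total (λ k i → Im (Φ ρ k i) m)
      ≡⟨ cong₂ _+_ (∑-cong (finElems N) λ i → ∑-cong (finElems N) λ k → cong sq (re-kraus operators coefficient represented ρ k i m))
                   (∑-cong (finElems N) λ i → ∑-cong (finElems N) λ k → cong sq (im-kraus operators coefficient represented ρ k i m)) ⟩
    total (krausℚ operators coefficient represented ρʳ) + total (krausℚ operators coefficient represented ρⁱ)
      ≤⟨ +-mono-≤ (contracts ρʳ) (contracts ρⁱ) ⟩
    sq ν * total ρʳ + sq (diagonal ρʳ) + (sq ν * total ρⁱ + sq (diagonal ρⁱ))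
      ≡⟨ regroup (sq ν) (total ρʳ) (sq (diagonal ρʳ)) (total ρⁱ) (sq (diagonal ρⁱ)) ⟩
    sq ν * (total ρʳ + total ρⁱ) + (sq (diagonal ρʳ) + sq (diagonal ρⁱ))
      ≡⟨ cong₂ (λ s t → sq ν * s + t)
           (sym (trans (∑-cong (finElems N) λ i → ∑-+ (finElems N) (λ k → sq (Re (ρ k i) m)) (λ k → sq (Im (ρ k i) m)))
             (∑-+ (finElems N) (λ i → ∑ (finElems N) λ k → sq (Re (ρ k i) m)) (λ i → ∑ (finElems N) λ k → sq (Im (ρ k i) m)))))
           (sym (cong₂ (λ s t → sq s + sq t) (re-∑ (λ i → ρ i i) m) (im-∑ (λ i → ρ i i) m))) ⟩
    sq ν * frobenius ρ m + (sq (Re (Tr ρ) m) + sq (Im (Tr ρ) m)) ∎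
    where
    open ℚ.≤-Reasoning
    ρʳ ρⁱ : Fin N → Fin N → ℚ
    ρʳ k i = Re (ρ k i) m
    ρⁱ k i = Im (ρ k i) m
    regroup : ∀ v a b c d → v * a + b + (v * c + d) ≡ v * (a + c) + (b + d)
    regroup = solve-∀ ring

  -- Each operator is `½ ^ h₂` times a signed permutation matrix, so each of the `2 ^ h` summands is
  -- `½ ^ h` times the identity.
  complete : ∑ᴹ (λ i → operators i † · operators i) ≋ I
  complete v v′ = ≐⇒≈ (∑ᴹ (λ i → operators i † · operators i) v v′) (I v v′) (rep⇒≐ (∑ᴹ (λ i → operators i † · operators i) v v′) (I v v′) {q = if does (v Fin.≟ v′) then 1ℚ else 0ℚ}
    (rep-≡ {∑ᴹ (λ i → operators i † · operators i) v v′} identity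
      (rep-∑ {F = λ w → (operators w † · operators w) v v′} λ w → rep-∑ {F = λ u → (operators w †) v u *ᶜ operators w u v′} λ u →
        rep-* {(operators w †) v u} {operators w u v′} (rep-conj {operators w u v} (represented w u v)) (represented w u v′)))
    (rep-if (does (v Fin.≟ v′)) {1ᶜ} {0ᶜ} (rep-const 1ℚ) (rep-const 0ℚ)))
    where
    open ≡-Reasoning
    source : Fin d → Fin N → Fin N
    source w u = code n (moves⁻ n (letters w) (decode n u))
    source-target : ∀ w u → source w (target w u) ≡ u
    source-target w u = trans (cong (λ x → code n (moves⁻ n (letters w) x)) (decode-code n (moves n (letters w) (decode n u))))
      (trans (cong (code n) (moves⁻-moves n (letters w) (decode n u))) (code-decode n u))
    target-source : ∀ w u → target w (source w u) ≡ u
    target-source w u = trans (cong (λ x → code n (moves n (letters w) x)) (decode-code n (moves⁻ n (letters w) (decode n u))))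
      (trans (cong (code n) (moves-moves⁻ n (letters w) (decode n u))) (code-decode n u))
    amplitude-sq : ∀ w u → amplitude w u * amplitude w u ≡ ½ ^ h
    amplitude-sq w u = trans (*-squares (½ ^ h₂) (phases n (letters w) (decode n u))) (trans (cong (½ ^ h₂ * ½ ^ h₂ *_) (phases-sq n (letters w) (decode n u))) (trans (*-identityʳ (½ ^ h₂ * ½ ^ h₂)) ½^h))
      where
    each : ∀ w → ∑ (finElems N) (λ u → coefficient w u v * coefficient w u v′) ≡ (if does (v Fin.≟ v′) then ½ ^ h else 0ℚ)
    each w = begin
      ∑ (finElems N) (λ u → coefficient w u v * coefficient w u v′)
        ≡⟨ ∑-cong (finElems N) (λ u → both (amplitude-sq w u) (v Fin.≟ target w u) (v′ Fin.≟ target w u)) ⟩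
      ∑ (finElems N) (λ u → F (target w u))
        ≡⟨ reindex (finiteFin N) (finiteFin N) (target w) (source w) (source-target w) (target-source w) F ⟩
      ∑ (finElems N) F
        ≡⟨ ∑-cong (finElems N) (λ u → cong (λ b → if b then (if does (v′ Fin.≟ u) then ½ ^ h else 0ℚ) else 0ℚ) (flip v u)) ⟩
      ∑ (finElems N) (λ u → if does (u Fin.≟ v) then (if does (v′ Fin.≟ u) then ½ ^ h else 0ℚ) else 0ℚ)
        ≡⟨ FN.pick v (λ u → if does (v′ Fin.≟ u) then ½ ^ h else 0ℚ) ⟩
      (if does (v′ Fin.≟ v) then ½ ^ h else 0ℚ)
        ≡⟨ cong (λ b → if b then ½ ^ h else 0ℚ) (flip v′ v) ⟩
      (if does (v Fin.≟ v′) then ½ ^ h else 0ℚ) ∎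
      where
      F : Fin N → ℚ
      F u = if does (v Fin.≟ u) then (if does (v′ Fin.≟ u) then ½ ^ h else 0ℚ) else 0ℚ
      flip : ∀ {m} (x y : Fin m) → does (x Fin.≟ y) ≡ does (y Fin.≟ x)
      flip x y with x Fin.≟ y
      ... | yes refl = sym (dec-true (x Fin.≟ x) refl)
      ... | no x≢y = sym (dec-false (y Fin.≟ x) (x≢y ∘ sym))
      both : ∀ {a : ℚ} {c : ℚ} {P Q : Set} → a * a ≡ c → (D : Dec P) (D′ : Dec Q) →
        (if does D then a else 0ℚ) * (if does D′ then a else 0ℚ) ≡ (if does D then (if does D′ then c else 0ℚ) else 0ℚ)
      both {a} e (yes _) (yes _) = e
      both {a} e (yes _) (no _) = *-zeroʳ a
      both {a} e (no _) D′ = *-zeroˡ (if does D′ then a else 0ℚ)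
    identity : ∑ (finElems d) (λ w → ∑ (finElems N) (λ u → coefficient w u v * coefficient w u v′)) ≡ (if does (v Fin.≟ v′) then 1ℚ else 0ℚ)
    identity = trans (∑-cong (finElems d) each) (trans (reindex (finiteFin d) (Group.finite (bits h)) (bitsOf h) (ofBits h) (ofBits-bitsOf h) (bitsOf-ofBits h) (λ _ → if does (v Fin.≟ v′) then ½ ^ h else 0ℚ))
      (trans (Group.∑-const (bits h) (if does (v Fin.≟ v′) then ½ ^ h else 0ℚ)) (choose′ (does (v Fin.≟ v′)))))
      where
      choose′ : ∀ b → Group.size (bits h) * (if b then ½ ^ h else 0ℚ) ≡ (if b then 1ℚ else 0ℚ)
      choose′ true = trans (cong (λ e → Group.size (bits h) * ½ ^ e) (sym (trans (powDim bitGroup h) (ℕ.*-identityʳ h)))) (trans (*-comm (Group.size (bits h)) (Group.isize (bits h))) (Group.size-inv (bits h)))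
      choose′ false = *-zeroʳ (Group.size (bits h))

  hasDegree : HasDegree d Φ
  hasDegree = operators , (λ ρ i j → ≐⇒≈ (Φ ρ i j) (Φ ρ i j) (λ n → refl , refl)) , complete

  -- The approximations of the trace form a null sequence and enter as the defect `τ` of
  -- `root-contraction`.
  expands : ∀ lam M → 0ℚ ≤ ν → ν ≤ 1ℚ → (∀ m → M ℕ.≤ m → ν ≤ seq lam m) → Expands lam Φ
  expands lam M 0≤ν ν≤1 ν≤lam ρ Tr≈0 = Root.root (normRoot (Φ ρ)) , Root.root (normRoot ρ) , isNorm₂ (Φ ρ) , isNorm₂ ρ ,
    root-contraction (normRoot (Φ ρ)) (normRoot ρ) lam ν M 0≤ν ν≤1 ν≤lam τ τ→0
      (λ m → subst₂ (λ s t → s ≤ sq ν * t + τ m) (sym (re-Tr (Φ ρ) m)) (sym (re-Tr ρ m)) (frobenius-bound ρ m))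
    where
    τ : ℕ → ℚ
    τ m = sq (Re (Tr ρ) m) + sq (Im (Tr ρ) m)
    sq-small : ∀ (x : ℝ) → x ≈ᴿ 0ᴿ → ∀ ε → 0ℚ < ε → ∃ λ K → ∀ m → K ℕ.≤ m → sq (seq x m) ≤ ε
    sq-small x (x≤0 , 0≤x) ε 0<ε =
      let s , 0≤s , s²≤ , s>0 = positive-root
          K₁ , up = x≤0 s s>0
          K₂ , down = 0≤x s s>0 in
      K₁ ℕ.+ K₂ , λ m k → ≤-trans (between (up m (ℕ.m+n≤o⇒m≤o K₁ k)) (down m (ℕ.m+n≤o⇒n≤o K₁ k))) s²≤
      where
      positive-root : ∃ λ s → 0ℚ ≤ s × sq s ≤ ε × 0ℚ < s
      positive-root with ≤-total ε 1ℚ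
      ... | inj₁ ε≤1 = ε , <⇒≤ 0<ε , subst (sq ε ≤_) (*-identityʳ ε) (*-monoˡ (<⇒≤ 0<ε) ε≤1) , 0<ε
      ... | inj₂ 1≤ε = 1ℚ , 0≤1 , 1≤ε , 0<1
      between : ∀ {a s} → a ≤ 0ℚ + s → 0ℚ ≤ a + s → sq a ≤ sq s
      between {a} {s} p q = diff⇒≤ (subst (0ℚ ≤_) (lemma a s) (*-nonNeg (≤⇒diff p) q))
        where
        lemma : ∀ a s → (0ℚ + s - a) * (a + s) ≡ s * s - a * a
        lemma = solve-∀ ring
    τ→0 : ∀ ε → 0ℚ < ε → ∃ λ K → ∀ m → K ℕ.≤ m → τ m ≤ ε
    τ→0 ε 0<ε =
      let K₁ , a = sq-small (re (Tr ρ)) (proj₁ Tr≈0) (½ * ε) (½-pos 0<ε)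
          K₂ , b = sq-small (im (Tr ρ)) (proj₂ Tr≈0) (½ * ε) (½-pos 0<ε) in
      K₁ ℕ.+ K₂ , λ m k → ≤-trans (+-mono-≤ (a m (ℕ.m+n≤o⇒m≤o K₁ k)) (b m (ℕ.m+n≤o⇒n≤o K₁ k))) (≤-reflexive (half-sum ε))

-- Circuits for the channels

xor-cancelʳ : ∀ a b → xor (xor a b) b ≡ a
xor-cancelʳ = Group.⊕-cancel bitGroup

-- Signed permutation matrices, given by the column of the nonzero entry of each row

signedRep : ∀ {N} → Mat N → (Fin N → Fin N) → (Fin N → ℚ) → Set
signedRep M π s = ∀ x y → Rep (M x y) (if does (y Fin.≟ π x) then s x else 0ℚ)

≟-sym : ∀ {m} (x y : Fin m) → does (x Fin.≟ y) ≡ does (y Fin.≟ x)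
≟-sym x y with x Fin.≟ y
... | yes refl = sym (dec-true (x Fin.≟ x) refl)
... | no x≢y = sym (dec-false (y Fin.≟ x) (x≢y ∘ sym))

unitary-from : ∀ {N} (M : Mat N) (m : Fin N → Fin N → ℚ) → (∀ x y → Rep (M x y) (m x y)) →
  (∀ y y′ → ∑ (finElems N) (λ x → m x y * m x y′) ≡ (if does (y Fin.≟ y′) then 1ℚ else 0ℚ)) → M † · M ≋ I
unitary-from {N} M m rep eq y y′ = ≐⇒≈ ((M † · M) y y′) (I y y′) (rep⇒≐ ((M † · M) y y′) (I y y′)
  (rep-≡ {(M † · M) y y′} (eq y y′) (rep-∑ {F = λ x → (M †) y x *ᶜ M x y′} λ x → rep-* {(M †) y x} {M x y′} (rep-conj {M x y} (rep x y)) (rep x y′)))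
  (rep-if (does (y Fin.≟ y′)) {1ᶜ} {0ᶜ} (rep-const 1ℚ) (rep-const 0ℚ)))

signed-unitary : ∀ {N} (M : Mat N) π π⁻ s → (∀ x → π⁻ (π x) ≡ x) → (∀ x → π (π⁻ x) ≡ x) → (∀ x → s x * s x ≡ 1ℚ) →
  signedRep M π s → M † · M ≋ I
signed-unitary {N} M π π⁻ s π⁻π ππ⁻ s² rep = unitary-from M (λ x y → if does (y Fin.≟ π x) then s x else 0ℚ) rep eq
  where
  F : Fin N → Fin N → Fin N → ℚ
  F y y′ u = if does (u Fin.≟ y) then (if does (y′ Fin.≟ u) then 1ℚ else 0ℚ) else 0ℚ
  both : ∀ (b b′ : Bool) {a} → a * a ≡ 1ℚ → (if b then a else 0ℚ) * (if b′ then a else 0ℚ) ≡ (if b then (if b′ then 1ℚ else 0ℚ) else 0ℚ)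
  both true true e = e
  both true false {a} e = *-zeroʳ a
  both false b′ {a} e = *-zeroˡ (if b′ then a else 0ℚ)
  eq : ∀ y y′ → ∑ (finElems N) (λ x → (if does (y Fin.≟ π x) then s x else 0ℚ) * (if does (y′ Fin.≟ π x) then s x else 0ℚ)) ≡ (if does (y Fin.≟ y′) then 1ℚ else 0ℚ)
  eq y y′ = trans (∑-cong (finElems N) λ x → trans (both (does (y Fin.≟ π x)) (does (y′ Fin.≟ π x)) (s² x))
      (cong (if_then (if does (y′ Fin.≟ π x) then 1ℚ else 0ℚ) else 0ℚ) (≟-sym y (π x))))
    (trans (reindex (finiteFin N) (finiteFin N) π π⁻ π⁻π ππ⁻ (F y y′))
    (trans (Finite.pick (finiteFin N) y (λ u → if does (y′ Fin.≟ u) then 1ℚ else 0ℚ)) (cong (if_then 1ℚ else 0ℚ) (≟-sym y′ y))))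

-- The gates

data Name (L : ℕ) : Set where
  prep : Name L
  lower link upper : Fin L → Name L

module GateFamily {h₂ L : ℕ} (word : Pow (Fin 2) (h₂ ℕ.* 2) → List Letter) where
  h : ℕ
  h = h₂ ℕ.* 2

  gateCount : ℕ
  gateCount = suc (L ℕ.* 3)

  private
    kinds : Fin L × Fin 3 → Name L
    kinds (v , zero) = lower v
    kinds (v , suc zero) = link v
    kinds (v , suc (suc _)) = upper v

  name : Fin gateCount → Name L
  name zero = prep
  name (suc g) = kinds (remQuot 3 g)

  index : Name L → Fin gateCount
  index prep = zero
  index (lower v) = suc (combine v zero)
  index (link v) = suc (combine v (suc zero))
  index (upper v) = suc (combine v (suc (suc zero)))

  name-index : ∀ nm → name (index nm) ≡ nm
  name-index prep = refl
  name-index (lower v) = cong kinds (Fin.remQuot-combine {L} {3} v zero)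
  name-index (link v) = cong kinds (Fin.remQuot-combine {L} {3} v (suc zero))
  name-index (upper v) = cong kinds (Fin.remQuot-combine {L} {3} v (suc (suc zero)))

  extra : Name L → ℕ
  extra prep = 0
  extra (lower _) = 2
  extra (link _) = 3
  extra (upper _) = 2

  Control : Set
  Control = Pow (Fin 2) h

  nth : ∀ {m} → List Letter → Fin m → Letter
  -- A default beyond the end of the list; the words in use have length `L`.
  nth [] v = ((0b , 0b) , (0b , 0b)) , (0b , 0b , 0b , tt)
  nth (l ∷ ls) zero = l
  nth (l ∷ ls) (suc v) = nth ls v

  map-nth : ∀ {m} ls → length ls ≡ m → map (nth ls) (finElems m) ≡ ls
  map-nth [] refl = refl
  map-nth (l ∷ ls) refl = cong (l ∷_) (trans (sym (List.map-∘ (finElems (length ls)))) (map-nth ls refl))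

  -- Matrix products act in the opposite order.
  letter : Fin L → Control → Letter
  letter v c = nth (reverse (word c)) v

  siteLocal siteLocal⁻ : Letter → Site → Site
  siteLocal ((z , ξ) , r) s = turn (exponent r) s Site.⊕ ξ
  siteLocal⁻ ((z , ξ) , r) s = turn⁻ (exponent r) (s Site.⊕ ξ)

  -- The bit `b` is the q of the site below; it is added to p before the turn.
  linkLocal linkLocal⁻ : Letter → Fin 2 → Site → Site
  linkLocal (_ , r) b (p , q) = turn (exponent r) (xor p b , q)
  linkLocal⁻ (_ , r) b s = xor (proj₁ (turn⁻ (exponent r) s)) b , proj₂ (turn⁻ (exponent r) s)

  Local : Name L → Set
  Local nm = Pow (Fin 2) (extra nm)

  pack : Site → Pow (Fin 2) 2
  pack (p , q) = p , q , tt

  local local⁻ : ∀ nm → Control → Local nm → Local nm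
  local prep c x = x
  local (lower v) c (p , q , _) = pack (siteLocal (letter v c) (p , q))
  local (link v) c (b , p , q , _) = b , pack (linkLocal (letter v c) b (p , q))
  local (upper v) c x = x
  local⁻ prep c x = x
  local⁻ (lower v) c (p , q , _) = pack (siteLocal⁻ (letter v c) (p , q))
  local⁻ (link v) c (b , p , q , _) = b , pack (linkLocal⁻ (letter v c) b (p , q))
  local⁻ (upper v) c x = x

  phaseOf : ∀ nm → Control → Local nm → ℚ
  phaseOf (upper v) c (p , q , _) = Site.χ (proj₁ (proj₁ (letter v c))) (p , q)
  phaseOf _ c x = 1ℚ

  local⁻-local : ∀ nm c x → local⁻ nm c (local nm c x) ≡ x
  local⁻-local prep c x = refl
  local⁻-local (lower v) c (p , q , _) = cong pack (trans (cong (turn⁻ e) (Site.⊕-cancel (turn e (p , q)) (proj₂ (proj₁ (letter v c))))) (turn⁻-turn e (p , q)))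
    where e = exponent (proj₂ (letter v c))
  local⁻-local (link v) c (b , p , q , _) = cong (λ s → b , pack (xor (proj₁ s) b , proj₂ s)) (turn⁻-turn e (xor p b , q)) ■ cong (λ p → b , p , q , tt) (xor-cancelʳ p b)
    where
    e = exponent (proj₂ (letter v c))
    _■_ : ∀ {a b c : Pow (Fin 2) 3} → a ≡ b → b ≡ c → a ≡ c
    _■_ = trans
  local⁻-local (upper v) c x = refl

  local-local⁻ : ∀ nm c x → local nm c (local⁻ nm c x) ≡ x
  local-local⁻ prep c x = refl
  local-local⁻ (lower v) c (p , q , _) = cong pack (trans (cong (Site._⊕ ξ) (turn-turn⁻ (exponent (proj₂ (letter v c))) ((p , q) Site.⊕ ξ))) (Site.⊕-cancel (p , q) ξ))
    where ξ = proj₂ (proj₁ (letter v c))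
  local-local⁻ (link v) c (b , p , q , _) = cong (λ s → b , pack s) (trans (cong (λ p → turn e (p , proj₂ (turn⁻ e (p₀ , q)))) (xor-cancelʳ (proj₁ (turn⁻ e (p₀ , q))) b)) (turn-turn⁻ e (p₀ , q)))
    where
    e = exponent (proj₂ (letter v c))
    p₀ = p
  local-local⁻ (upper v) c x = refl

  phaseOf-sq : ∀ nm c x → phaseOf nm c x * phaseOf nm c x ≡ 1ℚ
  phaseOf-sq prep c x = refl
  phaseOf-sq (lower v) c x = refl
  phaseOf-sq (link v) c x = refl
  phaseOf-sq (upper v) c (p , q , _) = Site.χ-sq (proj₁ (proj₁ (letter v c))) (p , q)

  control : ∀ e → Fin (2 ℕ.^ (h ℕ.+ e)) → Control
  control e a = toPow h (λ i → finToFun {2} {h ℕ.+ e} a (i ↑ˡ e))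

  payload : ∀ e → Fin (2 ℕ.^ (h ℕ.+ e)) → Pow (Fin 2) e
  payload e a = toPow e (λ i → finToFun {2} {h ℕ.+ e} a (h ↑ʳ i))

  combined : ∀ e → Control → Pow (Fin 2) e → Bits (h ℕ.+ e)
  combined e c x = fromPow h c Vector.++ fromPow e x

  assemble : ∀ e → Control → Pow (Fin 2) e → Fin (2 ℕ.^ (h ℕ.+ e))
  assemble e c x = funToFin (combined e c x)

  combined-ˡ : ∀ e c x i → combined e c x (i ↑ˡ e) ≡ fromPow h c i
  combined-ˡ e c x i = cong [ fromPow h c , fromPow e x ] (Fin.splitAt-↑ˡ h i e)

  combined-ʳ : ∀ e c x i → combined e c x (h ↑ʳ i) ≡ fromPow e x i
  combined-ʳ e c x i = cong [ fromPow h c , fromPow e x ] (Fin.splitAt-↑ʳ h e i)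

  control-assemble : ∀ e c x → control e (assemble e c x) ≡ c
  control-assemble e c x = trans (toPow-cong h λ i → trans (Fin.finToFun-funToFin (combined e c x) (i ↑ˡ e)) (combined-ˡ e c x i)) (toPow-fromPow h c)

  payload-assemble : ∀ e c x → payload e (assemble e c x) ≡ x
  payload-assemble e c x = trans (toPow-cong e λ i → trans (Fin.finToFun-funToFin (combined e c x) (h ↑ʳ i)) (combined-ʳ e c x i)) (toPow-fromPow e x)

  by-halves : ∀ e {P : Fin (h ℕ.+ e) → Set} → (∀ i → P (i ↑ˡ e)) → (∀ i → P (h ↑ʳ i)) → ∀ i → P i
  by-halves e {P} l r i = subst P (Fin.join-splitAt h e i) (cases (splitAt h i))
    where
    cases : ∀ s → P (Fin.join h e s)
    cases (inj₁ i) = l i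
    cases (inj₂ i) = r i

  assemble-parts : ∀ e a → assemble e (control e a) (payload e a) ≡ a
  assemble-parts e a = trans (funToFin-cong (by-halves e
      (λ i → trans (combined-ˡ e (control e a) (payload e a) i) (fromPow-toPow h (λ i → finToFun {2} {h ℕ.+ e} a (i ↑ˡ e)) i))
      (λ i → trans (combined-ʳ e (control e a) (payload e a) i) (fromPow-toPow e (λ i → finToFun {2} {h ℕ.+ e} a (h ↑ʳ i)) i))))
    (Fin.funToFin-finToFin {h ℕ.+ e} a)

  act act⁻ : ∀ nm → Fin (2 ℕ.^ (h ℕ.+ extra nm)) → Fin (2 ℕ.^ (h ℕ.+ extra nm))
  act nm a = assemble (extra nm) (control (extra nm) a) (local nm (control (extra nm) a) (payload (extra nm) a))
  act⁻ nm a = assemble (extra nm) (control (extra nm) a) (local⁻ nm (control (extra nm) a) (payload (extra nm) a))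

  act⁻-act : ∀ nm a → act⁻ nm (act nm a) ≡ a
  act⁻-act nm a = trans (cong₂ (λ c x → assemble e c (local⁻ nm c x)) (control-assemble e (control e a) (local nm (control e a) (payload e a))) (payload-assemble e (control e a) (local nm (control e a) (payload e a))))
    (trans (cong (assemble e (control e a)) (local⁻-local nm (control e a) (payload e a))) (assemble-parts e a))
    where e = extra nm

  act-act⁻ : ∀ nm a → act nm (act⁻ nm a) ≡ a
  act-act⁻ nm a = trans (cong₂ (λ c x → assemble e c (local nm c x)) (control-assemble e (control e a) (local⁻ nm (control e a) (payload e a))) (payload-assemble e (control e a) (local⁻ nm (control e a) (payload e a))))
    (trans (cong (assemble e (control e a)) (local-local⁻ nm (control e a) (payload e a))) (assemble-parts e a))
    where e = extra nm

  gateSign : ∀ nm → Fin (2 ℕ.^ (h ℕ.+ extra nm)) → ℚ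
  gateSign nm a = phaseOf nm (control (extra nm) a) (payload (extra nm) a)

  -- The Walsh-Hadamard transform of all control qubits as one gate, with rational entries because
  -- `h` is even.
  hadamard : Fin (2 ℕ.^ h) → Fin (2 ℕ.^ h) → ℚ
  hadamard a b = ½ ^ h₂ * Group.χ (bits h) (bitsOf h a) (bitsOf h b)

  arityOf : Name L → ℕ
  arityOf prep = h
  arityOf nm = h ℕ.+ extra nm

  signedMatrix : ∀ nm → Mat (2 ℕ.^ (h ℕ.+ extra nm))
  signedMatrix nm a b = fromℝ (fromℚ (if does (b Fin.≟ act nm a) then gateSign nm a else 0ℚ))

  matrixOf : ∀ nm → Mat (2 ℕ.^ arityOf nm)
  matrixOf prep a b = fromℝ (fromℚ (hadamard a b))
  matrixOf (lower v) = signedMatrix (lower v)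
  matrixOf (link v) = signedMatrix (link v)
  matrixOf (upper v) = signedMatrix (upper v)

  signedMatrix-rep : ∀ nm → signedRep (signedMatrix nm) (act nm) (gateSign nm)
  signedMatrix-rep nm a b = rep-const (if does (b Fin.≟ act nm a) then gateSign nm a else 0ℚ)

  signedMatrix-unitary : ∀ nm → signedMatrix nm † · signedMatrix nm ≋ I
  signedMatrix-unitary nm = signed-unitary (signedMatrix nm) (act nm) (act⁻ nm) (gateSign nm) (act⁻-act nm) (act-act⁻ nm)
    (λ a → phaseOf-sq nm (control (extra nm) a) (payload (extra nm) a)) (signedMatrix-rep nm)

  hadamard-orthogonal : ∀ b b′ → ∑ (finElems (2 ℕ.^ h)) (λ a → hadamard a b * hadamard a b′) ≡ (if does (b Fin.≟ b′) then 1ℚ else 0ℚ)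
  hadamard-orthogonal b b′ = begin
    ∑ (finElems (2 ℕ.^ h)) (λ a → hadamard a b * hadamard a b′)
      ≡⟨ ∑-cong (finElems (2 ℕ.^ h)) (λ a → trans (interchange (½ ^ h₂) (H.χ (bitsOf h a) (bitsOf h b)) (H.χ (bitsOf h a) (bitsOf h b′))) (cong (_* (H.χ (bitsOf h a) (bitsOf h b) * H.χ (bitsOf h a) (bitsOf h b′))) ½^h)) ⟩
    ∑ (finElems (2 ℕ.^ h)) (λ a → H.isize * (H.χ (bitsOf h a) (bitsOf h b) * H.χ (bitsOf h a) (bitsOf h b′)))
      ≡⟨ ∑-*ˡ (finElems (2 ℕ.^ h)) H.isize (λ a → H.χ (bitsOf h a) (bitsOf h b) * H.χ (bitsOf h a) (bitsOf h b′)) ⟩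
    H.isize * ∑ (finElems (2 ℕ.^ h)) (λ a → H.χ (bitsOf h a) (bitsOf h b) * H.χ (bitsOf h a) (bitsOf h b′))
      ≡⟨ cong (H.isize *_) (trans (reindex (finiteFin (2 ℕ.^ h)) H.finite (bitsOf h) (ofBits h) (ofBits-bitsOf h) (bitsOf-ofBits h) (λ c → H.χ c (bitsOf h b) * H.χ c (bitsOf h b′)))
           (H.orthogonality (bitsOf h b) (bitsOf h b′))) ⟩
    H.isize * (if does (bitsOf h b H.≟ bitsOf h b′) then H.size else 0ℚ)
      ≡⟨ choose′ (does (bitsOf h b H.≟ bitsOf h b′)) ⟩
    (if does (bitsOf h b H.≟ bitsOf h b′) then 1ℚ else 0ℚ)
      ≡⟨ cong (if_then 1ℚ else 0ℚ) same ⟩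
    (if does (b Fin.≟ b′) then 1ℚ else 0ℚ) ∎
    where
    open ≡-Reasoning
    module H = Group (bits h)
    interchange : ∀ a p q → a * p * (a * q) ≡ a * a * (p * q)
    interchange = solve-∀ ring
    ½^h : ½ ^ h₂ * ½ ^ h₂ ≡ H.isize
    ½^h = trans (sym (^-+ ½ h₂ h₂)) (cong (½ ^_) (trans (trans (cong (h₂ ℕ.+_) (sym (ℕ.+-identityʳ h₂))) (ℕ.*-comm 2 h₂)) (sym (trans (powDim bitGroup h) (ℕ.*-identityʳ h)))))
    choose′ : ∀ t → H.isize * (if t then H.size else 0ℚ) ≡ (if t then 1ℚ else 0ℚ)
    choose′ true = H.size-inv
    choose′ false = *-zeroʳ H.isize
    same : does (bitsOf h b H.≟ bitsOf h b′) ≡ does (b Fin.≟ b′)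
    same with b Fin.≟ b′
    ... | yes refl = dec-true (bitsOf h b H.≟ bitsOf h b) refl
    ... | no b≢b′ = dec-false (bitsOf h b H.≟ bitsOf h b′) λ e → b≢b′ (trans (sym (ofBits-bitsOf h b)) (trans (cong (ofBits h) e) (ofBits-bitsOf h b′)))

  matrixOf-unitary : ∀ nm → matrixOf nm † · matrixOf nm ≋ I
  matrixOf-unitary prep = unitary-from (matrixOf prep) hadamard (λ a b → rep-const (hadamard a b)) hadamard-orthogonal
  matrixOf-unitary (lower v) = signedMatrix-unitary (lower v)
  matrixOf-unitary (link v) = signedMatrix-unitary (link v)
  matrixOf-unitary (upper v) = signedMatrix-unitary (upper v)

  𝒢 : GateSet
  𝒢 = record { gates = gateCount ; arity = arityOf ∘ name ; matrix = matrixOf ∘ name ; unitary = matrixOf-unitary ∘ name }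

-- Positions of the qubits of a site

siteP siteQ : ∀ {n} → Fin n → Fin (n ℕ.* 2)
siteP zero = zero
siteP (suc j) = suc (suc (siteP j))
siteQ zero = suc zero
siteQ (suc j) = suc (suc (siteQ j))

siteQ-injective : ∀ {n} {i j : Fin n} → siteQ i ≡ siteQ j → i ≡ j
siteQ-injective {i = zero} {zero} e = refl
siteQ-injective {i = suc i} {suc j} e = cong suc (siteQ-injective (Fin.suc-injective (Fin.suc-injective e)))

siteP≢siteQ : ∀ {n} (i j : Fin n) → siteP i ≢ siteQ j
siteP≢siteQ zero zero ()
siteP≢siteQ zero (suc j) ()
siteP≢siteQ (suc i) zero ()
siteP≢siteQ (suc i) (suc j) e = siteP≢siteQ i j (Fin.suc-injective (Fin.suc-injective e))

inject₁≢suc : ∀ {n} (j : Fin n) → inject₁ j ≢ suc j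
inject₁≢suc (suc j) e = inject₁≢suc j (Fin.suc-injective e)

-- The entries of a gate applied to some of the qubits

entry : ∀ {m r} → (Fin r → Fin m) → Mat (2 ℕ.^ r) → Mat (2 ℕ.^ m)
entry wires M x y =
  if does (Fin.all? λ j → Fin.any? (λ i → wires i Fin.≟ j) ⊎-dec (finToFun {2} x j Fin.≟ finToFun {2} y j))
  then M (funToFin (finToFun {2} x ∘ wires)) (funToFin (finToFun {2} y ∘ wires))
  else 0ᶜ

-- The row of `x` has its nonzero entry at the `x′` that agrees with the gate's output on the wires
-- and with `x` elsewhere; both conditions together determine `x′`, and a column failing the second
-- is cut off by the decision in `entry`.
entry-acts : ∀ {m r} (wires : Fin r → Fin m) (M : Mat (2 ℕ.^ r)) π s → signedRep M π s → ∀ (x x′ : Fin (2 ℕ.^ m)) →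
  (∀ i → finToFun {2} x′ (wires i) ≡ finToFun (π (funToFin (finToFun {2} x ∘ wires))) i) →
  (∀ j → (∃ λ i → wires i ≡ j) ⊎ finToFun {2} x j ≡ finToFun x′ j) →
  ∀ y → Rep (entry wires M x y) (if does (y Fin.≟ x′) then s (funToFin (finToFun {2} x ∘ wires)) else 0ℚ)
entry-acts {m} {r} wires M π s rep x x′ on off y = cases (Fin.all? λ j → Fin.any? (λ i → wires i Fin.≟ j) ⊎-dec (finToFun {2} x j Fin.≟ finToFun y j))
  where
  a = funToFin (finToFun {2} x ∘ wires)
  b = funToFin (finToFun {2} y ∘ wires)
  cases : (D : Dec (∀ j → (∃ λ i → wires i ≡ j) ⊎ finToFun {2} x j ≡ finToFun y j)) →
    Rep (if does D then M a b else 0ᶜ) (if does (y Fin.≟ x′) then s a else 0ℚ)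
  cases (yes agree) = rep-≡ {M a b} (cong (if_then s a else 0ℚ) same) (rep a b)
    where
    same : does (b Fin.≟ π a) ≡ does (y Fin.≟ x′)
    same with y Fin.≟ x′
    ... | yes refl = dec-true (b Fin.≟ π a) (trans (funToFin-cong on) (Fin.funToFin-finToFin {r} (π a)))
    ... | no y≢x′ = dec-false (b Fin.≟ π a) λ e → y≢x′ (finToFun-injective {m} y x′ (equal e))
      where
      equal : b ≡ π a → ∀ j → finToFun {2} y j ≡ finToFun x′ j
      equal e j with agree j | off j
      ... | inj₁ (i , refl) | _ = trans (sym (Fin.finToFun-funToFin (finToFun {2} y ∘ wires) i)) (trans (cong (λ t → finToFun t i) e) (sym (on i)))
      ... | inj₂ e₁ | inj₂ e₂ = trans (sym e₁) e₂
      ... | inj₂ _ | inj₁ (i , refl) = trans (sym (Fin.finToFun-funToFin (finToFun {2} y ∘ wires) i)) (trans (cong (λ t → finToFun t i) e) (sym (on i)))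
  cases (no ¬agree) = rep-≡ {0ᶜ} (sym (cong (if_then s a else 0ℚ) (dec-false (y Fin.≟ x′) λ { refl → ¬agree off }))) (rep-const 0ℚ)

module _ {𝒢 : GateSet} {m : ℕ} where
  open GateSet 𝒢

  -- Follows a row of the product: `s` stands at column `x′` and the rest is zero. Along rows the
  -- last operation of the list comes first, so lists are read backwards below.
  Acts : List (Op 𝒢 m) → Fin (2 ℕ.^ m) → Fin (2 ℕ.^ m) → ℚ → Set
  Acts os x x′ s = ∀ y → Rep (opsMatrix os x y) (if does (y Fin.≟ x′) then s else 0ℚ)

  acts-[] : ∀ x → Acts [] x x 1ℚ
  acts-[] x y = rep-≡ {I x y} (cong (if_then 1ℚ else 0ℚ) (≟-sym x y)) (rep-if (does (x Fin.≟ y)) {1ᶜ} {0ᶜ} (rep-const 1ℚ) (rep-const 0ℚ))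

  -- Only the entry of the row of `os` at x₁ matters.
  product-row : ∀ os o x x₁ s {q} y → Acts os x x₁ s → Rep (opMatrix o x₁ y) q → Rep (opsMatrix (o ∷ os) x y) (s * q)
  product-row os o x x₁ s {q} y p r = rep-≡ {opsMatrix (o ∷ os) x y} (Finite.pick (finiteFin (2 ℕ.^ m)) x₁ (λ _ → s * q))
    (rep-∑ {F = λ k → opsMatrix os x k *ᶜ opMatrix o k y} each)
    where
    each : ∀ k → Rep (opsMatrix os x k *ᶜ opMatrix o k y) (if does (k Fin.≟ x₁) then s * q else 0ℚ)
    each k with k Fin.≟ x₁ | p k
    ... | yes refl | rep = rep-* {opsMatrix os x k} {opMatrix o k y} rep r
    ... | no _ | rep = rep-0* {opsMatrix os x k} (opMatrix o k y) rep

  acts-∷ : ∀ os o x x₁ x₂ s t → Acts os x x₁ s → (∀ y → Rep (opMatrix o x₁ y) (if does (y Fin.≟ x₂) then t else 0ℚ)) → Acts (o ∷ os) x x₂ (s * t)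
  acts-∷ os o x x₁ x₂ s t p r y = rep-≡ {opsMatrix (o ∷ os) x y} (push (does (y Fin.≟ x₂))) (product-row os o x x₁ s y p (r y))
    where
    push : ∀ b → s * (if b then t else 0ℚ) ≡ (if b then s * t else 0ℚ)
    push true = refl
    push false = *-zeroʳ s

-- The circuit on k + 2 sites

module Circuits {h₂ L : ℕ} (word : Pow (Fin 2) (h₂ ℕ.* 2) → List Letter) (k : ℕ) where
  open GateFamily {h₂} {L} word public

  sites qubits : ℕ
  sites = suc (suc k)
  qubits = sites ℕ.* 2

  last : Fin sites
  last = Fin.fromℕ (suc k)

  dataWires : ∀ nm → Fin (suc k) → Fin (extra nm) → Fin qubits
  dataWires (lower v) j zero = siteP {sites} zero
  dataWires (lower v) j (suc zero) = siteQ {sites} zero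
  dataWires (link v) j zero = siteQ (inject₁ j)
  dataWires (link v) j (suc zero) = siteP (suc j)
  dataWires (link v) j (suc (suc zero)) = siteQ (suc j)
  dataWires (upper v) j zero = siteP last
  dataWires (upper v) j (suc zero) = siteQ last

  dataWires-injective : ∀ nm j {i i′} → dataWires nm j i ≡ dataWires nm j i′ → i ≡ i′
  dataWires-injective (lower v) j {zero} {zero} e = refl
  dataWires-injective (lower v) j {zero} {suc zero} ()
  dataWires-injective (lower v) j {suc zero} {zero} ()
  dataWires-injective (lower v) j {suc zero} {suc zero} e = refl
  dataWires-injective (link v) j {zero} {zero} e = refl
  dataWires-injective (link v) j {zero} {suc zero} e = contradiction (sym e) (siteP≢siteQ (suc j) (inject₁ j))
  dataWires-injective (link v) j {zero} {suc (suc zero)} e = contradiction (siteQ-injective e) (inject₁≢suc j)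
  dataWires-injective (link v) j {suc zero} {zero} e = contradiction e (siteP≢siteQ (suc j) (inject₁ j))
  dataWires-injective (link v) j {suc zero} {suc zero} e = refl
  dataWires-injective (link v) j {suc zero} {suc (suc zero)} e = contradiction e (siteP≢siteQ (suc j) (suc j))
  dataWires-injective (link v) j {suc (suc zero)} {zero} e = contradiction (sym (siteQ-injective e)) (inject₁≢suc j)
  dataWires-injective (link v) j {suc (suc zero)} {suc zero} e = contradiction (sym e) (siteP≢siteQ (suc j) (suc j))
  dataWires-injective (link v) j {suc (suc zero)} {suc (suc zero)} e = refl
  dataWires-injective (upper v) j {zero} {zero} e = refl
  dataWires-injective (upper v) j {zero} {suc zero} e = contradiction e (siteP≢siteQ last last)
  dataWires-injective (upper v) j {suc zero} {zero} e = contradiction (sym e) (siteP≢siteQ last last)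
  dataWires-injective (upper v) j {suc zero} {suc zero} e = refl

  mixed : ∀ nm → Fin (suc k) → Fin h ⊎ Fin (extra nm) → Fin qubits ⊎ Fin h
  mixed nm j (inj₁ i) = inj₂ i
  mixed nm j (inj₂ i) = inj₁ (dataWires nm j i)

  signedWires : ∀ nm → Fin (suc k) → Fin (h ℕ.+ extra nm) → Fin (qubits ℕ.+ h)
  signedWires nm j i = Fin.join qubits h (mixed nm j (splitAt h i))

  wiresOf : ∀ nm → Fin (suc k) → Fin (arityOf nm) → Fin (qubits ℕ.+ h)
  wiresOf prep j i = qubits ↑ʳ i
  wiresOf (lower v) j i = signedWires (lower v) j i
  wiresOf (link v) j i = signedWires (link v) j i
  wiresOf (upper v) j i = signedWires (upper v) j i

  signedWires-injective : ∀ nm j → Injective _≡_ _≡_ (signedWires nm j)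
  signedWires-injective nm j {i} {i′} e = trans (sym (Fin.join-splitAt h (extra nm) i))
    (trans (cong (Fin.join h (extra nm)) (mixed-injective (splitAt h i) (splitAt h i′)
      (trans (sym (Fin.splitAt-join qubits h (mixed nm j (splitAt h i)))) (trans (cong (splitAt qubits) e) (Fin.splitAt-join qubits h (mixed nm j (splitAt h i′)))))))
      (Fin.join-splitAt h (extra nm) i′))
    where
    mixed-injective : ∀ s s′ → mixed nm j s ≡ mixed nm j s′ → s ≡ s′
    mixed-injective (inj₁ i) (inj₁ i′) e = cong inj₁ (Sum.inj₂-injective e)
    mixed-injective (inj₂ i) (inj₂ i′) e = cong inj₂ (dataWires-injective nm j (Sum.inj₁-injective e))

  wiresOf-injective : ∀ nm j → Injective _≡_ _≡_ (wiresOf nm j)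
  wiresOf-injective prep j = Fin.↑ʳ-injective qubits _ _
  wiresOf-injective (lower v) j = signedWires-injective (lower v) j
  wiresOf-injective (link v) j = signedWires-injective (link v) j
  wiresOf-injective (upper v) j = signedWires-injective (upper v) j

  operation : Fin gateCount → Fin (suc k) → Op 𝒢 (qubits ℕ.+ h)
  operation g j = record { gate = g ; wires = wiresOf (name g) j ; distinct = wiresOf-injective (name g) j }

  links : Fin L → List (Op 𝒢 (qubits ℕ.+ h))
  links v = map (operation (index (link v))) (finElems (suc k))

  -- Read from the end, as rows are followed: the phase at the top, the links from the top down, and
  -- the bottom site. Descending order ensures that a site is still unturned when the site above
  -- reads its q.
  stepOps : Fin L → List (Op 𝒢 (qubits ℕ.+ h))
  stepOps v = operation (index (lower v)) zero ∷ links v ++ operation (index (upper v)) zero ∷ []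

  bodyOps allOps : List (Op 𝒢 (qubits ℕ.+ h))
  bodyOps = concatMap stepOps (finElems L)
  allOps = operation (index prep) zero ∷ bodyOps

  circuit : Circuit 𝒢 qubits
  circuit = record { ancillas = h ; ops = allOps }

  joint : States sites → Control → Bits (qubits ℕ.+ h)
  joint x c = bitAt sites x Vector.++ fromPow h c

  basis : States sites → Control → Fin (2 ℕ.^ (qubits ℕ.+ h))
  basis x c = funToFin (joint x c)

  joint-data : ∀ x c d → joint x c (d ↑ˡ h) ≡ bitAt sites x d
  joint-data x c d = cong [ bitAt sites x , fromPow h c ] (Fin.splitAt-↑ˡ qubits d h)

  joint-control : ∀ x c i → joint x c (qubits ↑ʳ i) ≡ fromPow h c i
  joint-control x c i = cong [ bitAt sites x , fromPow h c ] (Fin.splitAt-↑ʳ qubits h i)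

  gathered : ∀ nm → Fin (suc k) → States sites → Local nm
  gathered nm j x = toPow (extra nm) (bitAt sites x ∘ dataWires nm j)

  control-wire : ∀ nm j i → signedWires nm j (i ↑ˡ extra nm) ≡ qubits ↑ʳ i
  control-wire nm j i = cong (λ s → Fin.join qubits h (mixed nm j s)) (Fin.splitAt-↑ˡ h i (extra nm))

  data-wire : ∀ nm j i → signedWires nm j (h ↑ʳ i) ≡ dataWires nm j i ↑ˡ h
  data-wire nm j i = cong (λ s → Fin.join qubits h (mixed nm j s)) (Fin.splitAt-↑ʳ h (extra nm) i)

  module _ (nm : Name L) (j : Fin (suc k)) (x : States sites) (c : Control) where
    private
      e = extra nm

      input : Fin (2 ℕ.^ (h ℕ.+ e))
      input = funToFin (finToFun {2} (basis x c) ∘ signedWires nm j)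

      read : ∀ x i → finToFun {2} (basis x c) i ≡ joint x c i
      read x = Fin.finToFun-funToFin (joint x c)

      input≡ : input ≡ assemble e c (gathered nm j x)
      input≡ = funToFin-cong (by-halves e
        (λ i → trans (read x (signedWires nm j (i ↑ˡ e))) (trans (cong (joint x c) (control-wire nm j i)) (trans (joint-control x c i) (sym (combined-ˡ e c (gathered nm j x) i)))))
        (λ i → trans (read x (signedWires nm j (h ↑ʳ i))) (trans (cong (joint x c) (data-wire nm j i)) (trans (joint-data x c (dataWires nm j i))
          (sym (trans (combined-ʳ e c (gathered nm j x) i) (fromPow-toPow e (bitAt sites x ∘ dataWires nm j) i)))))))

      input-act : act nm input ≡ assemble e c (local nm c (gathered nm j x))
      input-act = trans (cong (act nm) input≡) (cong₂ (λ c x → assemble e c (local nm c x)) (control-assemble e c (gathered nm j x)) (payload-assemble e c (gathered nm j x)))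

    sign-input : gateSign nm input ≡ phaseOf nm c (gathered nm j x)
    sign-input = trans (cong (gateSign nm) input≡) (cong₂ (phaseOf nm) (control-assemble e c (gathered nm j x)) (payload-assemble e c (gathered nm j x)))

    condition-on : ∀ x′ → (∀ i → bitAt sites x′ (dataWires nm j i) ≡ fromPow e (local nm c (gathered nm j x)) i) →
      ∀ i → finToFun {2} (basis x′ c) (signedWires nm j i) ≡ finToFun (act nm input) i
    condition-on x′ updated i = trans (read x′ (signedWires nm j i)) (trans (by-halves e {λ i → joint x′ c (signedWires nm j i) ≡ combined e c (local nm c (gathered nm j x)) i}
        (λ i → trans (cong (joint x′ c) (control-wire nm j i)) (trans (joint-control x′ c i) (sym (combined-ˡ e c (local nm c (gathered nm j x)) i))))
        (λ i → trans (cong (joint x′ c) (data-wire nm j i)) (trans (joint-data x′ c (dataWires nm j i)) (trans (updated i) (sym (combined-ʳ e c (local nm c (gathered nm j x)) i))))) i)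
      (sym (trans (cong (λ a → finToFun a i) input-act) (Fin.finToFun-funToFin (combined e c (local nm c (gathered nm j x))) i))))

    condition-off : ∀ x′ → (∀ d → (∃ λ i → dataWires nm j i ≡ d) ⊎ bitAt sites x d ≡ bitAt sites x′ d) →
      ∀ w → (∃ λ i → signedWires nm j i ≡ w) ⊎ finToFun {2} (basis x c) w ≡ finToFun (basis x′ c) w
    condition-off x′ kept w = subst (λ w → (∃ λ i → signedWires nm j i ≡ w) ⊎ finToFun {2} (basis x c) w ≡ finToFun (basis x′ c) w) (Fin.join-splitAt qubits h w) (cases (splitAt qubits w))
      where
      cases : ∀ s → (∃ λ i → signedWires nm j i ≡ Fin.join qubits h s) ⊎ finToFun {2} (basis x c) (Fin.join qubits h s) ≡ finToFun (basis x′ c) (Fin.join qubits h s)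
      cases (inj₂ i) = inj₁ (i ↑ˡ e , control-wire nm j i)
      cases (inj₁ d) = [ (λ (i , q) → inj₁ (h ↑ʳ i , trans (data-wire nm j i) (cong (_↑ˡ h) q))) ,
        (λ q → inj₂ (trans (read x (d ↑ˡ h)) (trans (trans (joint-data x c d) (trans q (sym (joint-data x′ c d)))) (sym (read x′ (d ↑ˡ h)))))) ] (kept d)

  OpActs : Name L → Fin (suc k) → Control → States sites → States sites → ℚ → Set
  OpActs nm j c x x′ s = ∀ y → Rep (opMatrix (operation (index nm) j) (basis x c) y) (if does (y Fin.≟ basis x′ c) then s else 0ℚ)

  rename : ∀ nm j x y {q} → Rep (entry (wiresOf nm j) (matrixOf nm) x y) q → Rep (opMatrix (operation (index nm) j) x y) q
  rename nm j x y {q} = subst (λ nm → Rep (entry (wiresOf nm j) (matrixOf nm) x y) q) (sym (name-index nm))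

  private
    signed-acts : ∀ nm j c x x′ →
      (∀ i → bitAt sites x′ (dataWires nm j i) ≡ fromPow (extra nm) (local nm c (gathered nm j x)) i) →
      (∀ d → (∃ λ i → dataWires nm j i ≡ d) ⊎ bitAt sites x d ≡ bitAt sites x′ d) →
      ∀ y → Rep (entry (signedWires nm j) (signedMatrix nm) (basis x c) y) (if does (y Fin.≟ basis x′ c) then phaseOf nm c (gathered nm j x) else 0ℚ)
    signed-acts nm j c x x′ updated kept y = rep-≡ {entry (signedWires nm j) (signedMatrix nm) (basis x c) y}
      (cong (λ s → if does (y Fin.≟ basis x′ c) then s else 0ℚ) (sign-input nm j x c))
      (entry-acts (signedWires nm j) (signedMatrix nm) (act nm) (gateSign nm) (signedMatrix-rep nm) (basis x c) (basis x′ c)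
        (condition-on nm j x c x′ updated) (condition-off nm j x c x′ kept) y)

  applyBot : Letter → States sites → States sites
  applyBot l (s , x) = siteLocal l s , x

  applyLink : ∀ {n} → Letter → Fin n → States (suc n) → States (suc n)
  applyLink l zero (s , (t , x)) = s , (linkLocal l (proj₂ s) t , x)
  applyLink l (suc j) (s , x) = s , applyLink l j x

  bot-acts : ∀ v c x → OpActs (lower v) zero c x (applyBot (letter v c) x) 1ℚ
  bot-acts v c x y = rename (lower v) zero (basis x c) y (signed-acts (lower v) zero c x (applyBot (letter v c) x)
    (λ { zero → refl ; (suc zero) → refl })
    (λ { zero → inj₁ (zero , refl) ; (suc zero) → inj₁ (suc zero , refl) ; (suc (suc d)) → inj₂ refl }) y)

  private
    linkWires : ∀ {n} → Fin n → Fin 3 → Fin (suc n ℕ.* 2)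
    linkWires j zero = siteQ (inject₁ j)
    linkWires j (suc zero) = siteP (suc j)
    linkWires j (suc (suc zero)) = siteQ (suc j)

    link-updated : ∀ {n} l (j : Fin n) x i → bitAt (suc n) (applyLink l j x) (linkWires j i) ≡
      fromPow 3 (bitAt (suc n) x (linkWires j zero) , pack (linkLocal l (bitAt (suc n) x (linkWires j zero)) (bitAt (suc n) x (linkWires j (suc zero)) , bitAt (suc n) x (linkWires j (suc (suc zero)))))) i
    link-updated l zero (s , (t , x)) zero = refl
    link-updated l zero (s , (t , x)) (suc zero) = refl
    link-updated l zero (s , (t , x)) (suc (suc zero)) = refl
    link-updated l (suc j) (s , x) zero = link-updated l j x zero
    link-updated l (suc j) (s , x) (suc zero) = link-updated l j x (suc zero)
    link-updated l (suc j) (s , x) (suc (suc zero)) = link-updated l j x (suc (suc zero))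

    link-kept : ∀ {n} l (j : Fin n) x d → (∃ λ i → linkWires j i ≡ d) ⊎ bitAt (suc n) x d ≡ bitAt (suc n) (applyLink l j x) d
    link-kept l zero (s , (t , x)) zero = inj₂ refl
    link-kept l zero (s , (t , x)) (suc zero) = inj₁ (zero , refl)
    link-kept l zero (s , (t , x)) (suc (suc zero)) = inj₁ (suc zero , refl)
    link-kept l zero (s , (t , x)) (suc (suc (suc zero))) = inj₁ (suc (suc zero) , refl)
    link-kept l zero (s , (t , x)) (suc (suc (suc (suc d)))) = inj₂ refl
    link-kept l (suc j) (s , x) zero = inj₂ refl
    link-kept l (suc j) (s , x) (suc zero) = inj₂ refl
    link-kept l (suc j) (s , x) (suc (suc d)) with link-kept l j x d
    ... | inj₂ e = inj₂ e
    ... | inj₁ (zero , e) = inj₁ (zero , cong (λ d → Fin.suc (Fin.suc d)) e)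
    ... | inj₁ (suc zero , e) = inj₁ (suc zero , cong (λ d → Fin.suc (Fin.suc d)) e)
    ... | inj₁ (suc (suc zero) , e) = inj₁ (suc (suc zero) , cong (λ d → Fin.suc (Fin.suc d)) e)

  link-acts : ∀ v j c x → OpActs (link v) j c x (applyLink (letter v c) j x) 1ℚ
  link-acts v j c x y = rename (link v) j (basis x c) y (signed-acts (link v) j c x (applyLink (letter v c) j x)
    (λ { zero → link-updated (letter v c) j x zero ; (suc zero) → link-updated (letter v c) j x (suc zero) ; (suc (suc zero)) → link-updated (letter v c) j x (suc (suc zero)) })
    (λ d → kept d (link-kept (letter v c) j x d)) y)
    where
    kept : ∀ d → (∃ λ i → linkWires j i ≡ d) ⊎ bitAt sites x d ≡ bitAt sites (applyLink (letter v c) j x) d →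
      (∃ λ i → dataWires (link v) j i ≡ d) ⊎ bitAt sites x d ≡ bitAt sites (applyLink (letter v c) j x) d
    kept d (inj₂ e) = inj₂ e
    kept d (inj₁ (zero , e)) = inj₁ (zero , e)
    kept d (inj₁ (suc zero , e)) = inj₁ (suc zero , e)
    kept d (inj₁ (suc (suc zero) , e)) = inj₁ (suc (suc zero) , e)

  top-acts : ∀ v c x → OpActs (upper v) zero c x x (phase sites (letter v c) x)
  top-acts v c x y = rep-≡ {opMatrix (operation (index (upper v)) zero) (basis x c) y} (cong (λ s → if does (y Fin.≟ basis x c) then s else 0ℚ) sign-top)
    (rename (upper v) zero (basis x c) y (signed-acts (upper v) zero c x x (λ { zero → refl ; (suc zero) → refl }) (λ d → inj₂ refl) y))
    where
    top-bits : ∀ n (x : States (suc n)) → (bitAt (suc n) x (siteP (Fin.fromℕ n)) , bitAt (suc n) x (siteQ (Fin.fromℕ n))) ≡ top (suc n) x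
    top-bits zero (s , _) = refl
    top-bits (suc n) (s , x) = top-bits n x
    z = proj₁ (proj₁ (letter v c))
    sign-top : Site.χ z (bitAt sites x (siteP last) , bitAt sites x (siteQ last)) ≡ State.χ sites (atTop sites z) x
    sign-top = trans (cong (Site.χ z) (top-bits (suc k) x)) (sym (χ-atTop sites z x))

  allLinks : ∀ {n} → Letter → List (Fin n) → States (suc n) → States (suc n)
  allLinks l [] x = x
  allLinks l (j ∷ js) x = applyLink l j (allLinks l js x)

  allLinks-map : ∀ {n} l (js : List (Fin n)) s x → allLinks l (map suc js) (s , x) ≡ (s , allLinks l js x)
  allLinks-map l [] s x = refl
  allLinks-map l (j ∷ js) s x = cong (applyLink l (suc j)) (allLinks-map l js s x)

  -- The links above are done before the link to `t`, so each reads the old q of the site below it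
  -- and the sweep equals the simultaneous carry followed by the turns.
  allLinks-sweep : ∀ n l s x → allLinks {n} l (finElems n) (s , x) ≡ (s , mapS (turn (exponent (proj₂ l))) n (carry (proj₂ s) n x))
  allLinks-sweep zero l s tt = refl
  allLinks-sweep (suc n) l s (t , x) = trans (cong (applyLink l zero) (trans (allLinks-map l (finElems n) s (t , x)) (cong (s ,_) (allLinks-sweep n l t x)))) refl

  step-result : ∀ l x → applyBot l (allLinks l (finElems (suc k)) x) ≡ move sites l x
  step-result l@((z , ξ) , r) ((p , q) , x) = trans (cong (applyBot l) (allLinks-sweep (suc k) l (p , q) x))
    (cong₂ _,_ (cong (λ b → turn (exponent r) (b , q) Site.⊕ ξ) (sym (Group.⊕-idʳ bitGroup p))) (sym (State.⊕-idʳ (suc k) (mapS (turn (exponent r)) (suc k) (carry q (suc k) x)))))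

  ListActs : List (Op 𝒢 (qubits ℕ.+ h)) → Control → States sites → States sites → ℚ → Set
  ListActs os c x x′ s = Acts os (basis x c) (basis x′ c) s

  cons-acts : ∀ os nm j c x x₁ x₂ s t → ListActs os c x x₁ s → OpActs nm j c x₁ x₂ t → ListActs (operation (index nm) j ∷ os) c x x₂ (s * t)
  cons-acts os nm j c x x₁ x₂ s t p r = acts-∷ os (operation (index nm) j) (basis x c) (basis x₁ c) (basis x₂ c) s t p r

  links-act : ∀ v c x x₁ s os → ListActs os c x x₁ s → ∀ js → ListActs (map (operation (index (link v))) js ++ os) c x (allLinks (letter v c) js x₁) s
  links-act v c x x₁ s os p [] = p
  links-act v c x x₁ s os p (j ∷ js) = subst (ListActs (map (operation (index (link v))) (j ∷ js) ++ os) c x (allLinks (letter v c) (j ∷ js) x₁)) (*-identityʳ s)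
    (cons-acts (map (operation (index (link v))) js ++ os) (link v) j c x (allLinks (letter v c) js x₁) (allLinks (letter v c) (j ∷ js) x₁) s 1ℚ (links-act v c x x₁ s os p js) (link-acts v j c (allLinks (letter v c) js x₁)))

  stepOps-act : ∀ v c x x₁ s os → ListActs os c x x₁ s → ListActs (stepOps v ++ os) c x (move sites (letter v c) x₁) (s * phase sites (letter v c) x₁)
  stepOps-act v c x x₁ s os p = subst₂ (λ y os′ → ListActs (operation (index (lower v)) zero ∷ os′) c x y (s * phase sites l x₁)) (step-result l x₁) (sym (List.++-assoc (links v) (operation (index (upper v)) zero ∷ []) os))
    (subst (ListActs (operation (index (lower v)) zero ∷ links v ++ operation (index (upper v)) zero ∷ os) c x (applyBot l (allLinks l (finElems (suc k)) x₁))) (*-identityʳ (s * phase sites l x₁))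
      (cons-acts (links v ++ operation (index (upper v)) zero ∷ os) (lower v) zero c x (allLinks l (finElems (suc k)) x₁) (applyBot l (allLinks l (finElems (suc k)) x₁)) (s * phase sites l x₁) 1ℚ
        (links-act v c x x₁ (s * phase sites l x₁) (operation (index (upper v)) zero ∷ os) (cons-acts os (upper v) zero c x x₁ x₁ s (phase sites l x₁) p (top-acts v c x₁)) (finElems (suc k)))
        (bot-acts v c (allLinks l (finElems (suc k)) x₁))))
    where l = letter v c

  moves-snoc : ∀ ls l x → moves sites (ls ++ l ∷ []) x ≡ move sites l (moves sites ls x)
  moves-snoc [] l x = refl
  moves-snoc (m ∷ ls) l x = moves-snoc ls l (move sites m x)

  phases-snoc : ∀ ls l x → phases sites (ls ++ l ∷ []) x ≡ phases sites ls x * phase sites l (moves sites ls x)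
  phases-snoc [] l x = trans (*-identityʳ (phase sites l x)) (sym (*-identityˡ (phase sites l x)))
  phases-snoc (m ∷ ls) l x = trans (cong (phase sites m x *_) (phases-snoc ls l (move sites m x))) (sym (*-assoc (phase sites m x) (phases sites ls (move sites m x)) (phase sites l (moves sites ls (move sites m x)))))

  body-acts : ∀ vs c x → ListActs (concatMap stepOps vs) c x (moves sites (reverse (map (λ v → letter v c) vs)) x) (phases sites (reverse (map (λ v → letter v c) vs)) x)
  body-acts [] c x = acts-[] {𝒢} {qubits ℕ.+ h} (basis x c)
  body-acts (v ∷ vs) c x = subst (λ ls → ListActs (stepOps v ++ concatMap stepOps vs) c x (moves sites ls x) (phases sites ls x)) (sym (List.unfold-reverse (letter v c) (map (λ v → letter v c) vs)))
    (subst₂ (ListActs (stepOps v ++ concatMap stepOps vs) c x) (sym (moves-snoc ls (letter v c) x)) (sym (phases-snoc ls (letter v c) x))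
      (stepOps-act v c x (moves sites ls x) (phases sites ls x) (concatMap stepOps vs) (body-acts vs c x)))
    where ls = reverse (map (λ v → letter v c) vs)

  module _ (word-length : ∀ c → length (word c) ≡ L) where

    reversed-letters : ∀ c → reverse (map (λ v → letter v c) (finElems L)) ≡ word c
    reversed-letters c = trans (cong reverse (map-nth (reverse (word c)) (trans (List.length-reverse (word c)) (word-length c)))) (List.reverse-involutive (word c))

    -- The body keeps the control string `c` and applies its word. The preparation is reached last
    -- along the row, and in the column of ancillas 0 all entries of the Hadamard gate are `½ ^ h₂`.
    circuit-entry : ∀ c x (v : Fin (2 ℕ.^ qubits)) → Rep (opsMatrix allOps (basis x c) (basis (decode sites v) (toPow h (λ _ → zero))))
      (phases sites (word c) x * (if does (v Fin.≟ code sites (moves sites (word c) x)) then ½ ^ h₂ else 0ℚ))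
    circuit-entry c x v = product-row bodyOps (operation (index prep) zero) (basis x c) (basis x′ c) (phases sites (word c) x) y
      (subst (λ ls → ListActs bodyOps c x (moves sites ls x) (phases sites ls x)) (reversed-letters c) (body-acts (finElems L) c x))
      (prepared (Fin.all? λ j → Fin.any? (λ i → wiresOf prep zero i Fin.≟ j) ⊎-dec (finToFun {2} (basis x′ c) j Fin.≟ finToFun {2} y j)))
      where
      x′ = moves sites (word c) x
      zeros = toPow h (λ _ → zero)
      y = basis (decode sites v) zeros
      a = funToFin (finToFun {2} (basis x′ c) ∘ wiresOf prep zero)
      b = funToFin (finToFun {2} y ∘ wiresOf prep zero)
      read : ∀ x c i → finToFun {2} (basis x c) i ≡ joint x c i
      read x c = Fin.finToFun-funToFin (joint x c)
      b-zero : bitsOf h b ≡ Group.𝟘 (bits h)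
      b-zero = trans (toPow-cong h λ i → trans (Fin.finToFun-funToFin (finToFun {2} y ∘ wiresOf prep zero) i) (trans (read (decode sites v) zeros (qubits ↑ʳ i)) (trans (joint-control (decode sites v) zeros i) (fromPow-toPow h (λ _ → zero) i)))) (zero-pow h)
        where
        zero-pow : ∀ n → toPow n (λ _ → zero) ≡ Group.𝟘 (bits n)
        zero-pow zero = refl
        zero-pow (suc n) = cong (zero ,_) (zero-pow n)
      flat-entry : hadamard a b ≡ ½ ^ h₂
      flat-entry = trans (cong (λ t → ½ ^ h₂ * Group.χ (bits h) (bitsOf h a) t) b-zero) (trans (cong (½ ^ h₂ *_) (Group.χ-𝟘 (bits h) (bitsOf h a))) (*-identityʳ (½ ^ h₂)))
      prepared : (D : Dec (∀ j → (∃ λ i → wiresOf prep zero i ≡ j) ⊎ finToFun {2} (basis x′ c) j ≡ finToFun {2} y j)) →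
        Rep (if does D then matrixOf prep a b else 0ᶜ) (if does (v Fin.≟ code sites x′) then ½ ^ h₂ else 0ℚ)
      prepared (yes agree) = rep-≡ {matrixOf prep a b} (trans flat-entry (sym (cong (if_then ½ ^ h₂ else 0ℚ) (dec-true (v Fin.≟ code sites x′)
          (trans (sym (code-decode sites v)) (cong (code sites) (trans (sym (ofBitAt-bitAt sites (decode sites v))) (trans (ofBitAt-cong sites data-agree) (ofBitAt-bitAt sites x′))))))))) (rep-const (hadamard a b))
        where
        data-agree : ∀ d → bitAt sites (decode sites v) d ≡ bitAt sites x′ d
        data-agree d with agree (d ↑ˡ h)
        ... | inj₂ e = trans (sym (joint-data (decode sites v) zeros d)) (trans (sym (read (decode sites v) zeros (d ↑ˡ h))) (trans (sym e) (trans (read x′ c (d ↑ˡ h)) (joint-data x′ c d))))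
        ... | inj₁ (i , e) = contradiction (trans (sym (Fin.splitAt-↑ʳ qubits h i)) (trans (cong (splitAt qubits) e) (Fin.splitAt-↑ˡ qubits d h))) λ ()
      prepared (no ¬agree) = rep-≡ {0ᶜ} (sym (cong (if_then ½ ^ h₂ else 0ℚ) (dec-false (v Fin.≟ code sites x′) λ { refl → ¬agree (by-wire refl) }))) (rep-const 0ℚ)
        where
        by-wire : v ≡ code sites x′ → ∀ j → (∃ λ i → wiresOf prep zero i ≡ j) ⊎ finToFun {2} (basis x′ c) j ≡ finToFun {2} y j
        by-wire e j = subst (λ j → (∃ λ i → qubits ↑ʳ i ≡ j) ⊎ finToFun {2} (basis x′ c) j ≡ finToFun {2} y j) (Fin.join-splitAt qubits h j) (cases (splitAt qubits j))
          where
          cases : ∀ s → (∃ λ i → qubits ↑ʳ i ≡ Fin.join qubits h s) ⊎ finToFun {2} (basis x′ c) (Fin.join qubits h s) ≡ finToFun {2} y (Fin.join qubits h s)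
          cases (inj₂ i) = inj₁ (i , refl)
          cases (inj₁ d) = inj₂ (trans (read x′ c (d ↑ˡ h)) (trans (joint-data x′ c d) (sym (trans (read (decode sites v) zeros (d ↑ˡ h)) (trans (joint-data (decode sites v) zeros d)
            (cong (λ x → bitAt sites x d) (trans (cong (decode sites) e) (decode-code sites x′))))))))

-- Encoding and size of the circuits, and the assembled family

concat-tabulate-+ : ∀ h {e} (f : Fin (h ℕ.+ e) → List (Fin 2)) → concat (tabulate f) ≡ concat (tabulate (λ i → f (i ↑ˡ e))) ++ concat (tabulate (λ i → f (h ↑ʳ i)))
concat-tabulate-+ zero f = refl
concat-tabulate-+ (suc h) f = trans (cong (f zero ++_) (concat-tabulate-+ h (f ∘ suc))) (sym (List.++-assoc (f zero) _ _))

concat-tabulate-cong : ∀ {n} {f g : Fin n → List (Fin 2)} → (∀ i → f i ≡ g i) → concat (tabulate f) ≡ concat (tabulate g)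
concat-tabulate-cong e = cong concat (List.tabulate-cong e)

toℕ-siteP : ∀ {n} (j : Fin n) → toℕ (siteP j) ≡ toℕ j ℕ.* 2
toℕ-siteP zero = refl
toℕ-siteP (suc j) = cong (ℕ.suc ∘ ℕ.suc) (toℕ-siteP j)

toℕ-siteQ : ∀ {n} (j : Fin n) → toℕ (siteQ j) ≡ suc (toℕ j ℕ.* 2)
toℕ-siteQ zero = refl
toℕ-siteQ (suc j) = cong (ℕ.suc ∘ ℕ.suc) (toℕ-siteQ j)

length-finElems : ∀ n → length (finElems n) ≡ n
length-finElems zero = refl
length-finElems (suc n) = cong suc (trans (List.length-map suc (finElems n)) (length-finElems n))

n<2^n : ∀ n → n ℕ.< 2 ℕ.^ n
n<2^n zero = ℕ.s≤s ℕ.z≤n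
n<2^n (suc n) = ℕ.≤-trans (ℕ.+-mono-≤ (ℕ.m^n>0 2 n) (n<2^n n)) (ℕ.≤-reflexive (cong (2 ℕ.^ n ℕ.+_) (sym (ℕ.+-identityʳ (2 ℕ.^ n)))))

embed-self : ∀ {N} (ρ : Mat N) u v → embed {N} {N} ρ u v ≡ ρ u v
embed-self {N} ρ u v with toℕ u ℕ.<? N | toℕ v ℕ.<? N
... | yes p | yes q = cong₂ ρ (Fin.fromℕ<-toℕ u p) (Fin.fromℕ<-toℕ v q)
... | yes _ | no ¬q = contradiction (Fin.toℕ<n v) ¬q
... | no ¬p | yes _ = contradiction (Fin.toℕ<n u) ¬p
... | no ¬p | no _ = contradiction (Fin.toℕ<n u) ¬p

++-cong : ∀ {m n} {f f′ : Bits m} {g g′ : Bits n} → (∀ i → f i ≡ f′ i) → (∀ i → g i ≡ g′ i) → ∀ i → (f Vector.++ g) i ≡ (f′ Vector.++ g′) i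
++-cong {m} p q i with splitAt m i
... | inj₁ j = p j
... | inj₂ j = q j

module Family {ν : ℚ} {h₂ L : ℕ} (W : WordSystem ν (h₂ ℕ.* 2) L) where
  open WordSystem W
  open GateFamily {h₂} {L} word using (h; 𝒢; index; name; name-index; arityOf; extra)
  open Layout h

  gateNumbers : Fin L → Gates
  gateNumbers v = toℕ (index (lower v)) , toℕ (index (link v)) , toℕ (index (upper v))

  numbers : List Gates
  numbers = map gateNumbers (finElems L)

  -- One constant, serving both as factor and as exponent, that dominates the requirements of size
  -- and of running time.
  order polyDegree : ℕ
  order = steps numbers
  polyDegree = degree order ℕ.+ (L ℕ.+ suc h)

  module _ (k : ℕ) where
    open Circuits {h₂} {L} word k using (sites; qubits; last; dataWires; signedWires; wiresOf; control-wire; data-wire; operation; links; stepOps; bodyOps; allOps; circuit; basis; joint; circuit-entry)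
    open Channel {ν} {h₂} {L} W sites using (Φ; operators; coefficient; represented)

    m : ℕ
    m = suc k ℕ.* 2

    wiresText : Name L → Fin (suc k) → List (Fin 2)
    wiresText nm j = concat (tabulate (unary ∘ toℕ ∘ wiresOf nm j))

    dataText : Name L → Fin (suc k) → List (Fin 2)
    dataText nm j = concat (tabulate (unary ∘ toℕ ∘ dataWires nm j))

    controlText≡ : concat (tabulate {n = h} (λ i → unary (toℕ (qubits ↑ʳ i)))) ≡ controlText m
    controlText≡ = concat-tabulate-cong {h} λ i → cong unary (trans (Fin.toℕ-↑ʳ qubits i) (sym (trans (ℕ.+-suc m (suc (toℕ i))) (cong suc (ℕ.+-suc m (toℕ i))))))

    signedText : ∀ nm j → concat (tabulate (unary ∘ toℕ ∘ signedWires nm j)) ≡ controlText m ++ dataText nm j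
    signedText nm j = trans (concat-tabulate-+ h (unary ∘ toℕ ∘ signedWires nm j)) (cong₂ _++_
      (trans (concat-tabulate-cong λ i → cong (unary ∘ toℕ) (control-wire nm j i)) controlText≡)
      (concat-tabulate-cong λ i → cong unary (trans (cong toℕ (data-wire nm j i)) (Fin.toℕ-↑ˡ (dataWires nm j i) h))))

    two : ∀ {a b c d} → a ≡ c → b ≡ d → unary a ++ unary b ++ [] ≡ unary c ++ unary d ++ []
    two refl refl = refl

    linkText≡ : ∀ v j → dataText (link v) j ≡ concatMap (λ i → unary (toℕ j ℕ.* 2 ℕ.+ i)) (1 ∷ 2 ∷ 3 ∷ [])
    linkText≡ v j = three
      (trans (toℕ-siteQ (inject₁ j)) (trans (cong (λ i → suc (i ℕ.* 2)) (Fin.toℕ-inject₁ j)) (ℕ.+-comm 1 (toℕ j ℕ.* 2))))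
      (trans (toℕ-siteP (suc j)) (ℕ.+-comm 2 (toℕ j ℕ.* 2))) (trans (toℕ-siteQ (suc j)) (ℕ.+-comm 3 (toℕ j ℕ.* 2)))
      where
      three : ∀ {a b c a′ b′ c′} → a ≡ a′ → b ≡ b′ → c ≡ c′ → unary a ++ unary b ++ unary c ++ [] ≡ unary a′ ++ unary b′ ++ unary c′ ++ []
      three refl refl refl = refl

    topText≡ : ∀ v → dataText (upper v) zero ≡ concatMap (λ i → unary (m ℕ.+ i)) (0 ∷ 1 ∷ [])
    topText≡ v = two (trans (toℕ-siteP last) (trans (cong (ℕ._* 2) (Fin.toℕ-fromℕ (suc k))) (sym (ℕ.+-identityʳ m))))
      (trans (toℕ-siteQ last) (trans (cong (λ i → suc (i ℕ.* 2)) (Fin.toℕ-fromℕ (suc k))) (ℕ.+-comm 1 m)))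

    -- Stated for any `F` with the right values on the operations that occur, so that it applies to
    -- the local encoding function inside `encode`.
    module Encoding (F : Op 𝒢 (qubits ℕ.+ h) → List (Fin 2))
      (F≡ : ∀ g j → F (operation g j) ≡ unary (toℕ g) ++ wiresText (name g) j) where

      named : ∀ nm j → F (operation (index nm) j) ≡ unary (toℕ (index nm)) ++ wiresText nm j
      named nm j = trans (F≡ (index nm) j) (cong (λ nm′ → unary (toℕ (index nm)) ++ wiresText nm′ j) (name-index nm))

      signed : ∀ nm j i ks → wiresText nm j ≡ controlText m ++ dataText nm j → dataText nm j ≡ concatMap (λ t → unary (i ℕ.+ t)) ks →
        F (operation (index nm) j) ≡ opText m i (toℕ (index nm)) ks
      signed nm j i ks p q = trans (named nm j) (cong (unary (toℕ (index nm)) ++_) (trans p (cong (controlText m ++_) q)))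

      sequence : ∀ v n a (ops : Fin n → Op 𝒢 (qubits ℕ.+ h)) → (∀ j → F (ops j) ≡ opText m ((toℕ j ℕ.+ a) ℕ.* 2) (toℕ (index (link v))) (1 ∷ 2 ∷ 3 ∷ [])) →
        concatMap F (map ops (finElems n)) ≡ linksText m (toℕ (index (link v))) n a
      sequence v zero a ops e = refl
      sequence v (suc n) a ops e = cong₂ _++_ (e zero) (trans (cong (concatMap F) (sym (List.map-∘ (finElems n))))
        (sequence v n (suc a) (ops ∘ suc) λ j → trans (e (suc j)) (cong (λ i → opText m (i ℕ.* 2) (toℕ (index (link v))) (1 ∷ 2 ∷ 3 ∷ [])) (sym (ℕ.+-suc (toℕ j) a)))))

      links-text : ∀ v → concatMap F (links v) ≡ linksText m (toℕ (index (link v))) (suc k) 0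
      links-text v = sequence v (suc k) 0 (operation (index (link v))) λ j →
        trans (signed (link v) j (toℕ j ℕ.* 2) (1 ∷ 2 ∷ 3 ∷ []) (signedText (link v) j) (linkText≡ v j))
          (cong (λ i → opText m (i ℕ.* 2) (toℕ (index (link v))) (1 ∷ 2 ∷ 3 ∷ [])) (sym (ℕ.+-identityʳ (toℕ j))))

      step-text : ∀ v → concatMap F (stepOps v) ≡ blockText k (gateNumbers v)
      step-text v = cong₂ _++_ (signed (lower v) zero 0 (0 ∷ 1 ∷ []) (signedText (lower v) zero) refl)
        (trans (List.concatMap-++ F (links v) _) (cong₂ _++_ (links-text v)
          (trans (List.++-identityʳ _) (signed (upper v) zero m (0 ∷ 1 ∷ []) (signedText (upper v) zero) (topText≡ v)))))

      body-text : ∀ vs → concatMap F (concatMap stepOps vs) ≡ concatMap (blockText k) (map gateNumbers vs)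
      body-text [] = refl
      body-text (v ∷ vs) = trans (List.concatMap-++ F (stepOps v) (concatMap stepOps vs)) (cong₂ _++_ (step-text v) (body-text vs))

      all-text : unary h ++ concatMap F allOps ≡ programText k numbers
      all-text = trans (cong (unary h ++_) (trans (cong₂ _++_ (trans (named prep zero) (cong (unary 0 ++_) controlText≡)) (body-text (finElems L))) refl))
        (sym (List.++-assoc (unary h) (unary 0 ++ controlText m) _))

    encode-circuit : encode circuit ≡ programText k numbers
    encode-circuit = Encoding.all-text (λ o → unary (toℕ (Op.gate o)) ++ concat (tabulate (unary ∘ toℕ ∘ Op.wires o))) (λ g j → refl)

    length-steps : ∀ vs → length (concatMap stepOps vs) ℕ.≤ length vs ℕ.* qubits
    length-steps [] = ℕ.z≤n
    length-steps (v ∷ vs) = ℕ.≤-trans (ℕ.≤-reflexive (List.length-++ (stepOps v))) (ℕ.+-mono-≤ (ℕ.≤-trans (ℕ.≤-reflexive step-length) k+3≤) (length-steps vs))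
      where
      step-length : length (stepOps v) ≡ 3 ℕ.+ k
      step-length = cong suc (trans (List.length-++ (links v)) (trans (ℕ.+-comm (length (links v)) 1) (cong suc (trans (List.length-map _ (finElems (suc k))) (length-finElems (suc k))))))
      k+3≤ : 3 ℕ.+ k ℕ.≤ qubits
      k+3≤ = ℕ.+-mono-≤ (ℕ.n≤1+n 3) (ℕ.m≤m*n k 2)

    size-bound : size circuit ℕ.≤ polyDegree ℕ.* qubits ℕ.^ polyDegree ℕ.+ polyDegree
    size-bound = begin
      h ℕ.+ suc (length bodyOps) ≤⟨ ℕ.+-monoʳ-≤ h (ℕ.s≤s (ℕ.≤-trans (length-steps (finElems L)) (ℕ.*-mono-≤ (ℕ.≤-trans (ℕ.≤-reflexive (length-finElems L)) L≤) n≤n^))) ⟩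
      h ℕ.+ suc (polyDegree ℕ.* qubits ℕ.^ polyDegree) ≡⟨ trans (ℕ.+-suc h _) (ℕ.+-comm (suc h) _) ⟩
      polyDegree ℕ.* qubits ℕ.^ polyDegree ℕ.+ suc h ≤⟨ ℕ.+-monoʳ-≤ (polyDegree ℕ.* qubits ℕ.^ polyDegree) h≤ ⟩
      polyDegree ℕ.* qubits ℕ.^ polyDegree ℕ.+ polyDegree ∎
      where
      open ℕ.≤-Reasoning
      L≤ : L ℕ.≤ polyDegree
      L≤ = ℕ.≤-trans (ℕ.m≤m+n L (suc h)) (ℕ.m≤n+m (L ℕ.+ suc h) (degree order))
      h≤ : suc h ℕ.≤ polyDegree
      h≤ = ℕ.≤-trans (ℕ.m≤n+m (suc h) L) (ℕ.m≤n+m (L ℕ.+ suc h) (degree order))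
      n≤n^ : qubits ℕ.≤ qubits ℕ.^ polyDegree
      n≤n^ = ℕ.≤-trans (ℕ.≤-reflexive (sym (ℕ.*-identityʳ qubits))) (ℕ.^-monoʳ-≤ qubits (ℕ.≤-trans (ℕ.s≤s ℕ.z≤n) h≤))

    machine : TuringMachine
    machine = Machine.M (program numbers)

    computes : OutputsWithin machine (polyDegree ℕ.* qubits ℕ.^ polyDegree ℕ.+ polyDegree) (binary (2 ℕ.^ qubits)) (encode circuit)
    computes = subst₂ (OutputsWithin machine _) (sym (proj₂ (binary-2^ qubits))) (sym encode-circuit)
      (program-outputs numbers (proj₁ (binary-2^ qubits)) k _ (time-bound order k polyDegree (ℕ.m≤m+n (degree order) (L ℕ.+ suc h))))

    joined : Fin (2 ℕ.^ qubits) → Bits h → Fin (2 ℕ.^ (qubits ℕ.+ h))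
    joined u w = funToFin (finToFun {2} {qubits} u Vector.++ w)

    joined-basis : ∀ u w → joined u w ≡ basis (decode sites u) (toPow h w)
    joined-basis u w = funToFin-cong (++-cong (λ i → sym (bitAt-ofBitAt sites (finToFun {2} {qubits} u) i)) (λ i → sym (fromPow-toPow h w i)))

    -- The dimension is a power of two, so `embed` changes nothing, and the Kraus operators obtained
    -- by tracing out the ancillas have the same entries as `operators`.
    implements : ∀ ρ → channel circuit (embed ρ) ≋ embed (Φ ρ)
    implements ρ u v = subst (channel circuit (embed ρ) u v ≈ᶜ_) (sym (embed-self (Φ ρ) u v))
      (≐⇒≈ (channel circuit (embed ρ) u v) (Φ ρ u v) (kraus-≐ K operators coefficient entry-rep represented (embed ρ) ρ (λ i j n → cong (λ z → Re z n) (embed-self ρ i j) , cong (λ z → Im z n) (embed-self ρ i j)) u v))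
      where
      K : Vector (Mat (2 ℕ.^ qubits)) (2 ℕ.^ h)
      K w u v = opsMatrix allOps (joined u (finToFun w)) (joined v (λ _ → zero))
      entry-rep : ∀ w u v → Rep (K w u v) (coefficient w u v)
      entry-rep w u v = subst₂ (λ x y → Rep (opsMatrix allOps x y) (coefficient w u v)) (sym (joined-basis u (finToFun w))) (sym (joined-basis v (λ _ → zero)))
        (rep-≡ {opsMatrix allOps (basis (decode sites u) (bitsOf h w)) (basis (decode sites v) (toPow h (λ _ → zero)))}
          (swap (does (v Fin.≟ code sites (moves sites (word (bitsOf h w)) (decode sites u)))) (phases sites (word (bitsOf h w)) (decode sites u)))
          (circuit-entry word-length (bitsOf h w) (decode sites u) v))
        where
        swap : ∀ b p → p * (if b then ½ ^ h₂ else 0ℚ) ≡ (if b then ½ ^ h₂ * p else 0ℚ)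
        swap true p = *-comm p (½ ^ h₂)
        swap false p = *-zeroʳ p

    -- The number of qubits demanded is a logarithm that equals `qubits` only propositionally;
    -- abstracting it as `n` allows matching on the equation.
    explicit-at : ∀ {n} → n ≡ qubits → ∃ λ (Γ : Circuit 𝒢 n) → (∀ ρ → channel Γ (embed ρ) ≋ embed (Φ ρ)) ×
      size Γ ℕ.≤ polyDegree ℕ.* n ℕ.^ polyDegree ℕ.+ polyDegree ×
      OutputsWithin machine (polyDegree ℕ.* n ℕ.^ polyDegree ℕ.+ polyDegree) (binary (2 ℕ.^ qubits)) (encode Γ)
    explicit-at refl = circuit , implements , size-bound , computes

  module Ch (k : ℕ) = Channel {ν} {h₂} {L} W (suc (suc k))

  family : ∀ lam M → 0ℚ ≤ ν → ν ≤ 1ℚ → (∀ m → M ℕ.≤ m → ν ≤ ℝ.seq lam m) → ExplicitExpanderFamily (2 ℕ.^ (h₂ ℕ.* 2)) lam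
  family lam M 0≤ν ν≤1 ν≤lam = record
    { dim = λ k → 2 ℕ.^ (suc (suc k) ℕ.* 2)
    ; Φ = Ch.Φ
    ; diverges = λ M → M , λ k M≤k → ℕ.≤-trans M≤k (ℕ.≤-trans (ℕ.≤-trans (ℕ.m≤n+m k 2) (ℕ.m≤m*n (suc (suc k)) 2)) (ℕ.<⇒≤ (n<2^n (suc (suc k) ℕ.* 2))))
    ; expander = λ k → Ch.hasDegree k , Ch.expands k lam M 0≤ν ν≤1 ν≤lam
    ; explicit = 𝒢 , Machine.M (program numbers) , polyDegree , λ k → explicit-at k (⌈log₂2^n⌉≡n (suc (suc k) ℕ.* 2))
    }

corollary1p5 : ∃ λ (C : ℝ) → ∃ λ (β : OpenUnitInterval → ℝ) →
    Extensional β ×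
    (∀ lam → 0ᴿ <ᴿ β lam) ×
    TendsTo0At0⁺ β ×
    (∀ lam → ∃ λ (d : ℕ) →
    DegreeBound d C (value lam) (fromℕ 2 +ᴿ β lam) ×
    ExplicitExpanderFamily d (value lam))
corollary1p5 = fromℚ C₀ , β , β-extensional , β-positive , β-tends , λ lam → _ , degree-bound lam , expanders lam
  where
  expanders : ∀ lam → ExplicitExpanderFamily (2 ℕ.^ Gadgetⱼ.width (Selection.j (select lam)) (gadgets (Selection.j (select lam))) (suc (Selection.t (select lam)))) (value lam)
  expanders lam = Family.family {h₂ = G.offset ℕ.+ suc t ℕ.* G.slope} (G.system (suc t)) (value lam) N (^-nonNeg (suc t) G.0≤ν) (≤-trans contracts (<⇒≤ lo<1)) λ n N≤n → ≤-trans contracts (lo≤ n N≤n)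
    where
    open Selection (select lam)
    module G = Gadgetⱼ j (gadgets j)
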